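{- Let $t\geq 1$ be an integer and let $0 < c < 1/3$ be a real constant. For undirected unweighted graphs $G=(V,E)$ with $n=|V|$ and $m=|E|$, there is a distance oracle that uses $\tilde{O}(n^{2-2c})$ space and that, given two query vertices $u,v\in V$, computes in $\tilde{O}(n^{tc})$ time a distance estimation $\hat{d}(u,v)$ satisfying $$d(u,v) \leq \hat{d}(u,v) \le d(u,v) + 2\lceil d(u,v) / t\rceil + 2.$$ The distance oracle is constructed in $\tilde{O}(mn^{1-c})$ time.
   Context: $d(u,v)$ is the length of a shortest path between $u$ and $v$ in $G$. A distance oracle is a data structure obtained by preprocessing $G$ (possibly with a randomized algorithm); a query algorithm, given any pair $u,v\in V$ and access only to the data structure, returns an estimate $\hat d(u,v)$. The space of the oracle is the size of the data structure; the construction time is the running time of the preprocessing. $\tilde{O}(\cdot)$ hides factors polylogarithmic in $n$. -}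

module Defs where

open import Data.Bool using (Bool; true; false; if_then_else_)
open import Data.Empty using (⊥)
open import Data.Fin using (Fin; toℕ)
open import Data.Integer using (+_)
open import Data.List using (List; []; _∷_; length; concatMap)
open import Data.List.Membership.Propositional using (_∈_)
open import Data.List.Relation.Unary.All using (All)
open import Data.List.Relation.Unary.Unique.Propositional using (Unique)
open import Data.Maybe using (Maybe; just; nothing)
open import Data.Nat using (ℕ; zero; suc; NonZero; _∸_; _^_; _<_; _≤_; _≡ᵇ_; _<ᵇ_)
import Data.Nat as ℕ
open import Data.Nat.DivMod using (_/_; _%_)
open import Data.Nat.Logarithm using (⌈log₂_⌉)
open import Data.Nat.Properties using (m^n≢0)
open import Data.Product using (_×_; _,_; ∃-syntax)
open import Data.Rational using (ℚ; 1/_; Positive)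
import Data.Rational as ℚ
import Data.Rational.Properties as ℚₚ
import Algebra.Properties.AbelianGroup ℚₚ.+-0-abelianGroup as ℚ+
open import Data.Sum using (_⊎_)
import Data.Sum as Sum
open import Data.Vec using (Vec; []; _∷_; toList)
open import Relation.Binary.PropositionalEquality using (_≡_; sym; trans; cong; subst)
open import Relation.Nullary using (¬_)

record ℝ : Set₁ where
  field
    Lower Upper     : ℚ → Set
    lower-inhabited : ∃[ q ] Lower q
    upper-inhabited : ∃[ q ] Upper q
    lower-closed    : ∀ {q r} → q ℚ.< r → Lower r → Lower q
    upper-closed    : ∀ {q r} → q ℚ.< r → Upper q → Upper r
    lower-open      : ∀ {q} → Lower q → ∃[ r ] (q ℚ.< r × Lower r)
    upper-open      : ∀ {r} → Upper r → ∃[ q ] (q ℚ.< r × Upper q)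
    disjoint        : ∀ {q} → Lower q → Upper q → ⊥
    located         : ∀ {q r} → q ℚ.< r → Lower q ⊎ Upper r

infix 4 _<ᴸ_ _<ᵁ_

_<ᴸ_ : ℚ → ℝ → Set
q <ᴸ x = ℝ.Lower x q

_<ᵁ_ : ℝ → ℚ → Set
x <ᵁ q = ℝ.Upper x q

inv : (s : ℚ) .{{_ : Positive s}} → ℚ
inv s = (1/ s) {{ℚₚ.pos⇒nonZero s}}

÷-mono : ∀ s .{{_ : Positive s}} {q r} → q ℚ.< r → q ℚ.* inv s ℚ.< r ℚ.* inv s
÷-mono s = ℚₚ.*-monoˡ-<-pos (inv s) {{ℚₚ.1/pos⇒pos s}}

*÷ : ∀ s .{{_ : Positive s}} q → (q ℚ.* s) ℚ.* inv s ≡ q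
*÷ s q = trans (ℚₚ.*-assoc q s (inv s))
               (trans (cong (q ℚ.*_) (ℚₚ.*-inverseʳ s {{ℚₚ.pos⇒nonZero s}}))
                      (ℚₚ.*-identityʳ q))

÷* : ∀ s .{{_ : Positive s}} q → (q ℚ.* inv s) ℚ.* s ≡ q
÷* s q = trans (ℚₚ.*-assoc q (inv s) s)
               (trans (cong (q ℚ.*_) (ℚₚ.*-inverseˡ s {{ℚₚ.pos⇒nonZero s}}))
                      (ℚₚ.*-identityʳ q))

scale : (s : ℚ) .{{_ : Positive s}} → ℝ → ℝ
scale s x = record
  { Lower = λ q → Lower (q ℚ.* inv s)
  ; Upper = λ q → Upper (q ℚ.* inv s)
  ; lower-inhabited = let q , l = lower-inhabited in
      q ℚ.* s , subst Lower (sym (*÷ s q)) l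
  ; upper-inhabited = let q , u = upper-inhabited in
      q ℚ.* s , subst Upper (sym (*÷ s q)) u
  ; lower-closed = λ q<r → lower-closed (÷-mono s q<r)
  ; upper-closed = λ q<r → upper-closed (÷-mono s q<r)
  ; lower-open = λ {q} l → let r , lt , l′ = lower-open l in
      r ℚ.* s , subst (ℚ._< r ℚ.* s) (÷* s q) (ℚₚ.*-monoˡ-<-pos s lt)
              , subst Lower (sym (*÷ s r)) l′
  ; upper-open = λ {r} u → let q , lt , u′ = upper-open u in
      q ℚ.* s , subst (q ℚ.* s ℚ.<_) (÷* s r) (ℚₚ.*-monoˡ-<-pos s lt)
              , subst Upper (sym (*÷ s q)) u′
  ; disjoint = disjoint
  ; located = λ q<r → located (÷-mono s q<r)
  } where open ℝ x

flip-< : ∀ k {q r} → q ℚ.< r → k ℚ.- r ℚ.< k ℚ.- q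
flip-< k lt = ℚₚ.+-monoʳ-< k (ℚₚ.neg-antimono-< lt)

flip-flip : ∀ k q → k ℚ.- (k ℚ.- q) ≡ q
flip-flip k q =
  trans (cong (k ℚ.+_) (trans (ℚₚ.neg-distrib-+ k (ℚ.- q))
                              (cong (ℚ.- k ℚ.+_) (ℚ+.⁻¹-involutive q))))
  (trans (sym (ℚₚ.+-assoc k (ℚ.- k) q))
  (trans (cong (ℚ._+ q) (ℚₚ.+-inverseʳ k)) (ℚₚ.+-identityˡ q)))

infixl 7 _·_
infixl 6 _⊖_

_·_ : (t : ℕ) .{{_ : NonZero t}} → ℝ → ℝ
t · x = scale (+ t ℚ./ 1) {{ℚₚ.normalize-pos t 1}} x

_⊖_ : ℚ → ℝ → ℝ
k ⊖ x = record
  { Lower = λ q → Upper (k ℚ.- q)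
  ; Upper = λ q → Lower (k ℚ.- q)
  ; lower-inhabited = let q , u = upper-inhabited in
      k ℚ.- q , subst Upper (sym (flip-flip k q)) u
  ; upper-inhabited = let q , l = lower-inhabited in
      k ℚ.- q , subst Lower (sym (flip-flip k q)) l
  ; lower-closed = λ q<r → upper-closed (flip-< k q<r)
  ; upper-closed = λ q<r → lower-closed (flip-< k q<r)
  ; lower-open = λ {q} u → let r , lt , u′ = upper-open u in
      k ℚ.- r , subst (ℚ._< k ℚ.- r) (flip-flip k q) (flip-< k lt)
              , subst Upper (sym (flip-flip k r)) u′
  ; upper-open = λ {q} l → let r , lt , l′ = lower-open l in
      k ℚ.- r , subst (k ℚ.- r ℚ.<_) (flip-flip k q) (flip-< k lt)
              , subst Lower (sym (flip-flip k r)) l′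
  ; disjoint = λ u l → disjoint l u
  ; located = λ q<r → Sum.swap (located (flip-< k q<r))
  } where open ℝ x

-- Comparison of naturals with real powers n ^ e, for n ≥ 1 and e ≥ 0.
-- As n ^ e is the infimum of the n ^ (a / b) over rationals a / b > e (and
-- the supremum over those below e), denominators can be cleared.

infix 4 _≼_·_^_ _^_≼_

_≼_·_^_ : ℕ → ℕ → ℕ → ℝ → Set
x ≼ A · n ^ e = ∀ a b .{{_ : NonZero b}} → e <ᵁ + a ℚ./ b →
                x ℕ.^ b ≤ A ℕ.^ b ℕ.* n ℕ.^ a

_^_≼_ : ℕ → ℝ → ℕ → Set
n ^ e ≼ x = ∀ a b .{{_ : NonZero b}} → + a ℚ./ b <ᴸ e → n ℕ.^ a ≤ x ℕ.^ b

-- n ^ e rounded up to an integer (n ^ e ≤ p ≤ n ^ e + 1).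
RoundedPower : ℕ → ℝ → ℕ → Set
RoundedPower n e p = (n ^ e ≼ p) × (p ∸ 1 ≼ 1 · n ^ e)

-- The factor C · log ^ k hidden in Õ; the 1 + keeps it positive at n = 1.
polylog : (C k n : ℕ) → ℕ
polylog C k n = C ℕ.* suc ⌈log₂ n ⌉ ℕ.^ k

-- Finite simple undirected graphs: each edge {u , v} is listed exactly once,
-- as the pair with u < v.
record Graph : Set where
  field
    n             : ℕ
    {{n-nonZero}} : NonZero n
    edges         : List (Fin n × Fin n)
    ordered       : All (λ (u , v) → toℕ u < toℕ v) edges
    unique        : Unique edges

  V : Set
  V = Fin n

  m : ℕ
  m = length edges

  Adjacent : V → V → Set
  Adjacent u v = (u , v) ∈ edges ⊎ (v , u) ∈ edges

  data Walk : V → V → ℕ → Set where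
    here : ∀ {u} → Walk u u 0
    step : ∀ {u v w l} → Adjacent u v → Walk v w l → Walk u w (suc l)

  IsDistance : V → V → ℕ → Set
  IsDistance u v d = Walk u v d × (∀ {l} → Walk u v l → d ≤ l)

open Graph using (n; m; V)

⌈_/_⌉ : (d t : ℕ) .{{_ : NonZero t}} → ℕ
⌈ d / t ⌉ = (d ℕ.+ (t ∸ 1)) / t

-- d(u,v) ≤ d̂ ≤ f (d(u,v)), in ℕ ∪ {∞} with nothing as ∞ and f ∞ = ∞.
Estimates : (G : Graph) → (ℕ → ℕ) → V G → V G → Maybe ℕ → Set
Estimates G f u v (just d̂) = ∃[ d ] (Graph.IsDistance G u v d × d ≤ d̂ × d̂ ≤ f d)
Estimates G f u v nothing   = ∀ l → ¬ Graph.Walk G u v l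

data Op : Set where
  add sub mul div mod lt eq : Op

⟦_⟧ : Op → ℕ → ℕ → ℕ
⟦ add ⟧ x y       = x ℕ.+ y
⟦ sub ⟧ x y       = x ∸ y
⟦ mul ⟧ x y       = x ℕ.* y
⟦ div ⟧ x zero    = 0
⟦ div ⟧ x (suc y) = x / suc y
⟦ mod ⟧ x zero    = x
⟦ mod ⟧ x (suc y) = x % suc y
⟦ lt ⟧  x y       = if x <ᵇ y then 1 else 0
⟦ eq ⟧  x y       = if x ≡ᵇ y then 1 else 0

Reg : Set
Reg = ℕ

infixr 5 _⨾_

data Program : Set where
  skip   : Program
  const  : Reg → ℕ → Program
  op     : Op → (dst src₁ src₂ : Reg) → Program
  input  : (dst addr : Reg) → Program
  load   : (dst addr : Reg) → Program
  store  : (addr src : Reg) → Program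
  flip   : (dst : Reg) → Program
  _⨾_    : Program → Program → Program
  ifnz   : Reg → Program → Program → Program
  while  : Reg → Program → Program

record State : Set where
  constructor state
  field
    reg mem : ℕ → ℕ
    coins   : List Bool

infixl 8 _[_≔_]

_[_≔_] : (ℕ → ℕ) → ℕ → ℕ → (ℕ → ℕ)
(f [ i ≔ x ]) j = if j ≡ᵇ i then x else f j

-- A word RAM with read-only random-access input, read-write memory and coin
-- flips. Run W inp P σ T τ: with words in {0 , … , W - 1} (arithmetic is modulo W)
-- and input cells inp, program P goes from σ to τ in T steps. A flip with no
-- coins left is stuck.
data Run (W : ℕ) .{{_ : NonZero W}} (inp : ℕ → ℕ) :
         Program → State → ℕ → State → Set where
  skip  : ∀ {σ} → Run W inp skip σ 1 σ
  const : ∀ {x k r μ cs} →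
          Run W inp (const x k) (state r μ cs) 1 (state (r [ x ≔ k % W ]) μ cs)
  op    : ∀ {o x y z r μ cs} →
          Run W inp (op o x y z) (state r μ cs) 1
                    (state (r [ x ≔ ⟦ o ⟧ (r y) (r z) % W ]) μ cs)
  input : ∀ {x y r μ cs} →
          Run W inp (input x y) (state r μ cs) 1
                    (state (r [ x ≔ inp (r y) % W ]) μ cs)
  load  : ∀ {x y r μ cs} →
          Run W inp (load x y) (state r μ cs) 1 (state (r [ x ≔ μ (r y) ]) μ cs)
  store : ∀ {x y r μ cs} →
          Run W inp (store x y) (state r μ cs) 1 (state r (μ [ r x ≔ r y ]) cs)
  flip  : ∀ {x r μ c cs} →
          Run W inp (flip x) (state r μ (c ∷ cs)) 1
                    (state (r [ x ≔ (if c then 1 else 0) % W ]) μ cs)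
  _⨾_   : ∀ {P Q σ τ υ S T} → Run W inp P σ S τ → Run W inp Q τ T υ →
          Run W inp (P ⨾ Q) σ (S ℕ.+ T) υ
  then  : ∀ {x P Q σ τ T} → ¬ State.reg σ x ≡ 0 → Run W inp P σ T τ →
          Run W inp (ifnz x P Q) σ (suc T) τ
  else  : ∀ {x P Q σ τ T} → State.reg σ x ≡ 0 → Run W inp Q σ T τ →
          Run W inp (ifnz x P Q) σ (suc T) τ
  loop  : ∀ {x P σ τ υ S T} → ¬ State.reg σ x ≡ 0 →
          Run W inp P σ S τ → Run W inp (while x P) τ T υ →
          Run W inp (while x P) σ (suc (S ℕ.+ T)) υ
  done  : ∀ {x P σ} → State.reg σ x ≡ 0 → Run W inp (while x P) σ 1 σ

cells : List ℕ → ℕ → ℕ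
cells []       _       = 0
cells (x ∷ xs) zero    = x
cells (x ∷ xs) (suc i) = cells xs i

-- Words are smaller than (2 + n) ^ κ, i.e. have O(log n) bits.
record DistanceOracle : Set where
  field
    κ          : ℕ
    preprocess : Program
    query      : Program

-- The contents of the first size memory cells.
record Structure : Set where
  field
    size    : ℕ
    content : ℕ → ℕ

  memory : ℕ → ℕ
  memory i = if i <ᵇ size then content i else 0

zeros : ℕ → ℕ
zeros _ = 0

module _ (O : DistanceOracle) where
  open DistanceOracle O

  Exec : ℕ → List ℕ → Program → State → ℕ → State → Set
  Exec n xs = Run ((2 ℕ.+ n) ^ κ) {{m^n≢0 (2 ℕ.+ n) κ}} (cells xs)

  -- The parameter p is meant to be n ^ c, rounded: a fixed program could not
  -- compute it from n for an arbitrary real c. Memory is initially zero, and the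
  -- size of the resulting structure is announced in register 0.
  Preprocesses : (G : Graph) (p : ℕ) (coins : List Bool) → ℕ → Structure → Set
  Preprocesses G p coins T D =
    ∃[ τ ] (Exec (n G) (n G ∷ m G ∷ p ∷ endpoints) preprocess (state zeros zeros coins) T τ
            × D ≡ record { size = State.reg τ 0 ; content = State.mem τ })
    where endpoints = concatMap (λ (u , v) → toℕ u ∷ toℕ v ∷ []) (Graph.edges G)

  decode : ℕ → Maybe ℕ
  decode zero    = nothing
  decode (suc d) = just d

  -- A query starts from the structure, and nothing else, in memory. Its answer
  -- is in register 0: 0 for ∞ and 1 + d̂ for d̂.
  Answers : (G : Graph) → Structure → (u v : V G) → ℕ → Maybe ℕ → Set
  Answers G D u v T d̂ =
    ∃[ τ ] (Exec (n G) (toℕ u ∷ toℕ v ∷ []) query (state zeros (Structure.memory D) []) T τ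
            × d̂ ≡ decode (State.reg τ 0))

count : ∀ {R} → (Vec Bool R → Bool) → ℕ
count {zero}  E = if E [] then 1 else 0
count {suc R} E = count (λ ω → E (true ∷ ω)) ℕ.+ count (λ ω → E (false ∷ ω))

-- P holds with probability at least 1 - 1 / N over a sufficiently long finite
-- sequence of fair coins.
WithFailure1/ : ℕ → (List Bool → Set) → Set
WithFailure1/ N P = ∃[ R ] ∃[ bad ]
  ((∀ (ω : Vec Bool R) → bad ω ≡ false → P (toList ω)) × count bad ℕ.* N ≤ 2 ^ R)

{-# OPTIONS --safe #-}
module Submission where

-- Preprocessing is deterministic. For every vertex x with a neighbour, a
-- breadth-first search finds the list B(x) of its p ≈ n ^ c nearest vertices, and
-- a threshold greedy algorithm finds a set of O((n / p) log n) landmarks hitting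
-- every list that is full. Stored are the lists, a landmark in each, and the
-- distances between landmarks.
--
-- A query expands u and v t times, replacing every vertex by its list. If the
-- two t-fold expansions share a vertex of a shortest path, the distance is found.
-- Otherwise walk greedily along the path, from w₀ = u and from x₀ = v, each time
-- to the last vertex of the current list. The 2 t lists do not cover the path, so
-- their radii a₀ , … , b₀ , … satisfy ∑ (aᵢ + b_{t-1-i}) < d(u,v), some summand
-- is below d(u,v) / t, and the detour through the landmarks of wᵢ and x_{t-1-i}
-- costs at most 2 (aᵢ + 1) + 2 (b_{t-1-i} + 1). There are only p ^ (t - 1) pairs
-- (w , x) at depths i and t - 1 - i.

open import Defs
open import Data.Bool using (Bool; true; false; if_then_else_; _∧_; _∨_; T)
open import Data.Empty using (⊥; ⊥-elim)
open import Data.Fin using (Fin; toℕ; fromℕ<)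
import Data.Fin.Properties as Finₚ
open import Data.Fin.Properties using (pigeonhole; toℕ<n; toℕ-injective; toℕ-fromℕ<; any?)
import Data.Integer as ℤ
import Data.Integer.Properties as ℤₚ
open import Data.List using (List; []; _∷_; length; concatMap)
import Data.List.Membership.DecPropositional as DecMembership
open import Data.List.Membership.Propositional using (_∈_)
open import Data.List.Relation.Unary.All as All using (All; []; _∷_)
open import Data.List.Relation.Unary.AllPairs using ([]; _∷_)
open import Data.List.Relation.Unary.Any using (here; there)
open import Data.List.Relation.Unary.Unique.Propositional using (Unique)
open import Data.Maybe using (Maybe; just; nothing)
open import Data.Nat using (ℕ; zero; suc; NonZero; >-nonZero; ≢-nonZero; _+_; _*_; _∸_; _^_; _⊔_; _⊓_; _≤_; _<_; _≡ᵇ_; _<ᵇ_; z≤n; s≤s; _≤?_; _<?_; _≟_; ≢-nonZero⁻¹; ⌊_/2⌋; ⌈_/2⌉)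
open import Data.Nat.DivMod using (_/_; _%_; m%n≤m; m/n≤m; m<n⇒m%n≡m; [m+kn]%n≡m%n; m*n/n≡m; /-monoˡ-≤; m≡m%n+[m/n]*n; m%n<n; m<n*o⇒m/o<n; [m+n]%n≡m%n)
open import Data.Nat.Induction using (<-rec)
open import Data.Nat.Logarithm using (⌈log₂_⌉; ⌈log₂⌉-mono-≤; ⌈log₂⌈n/2⌉⌉≡⌈log₂n⌉∸1)
open import Data.Nat.Properties
open import Data.Nat.Tactic.RingSolver using (solve-∀)
open import Data.Product using (_×_; _,_; proj₁; proj₂; ∃-syntax)
open import Data.Product.Properties using (≡-dec)
import Data.Rational as ℚ
open import Data.Rational using (ℚ; 0ℚ; 1ℚ)
import Data.Rational.Properties as ℚₚ
import Data.Rational.Unnormalised as ℚᵘ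
import Data.Rational.Unnormalised.Properties as ℚᵘₚ
open import Data.Sum using (_⊎_; inj₁; inj₂; [_,_]′)
open import Data.Unit using (⊤; tt)
open import Data.Vec using ([])
open import Relation.Binary.PropositionalEquality using (_≡_; _≢_; refl; sym; trans; cong; cong₂; subst; subst₂)
open import Relation.Nullary using (¬_; Dec; yes; no; contradiction)
open import Relation.Nullary.Decidable using (_⊎-dec_; _×-dec_; map′)

-- The source language

-- The condition `c < 1/3` enters twice. With `p ≈ n ^ c`, the lists take `n p ≤ n ^ (2 - 2c)` space
-- and their searches `p ^ 2 ≤ n ^ (1 - c)` time each, up to constants; both inequalities amount to
-- `3c ≤ 1`. Construction time is measured by `m`, which may be far below `n`. Hence isolated
-- vertices get no number, which leaves at most `2m` vertices, and nothing is ever initialised: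
-- memory starts at zero, and every search marks in a fresh window. High degrees must not spoil the
-- small searches either; at most `p` neighbours of a vertex are inspected, since so many already
-- fill the list. The additive 2 comes from the rim of a list: a full list with last distance ρ is
-- only sure to contain everything within `ρ - 1`, while its landmark may be at distance ρ. The
-- bounds concern steps of a word RAM, where arithmetic wraps around. The programs are written in a
-- small structured language over unbounded numbers. Weakest preconditions count their iterations,
-- and one compilation theorem turns iterations into machine steps for polynomially large words.

data Expr : Set where
  var : ℕ → Expr
  lit : ℕ → Expr
  inp : Expr → Expr
  _!_ : ℕ → Expr → Expr
  bin : Op → Expr → Expr → Expr

data Cmd : Set where
  nop      : Cmd
  _:=_     : ℕ → Expr → Cmd
  _[_]:=_  : ℕ → Expr → Expr → Cmd
  _▸_      : Cmd → Cmd → Cmd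
  cond     : Expr → Cmd → Cmd
  whilst   : Expr → Cmd → Cmd
  call     : Cmd → Cmd

infix  6 _:=_ _[_]:=_
infixr 5 _▸_
infixl 9 _!_
infixl 8 _⊗_
infixl 7 _⊕_ _⊝_

pattern _⊕_ a b = bin add a b
pattern _⊝_ a b = bin sub a b
pattern _⊗_ a b = bin mul a b

for : ℕ → ℕ → Cmd → Cmd
for x y C = whilst (bin lt (var x) (var y)) (C ▸ x := var x ⊕ lit 1)

record Store : Set where
  constructor ⟨_,_⟩
  field
    val : ℕ → ℕ
    arr : ℕ → ℕ → ℕ

open Store public

setV : Store → ℕ → ℕ → Store
setV s x v = ⟨ val s [ x ≔ v ] , arr s ⟩

setA : Store → ℕ → ℕ → ℕ → Store
setA s k i v = ⟨ val s , (λ k′ → if k′ ≡ᵇ k then arr s k [ i ≔ v ] else arr s k′) ⟩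

eval : (ℕ → ℕ) → Store → Expr → ℕ
eval I s (var x)     = val s x
eval I s (lit k)     = k
eval I s (inp e)     = I (eval I s e)
eval I s (k ! e)     = arr s k (eval I s e)
eval I s (bin o a b) = ⟦ o ⟧ (eval I s a) (eval I s b)

≡ᵇ-refl : ∀ i → (i ≡ᵇ i) ≡ true
≡ᵇ-refl zero    = refl
≡ᵇ-refl (suc i) = ≡ᵇ-refl i

≢⇒≡ᵇ : ∀ {i j} → i ≢ j → (i ≡ᵇ j) ≡ false
≢⇒≡ᵇ {zero}  {zero}  ne = ⊥-elim (ne refl)
≢⇒≡ᵇ {zero}  {suc j} ne = refl
≢⇒≡ᵇ {suc i} {zero}  ne = refl
≢⇒≡ᵇ {suc i} {suc j} ne = ≢⇒≡ᵇ (λ eqn → ne (cong suc eqn))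

upd-≡ : ∀ (f : ℕ → ℕ) {i j} v → j ≡ i → (f [ i ≔ v ]) j ≡ v
upd-≡ f {i} v refl rewrite ≡ᵇ-refl i = refl

upd-≢ : ∀ (f : ℕ → ℕ) {i j} v → j ≢ i → (f [ i ≔ v ]) j ≡ f j
upd-≢ f v ne rewrite ≢⇒≡ᵇ ne = refl

-- The time of a computation is, up to a factor depending on the program only,
-- the number of loop iterations; this is the number counted here. Every stored
-- value is at most B, so that polynomially large words never overflow.
module _ (I : ℕ → ℕ) (B : ℕ) where

  -- Asked of stored values only: addresses may exceed `B` and are covered by `degE`. Differences,
  -- quotients and remainders never exceed their first operand, comparisons are at most 1, and
  -- variables, entries and inputs are bounded already.
  Small : Store → Expr → Set
  Small s (lit k)       = k ≤ B
  Small s (bin add a b) = eval I s a + eval I s b ≤ B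
  Small s (bin mul a b) = eval I s a * eval I s b ≤ B
  Small s (bin sub a b) = Small s a
  Small s (bin div a b) = Small s a
  Small s (bin mod a b) = Small s a
  Small s _             = ⊤

  data Steps : Cmd → Store → ℕ → Store → Set where
    nop  : ∀ {s} → Steps nop s 0 s
    set  : ∀ {x e s} → Small s e → Steps (x := e) s 0 (setV s x (eval I s e))
    put  : ∀ {k e e′ s} → Small s e′ →
           Steps (k [ e ]:= e′) s 0 (setA s k (eval I s e) (eval I s e′))
    seq  : ∀ {C D s s′ s″ t t′} → Steps C s t s′ → Steps D s′ t′ s″ →
           Steps (C ▸ D) s (t + t′) s″
    tru  : ∀ {e C s s′ t} → eval I s e ≢ 0 → Steps C s t s′ → Steps (cond e C) s t s′
    fls  : ∀ {e C s} → eval I s e ≡ 0 → Steps (cond e C) s 0 s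
    stop : ∀ {e C s} → eval I s e ≡ 0 → Steps (whilst e C) s 0 s
    iter : ∀ {e C s s′ s″ t t′} → eval I s e ≢ 0 → Steps C s t s′ →
           Steps (whilst e C) s′ t′ s″ → Steps (whilst e C) s (suc t + t′) s″
    call : ∀ {C s s′ t} → Steps C s t s′ → Steps (call C) s t s′

modV : Cmd → ℕ → Bool
modV nop            y = false
modV (x := e)       y = y ≡ᵇ x
modV (k [ e ]:= e′) y = false
modV (C ▸ D)        y = modV C y ∨ modV D y
modV (cond e C)     y = modV C y
modV (whilst e C)   y = modV C y
modV (call C)       y = modV C y

modA : Cmd → ℕ → Bool
modA nop            y = false
modA (x := e)       y = false
modA (k [ e ]:= e′) y = y ≡ᵇ k
modA (C ▸ D)        y = modA C y ∨ modA D y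
modA (cond e C)     y = modA C y
modA (whilst e C)   y = modA C y
modA (call C)       y = modA C y

-- What a command leaves alone can be read off its text. As `modV` and `modA` compute on closed
-- commands, the side conditions below are mostly `refl`.
record Frame (C : Cmd) (s s′ : Store) : Set where
  constructor frame
  field
    onV : ∀ y → modV C y ≡ false → val s′ y ≡ val s y
    onA : ∀ k → modA C k ≡ false → arr s′ k ≡ arr s k

open Frame public

if-false : ∀ {A : Set} {b} {x y : A} → b ≡ false → (if b then x else y) ≡ y
if-false refl = refl

∨-false : ∀ {a b} → a ∨ b ≡ false → a ≡ false × b ≡ false
∨-false {false} {false} eqn = refl , refl

frame-refl : ∀ {C s} → Frame C s s
frame-refl = frame (λ _ _ → refl) (λ _ _ → refl)

frame-trans : ∀ {C s s′ s″} → Frame C s s′ → Frame C s′ s″ → Frame C s s″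
frame-trans f g = frame (λ y p → trans (onV g y p) (onV f y p))
                        (λ k p → trans (onA g k p) (onA f k p))

module _ {I : ℕ → ℕ} {B : ℕ} where

  steps-frame : ∀ {C s t s′} → Steps I B C s t s′ → Frame C s s′
  steps-frame nop = frame-refl
  steps-frame (set _) = frame (λ y p → if-false p) (λ _ _ → refl)
  steps-frame (put _) = frame (λ _ _ → refl) (λ k p → if-false p)
  steps-frame {C ▸ D} (seq p q) = frame
    (λ y r → trans (onV (steps-frame q) y (proj₂ (∨-false {modV C y} r)))
                   (onV (steps-frame p) y (proj₁ (∨-false {modV C y} r))))
    (λ y r → trans (onA (steps-frame q) y (proj₂ (∨-false {modA C y} r)))
                   (onA (steps-frame p) y (proj₁ (∨-false {modA C y} r))))
  steps-frame (call p) = frame (onV (steps-frame p)) (onA (steps-frame p))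
  steps-frame (tru _ p) = frame (onV (steps-frame p)) (onA (steps-frame p))
  steps-frame (fls _) = frame-refl
  steps-frame (stop _) = frame-refl
  steps-frame (iter {C = C} _ p q) = frame
    (λ y r → trans (onV (steps-frame q) y r) (onV (steps-frame p) y r))
    (λ y r → trans (onA (steps-frame q) y r) (onA (steps-frame p) y r))

-- Weakest preconditions; the postcondition also sees the number of iterations.
module _ (I : ℕ → ℕ) (B : ℕ) where

  WP : Cmd → Store → (ℕ → Store → Set) → Set
  WP C s Q = ∃[ t ] ∃[ s′ ] (Steps I B C s t s′ × Q t s′)

module _ {I : ℕ → ℕ} {B : ℕ} where

  wp-mono : ∀ {C s Q R} → (∀ {t s′} → Q t s′ → R t s′) → WP I B C s Q → WP I B C s R
  wp-mono f (t , s′ , st , q) = t , s′ , st , f q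

  wp-frame : ∀ {C s Q} → WP I B C s Q → WP I B C s (λ t s′ → Frame C s s′ × Q t s′)
  wp-frame (t , s′ , st , q) = t , s′ , st , steps-frame st , q

  wp-seq : ∀ {C D s Q} → WP I B C s (λ t s′ → WP I B D s′ (λ t′ → Q (t + t′))) →
           WP I B (C ▸ D) s Q
  wp-seq (t , s′ , st , t′ , s″ , st′ , q) = _ , _ , seq st st′ , q

  wp-cond : ∀ {e C s Q} → (eval I s e ≢ 0 → WP I B C s Q) → (eval I s e ≡ 0 → Q 0 s) →
            WP I B (cond e C) s Q
  wp-cond {e} {s = s} f g with eval I s e ≟ 0
  ... | yes z = _ , _ , fls z , g z
  ... | no nz = let t , s′ , st , q = f nz in t , s′ , tru nz st , q

  -- The precondition of a block of assignments and conditionals, computed. The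
  -- computation stops at calls, which are to be handled by a lemma.
  block-condition : Cmd → Store → (ℕ → Store → Set) → Set
  block-condition nop                  s Q = Q 0 s
  block-condition (x := e)             s Q = Small I B s e × Q 0 (setV s x (eval I s e))
  block-condition (k [ e ]:= e′)       s Q = Small I B s e′ × Q 0 (setA s k (eval I s e) (eval I s e′))
  block-condition (cond e C)           s Q = (eval I s e ≢ 0 → block-condition C s Q) × (eval I s e ≡ 0 → Q 0 s)
  block-condition ((x := e) ▸ D)       s Q = Small I B s e × block-condition D (setV s x (eval I s e)) Q
  block-condition ((k [ e ]:= e′) ▸ D) s Q = Small I B s e′ × block-condition D (setA s k (eval I s e) (eval I s e′)) Q
  block-condition (call C)             s Q = WP I B C s Q
  block-condition C                    s Q = WP I B C s Q

  infixr 3 block_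

  block_ : ∀ {C s Q} → block-condition C s Q → WP I B C s Q
  block_ {nop} q = _ , _ , nop , q
  block_ {x := e} (b , q) = _ , _ , set b , q
  block_ {k [ e ]:= e′} (b , q) = _ , _ , put b , q
  block_ {cond e C} (f , g) = wp-cond (λ nz → block (f nz)) g
  block_ {(x := e) ▸ D} (b , r) = let _ , _ , st , q = block_ {D} r in _ , _ , seq (set b) st , q
  block_ {(k [ e ]:= e′) ▸ D} (b , r) = let _ , _ , st , q = block_ {D} r in _ , _ , seq (put b) st , q
  block_ {call C} (_ , _ , st , q) = _ , _ , call st , q
  block_ {nop ▸ D} w = w
  block_ {call C ▸ D} w = w
  block_ {(C ▸ C′) ▸ D} w = w
  block_ {cond e C ▸ D} w = w
  block_ {whilst e C ▸ D} w = w
  block_ {whilst e C} w = w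

  -- The first index of `J` is fuel, which gives termination: an iteration must exhibit it as a
  -- successor, so an invariant at zero fuel has to contradict the guard. The second index counts
  -- the iterations so far, which makes time bounds part of the invariant.
  wp-whilst : ∀ {e C s} {Q : ℕ → Store → Set} (J : ℕ → ℕ → Store → Set) →
    (∀ {f t s′} → Frame C s s′ → J f t s′ → eval I s′ e ≢ 0 →
       ∃[ f′ ] (f ≡ suc f′ × WP I B C s′ (λ t′ s″ → J f′ (t + suc t′) s″))) →
    (∀ {f t s′} → Frame C s s′ → J f t s′ → eval I s′ e ≡ 0 → Q t s′) →
    ∀ {f} → J f 0 s → WP I B (whilst e C) s Q
  wp-whilst {e} {C} {s} {Q} J body out {f₀} j₀ = let t , s′ , st , q = go f₀ 0 s frame-refl j₀ in t , s′ , st , q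
    where
    go : ∀ f t s′ → Frame C s s′ → J f t s′ → WP I B (whilst e C) s′ (λ t′ → Q (t + t′))
    go f t s′ fr j with eval I s′ e ≟ 0
    ... | yes z = 0 , s′ , stop z , subst (λ u → Q u s′) (sym (+-identityʳ t)) (out fr j z)
    ... | no nz with body fr j nz
    ...   | f′ , refl , t′ , s″ , st , j′
        with go f′ (t + suc t′) s″ (frame-trans fr (steps-frame st)) j′
    ...     | t″ , s‴ , st′ , q =
            suc t′ + t″ , s‴ , iter nz st st′ , subst (λ u → Q u s‴) (+-assoc t (suc t′) t″) q

<?-true : ∀ {i k} → i < k → (if i <ᵇ k then 1 else 0) ≢ 0
<?-true {i} {k} i<k with i <ᵇ k | <⇒<ᵇ i<k
... | true | _ = λ ()

<?-nonzero : ∀ {i k} → (if i <ᵇ k then 1 else 0) ≢ 0 → i < k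
<?-nonzero {i} {k} nz with i <ᵇ k in eqn
... | true  = <ᵇ⇒< i k (subst T (sym eqn) tt)
... | false = ⊥-elim (nz refl)

<?-zero : ∀ {i k} → (if i <ᵇ k then 1 else 0) ≡ 0 → k ≤ i
<?-zero {i} {k} z = ≮⇒≥ (λ i<k → <?-true i<k z)

≡?-nonzero : ∀ {i k} → (if i ≡ᵇ k then 1 else 0) ≢ 0 → i ≡ k
≡?-nonzero {i} {k} nz with i ≡ᵇ k in eqn
... | true  = ≡ᵇ⇒≡ i k (subst T (sym eqn) tt)
... | false = ⊥-elim (nz refl)

≡?-zero : ∀ {i k} → (if i ≡ᵇ k then 1 else 0) ≡ 0 → i ≢ k
≡?-zero {i} z refl rewrite ≡ᵇ-refl i = contradiction z (λ ())

module _ {I : ℕ → ℕ} {B : ℕ} where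

  -- The fuel of `wp-whilst` is `k ∸ i`. By the first three premises the body changes neither
  -- counter nor bound, so the invariant can be indexed by the value of the counter; `k ≤ B` keeps
  -- the increment in range.
  wp-for : ∀ {x y C s} {Q : ℕ → Store → Set} (J : ℕ → ℕ → Store → Set) {i₀ k : ℕ} →
    modV C x ≡ false → modV C y ≡ false → (y ≡ᵇ x) ≡ false → k ≤ B →
    val s x ≡ i₀ → val s y ≡ k → i₀ ≤ k →
    (∀ {i t s′} → i₀ ≤ i → i < k → val s′ x ≡ i → Frame (for x y C) s s′ → J i t s′ →
       WP I B C s′ (λ t′ s″ → J (suc i) (t + suc t′) (setV s″ x (suc i)))) →
    (∀ {t s′} → Frame (for x y C) s s′ → J k t s′ → Q t s′) →
    J i₀ 0 s → WP I B (for x y C) s Q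
  wp-for {x} {y} {C} {s} {Q} J {i₀} {k} mx my y≢x k≤B x₀ y₀ i₀≤k step out j₀ =
    wp-whilst (λ f t s′ → ∃[ i ] (i₀ ≤ i × f + i ≡ k × val s′ x ≡ i × J i t s′)) body fin
      {k ∸ i₀} (i₀ , ≤-refl , m∸n+n≡m i₀≤k , x₀ , j₀)
    where
    my′ : modV (C ▸ x := var x ⊕ lit 1) y ≡ false
    my′ rewrite my = y≢x
    fy : ∀ {s′} → Frame (C ▸ x := var x ⊕ lit 1) s s′ → val s′ y ≡ k
    fy fr = trans (onV fr y my′) y₀
    body : ∀ {f t s′} → Frame (C ▸ x := var x ⊕ lit 1) s s′ →
      ∃[ i ] (i₀ ≤ i × f + i ≡ k × val s′ x ≡ i × J i t s′) →
      eval I s′ (bin lt (var x) (var y)) ≢ 0 →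
      ∃[ f′ ] (f ≡ suc f′ × WP I B (C ▸ x := var x ⊕ lit 1) s′
        (λ t′ s″ → ∃[ i ] (i₀ ≤ i × f′ + i ≡ k × val s″ x ≡ i × J i (t + suc t′) s″)))
    body {zero} fr (i , _ , refl , vx , j) nz =
      ⊥-elim (<-irrefl refl (subst₂ _<_ vx (fy fr) (<?-nonzero nz)))
    body {suc f} {t} {s′} fr (i , le , eqn , vx , j) nz = f , refl ,
      wp-seq (wp-mono (λ {t′} {s″} (fr′ , j′) →
          let vx′ = trans (onV fr′ x mx) vx
              v+1 = trans (cong (_+ 1) vx′) (+-comm i 1)
          in block subst (_≤ B) (sym v+1) (≤-trans i<k k≤B) ,
               (suc i , ≤-trans le (n≤1+n i) , trans (+-suc f i) eqn , trans (upd-≡ (val s″) {x} _ refl) v+1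
               , subst₂ (λ a b → J (suc i) (t + suc a) (setV s″ x b)) (sym (+-identityʳ t′)) (sym v+1) j′))
        (wp-frame (step le i<k vx (frame (onV fr) (onA fr)) j)))
      where i<k : i < k
            i<k = subst (suc i ≤_) eqn (s≤s (m≤n+m i f))
    fin : ∀ {f t s′} → Frame (C ▸ x := var x ⊕ lit 1) s s′ →
      ∃[ i ] (i₀ ≤ i × f + i ≡ k × val s′ x ≡ i × J i t s′) →
      eval I s′ (bin lt (var x) (var y)) ≡ 0 → Q t s′
    fin {f} {t} {s′} fr (i , le , eqn , vx , j) z = out (frame (onV fr) (onA fr)) (subst (λ a → J a t s′) i≡k j)
      where i≡k : i ≡ k
            i≡k = ≤-antisym (subst (i ≤_) eqn (m≤n+m i f)) (subst₂ _≤_ (fy fr) vx (<?-zero z))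

-- Compilation to the word RAM

-- Variable x lives in register 2 x; the odd registers form the evaluation stack.
-- Entry i of array k lives in memory cell 32 i + k.
vreg treg : ℕ → ℕ
vreg x = 2 * x
treg d = suc (2 * d)

address : ℕ → ℕ → Program
address d k = const (treg (suc d)) 32 ⨾ op mul (treg d) (treg d) (treg (suc d)) ⨾
              const (treg (suc d)) k ⨾ op add (treg d) (treg d) (treg (suc d))

compileE : ℕ → Expr → Program
-- There is no move instruction; adding zero copies a register.
compileE d (var x)     = const (treg d) 0 ⨾ op add (treg d) (vreg x) (treg d)
compileE d (lit k)     = const (treg d) k
compileE d (inp e)     = compileE d e ⨾ input (treg d) (treg d)
compileE d (k ! e)     = (compileE d e ⨾ address d k) ⨾ load (treg d) (treg d)
compileE d (bin o a b) = (compileE d a ⨾ compileE (suc d) b) ⨾ op o (treg d) (treg d) (treg (suc d))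

compile : Cmd → Program
compile nop            = skip
compile (x := e)       = compileE 0 e ⨾ const (treg 1) 0 ⨾ op add (vreg x) (treg 0) (treg 1)
compile (k [ e ]:= e′) = ((compileE 0 e ⨾ address 0 k) ⨾ compileE 1 e′) ⨾ store (treg 0) (treg 1)
compile (C ▸ D)        = compile C ⨾ compile D
compile (cond e C)     = compileE 0 e ⨾ ifnz (treg 0) (compile C) skip
compile (call C)       = compile C
compile (whilst e C)   = compileE 0 e ⨾ while (treg 0) (compile C ⨾ compileE 0 e)

costE : Expr → ℕ
costE (var x)     = 2
costE (lit k)     = 1
costE (inp e)     = costE e + 1
costE (k ! e)     = costE e + 4 + 1
costE (bin o a b) = costE a + costE b + 1

-- Not a time but a factor: `t` iterations take at most `costC C * suc t` machine steps. The guard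
-- of a loop counts twice, for the first test and for the test after each pass.
costC : Cmd → ℕ
costC nop            = 1
costC (x := e)       = costE e + 2
costC (k [ e ]:= e′) = costE e + 4 + costE e′ + 1
costC (C ▸ D)        = costC C + costC D
costC (cond e C)     = costE e + suc (suc (costC C))
costC (call C)       = costC C
costC (whilst e C)   = costE e + suc (costC C + costE e)

arraysE<32 : Expr → Bool
arraysE<32 (var x)     = true
arraysE<32 (lit k)     = true
arraysE<32 (inp e)     = arraysE<32 e
arraysE<32 (k ! e)     = (k <ᵇ 32) ∧ arraysE<32 e
arraysE<32 (bin o a b) = arraysE<32 a ∧ arraysE<32 b

arrays<32 : Cmd → Bool
arrays<32 nop            = true
arrays<32 (x := e)       = arraysE<32 e
arrays<32 (k [ e ]:= e′) = (k <ᵇ 32) ∧ (arraysE<32 e ∧ arraysE<32 e′)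
arrays<32 (C ▸ D)        = arrays<32 C ∧ arrays<32 D
arrays<32 (cond e C)     = arraysE<32 e ∧ arrays<32 C
arrays<32 (call C)       = arrays<32 C
arrays<32 (whilst e C)   = arraysE<32 e ∧ arrays<32 C

-- When variables, array entries and inputs are at most N ^ β, an expression e
-- evaluates to at most N ^ degE β e, and sizeE β e bounds the degrees of all
-- intermediate results.
degE : ℕ → Expr → ℕ
degE β (var x)       = suc β
degE β (lit k)       = suc k
degE β (inp e)       = suc β
degE β (k ! e)       = suc β
degE β (bin add a b) = degE β a + degE β b
degE β (bin mul a b) = degE β a + degE β b
degE β (bin sub a b) = degE β a
degE β (bin div a b) = degE β a
degE β (bin mod a b) = degE β a
degE β (bin lt a b)  = degE β a
degE β (bin eq a b)  = degE β a

sizeE : ℕ → Expr → ℕ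
sizeE β (var x)     = suc β
sizeE β (lit k)     = suc k
sizeE β (inp e)     = sizeE β e + suc β
sizeE β (k ! e)     = sizeE β e + (degE β e + 33 + suc k) + suc β
sizeE β (bin o a b) = (sizeE β a + sizeE β b) + degE β (bin o a b)

sizeC : ℕ → Cmd → ℕ
sizeC β nop            = 0
sizeC β (x := e)       = sizeE β e
sizeC β (k [ e ]:= e′) = (sizeE β e + (degE β e + 33 + suc k)) + sizeE β e′
sizeC β (C ▸ D)        = sizeC β C + sizeC β D
sizeC β (cond e C)     = sizeE β e + sizeC β C
sizeC β (call C)       = sizeC β C
sizeC β (whilst e C)   = sizeE β e + sizeC β C

deg≤size : ∀ β e → degE β e ≤ sizeE β e
deg≤size β (var x)     = ≤-refl
deg≤size β (lit k)     = ≤-refl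
deg≤size β (inp e)     = m≤n+m _ (sizeE β e)
deg≤size β (k ! e)     = m≤n+m _ (sizeE β e + _)
deg≤size β (bin o a b) = m≤n+m _ (sizeE β a + sizeE β b)

-- A sum is bounded by a product through `+≤*`, which needs both powers to be at least 2. This is
-- why a variable has the degree `suc β` rather than `β`.
deg≥1 : ∀ β e → 1 ≤ degE β e
deg≥1 β (var x)       = s≤s z≤n
deg≥1 β (lit k)       = s≤s z≤n
deg≥1 β (inp e)       = s≤s z≤n
deg≥1 β (k ! e)       = s≤s z≤n
deg≥1 β (bin add a b) = ≤-trans (deg≥1 β a) (m≤m+n _ _)
deg≥1 β (bin mul a b) = ≤-trans (deg≥1 β a) (m≤m+n _ _)
deg≥1 β (bin sub a b) = deg≥1 β a
deg≥1 β (bin div a b) = deg≥1 β a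
deg≥1 β (bin mod a b) = deg≥1 β a
deg≥1 β (bin lt a b)  = deg≥1 β a
deg≥1 β (bin eq a b)  = deg≥1 β a

Bounded : ℕ → Store → Set
Bounded B s = (∀ x → val s x ≤ B) × (∀ k i → arr s k i ≤ B)

record Sim (s : Store) (r μ : ℕ → ℕ) : Set where
  constructor sim
  field
    vars : ∀ x → r (vreg x) ≡ val s x
    mems : ∀ k i → k < 32 → μ (i * 32 + k) ≡ arr s k i

open Sim

+≤* : ∀ {x y} → 2 ≤ x → 2 ≤ y → x + y ≤ x * y
+≤* {suc (suc x)} {suc (suc y)} (s≤s (s≤s _)) (s≤s (s≤s _)) =
  subst (suc (suc x) + suc (suc y) ≤_) (identity x y) (m≤m+n _ _)
  where identity : ∀ x y → suc (suc x) + suc (suc y) + (x + y + x * y) ≡ suc (suc x) * suc (suc y)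
        identity = solve-∀

1? : ∀ b → (if b then 1 else 0) ≤ 1
1? true  = ≤-refl
1? false = z≤n

-- Crude, but uniform in the base: the degree of a literal depends on the program only, so one
-- exponent of the word size serves all graphs.
k<N^1+k : ∀ N → 2 ≤ N → ∀ k → k < N ^ suc k
k<N^1+k N 2≤N zero    = ≤-trans (≤-trans (s≤s z≤n) 2≤N) (≤-reflexive (sym (*-identityʳ N)))
k<N^1+k N 2≤N (suc k) = ≤-trans (s≤s IH) (≤-trans (m<m+n y (≤-trans (s≤s z≤n) IH))
                      (≤-trans (≤-reflexive (cong (y +_) (sym (+-identityʳ y)))) (*-monoˡ-≤ y 2≤N)))
  where y = N ^ suc k
        IH = k<N^1+k N 2≤N k

v≢t : ∀ {x d} → vreg x ≢ treg d
v≢t {x} {d} = even≢odd x d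

t-inj : ∀ {d d′} → treg d ≡ treg d′ → d ≡ d′
t-inj {d} {d′} p = *-cancelˡ-≡ d d′ 2 (suc-injective p)

-- Compilation is correct for words of N ^ κ values, if κ exceeds all degrees.
module Compile (N : ℕ) (2≤N : 2 ≤ N) (β κ : ℕ) (I : ℕ → ℕ) (I≤B : ∀ i → I i ≤ N ^ β) where

  private
    instance
      N≢0 : NonZero N
      N≢0 = >-nonZero (≤-trans (s≤s z≤n) 2≤N)
    B W : ℕ
    B = N ^ β
    W = N ^ κ
    instance
      W≢0 : NonZero W
      W≢0 = m^n≢0 N κ

  pow-mono : ∀ {a b} → a ≤ b → N ^ a ≤ N ^ b
  pow-mono = ^-monoʳ-≤ N

  B≤ : B ≤ N ^ suc β
  B≤ = pow-mono (n≤1+n β)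

  2≤pow : ∀ {a} → 1 ≤ a → 2 ≤ N ^ a
  2≤pow {a} p = ≤-trans 2≤N (≤-trans (≤-reflexive (sym (*-identityʳ N))) (pow-mono p))

  eval≤ : ∀ {s} → Bounded B s → ∀ e → eval I s e ≤ N ^ degE β e
  eval≤ b (var x) = ≤-trans (proj₁ b x) B≤
  eval≤ b (lit k) = <⇒≤ (k<N^1+k N 2≤N k)
  eval≤ {s} b (inp e) = ≤-trans (I≤B (eval I s e)) B≤
  eval≤ {s} b (k ! e) = ≤-trans (proj₂ b k (eval I s e)) B≤
  eval≤ b (bin add x y) = ≤-trans (+-mono-≤ (eval≤ b x) (eval≤ b y))
    (≤-trans (+≤* (2≤pow (deg≥1 β x)) (2≤pow (deg≥1 β y))) (≤-reflexive (sym (^-distribˡ-+-* N (degE β x) (degE β y)))))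
  eval≤ b (bin mul x y) = ≤-trans (*-mono-≤ (eval≤ b x) (eval≤ b y)) (≤-reflexive (sym (^-distribˡ-+-* N (degE β x) (degE β y))))
  eval≤ {s} b (bin sub x y) = ≤-trans (m∸n≤m (eval I s x) (eval I s y)) (eval≤ b x)
  eval≤ {s} b (bin div x y) with eval I s y
  ... | zero  = z≤n
  ... | suc z = ≤-trans (m/n≤m (eval I s x) (suc z)) (eval≤ b x)
  eval≤ {s} b (bin mod x y) with eval I s y
  ... | zero  = eval≤ b x
  ... | suc z = ≤-trans (m%n≤m (eval I s x) (suc z)) (eval≤ b x)
  eval≤ {s} b (bin lt x y) = ≤-trans (1? (eval I s x <ᵇ eval I s y)) (≤-trans (s≤s z≤n) (2≤pow (deg≥1 β x)))
  eval≤ {s} b (bin eq x y) = ≤-trans (1? (eval I s x ≡ᵇ eval I s y)) (≤-trans (s≤s z≤n) (2≤pow (deg≥1 β x)))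

  small≤ : ∀ {s} → Bounded B s → 1 ≤ B → ∀ e → Small I B s e → eval I s e ≤ B
  small≤ b 1≤B (var x) sm = proj₁ b x
  small≤ b 1≤B (lit k) sm = sm
  small≤ b 1≤B (inp e) sm = I≤B _
  small≤ b 1≤B (k ! e) sm = proj₂ b k _
  small≤ b 1≤B (bin add x y) sm = sm
  small≤ b 1≤B (bin mul x y) sm = sm
  small≤ {s} b 1≤B (bin sub x y) sm = ≤-trans (m∸n≤m (eval I s x) (eval I s y)) (small≤ b 1≤B x sm)
  small≤ {s} b 1≤B (bin div x y) sm with eval I s y
  ... | zero  = z≤n
  ... | suc z = ≤-trans (m/n≤m (eval I s x) (suc z)) (small≤ b 1≤B x sm)
  small≤ {s} b 1≤B (bin mod x y) sm with eval I s y
  ... | zero  = small≤ b 1≤B x sm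
  ... | suc z = ≤-trans (m%n≤m (eval I s x) (suc z)) (small≤ b 1≤B x sm)
  small≤ {s} b 1≤B (bin lt x y) sm = ≤-trans (1? (eval I s x <ᵇ eval I s y)) 1≤B
  small≤ {s} b 1≤B (bin eq x y) sm = ≤-trans (1? (eval I s x ≡ᵇ eval I s y)) 1≤B

  upd≤ : ∀ {f : ℕ → ℕ} {v} i → (∀ j → f j ≤ B) → v ≤ B → ∀ j → (f [ i ≔ v ]) j ≤ B
  upd≤ i f≤ v≤ j with j ≡ᵇ i
  ... | true  = v≤
  ... | false = f≤ j

  steps-bounded : ∀ {C s t s′} → Bounded B s → Steps I B C s t s′ → Bounded B s′
  steps-bounded b nop = b
  steps-bounded b (set {x} {e} sm) = upd≤ x (proj₁ b) (small≤ b (m^n>0 N β) e sm) , proj₂ b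
  steps-bounded {s = s} b (put {k} {e} {e′} sm) = proj₁ b , arr≤
    where arr≤ : ∀ k′ j → (if k′ ≡ᵇ k then arr s k [ eval I s e ≔ eval I s e′ ] else arr s k′) j ≤ B
          arr≤ k′ with k′ ≡ᵇ k
          ... | true  = upd≤ (eval I s e) (proj₂ b k) (small≤ b (m^n>0 N β) e′ sm)
          ... | false = proj₂ b k′
  steps-bounded b (seq p q) = steps-bounded (steps-bounded b p) q
  steps-bounded b (call p) = steps-bounded b p
  steps-bounded b (tru _ p) = steps-bounded b p
  steps-bounded b (fls _) = b
  steps-bounded b (stop _) = b
  steps-bounded b (iter _ p q) = steps-bounded (steps-bounded b p) q

  unwrap : ∀ {v a} → v ≤ N ^ a → a < κ → v % W ≡ v
  unwrap v≤ a<κ = m<n⇒m%n≡m (≤-<-trans v≤ (^-monoʳ-< N 2≤N a<κ))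

  -- Evaluation at stack depth `d` may overwrite stack registers from `d` upwards only; variables
  -- survive because they live in even registers. `runs` holds for every list of coins, as nothing
  -- is flipped.
  record Result (P : Program) (T d v : ℕ) (r μ : ℕ → ℕ) : Set where
    constructor result
    field
      regs : ℕ → ℕ
      runs : ∀ {cs} → Run W I P (state r μ cs) T (state regs μ cs)
      top  : regs (treg d) ≡ v
      keep : ∀ y → (∀ j → d ≤ j → y ≢ treg j) → regs y ≡ r y

  open Result

  keep-var : ∀ {P T d v r μ} (R : Result P T d v r μ) x → regs R (vreg x) ≡ r (vreg x)
  keep-var R x = keep R (vreg x) (λ j _ → v≢t {x} {j})

  keep-tmp : ∀ {P T d v r μ} (R : Result P T d v r μ) {d′} → d′ < d → regs R (treg d′) ≡ r (treg d′)
  keep-tmp {d = d} R {d′} d′<d = keep R (treg d′) (λ j d≤j p → <-irrefl (t-inj {d′} {j} p) (<-≤-trans d′<d d≤j))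

  t≢t : ∀ {d} → treg d ≢ treg (suc d)
  t≢t {d} p = <-irrefl (t-inj {d} {suc d} p) ≤-refl

  -- The degree `33` is that of the literal 32, the number of interleaved arrays, and `suc k` is
  -- that of the array number; the same expression occurs in `sizeE`.
  address-result : ∀ {P T d v r μ} k → Result P T d v r μ → ∀ {a} → v ≤ N ^ a → (a + 33 + suc k) < κ →
                   Result (P ⨾ address d k) (T + 4) d (v * 32 + k) r μ
  address-result {P} {T} {d} {v} {r} {μ} k R {a} v≤ lim = result r₄
      (runs R ⨾ (const ⨾ (op ⨾ (const ⨾ op)))) top₄ keep₄
    where
    t₀ = treg d
    t₁ = treg (suc d)
    r₁ = regs R [ t₁ ≔ 32 % W ]
    r₂ = r₁ [ t₀ ≔ (r₁ t₀ * r₁ t₁) % W ]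
    r₃ = r₂ [ t₁ ≔ k % W ]
    r₄ = r₃ [ t₀ ≔ (r₃ t₀ + r₃ t₁) % W ]
    lim₁ : a + 33 < κ
    lim₁ = ≤-<-trans (m≤m+n (a + 33) (suc k)) lim
    v32≤ : v * 32 ≤ N ^ (a + 33)
    v32≤ = ≤-trans (*-mono-≤ v≤ (<⇒≤ (k<N^1+k N 2≤N 32))) (≤-reflexive (sym (^-distribˡ-+-* N a 33)))
    sum≤ : v * 32 + k ≤ N ^ (a + 33 + suc k)
    sum≤ = ≤-trans (+-mono-≤ v32≤ (<⇒≤ (k<N^1+k N 2≤N k)))
      (≤-trans (+≤* (2≤pow (≤-trans (s≤s z≤n) (m≤n+m 33 a))) (2≤pow {suc k} (s≤s z≤n)))
        (≤-reflexive (sym (^-distribˡ-+-* N (a + 33) (suc k)))))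
    r₁t₀ : r₁ t₀ ≡ v
    r₁t₀ = trans (upd-≢ (regs R) _ (t≢t {d})) (top R)
    r₁t₁ : r₁ t₁ ≡ 32
    r₁t₁ = trans (upd-≡ (regs R) {t₁} _ refl) (unwrap (<⇒≤ (k<N^1+k N 2≤N 32)) (≤-<-trans (m≤n+m 33 a) lim₁))
    r₂t₀ : r₂ t₀ ≡ v * 32
    r₂t₀ = trans (upd-≡ r₁ {t₀} _ refl) (trans (cong (_% W) (cong₂ _*_ r₁t₀ r₁t₁)) (unwrap v32≤ lim₁))
    r₃t₀ : r₃ t₀ ≡ v * 32
    r₃t₀ = trans (upd-≢ r₂ _ (t≢t {d})) r₂t₀
    r₃t₁ : r₃ t₁ ≡ k
    r₃t₁ = trans (upd-≡ r₂ {t₁} _ refl) (unwrap (<⇒≤ (k<N^1+k N 2≤N k)) (≤-<-trans (m≤n+m (suc k) (a + 33)) lim))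
    top₄ : r₄ t₀ ≡ v * 32 + k
    top₄ = trans (upd-≡ r₃ {t₀} _ refl) (trans (cong (_% W) (cong₂ _+_ r₃t₀ r₃t₁)) (unwrap sum≤ lim))
    keep₄ : ∀ y → (∀ j → d ≤ j → y ≢ treg j) → r₄ y ≡ r y
    keep₄ y ne = trans (upd-≢ r₃ _ (ne d ≤-refl)) (trans (upd-≢ r₂ _ (ne (suc d) (n≤1+n d)))
                 (trans (upd-≢ r₁ _ (ne d ≤-refl)) (trans (upd-≢ (regs R) _ (ne (suc d) (n≤1+n d))) (keep R y ne))))

  ∧-T : ∀ {a b} → T (a ∧ b) → T a × T b
  ∧-T {true} {true} _ = tt , tt

  runE : ∀ e d {s r μ} → Bounded B s → Sim s r μ → T (arraysE<32 e) → sizeE β e < κ →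
         Result (compileE d e) (costE e) d (eval I s e) r μ
  runE (var x) d {s} {r} b sm ok lim = result (r₁ [ treg d ≔ (r₁ (vreg x) + r₁ (treg d)) % W ]) (const ⨾ op)
      (trans (upd-≡ r₁ {treg d} _ refl) (trans (cong (_% W) sum) (unwrap (≤-trans (proj₁ b x) B≤) lim)))
      (λ y ne → trans (upd-≢ r₁ _ (ne d ≤-refl)) (upd-≢ r _ (ne d ≤-refl)))
    where
    r₁ = r [ treg d ≔ 0 % W ]
    sum : r₁ (vreg x) + r₁ (treg d) ≡ val s x
    sum = trans (cong₂ _+_ (trans (upd-≢ r _ (v≢t {x} {d})) (vars sm x))
            (trans (upd-≡ r {treg d} _ refl) (m<n⇒m%n≡m {W} {0} (m^n>0 N κ)))) (+-identityʳ _)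
  runE (lit k) d {r = r} b sm ok lim = result (r [ treg d ≔ k % W ]) const
      (trans (upd-≡ r {treg d} _ refl) (unwrap (<⇒≤ (k<N^1+k N 2≤N k)) lim))
      (λ y ne → upd-≢ r _ (ne d ≤-refl))
  runE (inp e) d {s} {r} b sm ok lim = result (regs R [ treg d ≔ I (regs R (treg d)) % W ]) (runs R ⨾ input)
      (trans (upd-≡ (regs R) {treg d} _ refl) (trans (cong (λ v → I v % W) (top R))
        (unwrap (≤-trans (I≤B (eval I s e)) B≤) (≤-<-trans (m≤n+m (suc β) (sizeE β e)) lim))))
      (λ y ne → trans (upd-≢ (regs R) _ (ne d ≤-refl)) (keep R y ne))
    where R = runE e d b sm ok (≤-<-trans (m≤m+n (sizeE β e) _) lim)
  runE (k ! e) d {s} {r} {μ} b sm ok lim = result (regs R [ treg d ≔ μ (regs R (treg d)) ]) (runs R ⨾ load)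
      (trans (upd-≡ (regs R) {treg d} _ refl) (trans (cong μ (top R)) (mems sm k (eval I s e) k<32)))
      (λ y ne → trans (upd-≢ (regs R) _ (ne d ≤-refl)) (keep R y ne))
    where
    ok′ = ∧-T {k <ᵇ 32} ok
    k<32 = <ᵇ⇒< k 32 (proj₁ ok′)
    lim₁ : sizeE β e + (degE β e + 33 + suc k) < κ
    lim₁ = ≤-<-trans (m≤m+n _ (suc β)) lim
    R = address-result k (runE e d b sm (proj₂ ok′) (≤-<-trans (m≤m+n (sizeE β e) _) lim₁))
          (eval≤ b e) (≤-<-trans (m≤n+m _ (sizeE β e)) lim₁)
  runE (bin o e e′) d {s} {r} {μ} b sm ok lim = result (regs R′ [ treg d ≔ ⟦ o ⟧ (regs R′ (treg d)) (regs R′ (treg (suc d))) % W ])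
      ((runs R ⨾ runs R′) ⨾ op)
      (trans (upd-≡ (regs R′) {treg d} _ refl)
        (trans (cong (_% W) (cong₂ ⟦ o ⟧ (trans (keep-tmp R′ ≤-refl) (top R)) (top R′)))
          (unwrap (eval≤ {s} b (bin o e e′)) (≤-<-trans (m≤n+m _ (sizeE β e + sizeE β e′)) lim))))
      (λ y ne → trans (upd-≢ (regs R′) _ (ne d ≤-refl))
                  (trans (keep R′ y (λ j d<j → ne j (≤-trans (n≤1+n d) d<j))) (keep R y ne)))
    where
    ok′ = ∧-T {arraysE<32 e} ok
    lim′ : sizeE β e + sizeE β e′ < κ
    lim′ = ≤-<-trans (m≤m+n _ (degE β (bin o e e′))) lim
    R = runE e d b sm (proj₁ ok′) (≤-<-trans (m≤m+n (sizeE β e) _) lim′)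
    R′ = runE e′ (suc d) b (sim (λ x → trans (keep-var R x) (vars sm x)) (mems sm)) (proj₂ ok′)
           (≤-<-trans (m≤n+m (sizeE β e′) (sizeE β e)) lim′)

  cell-inj : ∀ {i j k l} → k < 32 → l < 32 → i * 32 + k ≡ j * 32 + l → i ≡ j × k ≡ l
  cell-inj {i} {j} {k} {l} k< l< p = *-cancelʳ-≡ i j 32 (+-cancelʳ-≡ l (i * 32) (j * 32)
      (trans (cong (i * 32 +_) (sym k≡l)) p)) , k≡l
    where
    rem : ∀ i {k} → k < 32 → (i * 32 + k) % 32 ≡ k
    rem i {k} k< = trans (cong (_% 32) (+-comm (i * 32) k)) (trans ([m+kn]%n≡m%n k i 32) (m<n⇒m%n≡m k<))
    k≡l : k ≡ l
    k≡l = trans (sym (rem i k<)) (trans (cong (_% 32) p) (rem j l<))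

  sim-put : ∀ {s r μ k i v a b} → k < 32 → Sim s r μ → a ≡ i * 32 + k → b ≡ v →
            ∀ k′ j → k′ < 32 → (μ [ a ≔ b ]) (j * 32 + k′) ≡ arr (setA s k i v) k′ j
  sim-put {s} {μ = μ} {k} {i} {v} k<32 sm refl refl k′ j k′<32 with k′ ≟ k | j ≟ i
  ... | yes refl | yes refl rewrite ≡ᵇ-refl k = trans (upd-≡ μ {j * 32 + k} v refl) (sym (upd-≡ (arr s k) {j} v refl))
  ... | yes refl | no j≢i rewrite ≡ᵇ-refl k = trans (upd-≢ μ v (λ p → j≢i (proj₁ (cell-inj {j} {i} k′<32 k<32 p))))
                             (trans (mems sm k j k′<32) (sym (upd-≢ (arr s k) v j≢i)))
  ... | no k′≢k | _ rewrite ≢⇒≡ᵇ k′≢k = trans (upd-≢ μ v (λ p → k′≢k (proj₂ (cell-inj {j} {i} k′<32 k<32 p)))) (mems sm k′ j k′<32)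

  record Outcome (P : Program) (s : Store) (r μ : ℕ → ℕ) (bound : ℕ) : Set where
    constructor outcome
    field
      time       : ℕ
      regs′ mem′ : ℕ → ℕ
      runs′      : ∀ {cs} → Run W I P (state r μ cs) time (state regs′ mem′ cs)
      sim′       : Sim s regs′ mem′
      time≤      : time ≤ bound

  open Outcome

  sim-E : ∀ {P T d v s r μ} → Sim s r μ → (R : Result P T d v r μ) → Sim s (regs R) μ
  sim-E sm R = sim (λ x → trans (keep-var R x) (vars sm x)) (mems sm)

  -- The bound has `suc t` instead of `t`, since a command without iterations still takes time. In a
  -- sequence the factors add, and the mixed products are slack.
  runC : ∀ {C s t s′} → Steps I B C s t s′ → Bounded B s → T (arrays<32 C) → sizeC β C < κ →
         ∀ {r μ} → Sim s r μ → Outcome (compile C) s′ r μ (costC C * suc t)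
  -- The machine's `while` tests a register, so a loop is considered from the moment when its guard
  -- has been evaluated into `treg 0`; the compiled body ends with a fresh evaluation.
  run-loop : ∀ {e C s t s′} → Steps I B (whilst e C) s t s′ → Bounded B s → T (arrays<32 (whilst e C)) →
         sizeC β (whilst e C) < κ → ∀ {r μ} → Sim s r μ → r (treg 0) ≡ eval I s e →
         Outcome (while (treg 0) (compile C ⨾ compileE 0 e)) s′ r μ (suc (suc (costC C + costE e) * t))

  runC (call p) b ok lim sm = let O = runC p b ok lim sm in outcome (time O) (regs′ O) (mem′ O) (runs′ O) (sim′ O) (time≤ O)
  runC nop b ok lim {r} {μ} sm = outcome 1 r μ skip sm ≤-refl
  runC {x := e} {s} (set small) b ok lim {r} {μ} sm = outcome _ r₂ μ (runs R ⨾ (const ⨾ op)) (sim vars₂ (mems sm))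
      (≤-reflexive (sym (*-identityʳ _)))
    where
    R = runE e 0 b sm ok lim
    r₁ = regs R [ treg 1 ≔ 0 % W ]
    r₂ = r₁ [ vreg x ≔ (r₁ (treg 0) + r₁ (treg 1)) % W ]
    value : (r₁ (treg 0) + r₁ (treg 1)) % W ≡ eval I s e
    value = trans (cong (_% W) (trans (cong₂ _+_ (trans (upd-≢ (regs R) (0 % W) (t≢t {0})) (top R))
              (trans (upd-≡ (regs R) {treg 1} _ refl) (m<n⇒m%n≡m {W} {0} (m^n>0 N κ)))) (+-identityʳ (eval I s e))))
              (unwrap (eval≤ b e) (≤-<-trans (deg≤size β e) lim))
    vars₂ : ∀ y → r₂ (vreg y) ≡ (val s [ x ≔ eval I s e ]) y
    vars₂ y with y ≟ x
    ... | yes refl = trans (upd-≡ r₁ {vreg y} _ refl) (trans value (sym (upd-≡ (val s) {y} _ refl)))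
    ... | no y≢x = trans (upd-≢ r₁ _ (λ p → y≢x (*-cancelˡ-≡ y x 2 p))) (trans (upd-≢ (regs R) _ (v≢t {y} {1}))
                     (trans (keep-var R y) (trans (vars sm y) (sym (upd-≢ (val s) _ y≢x)))))
  runC {k [ e ]:= e′} {s} (put small) b ok lim {r} {μ} sm = outcome _ (regs R′) _ ((runs R ⨾ runs R′) ⨾ store)
      (sim (λ x → trans (keep-var R′ x) (trans (keep-var R x) (vars sm x)))
           (sim-put k<32 sm (trans (keep-tmp R′ ≤-refl) (top R)) (top R′)))
      (≤-reflexive (sym (*-identityʳ _)))
    where
    ok₁ = ∧-T {k <ᵇ 32} ok
    ok₂ = ∧-T {arraysE<32 e} (proj₂ ok₁)
    k<32 = <ᵇ⇒< k 32 (proj₁ ok₁)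
    lim₁ : sizeE β e + (degE β e + 33 + suc k) < κ
    lim₁ = ≤-<-trans (m≤m+n _ (sizeE β e′)) lim
    R = address-result k (runE e 0 b sm (proj₁ ok₂) (≤-<-trans (m≤m+n (sizeE β e) _) lim₁))
          (eval≤ b e) (≤-<-trans (m≤n+m _ (sizeE β e)) lim₁)
    R′ = runE e′ 1 b (sim-E sm R) (proj₂ ok₂) (≤-<-trans (m≤n+m (sizeE β e′) _) lim)
  runC {C ▸ D} (seq {t = t} {t′} p q) b ok lim sm = outcome _ _ _ (runs′ O ⨾ runs′ O′) (sim′ O′)
      (≤-trans (+-mono-≤ (time≤ O) (time≤ O′)) (≤-trans (m≤m+n _ _) (≤-reflexive (sym (identity (costC C) (costC D) t t′)))))
    where
    ok₁ = ∧-T {arrays<32 C} ok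
    O = runC p b (proj₁ ok₁) (≤-<-trans (m≤m+n (sizeC β C) _) lim) sm
    O′ = runC q (steps-bounded b p) (proj₂ ok₁) (≤-<-trans (m≤n+m _ (sizeC β C)) lim) (sim′ O)
    identity : ∀ c d t t′ → (c + d) * suc (t + t′) ≡ c * suc t + d * suc t′ + (c * t′ + d * t)
    identity = solve-∀
  runC {cond e C} (tru {t = t} nz p) b ok lim sm = outcome _ _ _ (runs R ⨾ then (λ z → nz (trans (sym (top R)) z)) (runs′ O))
      (sim′ O) (≤-trans (+-monoʳ-≤ (costE e) (s≤s (time≤ O))) (≤-trans (m≤m+n _ _) (≤-reflexive (sym (identity (costE e) (costC C) t)))))
    where
    ok₁ = ∧-T {arraysE<32 e} ok
    R = runE e 0 b sm (proj₁ ok₁) (≤-<-trans (m≤m+n (sizeE β e) _) lim)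
    O = runC p b (proj₂ ok₁) (≤-<-trans (m≤n+m _ (sizeE β e)) lim) (sim-E sm R)
    identity : ∀ e c t → (e + suc (suc c)) * suc t ≡ e + suc (c * suc t) + (e * t + 1 + 2 * t)
    identity = solve-∀
  runC {cond e C} (fls z) b ok lim sm = outcome _ _ _ (runs R ⨾ else (trans (top R) z) skip) (sim-E sm R)
      (≤-trans (m≤m+n _ _) (≤-reflexive (sym (identity (costE e) (costC C)))))
    where
    ok₁ = ∧-T {arraysE<32 e} ok
    R = runE e 0 b sm (proj₁ ok₁) (≤-<-trans (m≤m+n (sizeE β e) _) lim)
    identity : ∀ e c → (e + suc (suc c)) * 1 ≡ e + 2 + c
    identity = solve-∀
  runC {whilst e C} {t = t} st@(stop _) b ok lim sm = outcome _ _ _ (runs R ⨾ runs′ O) (sim′ O)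
      (≤-trans (+-monoʳ-≤ (costE e) (time≤ O)) (≤-trans (m≤m+n _ _) (≤-reflexive (sym (identity (costE e) (costC C) t)))))
    where
    ok₁ = ∧-T {arraysE<32 e} ok
    R = runE e 0 b sm (proj₁ ok₁) (≤-<-trans (m≤m+n (sizeE β e) _) lim)
    O = run-loop st b ok lim (sim-E sm R) (top R)
    identity : ∀ e c t → (e + suc (c + e)) * suc t ≡ e + suc (suc (c + e) * t) + (c + e + e * t)
    identity = solve-∀
  runC {whilst e C} {t = t} st@(iter _ _ _) b ok lim sm = outcome _ _ _ (runs R ⨾ runs′ O) (sim′ O)
      (≤-trans (+-monoʳ-≤ (costE e) (time≤ O)) (≤-trans (m≤m+n _ _) (≤-reflexive (sym (identity (costE e) (costC C) t)))))
    where
    ok₁ = ∧-T {arraysE<32 e} ok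
    R = runE e 0 b sm (proj₁ ok₁) (≤-<-trans (m≤m+n (sizeE β e) _) lim)
    O = run-loop st b ok lim (sim-E sm R) (top R)
    identity : ∀ e c t → (e + suc (c + e)) * suc t ≡ e + suc (suc (c + e) * t) + (c + e + e * t)
    identity = solve-∀

  run-loop {e} {C} (stop z) b ok lim {r} {μ} sm tp = outcome 1 r μ (done (trans tp z)) sm (s≤s z≤n)
  run-loop {e} {C} (iter {t = t} {t′} nz p q) b ok lim sm tp =
      outcome _ _ _ (loop (λ z → nz (trans (sym tp) z)) (runs′ O ⨾ runs R) (runs′ O′)) (sim′ O′)
        (s≤s (≤-trans (+-mono-≤ (+-monoˡ-≤ (costE e) (time≤ O)) (time≤ O′))
          (≤-trans (m≤m+n _ _) (≤-reflexive (sym (identity (costC C) (costE e) t t′))))))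
    where
    ok₁ = ∧-T {arraysE<32 e} ok
    O = runC p b (proj₂ ok₁) (≤-<-trans (m≤n+m _ (sizeE β e)) lim) sm
    b′ = steps-bounded b p
    R = runE e 0 b′ (sim′ O) (proj₁ ok₁) (≤-<-trans (m≤m+n (sizeE β e) _) lim)
    O′ = run-loop q b′ ok lim (sim-E (sim′ O) R) (top R)
    identity : ∀ c e t t′ → suc (c + e) * (suc t + t′) ≡ (c * suc t + e) + suc (suc (c + e) * t′) + (t + e * t)
    identity = solve-∀

-- Stretch analysis of the query

∑ : (ℕ → ℕ) → ℕ → ℕ
∑ f zero    = 0
∑ f (suc k) = ∑ f k + f k

∑-cong : ∀ {f g} k → (∀ i → i < k → f i ≡ g i) → ∑ f k ≡ ∑ g k
∑-cong zero    h = refl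
∑-cong (suc k) h = cong₂ _+_ (∑-cong k (λ i i<k → h i (m≤n⇒m≤1+n i<k))) (h k ≤-refl)

∑-mono : ∀ {f g} k → (∀ i → i < k → f i ≤ g i) → ∑ f k ≤ ∑ g k
∑-mono zero    h = z≤n
∑-mono (suc k) h = +-mono-≤ (∑-mono k (λ i i<k → h i (m≤n⇒m≤1+n i<k))) (h k ≤-refl)

∑-+ : ∀ f g k → ∑ (λ i → f i + g i) k ≡ ∑ f k + ∑ g k
∑-+ f g zero    = refl
∑-+ f g (suc k) = trans (cong (_+ (f k + g k)) (∑-+ f g k)) (interchange (∑ f k) (∑ g k) (f k) (g k))
  where interchange : ∀ a b c d → a + b + (c + d) ≡ a + c + (b + d)
        interchange = solve-∀

∑-const : ∀ c k → ∑ (λ _ → c) k ≡ k * c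
∑-const c zero    = refl
∑-const c (suc k) = trans (cong (_+ c) (∑-const c k)) (+-comm (k * c) c)

∑-* : ∀ c f k → ∑ (λ i → c * f i) k ≡ c * ∑ f k
∑-* c f zero    = sym (*-zeroʳ c)
∑-* c f (suc k) = trans (cong (_+ c * f k) (∑-* c f k)) (sym (*-distribˡ-+ c (∑ f k) (f k)))

∑-shift : ∀ f k → ∑ f (suc k) ≡ f 0 + ∑ (λ i → f (suc i)) k
∑-shift f zero    = +-comm 0 (f 0)
∑-shift f (suc k) = trans (cong (_+ f (suc k)) (∑-shift f k)) (+-assoc (f 0) _ _)

∑-reverse : ∀ f k → ∑ (λ i → f (k ∸ suc i)) k ≡ ∑ f k
∑-reverse f zero    = refl
∑-reverse f (suc k) = trans (∑-shift (λ i → f (suc k ∸ suc i)) k)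
  (trans (cong (f k +_) (∑-reverse f k)) (+-comm (f k) (∑ f k)))

find< : ∀ {P : ℕ → Set} → (∀ i → Dec (P i)) → ∀ k → (∃[ i ] (i < k × P i)) ⊎ (∀ i → i < k → ¬ P i)
find< P? zero = inj₂ (λ _ ())
find< P? (suc k) with P? k | find< P? k
... | yes p | _ = inj₁ (k , ≤-refl , p)
... | no ¬p | inj₁ (i , i<k , p) = inj₁ (i , m≤n⇒m≤1+n i<k , p)
... | no ¬p | inj₂ none = inj₂ λ i i<1+k p → case-≤ i i<1+k p
  where case-≤ : ∀ i → i < suc k → _ → ⊥
        case-≤ i (s≤s i≤k) p with m≤n⇒m<n∨m≡n i≤k
        ... | inj₁ i<k = none i i<k p
        ... | inj₂ refl = ¬p p

-- Otherwise every `t * f i` is at least `d`, and summing over `i` gives `t * ∑ f t ≥ t * d`.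
average : ∀ f t d .{{_ : NonZero t}} → ∑ f t < d → ∃[ i ] (i < t × t * f i < d)
average f t d small with find< (λ i → t * f i <? d) t
... | inj₁ found = found
... | inj₂ none = ⊥-elim (<⇒≱ small (*-cancelˡ-≤ t (subst₂ _≤_ (∑-const d t) (∑-* t f t)
                    (∑-mono t (λ i i<t → ≮⇒≥ (none i i<t))))))

-- Paths, lists of near vertices, and the candidates for the estimate

infixl 5 _∷ʳ_

-- Grows at its far end, as a breadth-first search does.
data Path (E : ℕ → ℕ → Set) (x : ℕ) : ℕ → ℕ → Set where
  stay : Path E x x 0
  _∷ʳ_ : ∀ {y z l} → Path E x y l → E y z → Path E x z (suc l)

_++ᵖ_ : ∀ {E x y z k l} → Path E x y k → Path E y z l → Path E x z (k + l)
_++ᵖ_ {k = k} p stay = subst (Path _ _ _) (sym (+-identityʳ k)) p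
_++ᵖ_ {k = k} p (q ∷ʳ e) = subst (Path _ _ _) (sym (+-suc k _)) ((p ++ᵖ q) ∷ʳ e)

reverseᵖ : ∀ {E x y l} → (∀ {a b} → E a b → E b a) → Path E x y l → Path E y x l
reverseᵖ E-sym stay = stay
reverseᵖ E-sym (p ∷ʳ e) = (stay ∷ʳ E-sym e) ++ᵖ reverseᵖ E-sym p

-- A path as a sequence, so that positions on it can be added and compared; beyond `l` the values of
-- `at` are arbitrary.
record Points (E : ℕ → ℕ → Set) (x y l : ℕ) : Set where
  constructor points
  field
    at    : ℕ → ℕ
    at-0  : at 0 ≡ x
    at-l  : at l ≡ y
    edge  : ∀ {i} → i < l → E (at i) (at (suc i))

  segment : ∀ i k → i + k ≤ l → Path E (at i) (at (i + k)) k
  segment i zero    _ = subst (λ j → Path E (at i) (at j) 0) (sym (+-identityʳ i)) stay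
  segment i (suc k) h = subst (λ j → Path E (at i) (at j) (suc k)) (sym (+-suc i k))
    (segment i k (≤-trans (n≤1+n _) h′) ∷ʳ edge h′)
    where h′ : suc (i + k) ≤ l
          h′ = subst (_≤ l) (+-suc i k) h

path-points : ∀ {E x y l} → Path E x y l → Points E x y l
path-points {x = x} stay = points (λ _ → x) refl refl (λ ())
path-points {E} {x} {z} {suc l} (p ∷ʳ e) with path-points p
... | points at at0 atl edge = points at′ at0
        (upd-≡ at {suc l} z refl) edge′
  where
  at′ = at [ suc l ≔ z ]
  old : ∀ {i} → i ≤ l → at′ i ≡ at i
  old i≤l = upd-≢ at z (λ { refl → <-irrefl refl i≤l })
  edge′ : ∀ {i} → i < suc l → E (at′ i) (at′ (suc i))
  edge′ {i} (s≤s i≤l) with m≤n⇒m<n∨m≡n i≤l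
  ... | inj₁ i<l = subst₂ E (sym (old i≤l)) (sym (old i<l)) (edge i<l)
  ... | inj₂ refl = subst₂ E (trans (sym atl) (sym (old ≤-refl))) (sym (upd-≡ at {suc l} z refl)) e

reverse-points : ∀ {E x y l} → (∀ {a b} → E a b → E b a) → Points E x y l → Points E y x l
reverse-points {E} {l = l} E-sym (points at at0 atl edge) = points (λ i → at (l ∸ i)) atl
  (trans (cong at (n∸n≡0 l)) at0)
  (λ {i} i<l → E-sym (subst (λ j → E (at (l ∸ suc i)) (at j)) (sym (+-∸-assoc 1 i<l))
     (edge (subst (_≤ l) (+-∸-assoc 1 i<l) (m∸n≤m l i)))))

-- The first ln ≤ cap vertices found by a breadth-first search from s, with
-- their distances.
record Ball (E : ℕ → ℕ → Set) (nv cap s : ℕ) (q d : ℕ → ℕ) (ln : ℕ) : Set where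
  field
    nonempty : 0 < ln
    ln≤cap   : ln ≤ cap
    q-first  : q 0 ≡ s
    d-first  : d 0 ≡ 0
    q<       : ∀ {i} → i < ln → q i < nv
    q-inj    : ∀ {i j} → i < ln → j < ln → q i ≡ q j → i ≡ j
    sound    : ∀ {i} → i < ln → Path E s (q i) (d i)
    d≤       : ∀ {i} → i < ln → d i ≤ i
    d-mono   : ∀ {i j} → i ≤ j → j < ln → d i ≤ d j
    complete : ∀ {y l} → Path E s y l →
               (∃[ i ] (i < ln × q i ≡ y × d i ≤ l)) ⊎ (ln ≡ cap × (∀ {i} → i < ln → d i ≤ l))

-- `piv` and `tbl` are shifted by one, with 0 for a missing landmark and for landmarks in different
-- components. A landmark is promised to full lists only: a shorter list is already the whole
-- component.
record Oracle (E : ℕ → ℕ → Set) (nv P L : ℕ) (ln piv pd lm : ℕ → ℕ) (q d tbl : ℕ → ℕ → ℕ) : Set where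
  field
    E-sym        : ∀ {x y} → E x y → E y x
    E<           : ∀ {x y} → E x y → y < nv
    ball         : ∀ {x} → x < nv → Ball E nv P x (q x) (d x) (ln x)
    pivot        : ∀ {x} → x < nv → ln x ≡ P →
                   ∃[ k ] (piv x ≡ suc k × ∃[ j ] (j < ln x × pd x ≡ d x j))
    pivot-sound  : ∀ {x k} → x < nv → piv x ≡ suc k → k < L × Path E x (lm k) (pd x)
    tbl-sound    : ∀ {k k′ D} → k < L → k′ < L → tbl k k′ ≡ suc D → Path E (lm k) (lm k′) D
    tbl-complete : ∀ {k k′ l} → k < L → k′ < L → Path E (lm k) (lm k′) l →
                   ∃[ D ] (tbl k k′ ≡ suc D × D ≤ l)

data Level (ln : ℕ → ℕ) (q d : ℕ → ℕ → ℕ) (u : ℕ) : ℕ → ℕ → ℕ → Set where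
  root : Level ln q d u 0 u 0
  next : ∀ {k x δ j} → Level ln q d u k x δ → j < ln x → Level ln q d u (suc k) (q x j) (δ + d x j)

-- The lengths over which the query minimises. All of them are lengths of paths, so soundness does
-- not depend on which one wins.
data Candidate (ln piv pd : ℕ → ℕ) (q d tbl : ℕ → ℕ → ℕ) (t u v : ℕ) : ℕ → Set where
  meet : ∀ {y δ δ′} → Level ln q d u t y δ → Level ln q d v t y δ′ →
         Candidate ln piv pd q d tbl t u v (δ + δ′)
  via  : ∀ {i j w x δ δ′ k k′ D} → suc (i + j) ≡ t → Level ln q d u i w δ → Level ln q d v j x δ′ →
         piv w ≡ suc k → piv x ≡ suc k′ → tbl k k′ ≡ suc D →
         Candidate ln piv pd q d tbl t u v ((δ + pd w) + (D + (δ′ + pd x)))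

module Analysis {E : ℕ → ℕ → Set} {nv P L : ℕ} {ln piv pd lm : ℕ → ℕ} {q d tbl : ℕ → ℕ → ℕ}
                (O : Oracle E nv P L ln piv pd lm q d tbl) where
  open Oracle O
  open Ball

  Lv : ℕ → ℕ → ℕ → ℕ → Set
  Lv = Level ln q d

  path< : ∀ {x y l} → x < nv → Path E x y l → y < nv
  path< x< stay = x<
  path< x< (p ∷ʳ e) = E< e

  level-path : ∀ {u k x δ} → u < nv → Lv u k x δ → Path E u x δ
  level-path u< root = stay
  level-path u< (next {x = x} lv j<) = p ++ᵖ sound (ball (path< u< p)) j<
    where p = level-path u< lv

  level< : ∀ {u k x δ} → u < nv → Lv u k x δ → x < nv
  level< u< lv = path< u< (level-path u< lv)

  candidate-sound : ∀ {t u v δ} → u < nv → v < nv → Candidate ln piv pd q d tbl t u v δ → Path E u v δ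
  candidate-sound u< v< (meet lv lv′) = level-path u< lv ++ᵖ reverseᵖ E-sym (level-path v< lv′)
  candidate-sound u< v< (via {δ′ = δ′} {D = D} _ lv lv′ pw px tk) =
    (level-path u< lv ++ᵖ proj₂ P₁) ++ᵖ (tbl-sound (proj₁ P₁) (proj₁ P₂) tk ++ᵖ reverseᵖ E-sym (level-path v< lv′ ++ᵖ proj₂ P₂))
    where P₁ = pivot-sound (level< u< lv) pw
          P₂ = pivot-sound (level< v< lv′) px

  -- A full list with last distance ρ is sure to contain everything within `ρ ∸ 1`, its rim being
  -- cut off arbitrarily. A short list contains the whole component, so there the radius may be the
  -- length `D` of the walk.
  radius : ℕ → ℕ → ℕ
  radius D x = if ln x ≡ᵇ P then d x (P ∸ 1) ∸ 1 else D

  -- Greedy progress of the exploration along a fixed walk of length D.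
  position : ℕ → (ℕ → ℕ) → ℕ → ℕ
  position D at zero    = 0
  position D at (suc k) = (position D at k + radius D (at (position D at k))) ⊓ D

  position≤ : ∀ D at k → position D at k ≤ D
  position≤ D at zero    = z≤n
  position≤ D at (suc k) = m⊓n≤n _ D

  module Chain {u v D : ℕ} (u< : u < nv) (pts : Points E u v D) where
    open Points pts

    pos : ℕ → ℕ
    pos = position D at

    -- Every list begins with its own centre at distance 0, so the levels increase.
    stay-level : ∀ {k x δ} → Lv u k x δ → Lv u (suc k) x δ
    stay-level {k} {x} {δ} lv = subst₂ (Lv u (suc k)) (q-first b) (trans (cong (δ +_) (d-first b)) (+-identityʳ δ)) (next lv (nonempty b))
      where b = ball (level< u< lv)

    -- Up to the previous position this is `stay-level`. Beyond it, the vertex lies within the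
    -- radius of the list at `pos k`. Only `δ ≤ s` is claimed, because the walk need not be a
    -- shortest one.
    reach : ∀ k s → s ≤ pos k → ∃[ δ ] (δ ≤ s × Lv u k (at s) δ)
    reach zero zero _ = 0 , z≤n , subst (λ x → Lv u 0 x 0) (sym at-0) root
    reach (suc k) s s≤ with s ≤? pos k
    ... | yes s≤k = let δ , δ≤ , lv = reach k s s≤k in δ , δ≤ , stay-level lv
    ... | no s≰k with reach k (pos k) ≤-refl
    ...   | δ , δ≤ , lv with complete (ball (level< u< lv))
                               (subst (λ j → Path E (at (pos k)) (at j) (s ∸ pos k)) (m+[n∸m]≡n (<⇒≤ (≰⇒> s≰k)))
                                 (segment (pos k) (s ∸ pos k) (≤-trans (≤-reflexive (m+[n∸m]≡n (<⇒≤ (≰⇒> s≰k)))) (≤-trans s≤ (position≤ D at (suc k))))))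
    ...     | inj₁ (j , j< , refl-q , dj≤) = δ + d (at (pos k)) j
                , ≤-trans (+-mono-≤ δ≤ dj≤) (≤-reflexive (m+[n∸m]≡n (<⇒≤ (≰⇒> s≰k))))
                , subst (λ x → Lv u (suc k) x (δ + d (at (pos k)) j)) refl-q (next lv j<)
    -- A miss would bound the last distance ρ of the full list by `s ∸ pos k`, which is positive and
    -- at most `ρ ∸ 1`.
    ...     | inj₂ (full , all≤) = ⊥-elim (absurd (d x (P ∸ 1)) (s ∸ pos k) (m<n⇒0<n∸m (≰⇒> s≰k)) l≤ (all≤ last<))
      where
      x = at (pos k)
      b = ball (level< u< lv)
      last< : P ∸ 1 < ln x
      last< = subst (λ z → z ∸ 1 < ln x) full (∸-monoʳ-< {ln x} {1} {0} (s≤s z≤n) (nonempty b))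
      rad : radius D x ≡ d x (P ∸ 1) ∸ 1
      rad rewrite full | ≡ᵇ-refl P = refl
      l≤ : s ∸ pos k ≤ d x (P ∸ 1) ∸ 1
      l≤ = m≤n+o⇒m∸n≤o s (pos k) (≤-trans s≤ (≤-trans (m⊓n≤m _ D) (≤-reflexive (cong (pos k +_) rad))))
      absurd : ∀ ρ l → 0 < l → l ≤ ρ ∸ 1 → ρ ≤ l → ⊥
      absurd zero    (suc l) _ () _
      absurd (suc ρ) l _ l≤ρ ρ<l = <-irrefl refl (≤-trans ρ<l l≤ρ)

    pos-mono : ∀ k → pos k ≤ pos (suc k)
    pos-mono k = ⊓-glb (m≤m+n (pos k) _) (position≤ D at k)

    pos-mono′ : ∀ {k k′} → k ≤ k′ → pos k ≤ pos k′
    pos-mono′ {k} {k′} h = subst (λ j → pos k ≤ pos j) (m∸n+n≡m h) (go (k′ ∸ k))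
      where go : ∀ j → pos k ≤ pos (j + k)
            go zero    = ≤-refl
            go (suc j) = ≤-trans (go j) (pos-mono (j + k))

    advance : ℕ → ℕ
    advance k = radius D (at (pos k))

    pos-∑ : ∀ k → pos k < D → pos k ≡ ∑ advance k
    pos-∑ zero    _ = refl
    pos-∑ (suc k) h = trans (below h) (cong (_+ advance k) (pos-∑ k (≤-<-trans (pos-mono k) h)))
      where below : ∀ {a} → a ⊓ D < D → a ⊓ D ≡ a
            below {a} a⊓D< with ≤-total a D
            ... | inj₁ a≤D = m≤n⇒m⊓n≡m a≤D
            ... | inj₂ D≤a = ⊥-elim (<-irrefl (m≥n⇒m⊓n≡n D≤a) a⊓D<)

    -- If the list were short, its radius `D` would carry the next position to `D`. So it is full
    -- and has a landmark; being a member, the landmark is no farther than the last distance, which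
    -- is at most the radius plus 1.
    pivot-near : ∀ k → pos (suc k) < D → ∃[ δ ] (δ ≤ pos k × Lv u k (at (pos k)) δ
                   × ∃[ κ ] (piv (at (pos k)) ≡ suc κ × pd (at (pos k)) ≤ suc (advance k)))
    pivot-near k h with reach k (pos k) ≤-refl
    ... | δ , δ≤ , lv with ln (at (pos k)) ≡ᵇ P in e
    ...   | false = ⊥-elim (<-irrefl (m≥n⇒m⊓n≡n (m≤n+m D (pos k))) h)
    ...   | true with pivot (level< u< lv) (≡ᵇ⇒≡ (ln (at (pos k))) P (subst T (sym e) tt))
    ...     | κ , pv , j , j< , refl-d = δ , δ≤ , lv , κ , pv , ≤-trans (≤-reflexive refl-d)
                (≤-trans (d-mono b (suc[m]≤n⇒m≤pred[n] (≤-trans j< (ln≤cap b))) last<)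
                         (≤-trans (m≤n+m∸n (d x (P ∸ 1)) 1) ≤-refl))
      where
      x = at (pos k)
      b = ball (level< u< lv)
      full : ln x ≡ P
      full = ≡ᵇ⇒≡ (ln x) P (subst T (sym e) tt)
      last< : P ∸ 1 < ln x
      last< = subst (λ z → z ∸ 1 < ln x) full (∸-monoʳ-< {ln x} {1} {0} (s≤s z≤n) (nonempty b))

  ceiling : ∀ D t x .{{_ : NonZero t}} → t * x < D → suc x ≤ ⌈ D / t ⌉
  ceiling D t x h = subst (_≤ ⌈ D / t ⌉) (m*n/n≡m (suc x) t) (/-monoˡ-≤ t
    (subst₂ _≤_ (sym (arith t x)) refl (+-mono-≤ h (≤-refl {t ∸ 1}))))
    where arith : ∀ t x .{{_ : NonZero t}} → suc x * t ≡ suc (t * x) + (t ∸ 1)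
          arith (suc t) x = identity t x
            where identity : ∀ t x → suc x * suc t ≡ suc (suc t * x) + t
                  identity = solve-∀

  candidate-complete : ∀ {t u v D} .{{_ : NonZero t}} → u < nv → v < nv → Path E u v D →
    ∃[ δ ] (Candidate ln piv pd q d tbl t u v δ × δ ≤ D + 2 * ⌈ D / t ⌉ + 2)
  candidate-complete {t} {u} {v} {D} u< v< p with D ≤? CU.pos t + CV.pos t
    where module CU = Chain u< (path-points p)
          module CV = Chain v< (reverse-points E-sym (path-points p))
  -- The common vertex is `at s`, where `s` is the last position reached from `u`. On the reversed
  -- path it has position `D ∸ s`, which the expansion of `v` has reached.
  ... | yes h = let δ , δ≤ , lv = CU.reach t s ≤-refl
                    δ′ , δ′≤ , lv′ = CV.reach t (D ∸ s) (m≤n+o⇒m∸n≤o D s h)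
                in δ + δ′ , meet lv (subst (λ y → Lv v t (at y) δ′) (m∸[m∸n]≡n s≤D) lv′)
                 , ≤-trans (+-mono-≤ δ≤ δ′≤) (≤-trans (≤-reflexive (m+[n∸m]≡n s≤D))
                     (≤-trans (m≤m+n D (2 * ⌈ D / t ⌉)) (m≤m+n _ 2)))
    where
    module CU = Chain u< (path-points p)
    module CV = Chain v< (reverse-points E-sym (path-points p))
    open Points (path-points p)
    s = CU.pos t
    s≤D : s ≤ D
    s≤D = position≤ D at t
  ... | no h with average (λ i → CU.advance i + CV.advance (t ∸ suc i)) t D sum<
    where
    module CU = Chain u< (path-points p)
    module CV = Chain v< (reverse-points E-sym (path-points p))
    open ≤-Reasoning
    h′ : CU.pos t + CV.pos t < D
    h′ = ≰⇒> h
    -- Reversing the index pairs depth `i` on the side of `u` with depth `t ∸ suc i` on the side of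
    -- `v` and leaves the sum unchanged.
    sum< : ∑ (λ i → CU.advance i + CV.advance (t ∸ suc i)) t < D
    sum< = begin-strict
      ∑ (λ i → CU.advance i + CV.advance (t ∸ suc i)) t ≡⟨ ∑-+ CU.advance (λ i → CV.advance (t ∸ suc i)) t ⟩
      ∑ CU.advance t + ∑ (λ i → CV.advance (t ∸ suc i)) t ≡⟨ cong (∑ CU.advance t +_) (∑-reverse CV.advance t) ⟩
      ∑ CU.advance t + ∑ CV.advance t ≡⟨ sym (cong₂ _+_ (CU.pos-∑ t (≤-<-trans (m≤m+n _ _) h′)) (CV.pos-∑ t (≤-<-trans (m≤n+m _ (CU.pos t)) h′))) ⟩
      CU.pos t + CV.pos t <⟨ h′ ⟩
      D ∎
  ...   | i , i<t , small = δ + pd w + (T′ + (δ′ + pd x)) , via split lv lv′ pw px tk , bound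
    where
    module CU = Chain u< (path-points p)
    module CV = Chain v< (reverse-points E-sym (path-points p))
    open Points (path-points p)
    j = t ∸ suc i
    split : suc (i + j) ≡ t
    split = m+[n∸m]≡n i<t
    h′ : CU.pos t + CV.pos t < D
    h′ = ≰⇒> h
    j<t : suc j ≤ t
    j<t = subst (suc j ≤_) split (s≤s (m≤n+m j i))
    NU = CU.pivot-near i (≤-<-trans (CU.pos-mono′ i<t) (≤-<-trans (m≤m+n _ _) h′))
    NV = CV.pivot-near j (≤-<-trans (CV.pos-mono′ j<t) (≤-<-trans (m≤n+m _ (CU.pos t)) h′))
    a = CU.pos i
    b = CV.pos j
    w = at a
    x = at (D ∸ b)
    δ = proj₁ NU
    δ′ = proj₁ NV
    lv = proj₁ (proj₂ (proj₂ NU))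
    lv′ = proj₁ (proj₂ (proj₂ NV))
    pw = proj₁ (proj₂ (proj₂ (proj₂ (proj₂ NU))))
    px = proj₁ (proj₂ (proj₂ (proj₂ (proj₂ NV))))
    S₁ = pivot-sound (level< u< lv) pw
    S₂ = pivot-sound (level< v< lv′) px
    a+b≤D : a + b ≤ D
    a+b≤D = ≤-trans (+-mono-≤ (CU.pos-mono′ (<⇒≤ i<t)) (CV.pos-mono′ (<⇒≤ j<t))) (<⇒≤ h′)
    c = D ∸ b ∸ a
    a≤ : a ≤ D ∸ b
    a≤ = m+n≤o⇒m≤o∸n a a+b≤D
    mid : Path E w x c
    mid = subst (λ z → Path E w (at z) c) (m+[n∸m]≡n a≤) (segment a c (≤-trans (≤-reflexive (m+[n∸m]≡n a≤)) (m∸n≤m D b)))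
    -- The table entry is compared with the walk from the first landmark back to `w`, along the path
    -- to `x` and on to the second landmark. This triangle inequality is where each landmark
    -- distance is used a second time.
    TC = tbl-complete (proj₁ S₁) (proj₁ S₂) (reverseᵖ E-sym (proj₂ S₁) ++ᵖ (mid ++ᵖ proj₂ S₂))
    T′ = proj₁ TC
    tk = proj₁ (proj₂ TC)
    abc : a + c + b ≡ D
    abc = trans (cong (_+ b) (m+[n∸m]≡n a≤)) (m∸n+n≡m (≤-trans (m≤n+m b a) a+b≤D))
    r = CU.advance i
    r′ = CV.advance j
    -- Each landmark distance is at most the radius plus 1 and is travelled twice, so the detour is
    -- `2 * suc r + 2 * suc r′`, which is `2 * suc (r + r′) + 2`. By the averaging, `suc (r + r′)`
    -- is at most the ceiling.
    bound : δ + pd w + (T′ + (δ′ + pd x)) ≤ D + 2 * ⌈ D / t ⌉ + 2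
    bound = begin
      δ + pd w + (T′ + (δ′ + pd x)) ≤⟨ +-mono-≤ (+-mono-≤ (proj₁ (proj₂ NU)) pw≤)
          (+-mono-≤ (≤-trans (proj₂ (proj₂ TC)) (+-mono-≤ pw≤ (+-monoʳ-≤ c px≤))) (+-mono-≤ (proj₁ (proj₂ NV)) px≤)) ⟩
      a + suc r + ((suc r + (c + suc r′)) + (b + suc r′)) ≡⟨ rearrange a b c r r′ ⟩
      a + c + b + 2 * suc (r + r′) + 2 ≡⟨ cong (λ z → z + 2 * suc (r + r′) + 2) abc ⟩
      D + 2 * suc (r + r′) + 2 ≤⟨ +-monoˡ-≤ 2 (+-monoʳ-≤ D (*-monoʳ-≤ 2 (ceiling D t (r + r′) small))) ⟩
      D + 2 * ⌈ D / t ⌉ + 2 ∎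
      where
      open ≤-Reasoning
      pw≤ : pd w ≤ suc r
      pw≤ = proj₂ (proj₂ (proj₂ (proj₂ (proj₂ NU))))
      px≤ : pd x ≤ suc r′
      px≤ = proj₂ (proj₂ (proj₂ (proj₂ (proj₂ NV))))
      rearrange : ∀ a b c r r′ → a + suc r + ((suc r + (c + suc r′)) + (b + suc r′)) ≡ a + c + b + 2 * suc (r + r′) + 2
      rearrange = solve-∀

-- Breadth-first search

pattern vout = 0
pattern vn = 1
pattern vM = 2
pattern vP = 3
pattern vnv = 4
pattern vi = 5
pattern vsrc = 6
pattern vcap = 7
pattern vbase = 8
pattern vsb = 9
pattern vh = 10
pattern vtail = 11
pattern vx = 12
pattern vd = 13
pattern vdx = 14
pattern vj = 15
pattern vy = 16
pattern vτ = 17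
pattern vz = 18
pattern vl = 19
pattern vk = 20
pattern va = 21
pattern vb = 22

pattern aDEG = 0
pattern aADJ = 1
pattern aROW = 2
pattern aSEEN = 3
pattern aQ = 4
pattern aD = 5
pattern aLN = 6
pattern aLIVE = 7
pattern aCA = 8
pattern aCB = 9
pattern aPIV = 10
pattern aPD = 11
pattern aLM = 12
pattern aTBL = 13
pattern aSC = 14

-- A mark is the distance plus one. Every search marks in a window of its own, starting at `vsb`, so
-- marks are never cleared; those of the lists serve later as membership tests and as distances to
-- landmarks.
scan : Cmd
scan = vy := aADJ ! (var vx ⊗ var vM ⊕ var vj) ▸
       cond (bin lt (var vtail) (var vcap)) (
         cond (bin eq (aSEEN ! (var vsb ⊕ var vy)) (lit 0)) (
           aSEEN [ var vsb ⊕ var vy ]:= var vd ⊕ lit 1 ▸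
           aQ [ var vbase ⊕ var vtail ]:= var vy ▸
           aD [ var vbase ⊕ var vtail ]:= var vd ▸
           vtail := var vtail ⊕ lit 1))

-- At most `vcap` neighbours are inspected. Being distinct, that many fill the list, so nothing is
-- lost, and a truncated search costs a multiple of the squared capacity whatever the degrees are.
visit : Cmd
visit = vx := aQ ! (var vbase ⊕ var vh) ▸
        vd := aD ! (var vbase ⊕ var vh) ⊕ lit 1 ▸
        vdx := aDEG ! var vx ▸
        cond (bin lt (var vcap) (var vdx)) (vdx := var vcap) ▸
        vj := lit 0 ▸
        for vj vdx scan ▸
        vh := var vh ⊕ lit 1

bfs : Cmd
bfs = aSEEN [ var vsb ⊕ var vsrc ]:= lit 1 ▸
      aQ [ var vbase ]:= var vsrc ▸
      aD [ var vbase ]:= lit 0 ▸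
      vtail := lit 1 ▸
      vh := lit 0 ▸
      whilst (bin lt (var vh) (var vtail)) visit

rel-pigeonhole : ∀ {a b} (R : ℕ → ℕ → Set) → (∀ j → j < a → ∃[ i ] (i < b × R j i)) →
                 (∀ {j j′ i} → j < a → j′ < a → R j i → R j′ i → j ≡ j′) → a ≤ b
rel-pigeonhole {a} {b} R f inj with a ≤? b
... | yes a≤b = a≤b
... | no a≰b = ⊥-elim (clash (pigeonhole (≰⇒> a≰b) g))
  where
  g : Fin a → Fin b
  g j = fromℕ< (proj₁ (proj₂ (f (toℕ j) (toℕ<n j))))
  val-g : ∀ j → toℕ (g j) ≡ proj₁ (f (toℕ j) (toℕ<n j))
  val-g j = toℕ-fromℕ< _
  clash : _ → ⊥
  clash (j , j′ , j<j′ , same) = <-irrefl (inj (toℕ<n j) (toℕ<n j′) (proj₂ (proj₂ (f (toℕ j) (toℕ<n j))))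
      (subst (R (toℕ j′)) (trans (sym (val-g j′)) (trans (cong toℕ (sym same)) (val-g j)))
        (proj₂ (proj₂ (f (toℕ j′) (toℕ<n j′)))))) j<j′

-- Adjacency lists: the neighbours of x are adj (x * M + j), j < deg x.
record Adjacency (E : ℕ → ℕ → Set) (nv M : ℕ) (adj deg : ℕ → ℕ) : Set where
  field
    E<       : ∀ {x y} → E x y → y < nv
    listed   : ∀ {x j} → x < nv → j < deg x → E x (adj (x * M + j))
    lists    : ∀ {x y} → E x y → ∃[ j ] (j < deg x × adj (x * M + j) ≡ y)
    distinct : ∀ {x j j′} → x < nv → j < deg x → j′ < deg x → adj (x * M + j) ≡ adj (x * M + j′) → j ≡ j′

Outside : (base size : ℕ) (f g : ℕ → ℕ) → Set
Outside base size f g = ∀ a → (∀ i → i < size → a ≢ base + i) → f a ≡ g a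

outside-upd : ∀ {base size f g i v} → i < size → Outside base size f g → Outside base size (f [ base + i ≔ v ]) g
outside-upd {f = f} {v = v} i< o a a∉ = trans (upd-≢ f v (a∉ _ i<)) (o a a∉)

-- Search results Q, D and marks S are found in the windows starting at base and sb.
record Marks (base sb nv : ℕ) (Q D S : ℕ → ℕ) (tl : ℕ) : Set where
  field
    mark  : ∀ {i} → i < tl → S (sb + Q (base + i)) ≡ suc (D (base + i))
    mark⁻ : ∀ {y} → y < nv → S (sb + y) ≢ 0 → ∃[ i ] (i < tl × Q (base + i) ≡ y)

module BFS {E : ℕ → ℕ → Set} {nv M : ℕ} {adj deg : ℕ → ℕ} (A : Adjacency E nv M adj deg)
           (cap src base sb : ℕ) (Q₀ D₀ S₀ : ℕ → ℕ) where
  open Adjacency A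

  Reached : (Q D : ℕ → ℕ) (tl y l : ℕ) → Set
  Reached Q D tl y l = (∃[ i ] (i < tl × Q (base + i) ≡ y × D (base + i) ≤ l)) ⊎
                       (tl ≡ cap × (∀ {i} → i < tl → D (base + i) ≤ l))

  reached-≤ : ∀ {Q D tl y l l′} → l ≤ l′ → Reached Q D tl y l → Reached Q D tl y l′
  reached-≤ h (inj₁ (i , i< , qi , di)) = inj₁ (i , i< , qi , ≤-trans di h)
  reached-≤ h (inj₂ (full , all)) = inj₂ (full , λ i< → ≤-trans (all i<) h)

  record Found (Q D S : ℕ → ℕ) (tl : ℕ) : Set where
    field
      nonempty : 0 < tl
      tl≤cap   : tl ≤ cap
      q-first  : Q (base + 0) ≡ src
      d-first  : D (base + 0) ≡ 0
      q<       : ∀ {i} → i < tl → Q (base + i) < nv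
      q-inj    : ∀ {i j} → i < tl → j < tl → Q (base + i) ≡ Q (base + j) → i ≡ j
      sound    : ∀ {i} → i < tl → Path E src (Q (base + i)) (D (base + i))
      d≤       : ∀ {i} → i < tl → D (base + i) ≤ i
      d-mono   : ∀ {i j} → i ≤ j → j < tl → D (base + i) ≤ D (base + j)
      marks    : Marks base sb nv Q D S tl
      outQ     : Outside base cap Q Q₀
      outD     : Outside base cap D D₀
      outS     : Outside sb nv S S₀
    open Marks marks public

  module _ (h x d₁ : ℕ) (tl₁ : ℕ) (Q₁ : ℕ → ℕ) where

    -- `tl₁` and `Q₁` are the tail and the queue when the visit of the head `x` began. `above` says
    -- that the queue does not reach beyond the layer after `x`, and `prefix` keeps the account of
    -- earlier visits valid.
    record Scan (Q D S : ℕ → ℕ) (tl j : ℕ) : Set where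
      field
        found  : Found Q D S tl
        h<     : h < tl
        qh     : Q (base + h) ≡ x
        dh     : suc (D (base + h)) ≡ d₁
        above  : ∀ {i} → i < tl → D (base + i) ≤ d₁
        before : ∀ {i y} → i < h → E (Q (base + i)) y → Reached Q D tl y (suc (D (base + i)))
        part   : ∀ {j′} → j′ < j → Reached Q D tl (adj (x * M + j′)) d₁
        prefix : ∀ {i} → i < tl₁ → Q (base + i) ≡ Q₁ (base + i)
        grows  : tl₁ ≤ tl
      open Found found public

    scan-more : ∀ {Q D S tl j} (sc : Scan Q D S tl j) → Reached Q D tl (adj (x * M + j)) d₁ → Scan Q D S tl (suc j)
    scan-more {Q} {D} {tl = tl} {j} sc r = record
      { found = found ; h< = h< ; qh = qh ; dh = dh ; above = above ; before = before
      ; part = λ { {j′} (s≤s j′≤j) → part′ j′≤j } ; prefix = prefix ; grows = grows }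
      where
      open Scan sc
      part′ : ∀ {j′} → j′ ≤ j → Reached Q D tl (adj (x * M + j′)) d₁
      part′ j′≤j with m≤n⇒m<n∨m≡n j′≤j
      ... | inj₁ j′<j = part j′<j
      ... | inj₂ refl = r

    scan-full : ∀ {Q D S tl j} → Scan Q D S tl j → cap ≤ tl → Scan Q D S tl (suc j)
    scan-full sc full = scan-more sc (inj₂ (≤-antisym tl≤cap full , above))
      where open Scan sc

    scan-seen : ∀ {Q D S tl j y} → Scan Q D S tl j → y ≡ adj (x * M + j) → y < nv → S (sb + y) ≢ 0 → Scan Q D S tl (suc j)
    scan-seen sc refl y< seen with Marks.mark⁻ (Found.marks (Scan.found sc)) y< seen
    ... | i , i< , qi = scan-more sc (inj₁ (i , i< , qi , Scan.above sc i<))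

    scan-new : ∀ {Q D S tl j y e} → Scan Q D S tl j → y ≡ adj (x * M + j) → y < nv → E x y → S (sb + y) ≡ 0 → tl < cap →
               e ≡ suc d₁ →
               Scan (Q [ base + tl ≔ y ]) (D [ base + tl ≔ d₁ ]) (S [ sb + y ≔ e ]) (tl + 1) (suc j)
    scan-new {Q} {D} {S} {tl} {j} {y} {e} sc refl y< Exy unseen tl< refl = subst (λ tl′ → Scan Q′ D′ S′ tl′ (suc j)) (+-comm 1 tl) new
      where
      open Scan sc
      Q′ = Q [ base + tl ≔ y ]
      D′ = D [ base + tl ≔ d₁ ]
      S′ = S [ sb + y ≔ e ]
      ne : ∀ {i} → i < tl → base + i ≢ base + tl
      ne i< p = <-irrefl (+-cancelˡ-≡ base _ tl p) i<
      oldQ : ∀ {i} → i < tl → Q′ (base + i) ≡ Q (base + i)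
      oldQ i< = upd-≢ Q y (ne i<)
      oldD : ∀ {i} → i < tl → D′ (base + i) ≡ D (base + i)
      oldD i< = upd-≢ D d₁ (ne i<)
      newQ : Q′ (base + tl) ≡ y
      newQ = upd-≡ Q {base + tl} y refl
      newD : D′ (base + tl) ≡ d₁
      newD = upd-≡ D {base + tl} d₁ refl
      fresh : ∀ {i} → i < tl → Q (base + i) ≢ y
      fresh i< p with trans (sym unseen) (trans (cong (λ z → S (sb + z)) (sym p)) (mark i<))
      ... | ()
      below : ∀ {i} (P : ℕ → Set) → i < suc tl → (∀ {i} → i < tl → P i) → P tl → P i
      below P (s≤s i≤) f g with m≤n⇒m<n∨m≡n i≤
      ... | inj₁ i< = f i<
      ... | inj₂ refl = g
      d₁≤ : d₁ ≤ tl
      d₁≤ = subst (_≤ tl) dh (≤-trans (s≤s (d≤ h<)) h<)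
      oldS : ∀ {z} → z ≢ y → S′ (sb + z) ≡ S (sb + z)
      oldS z≢y = upd-≢ S e (λ p → z≢y (+-cancelˡ-≡ sb _ y p))
      reached : ∀ {z l} → Reached Q D tl z l → Reached Q′ D′ (suc tl) z l
      reached (inj₁ (i , i< , qi , di)) = inj₁ (i , m≤n⇒m≤1+n i< , trans (oldQ i<) qi , subst (_≤ _) (sym (oldD i<)) di)
      reached (inj₂ (full , _)) = ⊥-elim (<-irrefl full tl<)
      above′ : ∀ {i} → i < suc tl → D′ (base + i) ≤ d₁
      above′ i< = below (λ i → D′ (base + i) ≤ d₁) i< (λ i< → subst (_≤ d₁) (sym (oldD i<)) (above i<)) (≤-reflexive newD)
      new : Scan Q′ D′ S′ (suc tl) (suc j)
      new = record
        { found = record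
          { nonempty = s≤s z≤n
          ; tl≤cap = tl<
          ; q-first = trans (oldQ nonempty) q-first
          ; d-first = trans (oldD nonempty) d-first
          ; q< = λ i< → below (λ i → Q′ (base + i) < nv) i< (λ i< → subst (_< nv) (sym (oldQ i<)) (q< i<)) (subst (_< nv) (sym newQ) y<)
          ; q-inj = λ {i} {j} i< j< → below (λ i → Q′ (base + i) ≡ Q′ (base + j) → i ≡ j) i<
              (λ {i} i< → below (λ j → Q′ (base + i) ≡ Q′ (base + j) → i ≡ j) j<
                (λ j< p → q-inj i< j< (trans (sym (oldQ i<)) (trans p (oldQ j<))))
                (λ p → ⊥-elim (fresh i< (trans (sym (oldQ i<)) (trans p newQ)))))
              (below (λ j → Q′ (base + tl) ≡ Q′ (base + j) → tl ≡ j) j<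
                (λ j< p → ⊥-elim (fresh j< (trans (sym (oldQ j<)) (trans (sym p) newQ))))
                (λ _ → refl))
          ; sound = λ i< → below (λ i → Path E src (Q′ (base + i)) (D′ (base + i))) i<
              (λ i< → subst₂ (Path E src) (sym (oldQ i<)) (sym (oldD i<)) (sound i<))
              (subst₂ (Path E src) (sym newQ) (trans dh (sym newD)) (sound h< ∷ʳ subst (λ z → E z y) (sym qh) Exy))
          ; d≤ = λ i< → below (λ i → D′ (base + i) ≤ i) i< (λ i< → subst (_≤ _) (sym (oldD i<)) (d≤ i<)) (subst (_≤ tl) (sym newD) d₁≤)
          ; d-mono = λ {i} {j} i≤j j< → below (λ j → i ≤ j → D′ (base + i) ≤ D′ (base + j)) j<
              (λ j< i≤j → subst₂ _≤_ (sym (oldD (≤-<-trans i≤j j<))) (sym (oldD j<)) (d-mono i≤j j<))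
              (λ i≤tl → subst (D′ (base + i) ≤_) (sym newD) (above′ (s≤s i≤tl))) i≤j
          ; marks = record
            { mark = λ i< → below (λ i → S′ (sb + Q′ (base + i)) ≡ suc (D′ (base + i))) i<
                (λ i< → trans (cong (λ z → S′ (sb + z)) (oldQ i<)) (trans (oldS (fresh i<)) (trans (mark i<) (cong suc (sym (oldD i<))))))
                (trans (cong (λ z → S′ (sb + z)) newQ) (trans (upd-≡ S {sb + y} e refl) (cong suc (sym newD))))
            ; mark⁻ = mark⁻′ }
          ; outQ = outside-upd {base} {cap} {Q} tl< outQ
          ; outD = outside-upd {base} {cap} {D} tl< outD
          ; outS = outside-upd {sb} {nv} {S} y< outS }
        ; h< = m≤n⇒m≤1+n h<
        ; qh = trans (oldQ h<) qh
        ; dh = trans (cong suc (oldD h<)) dh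
        ; above = above′
        ; before = λ {i} i<h Eqy → subst (λ z → Reached Q′ D′ (suc tl) _ (suc z)) (sym (oldD (<-trans i<h h<)))
                     (reached (before i<h (subst (λ z → E z _) (oldQ (<-trans i<h h<)) Eqy)))
        ; part = λ { {j′} (s≤s j′≤j) → part′ j′≤j }
        ; prefix = λ i< → trans (oldQ (<-≤-trans i< grows)) (prefix i<)
        ; grows = m≤n⇒m≤1+n grows }
        where
        mark⁻′ : ∀ {z} → z < nv → S′ (sb + z) ≢ 0 → ∃[ i ] (i < suc tl × Q′ (base + i) ≡ z)
        mark⁻′ {z} z< seen with z ≟ y
        ... | yes refl = tl , ≤-refl , newQ
        ... | no z≢y = let i , i< , qi = mark⁻ z< (λ p → seen (trans (oldS z≢y) p))
                       in i , m≤n⇒m≤1+n i< , trans (oldQ i<) qi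
        part′ : ∀ {j′} → j′ ≤ j → Reached Q′ D′ (suc tl) (adj (x * M + j′)) d₁
        part′ j′≤j with m≤n⇒m<n∨m≡n j′≤j
        ... | inj₁ j′<j = reached (part j′<j)
        ... | inj₂ refl = inj₁ (tl , ≤-refl , newQ , ≤-reflexive newD)

    -- A neighbour of index at least `cap` is never inspected. But then `cap` distinct neighbours
    -- were; unless the list is full, each of them is listed, and the pigeonhole principle makes the
    -- list full.
    scan-end : ∀ {Q D S tl} → x < nv → Scan Q D S tl (deg x ⊓ cap) →
               ∀ {i y} → i < suc h → E (Q (base + i)) y → Reached Q D tl y (suc (D (base + i)))
    scan-end {Q} {D} {S} {tl} x< sc {i} {y} (s≤s i≤h) e with m≤n⇒m<n∨m≡n i≤h
    ... | inj₁ i<h = Scan.before sc i<h e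
    ... | inj₂ refl = subst (Reached Q D tl y) (sym dh) reached
      where
      open Scan sc
      reached : Reached Q D tl y d₁
      reached with lists (subst (λ z → E z y) qh e)
      ... | j , j< , refl with j <? deg x ⊓ cap
      ...   | yes j<k = part j<k
      ...   | no j≮k with tl ≟ cap
      ...     | yes full = inj₂ (full , above)
      ...     | no ¬full = ⊥-elim (¬full (≤-antisym tl≤cap (rel-pigeonhole (λ j i → Q (base + i) ≡ adj (x * M + j)) place
                             (λ j< j′< p p′ → distinct x< (<-≤-trans j< cap≤) (<-≤-trans j′< cap≤) (trans (sym p) p′)))))
        where
        cap≤j : cap ≤ j
        cap≤j with ≤-total (deg x) cap
        ... | inj₁ le = ⊥-elim (j≮k (subst (j <_) (sym (m≤n⇒m⊓n≡m le)) j<))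
        ... | inj₂ ge = ≤-trans (≤-reflexive (sym (m≥n⇒m⊓n≡n ge))) (≮⇒≥ j≮k)
        cap≤ : cap ≤ deg x
        cap≤ = ≤-trans cap≤j (<⇒≤ j<)
        place : ∀ j → j < cap → ∃[ i ] (i < tl × Q (base + i) ≡ adj (x * M + j))
        place j j<cap with part (⊓-glb (≤-trans j<cap cap≤) j<cap)
        ... | inj₁ (i , i< , qi , _) = i , i< , qi
        ... | inj₂ (full , _) = ⊥-elim (¬full full)

  Closed : (Q D : ℕ → ℕ) (tl h : ℕ) → Set
  Closed Q D tl h = ∀ {i y} → i < h → E (Q (base + i)) y → Reached Q D tl y (suc (D (base + i)))

  -- Completeness goes by induction along the path: an edge out of a listed vertex costs one more
  -- step, and the alternative of a full list only gets weaker for longer paths.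
  found-ball : ∀ {Q D S tl} → Found Q D S tl → Closed Q D tl tl →
               Ball E nv cap src (λ i → Q (base + i)) (λ i → D (base + i)) tl
  found-ball {Q} {D} {S} {tl} f closed = record
    { nonempty = nonempty ; ln≤cap = tl≤cap ; q-first = q-first ; d-first = d-first ; q< = q< ; q-inj = q-inj
    ; sound = sound ; d≤ = d≤ ; d-mono = d-mono ; complete = complete }
    where
    open Found f
    complete : ∀ {y l} → Path E src y l → Reached Q D tl y l
    complete stay = inj₁ (0 , nonempty , q-first , ≤-reflexive d-first)
    complete (p ∷ʳ e) with complete p
    ... | inj₁ (i , i< , refl , di) = reached-≤ {Q} {D} (s≤s di) (closed i< e)
    ... | inj₂ (full , all) = inj₂ (full , λ i< → m≤n⇒m≤1+n (all i<))

  Found-start : src < nv → 0 < cap → (∀ {y} → y < nv → S₀ (sb + y) ≡ 0) →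
                Found (Q₀ [ base ≔ src ]) (D₀ [ base ≔ 0 ]) (S₀ [ sb + src ≔ 1 ]) 1
  Found-start src< cap> fresh = record
    { nonempty = s≤s z≤n ; tl≤cap = cap> ; q-first = newQ ; d-first = newD
    ; q< = λ { {zero} _ → subst (_< nv) (sym newQ) src< ; {suc _} (s≤s ()) }
    ; q-inj = λ { {zero} {zero} _ _ _ → refl ; {suc _} (s≤s ()) ; {zero} {suc _} _ (s≤s ()) }
    ; sound = λ { {zero} _ → subst₂ (Path E src) (sym newQ) (sym newD) stay ; {suc _} (s≤s ()) }
    ; d≤ = λ { {zero} _ → ≤-reflexive newD ; {suc _} (s≤s ()) }
    ; d-mono = λ { {zero} {zero} _ _ → ≤-refl ; {suc _} {zero} () ; {i} {suc _} _ (s≤s ()) }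
    ; marks = record
      { mark = λ { {zero} _ → trans (cong (λ z → S′ (sb + z)) newQ) (trans (upd-≡ S₀ {sb + src} 1 refl) (cong suc (sym newD)))
                 ; {suc _} (s≤s ()) }
      ; mark⁻ = λ {y} y< seen → 0 , s≤s z≤n , trans newQ (sym (src≡ y y< seen)) }
    ; outQ = λ a a∉ → upd-≢ Q₀ src (λ p → a∉ 0 cap> (trans p (sym (+-identityʳ base))))
    ; outD = λ a a∉ → upd-≢ D₀ 0 (λ p → a∉ 0 cap> (trans p (sym (+-identityʳ base))))
    ; outS = λ a a∉ → upd-≢ S₀ 1 (a∉ src src<) }
    where
    S′ = S₀ [ sb + src ≔ 1 ]
    newQ : (Q₀ [ base ≔ src ]) (base + 0) ≡ src
    newQ = upd-≡ Q₀ {base} src (+-identityʳ base)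
    newD : (D₀ [ base ≔ 0 ]) (base + 0) ≡ 0
    newD = upd-≡ D₀ {base} 0 (+-identityʳ base)
    src≡ : ∀ y → y < nv → S′ (sb + y) ≢ 0 → y ≡ src
    src≡ y y< seen with y ≟ src
    ... | yes p = p
    ... | no y≢ = ⊥-elim (seen (trans (upd-≢ S₀ 1 (λ p → y≢ (+-cancelˡ-≡ sb y src p))) (fresh y<)))

module BFS-WP (I : ℕ → ℕ) (B : ℕ) {E : ℕ → ℕ → Set} {nv M : ℕ} {adj deg : ℕ → ℕ} (A : Adjacency E nv M adj deg)
              (cap base sb : ℕ) (1+cap≤B : suc cap ≤ B) where

  Ctx : Store → Set
  Ctx s = arr s aADJ ≡ adj × arr s aDEG ≡ deg × val s vM ≡ M × val s vcap ≡ cap × val s vbase ≡ base × val s vsb ≡ sb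

  module _ (src : ℕ) (Q₀ D₀ S₀ : ℕ → ℕ) where
    open BFS A cap src base sb Q₀ D₀ S₀

    -- The third component is the two-layer property of the queue: nothing in it is more than one
    -- step beyond its head.
    Searching : Store → ℕ → Set
    Searching s h = Found (arr s aQ) (arr s aD) (arr s aSEEN) (val s vtail) ×
                    Closed (arr s aQ) (arr s aD) (val s vtail) h ×
                    (∀ {i} → i < val s vtail → h < val s vtail → arr s aD (base + i) ≤ suc (arr s aD (base + h)))

    work : Store → ℕ → ℕ
    work s = ∑ (λ i → 1 + (deg (arr s aQ (base + i)) ⊓ cap))

    scan-step : ∀ {h x d₁ tl₁ Q₁ s j} → Ctx s → x < nv → val s vx ≡ x → val s vd ≡ d₁ → val s vj ≡ j → j < deg x →
      Scan h x d₁ tl₁ Q₁ (arr s aQ) (arr s aD) (arr s aSEEN) (val s vtail) j →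
      WP I B scan s (λ t s′ → t ≡ 0 × Scan h x d₁ tl₁ Q₁ (arr s′ aQ) (arr s′ aD) (arr s′ aSEEN) (val s′ vtail) (suc j))
    scan-step {h} {x} {d₁} {tl₁} {Q₁} {s} {j} (cA , cG , cM , cC , cB , cS) x< refl refl refl j< sc =
      block tt , (λ room →
          (λ unseen → d₁+1≤B , tt , tt , tail+1≤B , (refl ,
             subst₂ (λ b b′ → Scan h x d₁ tl₁ Q₁ (arr s aQ [ b + tl ≔ y ]) (arr s aD [ b + tl ≔ d₁ ]) (arr s aSEEN [ b′ + y ≔ d₁ + 1 ]) (tl + 1) (suc j))
               (sym cB) (sym cS)
               (scan-new h x d₁ tl₁ Q₁ sc y≡ y< (subst (E x) (sym y≡) edge)
                  (trans (cong (λ b → arr s aSEEN (b + y)) (sym cS)) (≡?-nonzero unseen)) (tl<cap room) (+-comm d₁ 1)))) ,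
          (λ seen → refl , scan-seen h x d₁ tl₁ Q₁ sc y≡ y<
             (λ z → ≡?-zero seen (trans (cong (λ b → arr s aSEEN (b + y)) cS) z)))) ,
        (λ full → refl , scan-full h x d₁ tl₁ Q₁ sc (subst (_≤ val s vtail) cC (<?-zero full)))
      where
      tl = val s vtail
      y = arr s aADJ (val s vx * val s vM + val s vj)
      y≡ : y ≡ adj (x * M + j)
      y≡ = trans (cong (λ f → f (x * val s vM + j)) cA) (cong (λ m → adj (x * m + j)) cM)
      edge : E x (adj (x * M + j))
      edge = Adjacency.listed A x< j<
      y< : y < nv
      y< = subst (_< nv) (sym y≡) (Adjacency.E< A edge)
      tl<cap : _ → tl < cap
      tl<cap room = subst (tl <_) cC (<?-nonzero room)
      open Scan sc using (h<; dh; tl≤cap; d≤)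
      d₁≤cap : d₁ ≤ cap
      d₁≤cap = subst (_≤ cap) dh (≤-trans (s≤s (d≤ h<)) (≤-trans h< tl≤cap))
      d₁+1≤B : d₁ + 1 ≤ B
      d₁+1≤B = ≤-trans (≤-reflexive (+-comm d₁ 1)) (≤-trans (s≤s d₁≤cap) 1+cap≤B)
      tail+1≤B : tl + 1 ≤ B
      tail+1≤B = ≤-trans (≤-reflexive (+-comm tl 1)) (≤-trans (s≤s tl≤cap) 1+cap≤B)

    rest : Cmd
    rest = vj := lit 0 ▸ for vj vdx scan ▸ vh := var vh ⊕ lit 1

    visit-rest : ∀ {s h} → Ctx s → val s vh ≡ h → h < val s vtail → Searching s h →
      val s vx ≡ arr s aQ (base + h) → val s vd ≡ suc (arr s aD (base + h)) → val s vdx ≡ deg (val s vx) ⊓ cap →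
      WP I B rest s (λ t s′ → val s′ vh ≡ suc h × h < val s′ vtail × Searching s′ (suc h) × suc (work s h + t) ≤ work s′ (suc h))
    visit-rest {s} {h} cx@(cA , cG , cM , cC , cB , cS) refl h< (found , closed , near) xq dq dx =
      block z≤n , wp-seq (wp-for {x = vj} {vdx} {scan}
        (λ j t s′ → t ≡ j × Scan h x d₁ tl₁ Q₁ (arr s′ aQ) (arr s′ aD) (arr s′ aSEEN) (val s′ vtail) j)
        refl refl refl k≤B refl dx z≤n
        (λ _ j< vj≡ fr (t≡j , sc) → wp-mono (λ { (refl , sc′) → trans (cong (_+ 1) t≡j) (+-comm _ 1) , sc′ })
           (scan-step (trans (onA fr aADJ refl) cA , trans (onA fr aDEG refl) cG , trans (onV fr vM refl) cM
                      , trans (onV fr vcap refl) cC , trans (onV fr vbase refl) cB , trans (onV fr vsb refl) cS)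
              x< (onV fr vx refl) (trans (onV fr vd refl) dq) vj≡ (≤-trans j< (m⊓n≤m (deg x) cap)) sc))
        (λ {t} {s′} fr (t≡k , sc) → let vh≡ = onV fr vh refl in
           block ≤-trans (≤-reflexive (trans (cong (_+ 1) vh≡) (+-comm h 1))) (≤-trans (Scan.h< sc) (≤-trans (Scan.tl≤cap sc) (≤-trans (n≤1+n cap) 1+cap≤B))) ,
             ( trans (cong (_+ 1) vh≡) (+-comm h 1)
             , Scan.h< sc
             , ( Scan.found sc , (λ {i} {y} → scan-end h x d₁ tl₁ Q₁ x< sc {i} {y})
               , λ {i} i< h′< → ≤-trans (Scan.above sc i<) (s≤s (subst (_≤ _) (suc-injective (Scan.dh sc)) (Scan.d-mono sc (n≤1+n h) h′<))))
             , ≤-reflexive (total {s′} t≡k sc)))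
        (refl , record { found = found ; h< = h< ; qh = sym xq ; dh = refl
                ; above = λ i< → near i< h< ; before = closed ; part = λ () ; prefix = λ _ → refl ; grows = ≤-refl }))
      where
      open Found found
      x = val s vx
      d₁ = suc (arr s aD (base + h))
      tl₁ = val s vtail
      Q₁ = arr s aQ
      x< : x < nv
      x< = subst (_< nv) (sym xq) (q< h<)
      k≤B : deg x ⊓ cap ≤ B
      k≤B = ≤-trans (m⊓n≤n (deg x) cap) (≤-trans (n≤1+n cap) 1+cap≤B)
      total : ∀ {s′ t} → t ≡ deg x ⊓ cap → Scan h x d₁ tl₁ Q₁ (arr s′ aQ) (arr s′ aD) (arr s′ aSEEN) (val s′ vtail) (deg x ⊓ cap) →
              suc (work s h + (t + 0)) ≡ work s′ (suc h)
      total {s′} {t} t≡ sc = trans (cong (λ z → suc (work s h + z)) (+-identityʳ t)) (trans (sym (+-suc (work s h) t)) (cong₂ _+_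
          (∑-cong h (λ i i<h → cong (λ z → 1 + (deg z ⊓ cap)) (sym (Scan.prefix sc (<-trans i<h h<)))))
          (cong suc (trans t≡ (cong (λ z → deg z ⊓ cap) (sym (Scan.qh sc)))))))

    visit-step : ∀ {s h} → Ctx s → val s vh ≡ h → h < val s vtail → Searching s h →
      WP I B visit s (λ t s′ → val s′ vh ≡ suc h × h < val s′ vtail × Searching s′ (suc h) × suc (work s h + t) ≤ work s′ (suc h))
    visit-step {s} {h} cx@(cA , cG , cM , cC , cB , cS) refl h< se@(found , _ , _) =
      block tt , d+1≤B , tt , wp-seq (block
        (λ big → tt , (visit-rest cx refl h< se xq dq
            (trans cC (sym (trans (cong (λ g → g X ⊓ cap) (sym cG)) (m≥n⇒m⊓n≡n (<⇒≤ (subst (_< arr s aDEG X) cC (<?-nonzero big))))))))) ,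
        (λ small → visit-rest cx refl h< se xq dq
            (trans (cong (λ g → g X) cG) (sym (m≤n⇒m⊓n≡m (subst₂ (λ g c → g X ≤ c) cG cC (<?-zero small)))))))
      where
      open Found found
      X = arr s aQ (val s vbase + val s vh)
      xq : X ≡ arr s aQ (base + h)
      xq = cong (λ b → arr s aQ (b + h)) cB
      dq : arr s aD (val s vbase + val s vh) + 1 ≡ suc (arr s aD (base + h))
      dq = trans (+-comm _ 1) (cong (λ b → suc (arr s aD (b + h))) cB)
      d+1≤B : arr s aD (val s vbase + val s vh) + 1 ≤ B
      d+1≤B = ≤-trans (≤-reflexive dq) (≤-trans (s≤s (d≤ h<)) (≤-trans h< (≤-trans tl≤cap (≤-trans (n≤1+n cap) 1+cap≤B))))

  record Searched (src : ℕ) (s : Store) (t : ℕ) (s′ : Store) : Set where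
    field
      ball   : Ball E nv cap src (λ i → arr s′ aQ (base + i)) (λ i → arr s′ aD (base + i)) (val s′ vtail)
      marks  : Marks base sb nv (arr s′ aQ) (arr s′ aD) (arr s′ aSEEN) (val s′ vtail)
      outQ   : Outside base cap (arr s′ aQ) (arr s aQ)
      outD   : Outside base cap (arr s′ aD) (arr s aD)
      outS   : Outside sb nv (arr s′ aSEEN) (arr s aSEEN)
      time   : t ≤ ∑ (λ i → 1 + (deg (arr s′ aQ (base + i)) ⊓ cap)) (val s′ vtail)

  bfs-correct : ∀ {s src} → Ctx s → val s vsrc ≡ src → src < nv → 0 < cap →
    (∀ {y} → y < nv → arr s aSEEN (sb + y) ≡ 0) → src ≤ B →
    WP I B bfs s (Searched src s)
  bfs-correct {s} {src} cx@(cA , cG , cM , cC , cB , cS) refl src< cap> fresh src≤ =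
    block 1≤B , tt , z≤n , 1≤B , z≤n ,
      wp-whilst {e = bin lt (var vh) (var vtail)} {C = visit}
        -- Fuel is the capacity minus the head, since the head never passes the tail and the tail
        -- never passes the capacity.
        (λ f t s′ → ∃[ h ] (f + h ≡ cap × val s′ vh ≡ h × h ≤ val s′ vtail × Searching′ s′ h × t ≤ work′ s′ h))
        (λ { {f} {t} {s′} fr (h , fh , vh≡ , h≤ , se , t≤) more →
             let h< = subst (_< val s′ vtail) vh≡ (<?-nonzero more)
                 h<cap = <-≤-trans h< (Found.tl≤cap (proj₁ se))
             in cap ∸ suc h , fuel fh h<cap , wp-mono
               (λ { (vh′ , h<′ , se′ , t′≤) → suc h , m∸n+n≡m h<cap , vh′ , h<′ , se′
                  , ≤-trans (≤-trans (≤-reflexive (+-suc t _)) (s≤s (+-monoˡ-≤ _ t≤))) t′≤ })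
               (visit-step src (arr s aQ) (arr s aD) (arr s aSEEN)
                 ( trans (onA fr aADJ refl) cA , trans (onA fr aDEG refl) cG , trans (onV fr vM refl) cM
                 , trans (onV fr vcap refl) cC , trans (onV fr vbase refl) cB , trans (onV fr vsb refl) cS) vh≡ h< se) })
        (λ { {f} {t} {s′} fr (h , fh , vh≡ , h≤ , se , t≤) over →
             let h≡ = ≤-antisym h≤ (subst (val s′ vtail ≤_) vh≡ (<?-zero over))
                 open Found (proj₁ se)
             in record { ball = found-ball (proj₁ se) (λ {i} {y} → subst (Closed (arr s′ aQ) (arr s′ aD) (val s′ vtail)) h≡ (proj₁ (proj₂ se)) {i} {y})
                       ; marks = marks ; outQ = outQ ; outD = outD ; outS = outS
                       ; time = subst (λ h → t ≤ work′ s′ h) h≡ t≤ } })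
        (0 , +-identityʳ cap , refl , z≤n , (start , (λ ()) , λ {i} → near {i}) , z≤n)
    where
    open BFS A cap src base sb (arr s aQ) (arr s aD) (arr s aSEEN)
    1≤B : 1 ≤ B
    1≤B = ≤-trans (s≤s z≤n) 1+cap≤B
    Searching′ = Searching src (arr s aQ) (arr s aD) (arr s aSEEN)
    work′ = work src (arr s aQ) (arr s aD) (arr s aSEEN)
    fuel : ∀ {f h} → f + h ≡ cap → h < cap → f ≡ suc (cap ∸ suc h)
    fuel {f} {h} refl h< = trans (sym (m+n∸n≡m f h)) (+-∸-assoc 1 h<)
    near : ∀ {i} → i < 1 → 0 < 1 → (arr s aD [ val s vbase ≔ 0 ]) (base + i) ≤ suc ((arr s aD [ val s vbase ≔ 0 ]) (base + 0))
    near {zero} _ _ = n≤1+n _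
    near {suc _} (s≤s ()) _
    start = subst₂ (λ b b′ → Found (arr s aQ [ b ≔ src ]) (arr s aD [ b ≔ 0 ]) (arr s aSEEN [ b′ + src ≔ 1 ]) 1) (sym cB) (sym cS)
              (Found-start src< cap> fresh)

-- Adjacency lists

index-inj : ∀ {M x y i j} → i < M → j < M → x * M + i ≡ y * M + j → x ≡ y × i ≡ j
index-inj {M} {zero}  {zero}  i< j< p = refl , p
index-inj {M} {zero}  {suc y} {i} {j} i< j< p = ⊥-elim (<⇒≱ i< (≤-trans (m≤m+n M (y * M)) (≤-trans (m≤m+n (M + y * M) j) (≤-reflexive (sym p)))))
index-inj {M} {suc x} {zero}  {i} {j} i< j< p = ⊥-elim (<⇒≱ j< (≤-trans (m≤m+n M (x * M)) (≤-trans (m≤m+n (M + x * M) i) (≤-reflexive p))))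
index-inj {M} {suc x} {suc y} {i} {j} i< j< p =
  let x≡y , i≡j = index-inj {M} {x} {y} i< j< (+-cancelˡ-≡ M _ _ (trans (sym (+-assoc M (x * M) i)) (trans p (+-assoc M (y * M) j))))
  in cong suc x≡y , i≡j

∑-upd : ∀ (f : ℕ → ℕ) {k} v n → k < n → ∑ (f [ k ≔ v ]) n + f k ≡ ∑ f n + v
∑-upd f {k} v (suc n) (s≤s k≤n) with m≤n⇒m<n∨m≡n k≤n
... | inj₁ k<n = trans (cong (λ z → ∑ (f [ k ≔ v ]) n + z + f k) (upd-≢ f v (λ { refl → <-irrefl refl k<n })))
      (trans (swap (∑ (f [ k ≔ v ]) n) (f n) (f k)) (trans (cong (_+ f n) (∑-upd f v n k<n)) (swap (∑ f n) v (f n))))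
  where swap : ∀ a b c → a + b + c ≡ a + c + b
        swap = solve-∀
... | inj₂ refl = trans (cong₂ (λ a b → a + b + f k) (∑-cong k (λ i i<k → upd-≢ f v (λ { refl → <-irrefl refl i<k }))) (upd-≡ f {k} v refl))
                    (swap (∑ f k) v (f k))
  where swap : ∀ a b c → a + b + c ≡ a + c + b
        swap = solve-∀

-- Vertices are numbered by their first occurrence among the edge ends. There are at most `m * 2`
-- numbers, so a loop over all of them is affordable even when `m` is far below the number of
-- vertices.
rows : Cmd
rows = vi := lit 0 ▸
       for vi vM (va := inp (var vi ⊕ lit 3) ▸
                  cond (bin eq (aROW ! var va) (lit 0)) (vnv := var vnv ⊕ lit 1 ▸ aROW [ var va ]:= var vnv))

-- The rows are `m * 2` cells apart, which no degree exceeds, so they cannot overlap. The gaps cost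
-- nothing: only cells that are written take time.
adjacency : Cmd
adjacency = vi := lit 0 ▸
            for vi vM (va := aROW ! inp (var vi ⊕ lit 3) ⊝ lit 1 ▸
                       vb := aROW ! inp (var vi ⊕ lit 4 ⊝ bin mod (var vi) (lit 2) ⊗ lit 2) ⊝ lit 1 ▸
                       aADJ [ var va ⊗ var vM ⊕ aDEG ! var va ]:= var vb ▸
                       aDEG [ var va ]:= aDEG ! var va ⊕ lit 1)

-- Non-isolated vertices u are numbered by row u ∸ 1; isolated ones have row u ≡ 0.
record Numbering (I : ℕ → ℕ) (nv k : ℕ) (row : ℕ → ℕ) : Set where
  field
    numbered : ∀ {e} → e < k → ∃[ x ] (x < nv × row (I (e + 3)) ≡ suc x)
    occurs   : ∀ {u x} → row u ≡ suc x → x < nv × ∃[ e ] (e < k × I (e + 3) ≡ u)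
    row-inj  : ∀ {u u′ x} → row u ≡ suc x → row u′ ≡ suc x → u ≡ u′
    onto     : ∀ {x} → x < nv → ∃[ u ] (row u ≡ suc x)
    nv≤      : nv ≤ k

module _ (I : ℕ → ℕ) (B : ℕ) where

  numbering-old : ∀ {nv k row} → Numbering I nv k row → row (I (k + 3)) ≢ 0 → Numbering I nv (suc k) row
  numbering-old {nv} {k} {row} N old = record
    { numbered = λ { {e} (s≤s e≤k) → num e≤k }
    ; occurs = λ p → let x< , e , e< , q = occurs p in x< , e , m≤n⇒m≤1+n e< , q
    ; row-inj = row-inj ; onto = onto ; nv≤ = m≤n⇒m≤1+n nv≤ }
    where
    open Numbering N
    known : ∀ r → r ≡ row (I (k + 3)) → r ≢ 0 → ∃[ x ] (x < nv × row (I (k + 3)) ≡ suc x)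
    known zero    p nz = ⊥-elim (nz refl)
    known (suc x) p nz = x , proj₁ (occurs (sym p)) , sym p
    num : ∀ {e} → e ≤ k → ∃[ x ] (x < nv × row (I (e + 3)) ≡ suc x)
    num e≤k with m≤n⇒m<n∨m≡n e≤k
    ... | inj₁ e<k = numbered e<k
    ... | inj₂ refl = known _ refl old

  numbering-new : ∀ {nv k row u} → Numbering I nv k row → u ≡ I (k + 3) → row u ≡ 0 →
                  Numbering I (nv + 1) (suc k) (row [ u ≔ nv + 1 ])
  numbering-new {nv} {k} {row} {u} N refl new = subst (λ z → Numbering I z (suc k) (row [ u ≔ z ])) (+-comm 1 nv) (record
    { numbered = λ { {e} (s≤s e≤k) → num e≤k }
    ; occurs = occ
    ; row-inj = inj
    ; onto = λ { (s≤s x≤) → ont x≤ }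
    ; nv≤ = s≤s nv≤ })
    where
    open Numbering N
    row′ = row [ u ≔ suc nv ]
    newR : row′ u ≡ suc nv
    newR = upd-≡ row {u} (suc nv) refl
    oldR : ∀ {w x} → row w ≡ suc x → row′ w ≡ suc x
    oldR {w} p = trans (upd-≢ row (suc nv) (λ { refl → contradiction (trans (sym p) new) λ () })) p
    num : ∀ {e} → e ≤ k → ∃[ x ] (x < suc nv × row′ (I (e + 3)) ≡ suc x)
    num e≤k with m≤n⇒m<n∨m≡n e≤k
    ... | inj₁ e<k = let x , x< , p = numbered e<k in x , m≤n⇒m≤1+n x< , oldR p
    ... | inj₂ refl = nv , ≤-refl , newR
    occ : ∀ {w x} → row′ w ≡ suc x → x < suc nv × ∃[ e ] (e < suc k × I (e + 3) ≡ w)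
    occ {w} p with w ≟ u
    ... | yes refl with suc-injective (trans (sym newR) p)
    ...   | refl = ≤-refl , k , ≤-refl , refl
    occ {w} p | no w≢u = let x< , e , e< , q = occurs (trans (sym (upd-≢ row (suc nv) w≢u)) p) in m≤n⇒m≤1+n x< , e , m≤n⇒m≤1+n e< , q
    inj : ∀ {w w′ x} → row′ w ≡ suc x → row′ w′ ≡ suc x → w ≡ w′
    inj {w} {w′} p p′ with w ≟ u | w′ ≟ u
    ... | yes refl | yes refl = refl
    ... | no w≢ | no w′≢ = row-inj (trans (sym (upd-≢ row (suc nv) w≢)) p) (trans (sym (upd-≢ row (suc nv) w′≢)) p′)
    ... | yes refl | no w′≢ = ⊥-elim (<-irrefl (suc-injective (trans (sym p) newR)) (proj₁ (occurs (trans (sym (upd-≢ row (suc nv) w′≢)) p′))))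
    ... | no w≢ | yes refl = ⊥-elim (<-irrefl (suc-injective (trans (sym p′) newR)) (proj₁ (occurs (trans (sym (upd-≢ row (suc nv) w≢)) p))))
    ont : ∀ {x} → x ≤ nv → ∃[ w ] (row′ w ≡ suc x)
    ont x≤ with m≤n⇒m<n∨m≡n x≤
    ... | inj₁ x< = let w , p = onto x< in w , oldR p
    ... | inj₂ refl = u , newR

  rows-correct : ∀ {s} M → val s vM ≡ M → M ≤ B → val s vnv ≡ 0 → (∀ u → arr s aROW u ≡ 0) →
    WP I B rows s (λ t s′ → Frame rows s s′ × t ≡ M × Numbering I (val s′ vnv) M (arr s′ aROW))
  rows-correct {s} M M≡ M≤B nv0 row0 = wp-frame (block z≤n , wp-for {y = vM}
    (λ i t s′ → t ≡ i × Numbering I (val s′ vnv) i (arr s′ aROW))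
    refl refl refl M≤B refl M≡ z≤n
    (λ { {i} {t} {s′} _ i<M vi≡ fr (refl , N) →
         block tt ,
           (λ new → nv+1≤B i<M N , tt ,
              (+-comm i 1 , numbering-new N (cong (λ i → I (i + 3)) vi≡) (≡?-nonzero new))) ,
           (λ old → +-comm i 1 , numbering-old N (λ z → ≡?-zero old (trans (cong (λ i → arr s′ aROW (I (i + 3))) vi≡) z))) })
    (λ _ j → j)
    (refl , record { numbered = λ () ; occurs = λ {u} p → contradiction (trans (sym (row0 u)) p) λ ()
                   ; row-inj = λ {u} p → contradiction (trans (sym (row0 u)) p) λ ()
                   ; onto = λ x< → contradiction (subst (_ <_) nv0 x<) λ () ; nv≤ = ≤-reflexive nv0 }))
    where
    nv+1≤B : ∀ {i nv row} → i < M → Numbering I nv i row → nv + 1 ≤ B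
    nv+1≤B {nv = nv} i<M N = ≤-trans (≤-reflexive (+-comm nv 1)) (≤-trans (s≤s (Numbering.nv≤ N)) (≤-trans i<M M≤B))

module Arcs (nv M : ℕ) (S T : ℕ → ℕ) (S< : ∀ {e} → e < M → S e < nv) (T< : ∀ {e} → e < M → T e < nv)
            (arc-inj : ∀ {e e′} → e < M → e′ < M → S e ≡ S e′ → T e ≡ T e′ → e ≡ e′) where

  Arc : ℕ → ℕ → Set
  Arc x y = ∃[ e ] (e < M × S e ≡ x × T e ≡ y)

  -- The state after `i` arcs. `deg≤` keeps a new entry inside its row, and `total`, once `i` is
  -- `M`, bounds the cost of a search through the whole graph.
  record Partial (i : ℕ) (adj deg : ℕ → ℕ) : Set where
    field
      listed   : ∀ {x j} → x < nv → j < deg x → ∃[ e ] (e < i × S e ≡ x × T e ≡ adj (x * M + j))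
      lists    : ∀ {e} → e < i → ∃[ j ] (j < deg (S e) × adj (S e * M + j) ≡ T e)
      distinct : ∀ {x j j′} → x < nv → j < deg x → j′ < deg x → adj (x * M + j) ≡ adj (x * M + j′) → j ≡ j′
      deg≤     : ∀ {x} → x < nv → deg x ≤ i
      total    : ∑ deg nv ≡ i

  partial-adjacency : ∀ {adj deg} → Partial M adj deg → Adjacency Arc nv M adj deg
  partial-adjacency P = record
    { E< = λ { (e , e< , _ , refl) → T< e< }
    ; listed = listed
    ; lists = λ { (e , e< , refl , refl) → lists e< }
    ; distinct = distinct }
    where open Partial P

  partial-add : ∀ {i adj deg a b} → i < M → Partial i adj deg → a ≡ S i → b ≡ T i →
                Partial (suc i) (adj [ a * M + deg a ≔ b ]) (deg [ a ≔ deg a + 1 ])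
  partial-add {i} {adj} {deg} {a} {b} i< P refl refl = record
    { listed = listed′ ; lists = lists′ ; distinct = distinct′ ; deg≤ = deg≤′
    ; total = +-cancelʳ-≡ (deg a) _ _ (trans (∑-upd deg (deg a + 1) nv (S< i<)) (trans (cong (_+ (deg a + 1)) total) (arith i (deg a)))) }
    where
    open Partial P
    arith : ∀ i d → i + (d + 1) ≡ suc i + d
    arith = solve-∀
    adj′ = adj [ a * M + deg a ≔ b ]
    deg′ = deg [ a ≔ deg a + 1 ]
    deg-a : deg′ a ≡ suc (deg a)
    deg-a = trans (upd-≡ deg {a} (deg a + 1) refl) (+-comm (deg a) 1)
    deg-o : ∀ {x} → x ≢ a → deg′ x ≡ deg x
    deg-o ne = upd-≢ deg (deg a + 1) ne
    degM : ∀ {x} → x < nv → deg x < M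
    degM x< = ≤-<-trans (deg≤ x<) i<
    adj-new : adj′ (a * M + deg a) ≡ b
    adj-new = upd-≡ adj {a * M + deg a} b refl
    adj-old : ∀ {x j} → x < nv → j < deg x → adj′ (x * M + j) ≡ adj (x * M + j)
    adj-old {x} {j} x< j< = upd-≢ adj b (λ p → clash (index-inj {M} {x} {a} (<-trans j< (degM x<)) (degM (S< i<)) p))
      where clash : ¬ (x ≡ a × j ≡ deg a)
            clash (refl , refl) = <-irrefl refl j<
    split : ∀ {x j} → j < deg′ x → (j < deg x) ⊎ (x ≡ a × j ≡ deg a)
    split {x} {j} j< with x ≟ a
    ... | no ne = inj₁ (subst (j <_) (deg-o ne) j<)
    ... | yes refl with m≤n⇒m<n∨m≡n (suc[m]≤n⇒m≤pred[n] (subst (j <_) deg-a j<))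
    ...   | inj₁ h = inj₁ h
    ...   | inj₂ h = inj₂ (refl , h)
    listed′ : ∀ {x j} → x < nv → j < deg′ x → ∃[ e ] (e < suc i × S e ≡ x × T e ≡ adj′ (x * M + j))
    listed′ x< j< with split j<
    ... | inj₁ h = let e , e< , p , q = listed x< h in e , m≤n⇒m≤1+n e< , p , trans q (sym (adj-old x< h))
    ... | inj₂ (refl , refl) = i , ≤-refl , refl , sym adj-new
    grow : ∀ x {j} → j < deg x → j < deg′ x
    grow x j< with x ≟ a
    ... | no ne = subst (_ <_) (sym (deg-o ne)) j<
    ... | yes refl = subst (_ <_) (sym deg-a) (m≤n⇒m≤1+n j<)
    lists′ : ∀ {e} → e < suc i → ∃[ j ] (j < deg′ (S e) × adj′ (S e * M + j) ≡ T e)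
    lists′ {e} (s≤s e≤i) with m≤n⇒m<n∨m≡n e≤i
    ... | inj₁ e<i = let j , j< , p = lists e<i in j , grow (S e) j< , trans (adj-old (S< (<-trans e<i i<)) j<) p
    ... | inj₂ refl = deg a , subst (deg a <_) (sym deg-a) ≤-refl , adj-new
    no-dup : ∀ {j} → j < deg a → adj (a * M + j) ≢ b
    no-dup j< p with listed (S< i<) j<
    ... | e , e<i , Se , Te = <-irrefl (arc-inj (<-trans e<i i<) i< Se (trans Te p)) e<i
    distinct′ : ∀ {x j j′} → x < nv → j < deg′ x → j′ < deg′ x → adj′ (x * M + j) ≡ adj′ (x * M + j′) → j ≡ j′
    distinct′ x< j< j′< p with split j< | split j′<
    ... | inj₁ h | inj₁ h′ = distinct x< h h′ (trans (sym (adj-old x< h)) (trans p (adj-old x< h′)))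
    ... | inj₂ (_ , r) | inj₂ (_ , r′) = trans r (sym r′)
    ... | inj₁ h | inj₂ (refl , refl) = ⊥-elim (no-dup h (trans (sym (adj-old x< h)) (trans p adj-new)))
    ... | inj₂ (refl , refl) | inj₁ h′ = ⊥-elim (no-dup h′ (trans (sym (adj-old x< h′)) (trans (sym p) adj-new)))
    deg≤′ : ∀ {x} → x < nv → deg′ x ≤ suc i
    deg≤′ {x} x< with x ≟ a
    ... | yes refl = subst (_≤ suc i) (sym deg-a) (s≤s (deg≤ x<))
    ... | no ne = subst (_≤ suc i) (sym (deg-o ne)) (m≤n⇒m≤1+n (deg≤ x<))

-- The endpoints of an edge are adjacent input cells; the arc starting at the
-- e-th cell leads to the other one of the pair.
other : ℕ → ℕ
other e = e + 4 ∸ e % 2 * 2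

arcS arcT : (I row : ℕ → ℕ) → ℕ → ℕ
arcS I row e = row (I (e + 3)) ∸ 1
arcT I row e = row (I (other e)) ∸ 1

module _ (I : ℕ → ℕ) (B : ℕ) {nv M : ℕ} (row : ℕ → ℕ) where

  module _ (S< : ∀ {e} → e < M → arcS I row e < nv) (T< : ∀ {e} → e < M → arcT I row e < nv)
           (arc-inj : ∀ {e e′} → e < M → e′ < M → arcS I row e ≡ arcS I row e′ → arcT I row e ≡ arcT I row e′ → e ≡ e′) where
    open Arcs nv M (arcS I row) (arcT I row) S< T< arc-inj

    adjacency-correct : ∀ {s} → arr s aROW ≡ row → val s vM ≡ M → M ≤ B → (∀ x → arr s aDEG x ≡ 0) →
      WP I B adjacency s (λ t s′ → Frame adjacency s s′ × t ≡ M × Partial M (arr s′ aADJ) (arr s′ aDEG))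
    adjacency-correct {s} row≡ M≡ M≤B deg0 = wp-frame (block z≤n , wp-for {y = vM}
      (λ i t s′ → t ≡ i × Partial i (arr s′ aADJ) (arr s′ aDEG))
      refl refl refl M≤B refl M≡ z≤n
      (λ { {i} {t} {s′} _ i<M vi≡ fr (refl , P) →
           let a≡ : arr s′ aROW (I (val s′ vi + 3)) ∸ 1 ≡ arcS I row i
               a≡ = trans (cong (λ r → r (I (val s′ vi + 3)) ∸ 1) (trans (onA fr aROW refl) row≡)) (cong (arcS I row) vi≡)
               b≡ : arr s′ aROW (I (val s′ vi + 4 ∸ val s′ vi % 2 * 2)) ∸ 1 ≡ arcT I row i
               b≡ = trans (cong (λ r → r (I (val s′ vi + 4 ∸ val s′ vi % 2 * 2)) ∸ 1) (trans (onA fr aROW refl) row≡)) (cong (arcT I row) vi≡)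
               vM≡ = trans (onV fr vM refl) M≡
           in block tt , tt , tt ,
                (≤-trans (≤-reflexive (+-comm _ 1)) (≤-trans (s≤s (subst (λ a → arr s′ aDEG a ≤ i) (sym a≡) (Partial.deg≤ P (S< i<M)))) (≤-trans i<M M≤B))) ,
                (+-comm i 1 , subst (λ m → Partial (suc i)
                      (arr s′ aADJ [ a s′ * m + arr s′ aDEG (a s′) ≔ b s′ ]) (arr s′ aDEG [ a s′ ≔ arr s′ aDEG (a s′) + 1 ]))
                    (sym vM≡) (partial-add i<M P a≡ b≡)) })
      (λ _ j → j)
      (refl , record
        { listed = λ {x} _ j< → contradiction (subst (_ <_) (deg0 x) j<) λ ()
        ; lists = λ () ; distinct = λ {x} _ j< → contradiction (subst (_ <_) (deg0 x) j<) λ ()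
        ; deg≤ = λ {x} _ → ≤-reflexive (deg0 x)
        ; total = trans (∑-cong nv (λ x _ → deg0 x)) (trans (∑-const 0 nv) (*-zeroʳ nv)) }))
      where
      a b : Store → ℕ
      a s′ = arr s′ aROW (I (val s′ vi + 3)) ∸ 1
      b s′ = arr s′ aROW (I (val s′ vi + 4 ∸ val s′ vi % 2 * 2)) ∸ 1

-- Truncated balls

ball-cong : ∀ {E nv cap s q q′ d d′ ln} → (∀ {i} → i < ln → q′ i ≡ q i) → (∀ {i} → i < ln → d′ i ≡ d i) →
            Ball E nv cap s q d ln → Ball E nv cap s q′ d′ ln
ball-cong {E} {nv} {cap} {s} {q} {q′} {d} {d′} {ln} q≡ d≡ b = record
  { nonempty = nonempty ; ln≤cap = ln≤cap ; q-first = trans (q≡ nonempty) q-first ; d-first = trans (d≡ nonempty) d-first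
  ; q< = λ i< → subst (_< nv) (sym (q≡ i<)) (q< i<)
  ; q-inj = λ i< j< p → q-inj i< j< (trans (sym (q≡ i<)) (trans p (q≡ j<)))
  ; sound = λ i< → subst₂ (Path E s) (sym (q≡ i<)) (sym (d≡ i<)) (sound i<)
  ; d≤ = λ i< → subst (_≤ _) (sym (d≡ i<)) (d≤ i<)
  ; d-mono = λ i≤j j< → subst₂ _≤_ (sym (d≡ (≤-<-trans i≤j j<))) (sym (d≡ j<)) (d-mono i≤j j<)
  ; complete = comp }
  where
  open Ball b
  comp : ∀ {y l} → Path E s y l → (∃[ i ] (i < ln × q′ i ≡ y × d′ i ≤ l)) ⊎ (ln ≡ cap × (∀ {i} → i < ln → d′ i ≤ l))
  comp p with complete p
  ... | inj₁ (i , i< , qi , di) = inj₁ (i , i< , trans (q≡ i<) qi , subst (_≤ _) (sym (d≡ i<)) di)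
  ... | inj₂ (full , all) = inj₂ (full , λ i< → subst (_≤ _) (sym (d≡ i<)) (all i<))

marks-cong : ∀ {base sb nv Q Q′ D D′ S S′ tl} → (∀ {i} → i < tl → Q′ (base + i) ≡ Q (base + i)) →
             (∀ {i} → i < tl → D′ (base + i) ≡ D (base + i)) → (∀ {y} → y < nv → S′ (sb + y) ≡ S (sb + y)) →
             (∀ {i} → i < tl → Q (base + i) < nv) → Marks base sb nv Q D S tl → Marks base sb nv Q′ D′ S′ tl
marks-cong {sb = sb} {S′ = S′} Q≡ D≡ S≡ Q< m = record
  { mark = λ i< → trans (cong (λ z → S′ (sb + z)) (Q≡ i<)) (trans (S≡ (Q< i<)) (trans (mark i<) (cong suc (sym (D≡ i<)))))
  ; mark⁻ = λ y< seen → let i , i< , p = mark⁻ y< (λ z → seen (trans (S≡ y<) z)) in i , i< , trans (Q≡ i<) p }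
  where open Marks m

record Rows (E : ℕ → ℕ → Set) (nv P : ℕ) (Q D S LN : ℕ → ℕ) (k : ℕ) : Set where
  field
    ball  : ∀ {x} → x < k → Ball E nv P x (λ j → Q (x * P + j)) (λ j → D (x * P + j)) (LN x)
    marks : ∀ {x} → x < k → Marks (x * P) (x * nv) nv Q D S (LN x)

balls : Cmd
balls = vcap := var vP ▸ vi := lit 0 ▸
        for vi vnv (vsrc := var vi ▸ vbase := var vi ⊗ var vP ▸ vsb := var vi ⊗ var vnv ▸
                    bfs ▸ aLN [ var vi ]:= var vtail)

module _ (I : ℕ → ℕ) (B : ℕ) {E : ℕ → ℕ → Set} {nv M : ℕ} {adj deg : ℕ → ℕ} (A : Adjacency E nv M adj deg)
         (P : ℕ) (P>0 : 0 < P) (1+P≤B : suc P ≤ B) (nvP≤B : nv * P ≤ B) (nvnv≤B : nv * nv ≤ B) where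

  -- By `index-inj` the queue windows of different sources are disjoint, and so are their mark
  -- windows. A search therefore spoils no earlier row and leaves the later mark windows zero.
  rows-step : ∀ {i s t s′ Q′ D′ S′} → i < nv → Rows E nv P (arr s aQ) (arr s aD) (arr s aSEEN) (arr s aLN) i →
    (∀ {x} → i ≤ x → ∀ {y} → y < nv → arr s aSEEN (x * nv + y) ≡ 0) →
    BFS-WP.Searched I B A P (i * P) (i * nv) 1+P≤B i s t s′ →
    arr s′ aLN ≡ arr s aLN → Q′ ≡ arr s′ aQ → D′ ≡ arr s′ aD → S′ ≡ arr s′ aSEEN →
    Rows E nv P Q′ D′ S′ (arr s′ aLN [ i ≔ val s′ vtail ]) (suc i) ×
    (∀ {x} → suc i ≤ x → ∀ {y} → y < nv → S′ (x * nv + y) ≡ 0)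
  rows-step {i} {s} {t} {s′} i<nv R fresh F ln≡ refl refl refl = record { ball = λ { (s≤s x≤) → ball′ x≤ } ; marks = λ { (s≤s x≤) → marks′ x≤ } } , fresh′
    where
    module F = BFS-WP.Searched F
    open Rows R
    LN′ = arr s′ aLN [ i ≔ val s′ vtail ]
    LN-i : LN′ i ≡ val s′ vtail
    LN-i = upd-≡ (arr s′ aLN) {i} _ refl
    LN-o : ∀ {x} → x < i → LN′ x ≡ arr s aLN x
    LN-o x<i = trans (upd-≢ (arr s′ aLN) _ (λ { refl → <-irrefl refl x<i })) (cong (λ f → f _) ln≡)
    sameQ : ∀ {x j} → x < i → j < arr s aLN x → arr s′ aQ (x * P + j) ≡ arr s aQ (x * P + j)
    sameQ {x} x<i j< = F.outQ _ (λ j′ j′< p → <-irrefl (proj₁ (index-inj {P} {x} {i} (<-≤-trans j< (Ball.ln≤cap (ball x<i))) j′< p)) x<i)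
    sameD : ∀ {x j} → x < i → j < arr s aLN x → arr s′ aD (x * P + j) ≡ arr s aD (x * P + j)
    sameD {x} x<i j< = F.outD _ (λ j′ j′< p → <-irrefl (proj₁ (index-inj {P} {x} {i} (<-≤-trans j< (Ball.ln≤cap (ball x<i))) j′< p)) x<i)
    sameS : ∀ {x y} → x ≢ i → y < nv → arr s′ aSEEN (x * nv + y) ≡ arr s aSEEN (x * nv + y)
    sameS {x} x≢ y< = F.outS _ (λ y′ y′< p → x≢ (proj₁ (index-inj {nv} {x} {i} y< y′< p)))
    ball′ : ∀ {x} → x ≤ i → Ball E nv P x (λ j → arr s′ aQ (x * P + j)) (λ j → arr s′ aD (x * P + j)) (LN′ x)
    ball′ x≤ with m≤n⇒m<n∨m≡n x≤
    ... | inj₁ x< = subst (Ball E nv P _ _ _) (sym (LN-o x<)) (ball-cong (sameQ x<) (sameD x<) (ball x<))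
    ... | inj₂ refl = subst (Ball E nv P i _ _) (sym LN-i) F.ball
    marks′ : ∀ {x} → x ≤ i → Marks (x * P) (x * nv) nv (arr s′ aQ) (arr s′ aD) (arr s′ aSEEN) (LN′ x)
    marks′ {x} x≤ with m≤n⇒m<n∨m≡n x≤
    ... | inj₁ x< = subst (Marks (x * P) (x * nv) nv (arr s′ aQ) (arr s′ aD) (arr s′ aSEEN)) (sym (LN-o x<))
                      (marks-cong (sameQ x<) (sameD x<) (sameS {x} (λ { refl → <-irrefl refl x< })) (Ball.q< (ball x<)) (marks x<))
    ... | inj₂ refl = subst (Marks (i * P) (i * nv) nv (arr s′ aQ) (arr s′ aD) (arr s′ aSEEN)) (sym LN-i) F.marks
    fresh′ : ∀ {x} → suc i ≤ x → ∀ {y} → y < nv → arr s′ aSEEN (x * nv + y) ≡ 0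
    fresh′ {x} i<x y< = trans (sameS {x} (λ { refl → <-irrefl refl i<x }) y<) (fresh (<⇒≤ i<x) y<)

  balls-correct : ∀ {s} → arr s aADJ ≡ adj → arr s aDEG ≡ deg → val s vM ≡ M → val s vP ≡ P → val s vnv ≡ nv → nv ≤ B →
    (∀ a → arr s aSEEN a ≡ 0) →
    WP I B balls s (λ t s′ → Frame balls s s′ × t ≤ nv * (1 + P * (1 + P)) ×
                             Rows E nv P (arr s′ aQ) (arr s′ aD) (arr s′ aSEEN) (arr s′ aLN) nv ×
                             (∀ {x} → nv ≤ x → ∀ {y} → y < nv → arr s′ aSEEN (x * nv + y) ≡ 0))
  balls-correct {s} adj≡ deg≡ M≡ P≡ nv≡ nv≤B fresh = wp-frame (block tt , z≤n , wp-for {y = vnv}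
    (λ i t s′ → t ≤ i * (1 + P * (1 + P)) × Rows E nv P (arr s′ aQ) (arr s′ aD) (arr s′ aSEEN) (arr s′ aLN) i ×
                (∀ {x} → i ≤ x → ∀ {y} → y < nv → arr s′ aSEEN (x * nv + y) ≡ 0))
    refl refl refl nv≤B refl nv≡ z≤n
    (λ { {i} {t} {s′} _ i<nv vi≡ fr (t≤ , R , fresh′) →
         let P≡′ = trans (onV fr vP refl) P≡
             nv≡′ = trans (onV fr vnv refl) nv≡
             base≡ = cong₂ _*_ vi≡ P≡′
             sb≡ = cong₂ _*_ vi≡ nv≡′
         in block tt , ≤-trans (≤-reflexive base≡) (≤-trans (*-monoˡ-≤ P (<⇒≤ i<nv)) nvP≤B)
            , ≤-trans (≤-reflexive sb≡) (≤-trans (*-monoˡ-≤ nv (<⇒≤ i<nv)) nvnv≤B)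
            , wp-seq (wp-mono (λ { {t₁} {s₁} (fr₁ , F) →
               let vi₁ = trans (onV fr₁ vi refl) vi≡
                   R′ , fr′ = rows-step i<nv R fresh′ F (onA fr₁ aLN refl) refl refl refl
               in block tt , ( time {i} {t} t₁ t≤ (search-time F)
                            , subst (λ z → Rows E nv P _ _ _ (arr s₁ aLN [ z ≔ val s₁ vtail ]) (suc i)) (sym vi₁) R′
                            , λ {x} → fr′ {x}) })
             (wp-frame (BFS-WP.bfs-correct I B A P (i * P) (i * nv) 1+P≤B
               ( trans (onA fr aADJ refl) adj≡ , trans (onA fr aDEG refl) deg≡ , trans (onV fr vM refl) M≡
               , trans (onV fr vcap refl) P≡ , base≡ , sb≡)
               vi≡ i<nv P>0 (λ y< → fresh′ ≤-refl y<) (≤-trans (<⇒≤ i<nv) nv≤B)))) })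
    (λ _ j → j)
    (z≤n , record { ball = λ () ; marks = λ () } , λ _ _ → fresh _))
    where
    search-time : ∀ {i s₀ t s₁} → BFS-WP.Searched I B A P (i * P) (i * nv) 1+P≤B i s₀ t s₁ → t ≤ P * (1 + P)
    search-time {i} {s₁ = s₁} F = ≤-trans F.time (≤-trans (∑-mono (val s₁ vtail) (λ j _ → s≤s (m⊓n≤n (deg (arr s₁ aQ (i * P + j))) P)))
        (≤-trans (≤-reflexive (∑-const (1 + P) (val s₁ vtail))) (*-monoˡ-≤ (1 + P) (Ball.ln≤cap F.ball))))
      where module F = BFS-WP.Searched F
    time : ∀ {i t} t₁ → t ≤ i * (1 + P * (1 + P)) → t₁ ≤ P * (1 + P) → t + suc (t₁ + 0) ≤ suc i * (1 + P * (1 + P))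
    time {i} {t} t₁ t≤ t₁≤ = ≤-trans (+-mono-≤ t≤ (s≤s (≤-trans (≤-reflexive (+-identityʳ t₁)) t₁≤))) (≤-reflexive (+-comm (i * (1 + P * (1 + P))) _))

-- Counting occurrences in the lists

∑-swap : ∀ (f : ℕ → ℕ → ℕ) a b → ∑ (λ x → ∑ (f x) b) a ≡ ∑ (λ y → ∑ (λ x → f x y) a) b
∑-swap f zero    b = sym (trans (∑-const 0 b) (*-zeroʳ b))
∑-swap f (suc a) b = trans (cong (_+ ∑ (f a) b) (∑-swap f a b)) (sym (∑-+ (λ y → ∑ (λ x → f x y) a) (f a) b))

-- Kronecker's delta.
δ : ℕ → ℕ → ℕ
δ x y = if x ≡ᵇ y then 1 else 0

δ≤1 : ∀ x y → δ x y ≤ 1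
δ≤1 x y with x ≡ᵇ y
... | true  = ≤-refl
... | false = z≤n

δ-refl : ∀ x → δ x x ≡ 1
δ-refl x rewrite ≡ᵇ-refl x = refl

δ-≢ : ∀ {x y} → x ≢ y → δ x y ≡ 0
δ-≢ ne rewrite ≢⇒≡ᵇ ne = refl

∑-zero : ∀ {f} k → (∀ {i} → i < k → f i ≡ 0) → ∑ f k ≡ 0
∑-zero k h = trans (∑-cong k (λ i i< → h i<)) (trans (∑-const 0 k) (*-zeroʳ k))

∑-δ : ∀ x n → x < n → ∑ (δ x) n ≡ 1
∑-δ x (suc n) (s≤s x≤n) with m≤n⇒m<n∨m≡n x≤n
... | inj₁ x<n = trans (cong₂ _+_ (∑-δ x n x<n) (δ-≢ {x} {n} (λ { refl → <-irrefl refl x<n }))) refl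
... | inj₂ refl = cong₂ _+_ (∑-zero x (λ {i} i< → δ-≢ {x} {i} (λ { refl → <-irrefl refl i< }))) (δ-refl x)

-- Multiplicity of `y` in the row of `x`. For full rows it is 0 or 1 and forms the incidence matrix
-- of the set system that the landmarks have to hit.
mult : (P : ℕ) (Q : ℕ → ℕ) (x y : ℕ) → ℕ
mult P Q x y = ∑ (λ j → δ (Q (x * P + j)) y) P

∑-δ≤1 : ∀ (q : ℕ → ℕ) y k → (∀ {i j} → i < k → j < k → q i ≡ q j → i ≡ j) → ∑ (λ j → δ (q j) y) k ≤ 1
∑-δ≤1 q y zero inj = z≤n
∑-δ≤1 q y (suc k) inj with q k ≟ y
... | no ne = subst (_≤ 1) (sym (trans (cong (∑ (λ j → δ (q j) y) k +_) (δ-≢ ne)) (+-identityʳ _)))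
                (∑-δ≤1 q y k (λ i< j< → inj (m≤n⇒m≤1+n i<) (m≤n⇒m≤1+n j<)))
... | yes refl = ≤-reflexive (cong₂ _+_ (∑-zero k (λ {i} i< → δ-≢ (λ p → <-irrefl (inj (m≤n⇒m≤1+n i<) ≤-refl p) i<))) (δ-refl y))

addrow : ℕ → Cmd
addrow k = vj := lit 0 ▸ for vj vP (vy := aQ ! (var vx ⊗ var vP ⊕ var vj) ▸ k [ var vy ]:= k ! var vy ⊕ lit 1)

arr-same : ∀ s k i v → arr (setA s k i v) k ≡ arr s k [ i ≔ v ]
arr-same s k i v rewrite ≡ᵇ-refl k = refl

module _ (I : ℕ → ℕ) (B : ℕ) where

  addrow-correct : ∀ {s k x P Q} → (aQ ≡ᵇ k) ≡ false → val s vx ≡ x → val s vP ≡ P → P ≤ B → arr s aQ ≡ Q →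
    (∀ y → arr s k y + P ≤ B) →
    WP I B (addrow k) s (λ t s′ → Frame (addrow k) s s′ × t ≡ P × (∀ y → arr s′ k y ≡ arr s k y + mult P Q x y))
  addrow-correct {s} {k} {x} {P} {Q} aQ≢k x≡ P≡ P≤B Q≡ small = wp-frame (block z≤n , wp-for {y = vP}
    (λ i t s′ → t ≡ i × (∀ y → arr s′ k y ≡ arr s k y + ∑ (λ j → δ (Q (x * P + j)) y) i))
    refl refl refl P≤B refl P≡ z≤n
    (λ { {i} {t} {s′} _ i<P vj≡ fr (refl , ih) →
       let Y = arr s′ aQ (val s′ vx * val s′ vP + val s′ vj)
           Y≡ : Y ≡ Q (x * P + i)
           Y≡ = trans (cong (λ f → f (val s′ vx * val s′ vP + val s′ vj)) (trans (onA fr aQ (trans (∨-no aQ≢k) refl)) Q≡))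
                  (cong Q (cong₂ _+_ (cong₂ _*_ (trans (onV fr vx refl) x≡) (trans (onV fr vP refl) P≡)) vj≡))
       in block tt , bound {arr s′ k} {i} {Y} i<P (ih Y) ,
            ( +-comm i 1
            , λ y → trans (cong (λ f → f y) (arr-same (setV s′ vy Y) k Y _)) (update ih Y≡ y)) })
    (λ _ j → j)
    (refl , λ y → sym (+-identityʳ _)))
    where
    ∨-no : ∀ {b} → b ≡ false → b ∨ false ≡ false
    ∨-no refl = refl
    ∑≤ : ∀ y i → ∑ (λ j → δ (Q (x * P + j)) y) i ≤ i
    ∑≤ y i = ≤-trans (∑-mono i (λ j _ → δ≤1 (Q (x * P + j)) y)) (≤-reflexive (trans (∑-const 1 i) (*-identityʳ i)))
    bound : ∀ {f : ℕ → ℕ} {i y} → i < P → f y ≡ arr s k y + ∑ (λ j → δ (Q (x * P + j)) y) i → f y + 1 ≤ B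
    bound {f} {i} {y} i<P p = ≤-trans (≤-reflexive (trans (cong (_+ 1) p) (trans (+-assoc (arr s k y) _ 1) (cong (arr s k y +_) (+-comm _ 1)))))
      (≤-trans (+-monoʳ-≤ (arr s k y) (≤-trans (s≤s (∑≤ y i)) i<P)) (small y))
    update : ∀ {f : ℕ → ℕ} {i Y} → (∀ y → f y ≡ arr s k y + ∑ (λ j → δ (Q (x * P + j)) y) i) → Y ≡ Q (x * P + i) →
             ∀ y → (f [ Y ≔ f Y + 1 ]) y ≡ arr s k y + ∑ (λ j → δ (Q (x * P + j)) y) (suc i)
    update {f} {i} {Y} ih refl y with y ≟ Y
    ... | yes refl = trans (upd-≡ f {y} (f y + 1) refl) (trans (cong₂ _+_ (ih y) (sym (δ-refl y))) (+-assoc (arr s k y) _ _))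
    ... | no ne = trans (upd-≢ f (f Y + 1) ne) (trans (ih y) (cong (arr s k y +_) (sym (trans (cong (∑ _ i +_) (δ-≢ (λ p → ne (sym p)))) (+-identityʳ _)))))

-- Landmarks

-- The number of live lists through a vertex is kept as the difference of two counters that only
-- grow: `aCA` counts all full lists, `aCB` those already hit. Each list is thus entered at most
-- twice, with `P` iterations each time.
census hit choose pick greedy : Cmd

census = vi := lit 0 ▸
         for vi vnv (cond (bin eq (aLN ! var vi) (var vP)) (aLIVE [ var vi ]:= lit 1 ▸ vx := var vi ▸ call (addrow aCA)))

hit = cond (aLIVE ! var vi) (cond (aSEEN ! (var vi ⊗ var vnv ⊕ var vz)) (
        aLIVE [ var vi ]:= lit 0 ▸
        aPIV [ var vi ]:= var vl ▸
        aPD [ var vi ]:= aSEEN ! (var vi ⊗ var vnv ⊕ var vz) ⊝ lit 1 ▸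
        vx := var vi ▸
        call (addrow aCB)))

choose = vl := var vl ⊕ lit 1 ▸ aLM [ var vl ⊝ lit 1 ]:= var vz ▸ vi := lit 0 ▸ for vi vnv hit

-- The test says that at least `vτ` live lists contain `vz`, written without subtraction.
pick = cond (bin lt (aCB ! var vz ⊕ var vτ) (aCA ! var vz ⊕ lit 1)) choose

-- A sweep with threshold τ leaves every vertex in fewer than τ live lists, and the sweep with
-- threshold 1 leaves no live list. Halving replaces the search for a maximum before each choice by
-- a logarithmic number of sweeps.
greedy = vτ := var vnv ⊕ lit 1 ▸
         whilst (var vτ) (vz := lit 0 ▸ for vz vnv pick ▸ vτ := bin div (var vτ) (lit 2))

module Greedy (I : ℕ → ℕ) (B : ℕ) {E : ℕ → ℕ → Set} {nv P : ℕ} {Q D S LN : ℕ → ℕ} (R : Rows E nv P Q D S LN nv)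
              (P>0 : 0 < P) (nvP≤B : nv * P + P ≤ B) (1+nv≤B : suc nv ≤ B) where
  open Rows R

  private
    mul′ : ℕ → ℕ → ℕ
    mul′ = mult P Q

    P≤B : P ≤ B
    P≤B = ≤-trans (m≤n+m P (nv * P)) nvP≤B

    nv≤B : nv ≤ B
    nv≤B = ≤-trans (n≤1+n nv) 1+nv≤B

  mult≤P : ∀ x y → mul′ x y ≤ P
  mult≤P x y = ≤-trans (∑-mono P (λ j _ → δ≤1 (Q (x * P + j)) y)) (≤-reflexive (trans (∑-const 1 P) (*-identityʳ P)))

  full-window : ∀ {x j} → x < nv → LN x ≡ P → j < P → j < LN x
  full-window x< full j< = subst (_ <_) (sym full) j<

  mult≤1 : ∀ {x} → x < nv → LN x ≡ P → ∀ y → mul′ x y ≤ 1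
  mult≤1 {x} x< full y = ∑-δ≤1 (λ j → Q (x * P + j)) y P
    (λ i< j< → Ball.q-inj (ball x<) (full-window x< full i<) (full-window x< full j<))

  unmarked-mult : ∀ {x z} → x < nv → LN x ≡ P → S (x * nv + z) ≡ 0 → mul′ x z ≡ 0
  unmarked-mult {x} {z} x< full un = ∑-zero P λ {j} j< → δ-≢ {Q (x * P + j)} {z}
    (λ { refl → contradiction (trans (sym (Marks.mark (marks x<) (full-window x< full j<))) un) λ () })

  ∑-mult : ∀ {x} → x < nv → LN x ≡ P → ∑ (mul′ x) nv ≡ P
  ∑-mult {x} x< full = trans (∑-swap (λ y j → δ (Q (x * P + j)) y) nv P)
    (trans (∑-cong P (λ j j< → ∑-δ (Q (x * P + j)) nv (Ball.q< (ball x<) (full-window x< full j<))))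
      (trans (∑-const 1 P) (*-identityʳ P)))

  alive : (ℕ → ℕ) → ℕ → ℕ
  alive LIVE y = ∑ (λ x → LIVE x * mul′ x y) nv

  census-counts : ℕ → ℕ → ℕ
  census-counts y = ∑ (λ x → δ (LN x) P * mul′ x y)

  census≤ : ∀ y i → i ≤ nv → census-counts y i ≤ nv * P
  census≤ y i i≤nv = ≤-trans (∑-mono i (λ x _ → ≤-trans (*-monoˡ-≤ (mul′ x y) (δ≤1 (LN x) P)) (≤-trans (≤-reflexive (*-identityˡ _)) (mult≤P x y))))
    (≤-trans (≤-reflexive (∑-const P i)) (*-monoˡ-≤ P i≤nv))

  census-correct : ∀ {s} → arr s aQ ≡ Q → arr s aLN ≡ LN → val s vP ≡ P → val s vnv ≡ nv →
    (∀ x → arr s aLIVE x ≡ 0) → (∀ y → arr s aCA y ≡ 0) →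
    WP I B census s (λ t s′ → Frame census s s′ × t ≤ nv * (1 + P) × (∀ x → x < nv → arr s′ aLIVE x ≡ δ (LN x) P) ×
                              (∀ y → arr s′ aCA y ≡ census-counts y nv))
  census-correct {s} Q≡ LN≡ P≡ nv≡ live0 ca0 = wp-frame (block z≤n , wp-for {y = vnv}
    (λ i t s′ → t ≤ i * (1 + P) × ((∀ x → x < i → arr s′ aLIVE x ≡ δ (LN x) P) × (∀ x → i ≤ x → arr s′ aLIVE x ≡ 0)) ×
                (∀ y → arr s′ aCA y ≡ census-counts y i))
    refl refl refl nv≤B refl nv≡ z≤n
    (λ { {i} {t} {s′} _ i<nv refl fr (t≤ , (live , live0′) , ca) →
       let LN≡′ = cong (λ f → f i) (trans (onA fr aLN refl) LN≡)
           P≡′ = trans (onV fr vP refl) P≡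
       in block
         (λ isfull → let full = trans (sym LN≡′) (trans (≡?-nonzero isfull) P≡′) in
           ≤-trans (s≤s z≤n) 1+nv≤B , tt , (wp-mono
             (λ { {t₁} {s₁} (fr₁ , refl , cb) →
                step-time {t} {i} t≤ ≤-refl ,
                live-step {f = arr s′ aLIVE} (onA fr₁ aLIVE refl) (sym (trans (cong (λ z → δ z P) full) (δ-refl P))) live live0′ ,
                (λ y → trans (cb y) (cong₂ _+_ (ca y) (sym (trans (cong (λ z → z * mul′ i y) (trans (cong (λ z → δ z P) full) (δ-refl P))) (*-identityˡ _))))) })
             (addrow-correct I B refl refl P≡′ P≤B (trans (onA fr aQ refl) Q≡)
               (λ y → ≤-trans (+-monoˡ-≤ P (≤-trans (≤-reflexive (ca y)) (census≤ y i (<⇒≤ i<nv)))) nvP≤B)))) ,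
         (λ nofull → let notfull = δ-≢ {LN i} {P} (λ p → ≡?-zero nofull (trans LN≡′ (trans p (sym P≡′)))) in
             step-time {t} {i} t≤ z≤n ,
             ((λ { x (s≤s x≤i) → live-skip live live0′ notfull x≤i }) , λ x i<x → live0′ x (<⇒≤ i<x)) ,
             (λ y → trans (ca y) (sym (trans (cong (λ z → census-counts y i + z * mul′ i y) notfull) (+-identityʳ _))))) })
    (λ { _ (t≤ , (live , _) , ca) → t≤ , live , ca })
    (z≤n , ((λ _ ()) , λ x _ → live0 x) , ca0))
    where
    step-time : ∀ {t i t₁} → t ≤ i * (1 + P) → t₁ ≤ P → t + suc t₁ ≤ suc i * (1 + P)
    step-time {t} {i} t≤ t₁≤ = ≤-trans (+-mono-≤ t≤ (s≤s t₁≤)) (≤-reflexive (+-comm (i * (1 + P)) (1 + P)))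
    live-step : ∀ {f g : ℕ → ℕ} {i} → g ≡ f [ i ≔ 1 ] → 1 ≡ δ (LN i) P → (∀ x → x < i → f x ≡ δ (LN x) P) → (∀ x → i ≤ x → f x ≡ 0) →
      (∀ x → x < suc i → g x ≡ δ (LN x) P) × (∀ x → suc i ≤ x → g x ≡ 0)
    live-step {f} {i = i} refl p live live0′ = (λ { x (s≤s x≤) → go x≤ }) ,
        λ x i<x → trans (upd-≢ f 1 (λ { refl → <-irrefl refl i<x })) (live0′ x (<⇒≤ i<x))
      where go : ∀ {x} → x ≤ i → (f [ i ≔ 1 ]) x ≡ δ (LN x) P
            go x≤ with m≤n⇒m<n∨m≡n x≤
            ... | inj₁ x< = trans (upd-≢ f 1 (λ { refl → <-irrefl refl x< })) (live _ x<)
            ... | inj₂ refl = trans (upd-≡ f {i} 1 refl) p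
    live-skip : ∀ {f : ℕ → ℕ} {i x} → (∀ x → x < i → f x ≡ δ (LN x) P) → (∀ x → i ≤ x → f x ≡ 0) → δ (LN i) P ≡ 0 →
      x ≤ i → f x ≡ δ (LN x) P
    live-skip live live0′ p x≤ with m≤n⇒m<n∨m≡n x≤
    ... | inj₁ x< = live _ x<
    ... | inj₂ refl = trans (live0′ _ ≤-refl) (sym p)

  module Choice (CA : ℕ → ℕ) (CA≤ : ∀ y → CA y ≤ nv * P) where

    -- LIVE marks the full rows without a pivot; CB counts occurrences in the others.
    record Progress (LIVE CB PIV PD LM : ℕ → ℕ) (l : ℕ) : Set where
      field
        live≤1    : ∀ {x} → x < nv → LIVE x ≤ 1
        live-full : ∀ {x} → x < nv → LIVE x ≢ 0 → LN x ≡ P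
        counts    : ∀ y → CB y + alive LIVE y ≡ CA y
        dead      : ∀ {x} → x < nv → LN x ≡ P → LIVE x ≡ 0 → PIV x ≢ 0
        pivots    : ∀ {x k} → x < nv → PIV x ≡ suc k →
                    k < l × ∃[ j ] (j < LN x × Q (x * P + j) ≡ LM k × PD x ≡ D (x * P + j))
        LM<       : ∀ {k} → k < l → LM k < nv

    initial : ∀ {LIVE CB PIV PD LM} → (∀ x → x < nv → LIVE x ≡ δ (LN x) P) → (∀ y → CA y ≡ census-counts y nv) →
              (∀ y → CB y ≡ 0) → (∀ x → PIV x ≡ 0) → Progress LIVE CB PIV PD LM 0
    initial {LIVE} {CB} live ca cb0 piv0 = record
      { live≤1 = λ {x} x< → ≤-trans (≤-reflexive (live x x<)) (δ≤1 (LN x) P)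
      ; live-full = λ {x} x< nz → full x (λ p → nz (trans (live x x<) p))
      ; counts = λ y → trans (cong₂ _+_ (cb0 y) (∑-cong nv (λ x x< → cong (_* mul′ x y) (live x x<)))) (sym (ca y))
      ; dead = λ {x} x< p q → contradiction (trans (sym (trans (live x x<) (trans (cong (λ z → δ z P) p) (δ-refl P)))) q) λ ()
      ; pivots = λ {x} _ p → contradiction (trans (sym (piv0 x)) p) λ ()
      ; LM< = λ () }
      where full : ∀ x → δ (LN x) P ≢ 0 → LN x ≡ P
            full x nz with LN x ≟ P
            ... | yes p = p
            ... | no ne = ⊥-elim (nz (δ-≢ {LN x} {P} ne))

    transport : ∀ {LIVE CB PIV PD LM l LIVE′ PIV′ PD′ LM′ l′} → LIVE′ ≡ LIVE → PIV′ ≡ PIV → PD′ ≡ PD → LM′ ≡ LM → l′ ≡ l →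
                Progress LIVE CB PIV PD LM l → Progress LIVE′ CB PIV′ PD′ LM′ l′
    transport refl refl refl refl refl G = G

    new-landmark : ∀ {LIVE CB PIV PD LM l z} → z < nv → Progress LIVE CB PIV PD LM l →
                   Progress LIVE CB PIV PD (LM [ l + 1 ∸ 1 ≔ z ]) (l + 1)
    new-landmark {LIVE} {CB} {PIV} {PD} {LM} {l} {z} z< G = subst₂ (λ a b → Progress LIVE CB PIV PD (LM [ a ≔ z ]) b) (sym (m+n∸n≡m l 1)) (+-comm 1 l) (record
      { live≤1 = live≤1 ; live-full = live-full ; counts = counts ; dead = dead
      ; pivots = λ x< p → let k< , j , j< , q , d = pivots x< p in m≤n⇒m≤1+n k< , j , j< , trans q (sym (old k<)) , d
      ; LM< = λ { (s≤s k≤) → lm k≤ } })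
      where
      open Progress G
      old : ∀ {k} → k < l → (LM [ l ≔ z ]) k ≡ LM k
      old k< = upd-≢ LM z (λ { refl → <-irrefl refl k< })
      lm : ∀ {k} → k ≤ l → (LM [ l ≔ z ]) k < nv
      lm k≤ with m≤n⇒m<n∨m≡n k≤
      ... | inj₁ k< = subst (_< nv) (sym (old k<)) (LM< k<)
      ... | inj₂ refl = subst (_< nv) (sym (upd-≡ LM {l} z refl)) z<

    nonzero-one : ∀ {a} → a ≤ 1 → a ≢ 0 → a ≡ 1
    nonzero-one {zero}        _        nz = ⊥-elim (nz refl)
    nonzero-one {suc zero}    _        _  = refl
    nonzero-one {suc (suc _)} (s≤s ()) _

    ∑-kill : ∀ (f g : ℕ → ℕ) {i} → i < nv → f i ≡ 1 → ∑ (λ x → (f [ i ≔ 0 ]) x * g x) nv + g i ≡ ∑ (λ x → f x * g x) nv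
    ∑-kill f g {i} i< fi = trans (cong₂ _+_ (∑-cong nv (λ x _ → at x)) (sym (trans (cong (_* g i) fi) (*-identityˡ _))))
        (trans (∑-upd (λ x → f x * g x) 0 nv i<) (+-identityʳ _))
      where at : ∀ x → (f [ i ≔ 0 ]) x * g x ≡ ((λ x → f x * g x) [ i ≔ 0 ]) x
            at x with x ≡ᵇ i
            ... | true  = refl
            ... | false = refl

    kill : ∀ {LIVE CB CB′ PIV PD LM k i z} → Progress LIVE CB PIV PD LM (suc k) → i < nv → z < nv → LIVE i ≢ 0 →
           S (i * nv + z) ≢ 0 → LM k ≡ z → (∀ y → CB′ y ≡ CB y + mul′ i y) →
           Progress (LIVE [ i ≔ 0 ]) CB′ (PIV [ i ≔ suc k ]) (PD [ i ≔ S (i * nv + z) ∸ 1 ]) LM (suc k)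
    kill {LIVE} {CB} {CB′} {PIV} {PD} {LM} {k} {i} {z} G i< z< liv seen refl cb = record
      { live≤1 = λ {x} x< → live≤1′ x x<
      ; live-full = λ {x} x< nz → live-full x< (λ p → nz (zero-upd x p))
      ; counts = λ y → trans (cong (_+ _) (cb y)) (trans (shuffle (CB y) (mul′ i y) _)
          (trans (cong (CB y +_) (∑-kill LIVE (λ x → mul′ x y) i< (nonzero-one (live≤1 i<) liv))) (counts y)))
      ; dead = dead′ ; pivots = pivots′ ; LM< = LM< }
      where
      open Progress G
      shuffle : ∀ a b c → a + b + c ≡ a + (c + b)
      shuffle = solve-∀
      zero-upd : ∀ x → LIVE x ≡ 0 → (LIVE [ i ≔ 0 ]) x ≡ 0
      zero-upd x p with x ≡ᵇ i
      ... | true = refl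
      ... | false = p
      live≤1′ : ∀ x → x < nv → (LIVE [ i ≔ 0 ]) x ≤ 1
      live≤1′ x x< with x ≡ᵇ i
      ... | true = z≤n
      ... | false = live≤1 x<
      dead′ : ∀ {x} → x < nv → LN x ≡ P → (LIVE [ i ≔ 0 ]) x ≡ 0 → (PIV [ i ≔ suc k ]) x ≢ 0
      dead′ {x} x< full d with x ≡ᵇ i
      ... | true = λ ()
      ... | false = dead x< full d
      pivots′ : ∀ {x k′} → x < nv → (PIV [ i ≔ suc k ]) x ≡ suc k′ →
                k′ < suc k × ∃[ j ] (j < LN x × Q (x * P + j) ≡ LM k′ × (PD [ i ≔ S (i * nv + LM k) ∸ 1 ]) x ≡ D (x * P + j))
      pivots′ {x} x< p with x ≟ i
      ... | no ne = let k< , j , j< , q , d = pivots x< (trans (sym (upd-≢ PIV (suc k) ne)) p)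
                    in k< , j , j< , q , trans (upd-≢ PD _ ne) d
      ... | yes refl with suc-injective (trans (sym (upd-≡ PIV {i} (suc k) refl)) p)
      ...   | refl = let j , j< , q = Marks.mark⁻ (marks i<) z< seen in
                ≤-refl , j , j< , q , trans (upd-≡ PD {i} _ refl)
                  (cong (_∸ 1) (trans (cong (λ y → S (i * nv + y)) (sym q)) (Marks.mark (marks i<) j<)))

    Ctx : Store → Set
    Ctx s = arr s aQ ≡ Q × arr s aSEEN ≡ S × val s vP ≡ P × val s vnv ≡ nv

    State-of : Store → Set
    State-of s = Progress (arr s aLIVE) (arr s aCB) (arr s aPIV) (arr s aPD) (arr s aLM) (val s vl)

    U : Store → ℕ
    U s = ∑ (arr s aLIVE) nv

    -- The potential is `U * P`: a list that is hit costs `P` iterations for its entry in `aCB`, and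
    -- its leaving `U` releases exactly that.
    hit-step : ∀ {s i z k} → Ctx s → val s vi ≡ i → val s vz ≡ z → val s vl ≡ suc k → i < nv → z < nv → arr s aLM k ≡ z → State-of s →
      WP I B hit s (λ t s′ → State-of s′ × (arr s′ aLIVE i ≢ 0 → S (i * nv + z) ≡ 0) × (∀ x → arr s′ aLIVE x ≤ arr s aLIVE x) ×
                             t + U s′ * P ≤ U s * P)
    hit-step {s} {i} {z} {k} (Q≡ , S≡ , P≡ , nv≡) refl refl l≡ i< z< LMk G = block
      (λ liv →
        (λ seen → z≤n , tt , tt , tt , (wp-mono
          (λ { {t₁} {s₁} (fr , refl , cb) →
               transport (onA fr aLIVE refl) (trans (onA fr aPIV refl) (cong (λ v → arr s aPIV [ i ≔ v ]) l≡))
                 (trans (onA fr aPD refl) (cong (λ v → arr s aPD [ i ≔ v ∸ 1 ]) seen≡)) (onA fr aLM refl) (trans (onV fr vl refl) l≡)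
                 (kill (transport refl refl refl refl (sym l≡) G) i< z< liv (λ p → seen (trans seen≡ p)) LMk cb)
               , (λ nz → ⊥-elim (nz (trans (cong (λ f → f i) (onA fr aLIVE refl)) (upd-≡ (arr s aLIVE) {i} 0 refl))))
               , (λ x → subst (λ f → f x ≤ arr s aLIVE x) (sym (onA fr aLIVE refl)) (drop x))
               , ≤-reflexive (trans (cong (λ f → P + ∑ f nv * P) (onA fr aLIVE refl)) (weigh liv)) })
          (addrow-correct I B refl refl P≡ P≤B Q≡
            (λ y → ≤-trans (+-monoˡ-≤ P (≤-trans (m≤m+n _ _) (≤-trans (≤-reflexive (Progress.counts G y)) (CA≤ y)))) nvP≤B)))) ,
        (λ unseen → G , (λ _ → trans (sym seen≡) unseen) , (λ _ → ≤-refl) , ≤-refl)) ,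
      (λ dead → G , (λ nz → ⊥-elim (nz dead)) , (λ _ → ≤-refl) , ≤-refl)
      where
      seen≡ : arr s aSEEN (val s vi * val s vnv + val s vz) ≡ S (i * nv + z)
      seen≡ = trans (cong (λ f → f (i * val s vnv + z)) S≡) (cong (λ m → S (i * m + z)) nv≡)
      drop : ∀ x → (arr s aLIVE [ i ≔ 0 ]) x ≤ arr s aLIVE x
      drop x with x ≡ᵇ i
      ... | true = z≤n
      ... | false = ≤-refl
      weigh : arr s aLIVE i ≢ 0 → P + ∑ (arr s aLIVE [ i ≔ 0 ]) nv * P ≡ U s * P
      weigh liv = trans (cong (λ w → P + w) refl) (cong (_* P)
        (trans (+-comm 1 _) (trans (cong (∑ (arr s aLIVE [ i ≔ 0 ]) nv +_) (sym (nonzero-one (Progress.live≤1 G i<) liv)))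
          (trans (∑-upd (arr s aLIVE) 0 nv i<) (+-identityʳ _)))))

    -- All live lists through `z` die, and as `z` occurs at most once in each, `U` falls by at least
    -- their count. The loop over the rows costs `nv`; the entries in `aCB` are paid by the
    -- potential.
    choose-correct : ∀ {s z} → Ctx s → val s vz ≡ z → z < nv → State-of s → val s vl < nv →
      WP I B choose s (λ t s′ → State-of s′ × val s′ vl ≡ suc (val s vl) × (∀ x → arr s′ aLIVE x ≤ arr s aLIVE x) ×
                                U s′ + alive (arr s aLIVE) z ≤ U s × alive (arr s′ aLIVE) z ≡ 0 × t + U s′ * P ≤ nv + U s * P)
    choose-correct {s} {z} (Q≡ , S≡ , P≡ , nv≡) refl z< G l<nv =
      block ≤-trans (≤-reflexive (+-comm _ 1)) (≤-trans l<nv nv≤B) , tt , z≤n , wp-for {y = vnv}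
        (λ i t s′ → State-of s′ × (∀ x → x < i → arr s′ aLIVE x ≢ 0 → S (x * nv + z) ≡ 0) ×
                    (∀ x → arr s′ aLIVE x ≤ arr s aLIVE x) × t + U s′ * P ≤ i + U s * P)
        refl refl refl nv≤B refl nv≡ z≤n
        (λ { {i} {t} {s′} _ i<nv vi≡ fr (G′ , un , le , t≤) → wp-mono
             (λ { {t₁} {s₁} (G₁ , un₁ , le₁ , t₁≤) → G₁ , (λ { x (s≤s x≤) → un-step {arr s′ aLIVE} {arr s₁ aLIVE} un un₁ le₁ x≤ })
                , (λ x → ≤-trans (le₁ x) (le x)) , time-step {i} {c = U s * P} t t₁ t₁≤ t≤ })
             (hit-step (trans (onA fr aQ refl) Q≡ , trans (onA fr aSEEN refl) S≡ , trans (onV fr vP refl) P≡ , trans (onV fr vnv refl) nv≡)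
               vi≡ (onV fr vz refl) (trans (onV fr vl refl) (+-comm l 1)) i<nv z<
               (trans (cong (λ f → f l) (onA fr aLM refl)) (upd-≡ (arr s aLM) {l + 1 ∸ 1} (val s vz) (sym (m+n∸n≡m l 1)))) G′) })
        (λ { {t} {s′} fr (G′ , un , le , t≤) →
             G′ , trans (onV fr vl refl) (+-comm l 1) , le , drop {s′} G′ un le
             , ∑-zero nv (λ {x} x< → gone {s′} G′ un x<) , t≤ })
        (new-landmark z< G , (λ _ ()) , (λ _ → ≤-refl) , ≤-refl)
      where
      l = val s vl
      un-step : ∀ {f f₁ : ℕ → ℕ} {i x} → (∀ x → x < i → f x ≢ 0 → S (x * nv + z) ≡ 0) → (f₁ i ≢ 0 → S (i * nv + z) ≡ 0) →
                (∀ x → f₁ x ≤ f x) → x ≤ i → f₁ x ≢ 0 → S (x * nv + z) ≡ 0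
      un-step {f} {f₁} {i} {x} un un₁ le x≤ nz with m≤n⇒m<n∨m≡n x≤
      ... | inj₁ x< = un x x< (λ p → nz (n≤0⇒n≡0 (subst (f₁ x ≤_) p (le x))))
      ... | inj₂ refl = un₁ nz
      time-step : ∀ {i a b c} t t₁ → t₁ + a ≤ b → t + b ≤ i + c → t + suc t₁ + a ≤ suc i + c
      time-step {i} {a} {b} {c} t t₁ p q = ≤-trans (≤-reflexive (arith t t₁ a)) (s≤s (≤-trans (+-monoʳ-≤ t p) q))
        where arith : ∀ t t₁ a → t + suc t₁ + a ≡ suc (t + (t₁ + a))
              arith = solve-∀
      gone : ∀ {s′} → State-of s′ → (∀ x → x < nv → arr s′ aLIVE x ≢ 0 → S (x * nv + z) ≡ 0) →
             ∀ {x} → x < nv → arr s′ aLIVE x * mul′ x z ≡ 0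
      gone {s′} G′ un {x} x< with arr s′ aLIVE x ≟ 0
      ... | yes p = cong (_* mul′ x z) p
      ... | no nz = trans (cong (arr s′ aLIVE x *_) (unmarked-mult x< (Progress.live-full G′ x< nz) (un x x< nz))) (*-zeroʳ (arr s′ aLIVE x))
      drop : ∀ {s′} → State-of s′ → (∀ x → x < nv → arr s′ aLIVE x ≢ 0 → S (x * nv + z) ≡ 0) →
             (∀ x → arr s′ aLIVE x ≤ arr s aLIVE x) → U s′ + alive (arr s aLIVE) z ≤ U s
      drop {s′} G′ un le = ≤-trans (≤-reflexive (sym (∑-+ (arr s′ aLIVE) (λ x → arr s aLIVE x * mul′ x z) nv))) (∑-mono nv pointwise)
        where
        pointwise : ∀ x → x < nv → arr s′ aLIVE x + arr s aLIVE x * mul′ x z ≤ arr s aLIVE x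
        pointwise x x< with arr s′ aLIVE x ≟ 0
        ... | no nz = ≤-trans (≤-reflexive (trans (cong (λ m → arr s′ aLIVE x + arr s aLIVE x * m)
                        (unmarked-mult x< (Progress.live-full G′ x< nz) (un x x< nz)))
                        (trans (cong (arr s′ aLIVE x +_) (*-zeroʳ (arr s aLIVE x))) (+-identityʳ _)))) (le x)
        ... | yes p rewrite p with arr s aLIVE x ≟ 0
        ...   | yes q rewrite q = z≤n
        ...   | no nz = ≤-trans (*-monoʳ-≤ (arr s aLIVE x) (mult≤1 x< (Progress.live-full G x< nz) z)) (≤-reflexive (*-identityʳ _))

    ∑-alive : ∀ {LIVE} → (∀ {x} → x < nv → LIVE x ≢ 0 → LN x ≡ P) → ∑ (alive LIVE) nv ≡ ∑ LIVE nv * P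
    ∑-alive {LIVE} lf = trans (sym (∑-swap (λ x y → LIVE x * mul′ x y) nv nv))
      (trans (∑-cong nv row) (trans (∑-* P LIVE nv) (*-comm P _)))
      where row : ∀ x → x < nv → ∑ (λ y → LIVE x * mul′ x y) nv ≡ P * LIVE x
            row x x< with LIVE x ≟ 0
            ... | yes p = trans (∑-zero nv (λ {y} _ → cong (_* mul′ x y) p)) (sym (trans (cong (P *_) p) (*-zeroʳ P)))
            ... | no nz = trans (∑-* (LIVE x) (mul′ x) nv) (trans (cong (LIVE x *_) (∑-mult x< (lf x< nz))) (*-comm (LIVE x) P))

    alive-mono : ∀ {f g : ℕ → ℕ} y → (∀ x → f x ≤ g x) → alive f y ≤ alive g y
    alive-mono y le = ∑-mono nv (λ x _ → *-monoˡ-≤ (mul′ x y) (le x))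

    alive≤U : ∀ {LIVE} → (∀ {x} → x < nv → LIVE x ≢ 0 → LN x ≡ P) → ∀ y → alive LIVE y ≤ ∑ LIVE nv
    alive≤U {LIVE} lf y = ∑-mono nv pointwise
      where pointwise : ∀ x → x < nv → LIVE x * mul′ x y ≤ LIVE x
            pointwise x x< with LIVE x ≟ 0
            ... | yes q rewrite q = z≤n
            ... | no nz = ≤-trans (*-monoʳ-≤ (LIVE x) (mult≤1 x< (lf x< nz) y)) (≤-reflexive (*-identityʳ _))

    -- `light` survives later choices since live lists only disappear. `paid` records that each
    -- choice kills at least `τ` lists, `few` that it kills at least one, and `spent` that it costs
    -- `nv` on top of the potential.
    record Pass (τ l₀ U₀ z t : ℕ) (s : Store) : Set where
      field
        progress : State-of s
        light    : ∀ {y} → y < z → alive (arr s aLIVE) y < τ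
        paid     : val s vl * τ + U s ≤ l₀ * τ + U₀
        few      : val s vl + U s ≤ nv
        spent    : t + U s * P + l₀ * nv ≤ z + val s vl * nv + U₀ * P

    Counts : Store → Set
    Counts s = Ctx s × arr s aCA ≡ CA

    setV-pass : ∀ {τ l₀ U₀ z t s v} → Pass τ l₀ U₀ z t s → Pass τ l₀ U₀ z t (setV s vz v)
    setV-pass p = record { Pass p }

    pick-step : ∀ {s z τ l₀ U₀ t} → Counts s → val s vz ≡ z → val s vτ ≡ τ → τ ≢ 0 → z < nv → Pass τ l₀ U₀ z t s →
      WP I B pick s (λ t′ s′ → Pass τ l₀ U₀ (suc z) (t + suc t′) s′)
    pick-step {s} {z} {τ} {l₀} {U₀} {t} (cx , CA≡) refl refl τ≢0 z< J = wp-cond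
      (λ heavy → let W≥τ = enough (<?-nonzero heavy) in wp-mono
        (λ { {t′} {s′} (G′ , l′ , le , drop , zero-z , t′≤) → record
           { progress = G′
           ; light = λ { (s≤s y≤) → light-step {s′} y≤ le zero-z }
           ; paid = ≤-trans (≤-reflexive (cong (λ l → l * τ + U s′) l′)) (≤-trans (≤-reflexive (swap τ (l * τ) (U s′)))
                      (≤-trans (+-monoʳ-≤ (l * τ) (≤-trans (+-monoʳ-≤ (U s′) W≥τ) drop)) paid))
           ; few = ≤-trans (≤-reflexive (trans (cong (_+ U s′) l′) (sym (+-suc l (U s′)))))
                     (≤-trans (+-monoʳ-≤ l (≤-trans (≤-reflexive (+-comm 1 (U s′))) (≤-trans (+-monoʳ-≤ (U s′) (≤-trans (n≢0⇒n>0 τ≢0) W≥τ)) drop))) few)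
           ; spent = subst (λ L → t + suc t′ + U s′ * P + l₀ * nv ≤ suc z + L * nv + U₀ * P) (sym l′) (account t′≤ spent) } })
        (choose-correct cx refl z< progress
          (≤-trans (≤-reflexive (+-comm 1 l)) (≤-trans (+-monoʳ-≤ l (≤-trans (n≢0⇒n>0 τ≢0) (≤-trans W≥τ (alive≤U (Progress.live-full progress) z)))) few))))
      (λ light-z → record
        { progress = progress
        ; light = λ { (s≤s y≤) → light-more y≤ (<?-zero light-z) }
        ; paid = paid ; few = few
        ; spent = ≤-trans (≤-reflexive (one t (U s * P) (l₀ * nv))) (s≤s spent) })
      where
      open Pass J
      l = val s vl
      W = alive (arr s aLIVE) z
      CB = arr s aCB z
      swap : ∀ τ a b → τ + a + b ≡ a + (b + τ)
      swap = solve-∀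
      one : ∀ a b c → a + 1 + b + c ≡ suc (a + b + c)
      one = solve-∀
      total : CB + W ≡ arr s aCA z
      total = trans (Progress.counts progress z) (cong (λ f → f z) (sym CA≡))
      enough : CB + τ < arr s aCA z + 1 → τ ≤ W
      enough h = +-cancelˡ-≤ CB τ W (suc[m]≤n⇒m≤pred[n] (≤-trans h (≤-reflexive (trans (+-comm (arr s aCA z) 1) (cong suc (sym total))))))
      light-z< : arr s aCA z + 1 ≤ CB + τ → W < τ
      light-z< h = +-cancelˡ-≤ CB (suc W) τ (≤-trans (≤-reflexive (trans (+-suc CB W) (trans (cong suc total) (+-comm 1 (arr s aCA z))))) h)
      light-more : ∀ {y} → y ≤ z → arr s aCA z + 1 ≤ CB + τ → alive (arr s aLIVE) y < τ
      light-more y≤ h with m≤n⇒m<n∨m≡n y≤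
      ... | inj₁ y< = light y<
      ... | inj₂ refl = light-z< h
      light-step : ∀ {s′ y} → y ≤ z → (∀ x → arr s′ aLIVE x ≤ arr s aLIVE x) → alive (arr s′ aLIVE) z ≡ 0 → alive (arr s′ aLIVE) y < τ
      light-step {s′} {y} y≤ le zero-z with m≤n⇒m<n∨m≡n y≤
      ... | inj₁ y< = ≤-<-trans (alive-mono y le) (light y<)
      ... | inj₂ refl = subst (_< τ) (sym zero-z) (n≢0⇒n>0 τ≢0)
      account : ∀ {t′ u} → t′ + u ≤ nv + U s * P → t + U s * P + l₀ * nv ≤ z + l * nv + U₀ * P →
                t + suc t′ + u + l₀ * nv ≤ suc z + suc l * nv + U₀ * P
      account {t′} {u} p q = ≤-trans (≤-reflexive (regroup t t′ u (l₀ * nv)))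
        (≤-trans (+-monoʳ-≤ (1 + t + l₀ * nv) p)
          (≤-trans (≤-reflexive (regroup′ t (l₀ * nv) nv (U s * P))) (≤-trans (s≤s (+-monoʳ-≤ nv q)) (≤-reflexive (regroup″ nv z (l * nv) (U₀ * P))))))
        where
        regroup : ∀ t t′ u x → t + suc t′ + u + x ≡ 1 + t + x + (t′ + u)
        regroup = solve-∀
        regroup′ : ∀ t x n u → 1 + t + x + (n + u) ≡ suc (n + (t + u + x))
        regroup′ = solve-∀
        regroup″ : ∀ n z x u → suc (n + (z + x + u)) ≡ suc z + (n + x) + u
        regroup″ = solve-∀

    module _ (F : ℕ) (nv<2^F : nv + 1 < 2 ^ F) where

      -- `sparse` is double counting: a live list has `P` members, and after the previous sweep a
      -- vertex lies in at most `2 τ` live lists (at the start, `P ≤ nv` gives the bound). As each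
      -- choice kills `τ` lists, a sweep makes at most `2 nv / P` choices; this is `chosen`.
      record Phase (U₀ f t : ℕ) (s : Store) : Set where
        field
          phases   : ℕ
          left     : f + phases ≡ F
          τ<       : val s vτ < 2 ^ f
          progress : State-of s
          sparse   : U s * P ≤ nv * (2 * val s vτ)
          few      : val s vl + U s ≤ nv
          chosen   : val s vl * P ≤ phases * (2 * nv)
          spent    : t + U s * P ≤ phases * (1 + nv) + val s vl * nv + U₀ * P

      halve : ∀ τ → τ ∸ 1 ≤ 2 * (τ / 2)
      halve zero = z≤n
      halve τ@(suc τ′) = suc[m]≤n⇒m≤pred[n] (≤-trans (≤-reflexive (m≡m%n+[m/n]*n τ 2))
          (+-mono-≤ (suc[m]≤n⇒m≤pred[n] (m%n<n τ 2)) (≤-reflexive (*-comm (τ / 2) 2))))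

      phase-end : ∀ {s s′ U₀ f t t′} → (ph : Phase U₀ f t s) → val s vτ ≢ 0 → Pass (val s vτ) (val s vl) (U s) nv t′ s′ →
                  val s′ vτ ≡ val s vτ → ∃[ f′ ] (f ≡ suc f′ × Phase U₀ f′ (t + suc t′) (setV s′ vτ (val s vτ / 2)))
      phase-end {f = zero} ph τ≢0 J same = ⊥-elim (τ≢0 (n≤0⇒n≡0 (suc[m]≤n⇒m≤pred[n] (Phase.τ< ph))))
      phase-end {s} {s′} {U₀} {suc f} {t} {t′} ph τ≢0 J same = f , refl , record
        { phases = suc phases
        ; left = trans (+-suc f phases) left
        ; τ< = m<n*o⇒m/o<n {τ} {2 ^ f} {2} (subst (τ <_) (*-comm 2 (2 ^ f)) τ<)
        ; progress = J.progress
        ; sparse = sparse′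
        ; few = J.few
        ; chosen = *-cancelʳ-≤ _ _ τ {{≢-nonZero τ≢0}} chosen′
        ; spent = spent′ }
        where
        open Phase ph
        module J = Pass J
        τ = val s vτ
        l = val s vl
        l′ = val s′ vl
        U₁ = U s
        U₂ = U s′
        -- Every vertex now lies in at most `τ ∸ 1` live lists, and `halve` compares this with the
        -- next threshold.
        sparse′ : U₂ * P ≤ nv * (2 * (τ / 2))
        sparse′ = ≤-trans (≤-reflexive (sym (∑-alive (Progress.live-full J.progress))))
          (≤-trans (∑-mono nv (λ y y< → suc[m]≤n⇒m≤pred[n] (J.light y<)))
            (≤-trans (≤-reflexive (∑-const (τ ∸ 1) nv)) (*-monoʳ-≤ nv (halve τ))))
        -- Division is avoided by multiplying with `τ`: the new choices contribute at most `U₁ * P`,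
        -- which `sparse` bounds by `nv * (2 * τ)`.
        chosen′ : l′ * P * τ ≤ suc phases * (2 * nv) * τ
        chosen′ = begin
          l′ * P * τ ≡⟨ shuffle l′ P τ ⟩
          l′ * τ * P ≤⟨ *-monoˡ-≤ P (≤-trans (m≤m+n _ U₂) J.paid) ⟩
          (l * τ + U₁) * P ≡⟨ expand l τ U₁ P ⟩
          l * P * τ + U₁ * P ≤⟨ +-mono-≤ (*-monoˡ-≤ τ chosen) sparse ⟩
          phases * (2 * nv) * τ + nv * (2 * τ) ≡⟨ collect phases nv τ ⟩
          suc phases * (2 * nv) * τ ∎
          where
          open ≤-Reasoning
          shuffle : ∀ a b c → a * b * c ≡ a * c * b
          shuffle = solve-∀
          expand : ∀ l τ u p → (l * τ + u) * p ≡ l * p * τ + u * p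
          expand = solve-∀
          collect : ∀ h n τ → h * (2 * n) * τ + n * (2 * τ) ≡ suc h * (2 * n) * τ
          collect = solve-∀
        spent′ : t + suc t′ + U₂ * P ≤ suc phases * (1 + nv) + l′ * nv + U₀ * P
        spent′ = +-cancelʳ-≤ (l * nv + U₁ * P) _ _ (begin
          t + suc t′ + U₂ * P + (l * nv + U₁ * P) ≡⟨ regroup t t′ (U₂ * P) (l * nv) (U₁ * P) ⟩
          suc ((t + U₁ * P) + (t′ + U₂ * P + l * nv)) ≤⟨ s≤s (+-mono-≤ spent J.spent) ⟩
          suc ((phases * (1 + nv) + l * nv + U₀ * P) + (nv + l′ * nv + U₁ * P)) ≡⟨ regroup′ (phases * (1 + nv)) (l * nv) (U₀ * P) nv (l′ * nv) (U₁ * P) ⟩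
          suc phases * (1 + nv) + l′ * nv + U₀ * P + (l * nv + U₁ * P) ∎)
          where
          open ≤-Reasoning
          regroup : ∀ t t′ a b c → t + suc t′ + a + (b + c) ≡ suc ((t + c) + (t′ + a + b))
          regroup = solve-∀
          regroup′ : ∀ a b c n d e → suc ((a + b + c) + (n + d + e)) ≡ suc (n + a) + d + c + (b + e)
          regroup′ = solve-∀

      record Hitting (t : ℕ) (s : Store) : Set where
        field
          pivots : ∀ {x k} → x < nv → arr s aPIV x ≡ suc k →
                   k < val s vl × ∃[ j ] (j < LN x × Q (x * P + j) ≡ arr s aLM k × arr s aPD x ≡ D (x * P + j))
          hits   : ∀ {x} → x < nv → LN x ≡ P → arr s aPIV x ≢ 0
          LM<    : ∀ {k} → k < val s vl → arr s aLM k < nv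
          l≤nv   : val s vl ≤ nv
          lP≤    : val s vl * P ≤ F * (2 * nv)
          time   : t ≤ F * (1 + nv) + val s vl * nv + nv * P

      greedy-correct : ∀ {s} → Counts s → State-of s → val s vl ≡ 0 →
        WP I B greedy s (λ t s′ → Frame greedy s s′ × Hitting t s′)
      greedy-correct {s} ((Q≡ , S≡ , P≡ , nv≡) , CA≡) G l≡0 = wp-frame
        (block nv+1≤B , wp-whilst {e = var vτ} (Phase (U s))
          (λ { {f} {t} {s′} fr ph more → let f′ , f≡ , _ = fuel ph more in f′ , f≡ , (
               block z≤n , wp-seq (wp-for {x = vz} {vnv} {pick} (Pass (val s′ vτ) (val s′ vl) (U s′))
                 refl refl refl nv≤B refl (trans (onV fr vnv refl) nv≡) z≤n
                 (λ {i} {t₁} {s₁} _ i< vz≡ fr₁ J → wp-mono setV-pass (pick-step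
                   ( (trans (onA fr₁ aQ refl) (trans (onA fr aQ refl) Q≡) , trans (onA fr₁ aSEEN refl) (trans (onA fr aSEEN refl) S≡)
                     , trans (onV fr₁ vP refl) (trans (onV fr vP refl) P≡) , trans (onV fr₁ vnv refl) (trans (onV fr vnv refl) nv≡))
                   , trans (onA fr₁ aCA refl) (trans (onA fr aCA refl) CA≡)) vz≡ (onV fr₁ vτ refl) more i< J))
                 (λ {t₁} {s₁} fr₁ J → block tt , (finish ph more f≡ J (onV fr₁ vτ refl)))
                 (record { progress = Phase.progress ph ; light = λ () ; paid = ≤-refl ; few = Phase.few ph
                         ; spent = ≤-reflexive (trans (+-comm (U s′ * P) _) refl) }))) })
          (λ { {f} {t} {s′} fr ph τ≡0 → done-phase ph τ≡0 })
          (record { phases = 0 ; left = +-identityʳ F ; τ< = subst (λ n → n + 1 < 2 ^ F) (sym nv≡) nv<2^F ; progress = G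
                  ; sparse = subst (λ n → U s * P ≤ nv * (2 * (n + 1))) (sym nv≡) sparse₀
                  ; few = ≤-trans (≤-reflexive (cong (_+ U s) l≡0)) U≤nv
                  ; chosen = ≤-reflexive (cong (_* P) l≡0)
                  ; spent = ≤-reflexive (cong (λ l → l * nv + U s * P) (sym l≡0)) }))
        where
        module G = Progress G
        nv+1≤B : val s vnv + 1 ≤ B
        nv+1≤B = ≤-trans (≤-reflexive (trans (+-comm _ 1) (cong suc nv≡))) 1+nv≤B
        U≤nv : U s ≤ nv
        U≤nv = ≤-trans (∑-mono nv (λ _ x< → G.live≤1 x<)) (≤-reflexive (trans (∑-const 1 nv) (*-identityʳ nv)))
        P≤nv : ∀ {x} → x < nv → LN x ≡ P → P ≤ nv
        P≤nv {x} x< full = rel-pigeonhole (λ j y → Q (x * P + j) ≡ y) (λ j j< → _ , Ball.q< (ball x<) (full-window x< full j<) , refl)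
          (λ j< j′< p p′ → Ball.q-inj (ball x<) (full-window x< full j<) (full-window x< full j′<) (trans p (sym p′)))
        sparse₀ : U s * P ≤ nv * (2 * (nv + 1))
        sparse₀ = ≤-trans (≤-reflexive (trans (*-comm (U s) P) (sym (∑-* P (arr s aLIVE) nv))))
          (≤-trans (∑-mono nv pointwise) (≤-trans (≤-reflexive (∑-const nv nv)) (*-monoʳ-≤ nv (≤-trans (m≤m+n nv 1) (m≤m+n (nv + 1) _)))))
          where pointwise : ∀ x → x < nv → P * arr s aLIVE x ≤ nv
                pointwise x x< with arr s aLIVE x ≟ 0
                ... | yes p = ≤-trans (≤-reflexive (trans (cong (P *_) p) (*-zeroʳ P))) z≤n
                ... | no nz = ≤-trans (*-monoʳ-≤ P (G.live≤1 x<)) (≤-trans (≤-reflexive (*-identityʳ P)) (P≤nv x< (G.live-full x< nz)))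
        fuel : ∀ {s′ f t} → Phase (U s) f t s′ → val s′ vτ ≢ 0 → ∃[ f′ ] (f ≡ suc f′ × ⊤)
        fuel {f = zero} ph more = ⊥-elim (more (n≤0⇒n≡0 (suc[m]≤n⇒m≤pred[n] (Phase.τ< ph))))
        fuel {f = suc f} ph more = f , refl , tt
        finish : ∀ {s′ s₁ f f′ t t₁} → (ph : Phase (U s) f t s′) → val s′ vτ ≢ 0 → f ≡ suc f′ →
                 Pass (val s′ vτ) (val s′ vl) (U s′) nv t₁ s₁ → val s₁ vτ ≡ val s′ vτ →
                 Phase (U s) f′ (t + suc (t₁ + 0)) (setV s₁ vτ (val s₁ vτ / 2))
        finish {s′} {s₁} {f′ = f′} {t} {t₁} ph more f≡ J same with phase-end ph more J same
        ... | f″ , f≡′ , ph′ = subst₂ (λ a b → Phase (U s) a (t + suc (t₁ + 0)) (setV s₁ vτ (b / 2)))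
            (suc-injective (trans (sym f≡′) f≡)) (sym same)
            (subst (λ u → Phase (U s) f″ (t + suc u) (setV s₁ vτ (val s′ vτ / 2))) (sym (+-identityʳ t₁)) ph′)
        done-phase : ∀ {s′ f t} → Phase (U s) f t s′ → val s′ vτ ≡ 0 → Hitting t s′
        done-phase {s′} {f} {t} ph τ≡0 = record
          { pivots = G′.pivots
          ; hits = λ x< full → G′.dead x< full (n≤0⇒n≡0 (≤-trans (member x<) (≤-reflexive U≡0)))
          ; LM< = G′.LM<
          ; l≤nv = ≤-trans (m≤m+n _ (U s′)) few
          ; lP≤ = ≤-trans chosen (*-monoˡ-≤ (2 * nv) phases≤F)
          ; time = ≤-trans (m≤m+n t _) (≤-trans spent (+-mono-≤ (+-monoˡ-≤ _ (*-monoˡ-≤ (1 + nv) phases≤F)) (*-monoˡ-≤ P U≤nv))) }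
          where
          open Phase ph
          module G′ = Progress progress
          phases≤F : phases ≤ F
          phases≤F = subst (phases ≤_) left (m≤n+m phases f)
          -- With threshold 0, `sparse` reads `U s′ * P ≤ 0`.
          U≡0 : U s′ ≡ 0
          U≡0 = m*n≡0⇒m≡0 (U s′) P {{>-nonZero P>0}} (n≤0⇒n≡0 (≤-trans sparse (≤-reflexive (trans (cong (λ τ → nv * (2 * τ)) τ≡0) (*-zeroʳ nv)))))
          member : ∀ {x} → x < nv → arr s′ aLIVE x ≤ U s′
          member {x} x< = term (arr s′ aLIVE) nv x<
            where term : ∀ f n {x} → x < n → f x ≤ ∑ f n
                  term f (suc n) (s≤s x≤) with m≤n⇒m<n∨m≡n x≤
                  ... | inj₁ x<n = ≤-trans (term f n x<n) (m≤m+n _ _)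
                  ... | inj₂ refl = m≤n+m (f n) (∑ f n)

-- Distances between landmarks

-- Induction on `k`: the value at `q k` is taken out of `f` and replaced by 0, which changes no
-- other term because `q` is injective.
∑-inj : ∀ (f : ℕ → ℕ) (q : ℕ → ℕ) n k → (∀ {i} → i < k → q i < n) → (∀ {i j} → i < k → j < k → q i ≡ q j → i ≡ j) →
        ∑ (λ i → f (q i)) k ≤ ∑ f n
∑-inj f q n zero    q< inj = z≤n
∑-inj f q n (suc k) q< inj = begin
  ∑ (λ i → f (q i)) k + f (q k)   ≡⟨ cong (_+ f (q k)) (∑-cong k (λ i i<k → sym (upd-≢ f 0 (λ p → <-irrefl (inj (m≤n⇒m≤1+n i<k) ≤-refl p) i<k)))) ⟩
  ∑ (λ i → f′ (q i)) k + f (q k)  ≤⟨ +-monoˡ-≤ (f (q k)) (∑-inj f′ q n k (λ i< → q< (m≤n⇒m≤1+n i<)) (λ i< j< → inj (m≤n⇒m≤1+n i<) (m≤n⇒m≤1+n j<))) ⟩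
  ∑ f′ n + f (q k)                ≡⟨ ∑-upd f 0 n (q< ≤-refl) ⟩
  ∑ f n + 0                       ≡⟨ +-identityʳ _ ⟩
  ∑ f n                           ∎
  where open ≤-Reasoning
        f′ = f [ q k ≔ 0 ]

-- With capacity `nv + 1` a search is never truncated. Its queue lies above all lists, at `nv * P`,
-- and is overwritten by the next one; its marks, in fresh windows behind those of the lists, are
-- table entries as they stand.
fill tables : Cmd
fill = vk := lit 0 ▸ for vk vl (aTBL [ var vi ⊗ var vl ⊕ var vk ]:= aSEEN ! (var vsb ⊕ aLM ! var vk))

tables = vcap := var vnv ⊕ lit 1 ▸ vbase := var vnv ⊗ var vP ▸ vi := lit 0 ▸
         for vi vl (vsrc := aLM ! var vi ▸ vsb := (var vnv ⊕ var vi) ⊗ var vnv ▸ bfs ▸ fill)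

module Tables (I : ℕ → ℕ) (B : ℕ) {E : ℕ → ℕ → Set} {nv M : ℕ} {adj deg : ℕ → ℕ} (A : Adjacency E nv M adj deg)
              (∑deg : ∑ deg nv ≡ M) (deg>0 : ∀ {x} → x < nv → 0 < deg x)
              (P L : ℕ) (LM : ℕ → ℕ) (LM< : ∀ {k} → k < L → LM k < nv) (L≤nv : L ≤ nv)
              (2+nv≤B : 2 + nv ≤ B) (nvP≤B : nv * P ≤ B) (sb≤B : (nv + nv) * nv ≤ B) where

  private
    cap base : ℕ
    cap = nv + 1
    base = nv * P

    1+cap≤B : suc cap ≤ B
    1+cap≤B = ≤-trans (≤-reflexive (cong suc (+-comm nv 1))) 2+nv≤B

    nv≤B : nv ≤ B
    nv≤B = ≤-trans (m≤n+m nv 2) 2+nv≤B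

  Entry : ℕ → ℕ → ℕ → Set
  Entry x y e = (∀ {D} → e ≡ suc D → Path E x y D) × (∀ {l} → Path E x y l → ∃[ D ] (e ≡ suc D × D ≤ l))

  module _ {sb x s t s′} (F : BFS-WP.Searched I B A cap base sb 1+cap≤B x s t s′) where
    private module F = BFS-WP.Searched F
    open Ball F.ball
    open Marks F.marks

    entry : ∀ {y} → y < nv → Entry x y (arr s′ aSEEN (sb + y))
    entry {y} y< = found , reached
      where
      found : ∀ {D} → arr s′ aSEEN (sb + y) ≡ suc D → Path E x y D
      found p with mark⁻ y< (λ z → contradiction (trans (sym p) z) λ ())
      ... | i , i< , refl = subst (Path E x _) (suc-injective (trans (sym (mark i<)) p)) (sound i<)
      reached : ∀ {l} → Path E x y l → ∃[ D ] (arr s′ aSEEN (sb + y) ≡ suc D × D ≤ l)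
      reached p with complete p
      ... | inj₁ (i , i< , refl , d≤l) = _ , mark i< , d≤l
      -- A full list would hold `nv + 1` different vertices.
      ... | inj₂ (full , _) = ⊥-elim (<-irrefl refl (≤-trans (≤-reflexive (+-comm 1 nv)) (≤-trans (≤-reflexive (sym full))
              (rel-pigeonhole (λ i y → arr s′ aQ (base + i) ≡ y) (λ i i< → _ , q< i< , refl) (λ i< j< p p′ → q-inj i< j< (trans p (sym p′)))))))

    -- Numbered vertices have positive degree, so one iteration for the visit and `deg` for the
    -- neighbours are at most `2 * deg`. Each vertex is visited at most once, and the degrees add up
    -- to `M`.
    search-time : t ≤ 2 * M
    search-time = ≤-trans F.time (≤-trans (∑-mono (val s′ vtail) (λ i i< →
          ≤-trans (+-mono-≤ (deg>0 (q< i<)) (m⊓n≤m _ cap)) (≤-reflexive (cong (deg (arr s′ aQ (base + i)) +_) (sym (+-identityʳ _))))))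
        (≤-trans (≤-reflexive (∑-* 2 (λ i → deg (arr s′ aQ (base + i))) (val s′ vtail)))
          (*-monoʳ-≤ 2 (≤-trans (∑-inj deg (λ i → arr s′ aQ (base + i)) nv (val s′ vtail) q< q-inj) (≤-reflexive ∑deg)))))

  fill-correct : ∀ {s i sb} → val s vi ≡ i → val s vl ≡ L → arr s aLM ≡ LM → val s vsb ≡ sb → i < L →
    (∀ {i′ k} → i′ < i → k < L → Entry (LM i′) (LM k) (arr s aTBL (i′ * L + k))) →
    (∀ {y} → y < nv → Entry (LM i) y (arr s aSEEN (sb + y))) →
    WP I B fill s (λ t s′ → Frame fill s s′ × t ≡ L ×
                            (∀ i′ k → i′ < suc i → k < L → Entry (LM i′) (LM k) (arr s′ aTBL (i′ * L + k))))
  fill-correct {s} {i} {sb} refl l≡ LM≡ refl i<L old row = wp-frame (block z≤n , wp-for {y = vl}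
    (λ k t s′ → t ≡ k × (∀ i′ k′ → i′ < i → k′ < L → Entry (LM i′) (LM k′) (arr s′ aTBL (i′ * L + k′))) ×
                (∀ k′ → k′ < k → Entry (LM i) (LM k′) (arr s′ aTBL (i * L + k′))))
    refl refl refl (≤-trans L≤nv nv≤B) refl l≡ z≤n
    (λ { {k} {t} {s′} _ k<L refl fr (refl , old′ , new) →
       let value : arr s′ aSEEN (val s′ vsb + arr s′ aLM k) ≡ arr s aSEEN (sb + LM k)
           value = trans (cong (λ f → f (val s′ vsb + arr s′ aLM k)) (onA fr aSEEN refl))
                     (cong (arr s aSEEN) (cong₂ _+_ (onV fr vsb refl) (cong (λ f → f k) (trans (onA fr aLM refl) LM≡))))
           index : val s′ vi * val s′ vl + k ≡ i * L + k
           index = cong (_+ k) (cong₂ _*_ (onV fr vi refl) (trans (onV fr vl refl) l≡))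
       in block tt , (+-comm k 1
          , (λ i′ k′ i′< k′< → subst (Entry (LM i′) (LM k′)) (sym (upd-≢ (arr s′ aTBL) _
               (λ p → <-irrefl (proj₁ (index-inj {L} {i′} {i} k′< k<L (trans p index))) i′<))) (old′ i′ k′ i′< k′<))
          , (λ { k′ (s≤s k′≤) → extend {arr s′ aTBL} index value new (row (LM< k<L)) k′≤ })) })
    (λ { {t} {s′} _ (t≡ , old′ , new) → t≡ , (λ { i′ k (s≤s i′≤) k< → both {arr s′ aTBL} old′ new i′≤ k< }) })
    (refl , (λ i′ k′ i′< k′< → old i′< k′<) , (λ _ ())))
    where
    extend : ∀ {f : ℕ → ℕ} {k a v} → a ≡ i * L + k → v ≡ arr s aSEEN (sb + LM k) → (∀ k′ → k′ < k → Entry (LM i) (LM k′) (f (i * L + k′))) →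
             Entry (LM i) (LM k) (arr s aSEEN (sb + LM k)) → ∀ {k′} → k′ ≤ k → Entry (LM i) (LM k′) ((f [ a ≔ v ]) (i * L + k′))
    extend {f} {k} refl refl new e {k′} k′≤ with m≤n⇒m<n∨m≡n k′≤
    ... | inj₁ k′< = subst (Entry (LM i) (LM k′)) (sym (upd-≢ f _ (λ p → <-irrefl (+-cancelˡ-≡ (i * L) k′ k p) k′<))) (new k′ k′<)
    ... | inj₂ refl = subst (Entry (LM i) (LM k)) (sym (upd-≡ f {i * L + k} _ refl)) e
    both : ∀ {f : ℕ → ℕ} → (∀ i′ k′ → i′ < i → k′ < L → Entry (LM i′) (LM k′) (f (i′ * L + k′))) →
           (∀ k′ → k′ < L → Entry (LM i) (LM k′) (f (i * L + k′))) → ∀ {i′ k} → i′ ≤ i → k < L → Entry (LM i′) (LM k) (f (i′ * L + k))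
    both old′ new {i′} {k} i′≤ k< with m≤n⇒m<n∨m≡n i′≤
    ... | inj₁ i′< = old′ i′ k i′< k<
    ... | inj₂ refl = new k k<

  Fresh : ℕ → Store → Set
  Fresh i s = ∀ x → nv + i ≤ x → ∀ y → y < nv → arr s aSEEN (x * nv + y) ≡ 0

  Low : (f g : ℕ → ℕ) → Set
  Low f g = ∀ a → a < nv * P → f a ≡ g a

  low-outside : ∀ {f g h : ℕ → ℕ} → Outside base cap f g → Low g h → Low f h
  low-outside o l a a< = trans (o a (λ i _ p → <⇒≱ a< (≤-trans (m≤m+n base i) (≤-reflexive (sym p))))) (l a a<)

  Filled : Store → ℕ → ℕ → Store → Set
  Filled s₀ i t s = t ≤ i * (1 + (2 * M + L)) × Low (arr s aQ) (arr s₀ aQ) × Low (arr s aD) (arr s₀ aD) × Fresh i s ×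
                    (∀ i′ k → i′ < i → k < L → Entry (LM i′) (LM k) (arr s aTBL (i′ * L + k)))

  tables-correct : ∀ {s} → arr s aADJ ≡ adj → arr s aDEG ≡ deg → val s vM ≡ M → val s vP ≡ P → val s vnv ≡ nv → val s vl ≡ L →
    arr s aLM ≡ LM → Fresh 0 s → WP I B tables s (λ t s′ → Frame tables s s′ × Filled s L t s′)
  tables-correct {s} adj≡ deg≡ M≡ P≡ nv≡ l≡ LM≡ fresh = wp-frame
    (block ≤-trans (≤-reflexive (cong (_+ 1) nv≡)) (≤-trans (n≤1+n cap) 1+cap≤B) ,
     ≤-trans (≤-reflexive (cong₂ _*_ nv≡ P≡)) nvP≤B , z≤n , wp-for {y = vl}
      (Filled s)
      refl refl refl (≤-trans L≤nv nv≤B) refl l≡ z≤n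
      (λ { {i} {t} {s′} _ i<L vi≡ fr (t≤ , lowQ , lowD , fresh′ , tbl) →
         let sb≡ : (val s′ vnv + val s′ vi) * val s′ vnv ≡ (nv + i) * nv
             sb≡ = cong₂ _*_ (cong₂ _+_ (trans (onV fr vnv refl) nv≡) vi≡) (trans (onV fr vnv refl) nv≡)
             LM≡′ = trans (onA fr aLM refl) LM≡
             src≡ : arr s′ aLM (val s′ vi) ≡ LM i
             src≡ = trans (cong (λ f → f (val s′ vi)) LM≡′) (cong LM vi≡)
         in block tt , ≤-trans (≤-reflexive sb≡) (≤-trans (*-monoˡ-≤ nv (+-monoʳ-≤ nv (≤-trans (<⇒≤ i<L) L≤nv))) sb≤B) ,
            wp-seq (wp-mono (λ { {t₁} {s₁} (fr₁ , F) → wp-mono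
               (λ { {t₂} {s₂} (fr₂ , refl , tbl₂) →
                    time {i} {t} t₁ t≤ (search-time F)
                  , subst (λ f → Low f (arr s aQ)) (sym (onA fr₂ aQ refl)) (low-outside (BFS-WP.Searched.outQ F) lowQ)
                  , subst (λ f → Low f (arr s aD)) (sym (onA fr₂ aD refl)) (low-outside (BFS-WP.Searched.outD F) lowD)
                  , (λ x x≥ y y< → trans (cong (λ f → f (x * nv + y)) (onA fr₂ aSEEN refl)) (trans
                       (BFS-WP.Searched.outS F (x * nv + y) (λ y′ y′< p → <-irrefl (sym (proj₁ (index-inj {nv} {x} {nv + i} y< y′< p)))
                          (≤-trans (≤-reflexive (sym (+-suc nv i))) x≥)))
                       (fresh′ x (≤-trans (+-monoʳ-≤ nv (n≤1+n i)) x≥) y y<)))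
                  , tbl₂ })
               (fill-correct {s₁} {i} {(nv + i) * nv} (trans (onV fr₁ vi refl) vi≡) (trans (onV fr₁ vl refl) (trans (onV fr vl refl) l≡)) (trans (onA fr₁ aLM refl) LM≡′)
                 (trans (onV fr₁ vsb refl) sb≡) i<L
                 (λ {i′} {k} i′< k< → subst (λ f → Entry (LM i′) (LM k) (f (i′ * L + k))) (sym (onA fr₁ aTBL refl)) (tbl i′ k i′< k<))
                 (entry F)) })
             (wp-frame (BFS-WP.bfs-correct I B A cap base ((nv + i) * nv) 1+cap≤B
               ( trans (onA fr aADJ refl) adj≡ , trans (onA fr aDEG refl) deg≡ , trans (onV fr vM refl) M≡
               , trans (onV fr vcap refl) (cong (_+ 1) nv≡) , trans (onV fr vbase refl) (cong₂ _*_ nv≡ P≡) , sb≡)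
               src≡ (LM< i<L) (≤-trans (s≤s z≤n) (≤-reflexive (+-comm 1 nv)))
               (λ {y} y< → fresh′ (nv + i) ≤-refl y y<) (≤-trans (<⇒≤ (LM< i<L)) nv≤B)))) })
      (λ _ j → j)
      (z≤n , (λ _ _ → refl) , (λ _ _ → refl) , fresh , (λ _ _ ())))
    where
    time : ∀ {i t} t₁ → t ≤ i * (1 + (2 * M + L)) → t₁ ≤ 2 * M → t + suc (t₁ + L) ≤ suc i * (1 + (2 * M + L))
    time {i} {t} t₁ t≤ t₁≤ = ≤-trans (+-mono-≤ t≤ (s≤s (+-monoˡ-≤ L t₁≤))) (≤-reflexive (+-comm (i * (1 + (2 * M + L))) _))

-- The preprocessing program

-- From cell 3 on come the ends of edges, and index `e` stands for the arc from the end in cell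
-- `e + 3` to the other end. `opposite` is the reversed arc; `simple` says that no arc occurs twice.
record Input (I : ℕ → ℕ) (n m P : ℕ) : Set where
  field
    cell-0   : I 0 ≡ n
    cell-1   : I 1 ≡ m
    cell-2   : I 2 ≡ P
    endpoint : ∀ {e} → e < m * 2 → I (e + 3) < n
    opposite : ∀ {e} → e < m * 2 → ∃[ e′ ] (e′ < m * 2 × I (e′ + 3) ≡ I (other e) × I (other e′) ≡ I (e + 3))
    simple   : ∀ {e e′} → e < m * 2 → e′ < m * 2 → I (e + 3) ≡ I (e′ + 3) → I (other e) ≡ I (other e′) → e ≡ e′

ArcOf : (I row : ℕ → ℕ) (M x y : ℕ) → Set
ArcOf I row M x y = ∃[ e ] (e < M × arcS I row e ≡ x × arcT I row e ≡ y)

finish preprocessing : Cmd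
finish = aSC [ lit 0 ]:= var vP ▸ aSC [ lit 1 ]:= var vl ▸
         -- In units of the 32 interleaved arrays: `n * P` entries hold the lists and, since `P` is
         -- positive, also the arrays indexed by vertices; `L * L` holds the table and 2 the
         -- parameters in `aSC`. It is `n` rather than `nv` because `aROW` is indexed by the
         -- original vertices.
         vout := (var vn ⊗ var vP ⊕ var vl ⊗ var vl ⊕ lit 2) ⊗ lit 32

preprocessing = vn := inp (lit 0) ▸ vM := inp (lit 1) ⊗ lit 2 ▸ vP := inp (lit 2) ▸
                rows ▸ adjacency ▸ balls ▸ census ▸ greedy ▸ tables ▸ finish

blank : Store
blank = ⟨ (λ _ → 0) , (λ _ _ → 0) ⟩

preprocessing-time : (n m P F nv L : ℕ) → ℕ
preprocessing-time n m P F nv L =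
  m * 2 + (m * 2 + (nv * (1 + P * (1 + P)) + (nv * (1 + P) + ((F * (1 + nv) + L * nv + nv * P) + L * (1 + (2 * (m * 2) + L))))))

record Built (I : ℕ → ℕ) (n m P F t : ℕ) (s : Store) : Set where
  field
    nv L      : ℕ
    numbering : Numbering I nv (m * 2) (arr s aROW)
    oracle    : Oracle (ArcOf I (arr s aROW) (m * 2)) nv P L (arr s aLN) (arr s aPIV) (arr s aPD) (arr s aLM)
                  (λ x j → arr s aQ (x * P + j)) (λ x j → arr s aD (x * P + j)) (λ k k′ → arr s aTBL (k * L + k′))
    P-stored  : arr s aSC 0 ≡ P
    L-stored  : arr s aSC 1 ≡ L
    size      : val s vout ≡ (n * P + L * L + 2) * 32
    nv≤n      : nv ≤ n
    L≤nv      : L ≤ nv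
    LP≤       : L * P ≤ F * (2 * nv)
    time      : t ≤ preprocessing-time n m P F nv L

-- Correctness of the preprocessing

module Preprocess (I : ℕ → ℕ) (B n m P F : ℕ) (inputs : Input I n m P) (P>0 : 0 < P)
                  (M≤B : m * 2 ≤ B) (X≤B : (n + P + 4) * (n + P + 4) * 32 ≤ B) (F-big : n + 1 < 2 ^ F) where
  open Input inputs

  private
    M X : ℕ
    M = m * 2
    X = n + P + 4

    X≤ : ∀ {a} → a ≤ X * X → a ≤ B
    X≤ h = ≤-trans h (≤-trans (m≤m*n (X * X) 32) X≤B)

    n≤X : n ≤ X
    n≤X = ≤-trans (m≤m+n n P) (m≤m+n _ 4)

    P≤X : P ≤ X
    P≤X = ≤-trans (m≤n+m P n) (m≤m+n _ 4)

    4+n≤X : 4 + n ≤ X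
    4+n≤X = ≤-trans (≤-reflexive (+-comm 4 n)) (+-monoˡ-≤ 4 (m≤m+n n P))

    1≤X : 1 ≤ X
    1≤X = ≤-trans (s≤s z≤n) 4+n≤X

    X*X≥ : ∀ {a} → a ≤ X → a ≤ X * X
    X*X≥ h = ≤-trans h (m≤m*n X X {{>-nonZero 1≤X}})

  module Numbered {nv : ℕ} {row : ℕ → ℕ} (N : Numbering I nv M row) where
    open Numbering N

    S< : ∀ {e} → e < M → arcS I row e < nv
    S< e< = let x , x< , p = numbered e< in subst (_< nv) (sym (cong (_∸ 1) p)) x<

    target : ∀ {e} → e < M → ∃[ x ] (x < nv × row (I (other e)) ≡ suc x)
    target e< = let e′ , e′< , p , _ = opposite e<
                    x , x< , q = numbered e′<
                in x , x< , trans (cong row (sym p)) q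

    T< : ∀ {e} → e < M → arcT I row e < nv
    T< e< = let x , x< , p = target e< in subst (_< nv) (sym (cong (_∸ 1) p)) x<

    unsuc : ∀ {a b x y} → a ≡ suc x → b ≡ suc y → a ∸ 1 ≡ b ∸ 1 → b ≡ suc x
    unsuc refl refl p = cong suc (sym p)

    arc-inj : ∀ {e e′} → e < M → e′ < M → arcS I row e ≡ arcS I row e′ → arcT I row e ≡ arcT I row e′ → e ≡ e′
    arc-inj e< e′< p q =
      let x , _ , a = numbered e<
          x′ , _ , a′ = numbered e′<
          y , _ , b = target e<
          y′ , _ , b′ = target e′<
      in simple e< e′< (row-inj a (unsuc a a′ p)) (row-inj b (unsuc b b′ q))

    arc-sym : ∀ {x y} → ArcOf I row M x y → ArcOf I row M y x
    arc-sym (e , e< , refl , refl) = let e′ , e′< , p , q = opposite e<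
      in e′ , e′< , cong (λ u → row u ∸ 1) p , cong (λ u → row u ∸ 1) q

    nv≤n : nv ≤ n
    nv≤n = rel-pigeonhole (λ x u → row u ≡ suc x)
      (λ x x< → let u , p = onto x<
                    _ , e , e< , q = occurs p
                in u , subst (_< n) q (endpoint e<) , p)
      (λ _ _ p p′ → suc-injective (trans (sym p) p′))

    open Arcs nv M (arcS I row) (arcT I row) S< T< arc-inj public using (Partial; partial-adjacency)

    deg>0 : ∀ {adj deg} → Partial M adj deg → ∀ {x} → x < nv → 0 < deg x
    deg>0 {deg = deg} A x< = let u , p = onto x<
                                 _ , e , e< , q = occurs p
                                 j , j< , _ = Partial.lists A e<
                             in subst (λ y → 0 < deg y) (cong (_∸ 1) (trans (cong row q) p)) (≤-trans (s≤s z≤n) j<)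

  preprocessing-correct : WP I B preprocessing blank (λ t s → Frame preprocessing blank s × Built I n m P F t s)
  preprocessing-correct = wp-frame (block tt , ≤-trans (≤-reflexive (cong (_* 2) cell-1)) M≤B , tt ,
    wp-seq (wp-mono (λ { {t₁} {s₁} (fr₁ , t₁≡ , N) → wp-seq (after-rows fr₁ t₁≡ N) })
      (rows-correct I B M (cong (_* 2) cell-1) M≤B refl (λ _ → refl))))
    where
    open ≤-Reasoning
    s₀ : Store
    s₀ = setV (setV (setV blank vn (I 0)) vM (I 1 * 2)) vP (I 2)

    -- Every nested module assumes the outcome of one more stage, so that facts of earlier stages
    -- can be carried through the frames of later ones.
    module _ {t₁ s₁} (fr₁ : Frame rows s₀ s₁) (t₁≡ : t₁ ≡ M) (N : Numbering I (val s₁ vnv) M (arr s₁ aROW)) where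
      open Numbered N using (S<; T<; arc-inj; arc-sym; nv≤n; deg>0; Partial; partial-adjacency)

      nv : ℕ
      nv = val s₁ vnv

      nv≤X : nv ≤ X
      nv≤X = ≤-trans nv≤n n≤X

      M≡₁ : val s₁ vM ≡ M
      M≡₁ = trans (onV fr₁ vM refl) (cong (_* 2) cell-1)

      P≡₁ : val s₁ vP ≡ P
      P≡₁ = trans (onV fr₁ vP refl) cell-2

      2+nv≤B : 2 + nv ≤ B
      2+nv≤B = X≤ (X*X≥ (≤-trans (+-mono-≤ (s≤s (s≤s (z≤n {2}))) nv≤n) 4+n≤X))

      1+nv≤B : suc nv ≤ B
      1+nv≤B = ≤-trans (n≤1+n _) 2+nv≤B

      nvP≤B : nv * P ≤ B
      nvP≤B = X≤ (*-mono-≤ nv≤X P≤X)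

      nvnv≤B : nv * nv ≤ B
      nvnv≤B = X≤ (*-mono-≤ nv≤X nv≤X)

      nvP+P≤B : nv * P + P ≤ B
      nvP+P≤B = ≤-trans (≤-reflexive (+-comm (nv * P) P))
        (X≤ (*-mono-≤ {suc nv} (≤-trans (s≤s nv≤n) (≤-trans (m≤n+m _ 3) 4+n≤X)) P≤X))

      1+P≤B : suc P ≤ B
      1+P≤B = X≤ (X*X≥ (≤-trans (≤-reflexive (+-comm 1 P)) (≤-trans (+-monoˡ-≤ 1 (m≤n+m P n)) (+-monoʳ-≤ (n + P) (s≤s (z≤n {3}))))))

      sb≤B : (nv + nv) * nv ≤ B
      sb≤B = begin
        (nv + nv) * nv ≤⟨ *-mono-≤ (+-mono-≤ nv≤X nv≤X) nv≤X ⟩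
        (X + X) * X    ≤⟨ m≤m+n _ (X * X * 30) ⟩
        (X + X) * X + X * X * 30 ≡⟨ identity X ⟩
        X * X * 32     ≤⟨ X≤B ⟩
        B ∎
        where identity : ∀ x → (x + x) * x + x * x * 30 ≡ x * x * 32
              identity = solve-∀

      module _ (s₂ : Store) (fr₂ : Frame adjacency s₁ s₂) (A : Partial M (arr s₂ aADJ) (arr s₂ aDEG)) where
        adj deg : ℕ → ℕ
        adj = arr s₂ aADJ
        deg = arr s₂ aDEG

        AL : Adjacency (ArcOf I (arr s₁ aROW) M) nv M adj deg
        AL = partial-adjacency A

        zero₂ : ∀ k → modA rows k ≡ false → modA adjacency k ≡ false → ∀ a → arr s₂ k a ≡ 0
        zero₂ k p q a = trans (cong (λ f → f a) (onA fr₂ k q)) (cong (λ f → f a) (onA fr₁ k p))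

        module _ (s₃ : Store) (fr₃ : Frame balls s₂ s₃) (R : Rows (ArcOf I (arr s₁ aROW) M) nv P (arr s₃ aQ) (arr s₃ aD) (arr s₃ aSEEN) (arr s₃ aLN) nv)
                 (fresh : ∀ {x} → nv ≤ x → ∀ {y} → y < nv → arr s₃ aSEEN (x * nv + y) ≡ 0) where
          module G = Greedy I B R P>0 nvP+P≤B 1+nv≤B

          module _ (s₄ : Store) (fr₄ : Frame census s₃ s₄) (live : ∀ x → x < nv → arr s₄ aLIVE x ≡ δ (arr s₃ aLN x) P)
                   (ca : ∀ y → arr s₄ aCA y ≡ G.census-counts y nv) where
            module C = G.Choice (arr s₄ aCA) (λ y → ≤-trans (≤-reflexive (ca y)) (G.census≤ y nv ≤-refl))

            zero₄ : ∀ k → modA rows k ≡ false → modA adjacency k ≡ false → modA balls k ≡ false → modA census k ≡ false → ∀ a → arr s₄ k a ≡ 0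
            zero₄ k p q r u a = trans (cong (λ f → f a) (trans (onA fr₄ k u) (onA fr₃ k r))) (zero₂ k p q a)

            l≡0 : val s₄ vl ≡ 0
            l≡0 = trans (onV fr₄ vl refl) (trans (onV fr₃ vl refl) (trans (onV fr₂ vl refl) (onV fr₁ vl refl)))

            start₄ : C.State-of s₄
            start₄ = subst (C.Progress _ _ _ _ _) (sym l≡0)
              (C.initial live ca (zero₄ aCB refl refl refl refl) (zero₄ aPIV refl refl refl refl))

            nv+1< : nv + 1 < 2 ^ F
            nv+1< = ≤-<-trans (+-monoˡ-≤ 1 nv≤n) F-big

            module _ (t₅ : ℕ) (s₅ : Store) (fr₅ : Frame greedy s₄ s₅) (H : C.Hitting F nv+1< t₅ s₅) where
              module H = C.Hitting H
              L : ℕ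
              L = val s₅ vl
              greedy-time : t₅ ≤ F * (1 + nv) + L * nv + nv * P
              greedy-time = H.time
              module Tb = Tables I B AL (Partial.total A) (deg>0 A) P L (arr s₅ aLM) H.LM< H.l≤nv 2+nv≤B nvP≤B sb≤B

              module _ (t₆ : ℕ) (s₆ : Store) (fr₆ : Frame tables s₅ s₆) (Fl : Tb.Filled s₅ L t₆ s₆) where

                below : ∀ {x j} → x < nv → j < P → x * P + j < nv * P
                below {x} {j} x< j< = ≤-trans (≤-reflexive (sym (+-suc (x * P) j)))
                  (≤-trans (+-monoʳ-≤ (x * P) j<) (≤-trans (≤-reflexive (+-comm (x * P) P)) (*-monoˡ-≤ P x<)))

                keep₃ : ∀ k → modA census k ≡ false → modA greedy k ≡ false → arr s₅ k ≡ arr s₃ k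
                keep₃ k p q = trans (onA fr₅ k q) (onA fr₄ k p)

                LN≡ : arr s₆ aLN ≡ arr s₃ aLN
                LN≡ = trans (onA fr₆ aLN refl) (keep₃ aLN refl refl)

                Q≡ : ∀ {x j} → x < nv → j < P → arr s₆ aQ (x * P + j) ≡ arr s₃ aQ (x * P + j)
                Q≡ x< j< = trans (proj₁ (proj₂ Fl) _ (below x< j<)) (cong (λ f → f _) (keep₃ aQ refl refl))

                D≡ : ∀ {x j} → x < nv → j < P → arr s₆ aD (x * P + j) ≡ arr s₃ aD (x * P + j)
                D≡ x< j< = trans (proj₁ (proj₂ (proj₂ Fl)) _ (below x< j<)) (cong (λ f → f _) (keep₃ aD refl refl))

                final-oracle : ∀ {row} → row ≡ arr s₁ aROW →
                  Oracle (ArcOf I row M) nv P L (arr s₆ aLN) (arr s₆ aPIV) (arr s₆ aPD) (arr s₆ aLM)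
                    (λ x j → arr s₆ aQ (x * P + j)) (λ x j → arr s₆ aD (x * P + j)) (λ k k′ → arr s₆ aTBL (k * L + k′))
                final-oracle refl = record
                  { E-sym = arc-sym
                  ; E< = Adjacency.E< AL
                  ; ball = λ {x} x< → subst (Ball _ nv P x _ _) (cong (λ f → f x) (sym LN≡))
                      (ball-cong (λ j< → Q≡ x< (inside x< j<)) (λ j< → D≡ x< (inside x< j<)) (Rows.ball R x<))
                  ; pivot = pivot
                  ; pivot-sound = λ x< p → let k< , j , j< , q , d = landmark x< p in
                      k< , subst₂ (Path _ _) (trans q (cong (λ f → f _) (sym (onA fr₆ aLM refl)))) (sym d) (Ball.sound (Rows.ball R x<) j<)
                  ; tbl-sound = λ {k} {k′} k< k′< p → subst₂ (λ a b → Path _ a b _) (LM≡ k) (LM≡ k′) (proj₁ (entry k< k′<) p)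
                  ; tbl-complete = λ {k} {k′} k< k′< p → proj₂ (entry k< k′<) (subst₂ (λ a b → Path _ a b _) (sym (LM≡ k)) (sym (LM≡ k′)) p) }
                  where
                  inside : ∀ {x j} → x < nv → j < arr s₃ aLN x → j < P
                  inside x< j< = <-≤-trans j< (Ball.ln≤cap (Rows.ball R x<))
                  LM≡ : ∀ k → arr s₅ aLM k ≡ arr s₆ aLM k
                  LM≡ k = cong (λ f → f k) (sym (onA fr₆ aLM refl))
                  entry : ∀ {k k′} → k < L → k′ < L → Tb.Entry (arr s₅ aLM k) (arr s₅ aLM k′) (arr s₆ aTBL (k * L + k′))
                  entry k< k′< = proj₂ (proj₂ (proj₂ (proj₂ Fl))) _ _ k< k′<
                  landmark : ∀ {x k} → x < nv → arr s₆ aPIV x ≡ suc k → k < L × ∃[ j ] (j < arr s₃ aLN x ×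
                        arr s₃ aQ (x * P + j) ≡ arr s₅ aLM k × arr s₆ aPD x ≡ arr s₃ aD (x * P + j))
                  landmark {x} x< p = let k< , j , j< , q , d = H.pivots x< (trans (cong (λ f → f x) (sym (onA fr₆ aPIV refl))) p)
                                 in k< , j , j< , q , trans (cong (λ f → f x) (onA fr₆ aPD refl)) d
                  pivot : ∀ {x} → x < nv → arr s₆ aLN x ≡ P → ∃[ k ] (arr s₆ aPIV x ≡ suc k ×
                          ∃[ j ] (j < arr s₆ aLN x × arr s₆ aPD x ≡ arr s₆ aD (x * P + j)))
                  pivot {x} x< full with arr s₆ aPIV x in e
                  ... | zero = ⊥-elim (H.hits x< (trans (cong (λ f → f x) (sym LN≡)) full) (trans (cong (λ f → f x) (sym (onA fr₆ aPIV refl))) e))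
                  ... | suc k = let _ , j , j< , _ , d = landmark x< e in
                          k , refl , j , subst (λ f → j < f x) (sym LN≡) j< , trans d (sym (D≡ x< (inside x< j<)))

                finish-correct : ∀ {t} → t ≤ preprocessing-time n m P F nv L → WP I B finish s₆ (λ t′ s → Built I n m P F (t + t′) s)
                finish-correct {t} t≤ = block tt , tt , out≤B , finished
                  where
                  row≡ : arr s₆ aROW ≡ arr s₁ aROW
                  row≡ = trans (onA fr₆ aROW refl) (trans (keep₃ aROW refl refl) (trans (onA fr₃ aROW refl) (onA fr₂ aROW refl)))
                  chain : ∀ x → modV tables x ≡ false → modV greedy x ≡ false → modV census x ≡ false → modV balls x ≡ false →
                          modV adjacency x ≡ false → val s₆ x ≡ val s₁ x
                  chain x p q r u v = trans (onV fr₆ x p) (trans (onV fr₅ x q) (trans (onV fr₄ x r) (trans (onV fr₃ x u) (onV fr₂ x v))))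
                  P≡₆ : val s₆ vP ≡ P
                  P≡₆ = trans (chain vP refl refl refl refl refl) P≡₁
                  n≡₆ : val s₆ vn ≡ n
                  n≡₆ = trans (chain vn refl refl refl refl refl) (trans (onV fr₁ vn refl) cell-0)
                  l≡₆ : val s₆ vl ≡ L
                  l≡₆ = onV fr₆ vl refl
                  size≡ : (val s₆ vn * val s₆ vP + val s₆ vl * val s₆ vl + 2) * 32 ≡ (n * P + L * L + 2) * 32
                  size≡ = cong₂ (λ a b → (a + b + 2) * 32) (cong₂ _*_ n≡₆ P≡₆) (cong₂ _*_ l≡₆ l≡₆)
                  size≤ : n * P + L * L + 2 ≤ X * X
                  size≤ = begin
                    n * P + L * L + 2 ≤⟨ +-monoˡ-≤ 2 (+-monoʳ-≤ (n * P) (*-mono-≤ (≤-trans H.l≤nv nv≤n) (≤-trans H.l≤nv nv≤n))) ⟩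
                    n * P + n * n + 2 ≤⟨ m≤m+n _ (P * P + n * P + 8 * n + 8 * P + 14) ⟩
                    n * P + n * n + 2 + (P * P + n * P + 8 * n + 8 * P + 14) ≡⟨ identity n P ⟩
                    X * X ∎
                    where identity : ∀ n P → n * P + n * n + 2 + (P * P + n * P + 8 * n + 8 * P + 14) ≡ (n + P + 4) * (n + P + 4)
                          identity = solve-∀
                  out≤B : (val s₆ vn * val s₆ vP + val s₆ vl * val s₆ vl + 2) * 32 ≤ B
                  out≤B = ≤-trans (≤-reflexive size≡) (≤-trans (*-monoˡ-≤ 32 size≤) X≤B)
                  finished : Built I n m P F (t + 0) (setV (setA (setA s₆ aSC 0 (val s₆ vP)) aSC 1 (val s₆ vl)) vout
                                                           ((val s₆ vn * val s₆ vP + val s₆ vl * val s₆ vl + 2) * 32))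
                  finished = record
                    { nv = nv ; L = L
                    ; numbering = subst (Numbering I nv M) (sym row≡) N
                    ; oracle = final-oracle row≡
                    ; P-stored = P≡₆ ; L-stored = l≡₆ ; size = size≡
                    ; nv≤n = nv≤n ; L≤nv = H.l≤nv ; LP≤ = H.lP≤
                    ; time = ≤-trans (≤-reflexive (+-identityʳ t)) t≤ }

      after-rows : WP I B (adjacency) s₁ (λ t₂ s₂ → WP I B (balls ▸ census ▸ greedy ▸ tables ▸ finish) s₂
                     (λ t s → Built I n m P F (t₁ + (t₂ + t)) s))
      after-rows = wp-mono (λ { {t₂} {s₂} (fr₂ , t₂≡ , A) → wp-seq (wp-mono
        (λ { {t₃} {s₃} (fr₃ , t₃≤ , R , fresh) → wp-seq (wp-mono
          (λ { {t₄} {s₄} (fr₄ , t₄≤ , live , ca) → wp-seq (wp-mono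
            (λ { {t₅} {s₅} (fr₅ , H) → let L = val s₅ vl in wp-seq (wp-mono
              (λ { {t₆} {s₆} (fr₆ , Fl) → wp-mono
                (λ {t₇} {s} b → subst (λ t → Built I n m P F t s) (assoc t₁ t₂ t₃ t₄ t₅ t₆ t₇) b)
                (finish-correct s₂ fr₂ A s₃ fr₃ R fresh s₄ fr₄ live ca t₅ s₅ fr₅ H t₆ s₆ fr₆ Fl {t₁ + (t₂ + (t₃ + (t₄ + (t₅ + t₆))))}
                  (+-mono-≤ (≤-reflexive t₁≡) (+-mono-≤ (≤-reflexive t₂≡) (+-mono-≤ t₃≤ (+-mono-≤ t₄≤
                    (+-mono-≤ (greedy-time s₂ fr₂ A s₃ fr₃ R fresh s₄ fr₄ live ca t₅ s₅ fr₅ H) (proj₁ Fl))))))) })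
              (Tb.tables-correct s₂ fr₂ A s₃ fr₃ R fresh s₄ fr₄ live ca t₅ s₅ fr₅ H
                (trans (onA fr₅ aADJ refl) (trans (onA fr₄ aADJ refl) (onA fr₃ aADJ refl)))
                (trans (onA fr₅ aDEG refl) (trans (onA fr₄ aDEG refl) (onA fr₃ aDEG refl)))
                (trans (onV fr₅ vM refl) (trans (onV fr₄ vM refl) (trans (onV fr₃ vM refl) (trans (onV fr₂ vM refl) M≡₁))))
                (trans (onV fr₅ vP refl) (trans (onV fr₄ vP refl) (trans (onV fr₃ vP refl) (trans (onV fr₂ vP refl) P≡₁))))
                (trans (onV fr₅ vnv refl) (trans (onV fr₄ vnv refl) (trans (onV fr₃ vnv refl) (onV fr₂ vnv refl))))
                refl refl
                (λ x x≥ y y< → trans (cong (λ f → f (x * nv + y)) (trans (onA fr₅ aSEEN refl) (onA fr₄ aSEEN refl)))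
                   (fresh (subst (_≤ x) (+-identityʳ nv) x≥) y<)))) })
            (C.greedy-correct s₂ fr₂ A s₃ fr₃ R fresh s₄ fr₄ live ca F (nv+1< s₂ fr₂ A s₃ fr₃ R fresh s₄ fr₄ live ca)
              ( (onA fr₄ aQ refl , onA fr₄ aSEEN refl
                , trans (onV fr₄ vP refl) (trans (onV fr₃ vP refl) (trans (onV fr₂ vP refl) P≡₁))
                , trans (onV fr₄ vnv refl) (trans (onV fr₃ vnv refl) (onV fr₂ vnv refl)))
              , refl)
              (start₄ s₂ fr₂ A s₃ fr₃ R fresh s₄ fr₄ live ca) (l≡0 s₂ fr₂ A s₃ fr₃ R fresh s₄ fr₄ live ca))) })
          (G.census-correct s₂ fr₂ A s₃ fr₃ R fresh refl refl (trans (onV fr₃ vP refl) (trans (onV fr₂ vP refl) P≡₁))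
            (trans (onV fr₃ vnv refl) (onV fr₂ vnv refl))
            (λ a → trans (cong (λ f → f a) (onA fr₃ aLIVE refl)) (zero₂ s₂ fr₂ A aLIVE refl refl a))
            (λ a → trans (cong (λ f → f a) (onA fr₃ aCA refl)) (zero₂ s₂ fr₂ A aCA refl refl a)))) })
        (balls-correct I B (AL s₂ fr₂ A) P P>0 1+P≤B nvP≤B nvnv≤B refl refl
          (trans (onV fr₂ vM refl) M≡₁) (trans (onV fr₂ vP refl) P≡₁) (onV fr₂ vnv refl) (≤-trans (n≤1+n nv) 1+nv≤B)
          (zero₂ s₂ fr₂ A aSEEN refl refl))) })
        (adjacency-correct I B (arr s₁ aROW) S< T< arc-inj refl M≡₁ M≤B
          (λ x → cong (λ f → f x) (onA fr₁ aDEG refl)))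
        where
        assoc : ∀ a b c d e f g → a + (b + (c + (d + (e + f)))) + g ≡ a + (b + (c + (d + (e + (f + g)))))
        assoc = solve-∀

-- The query program

pattern vkk = 23
pattern vlo = 24
pattern vhi = 25
pattern vlev = 26
pattern vt = 27
pattern vln = 28
pattern vroot = 29
pattern vc = 30
pattern vlo′ = 31
pattern vhi′ = 32

pattern aFV = 15
pattern aFD = 16
pattern aST = 17
pattern aMARK = 18

-- Both expansions go into `aFV` and `aFD`, one behind the other, and `aST` holds the boundaries:
-- level `k` lies between entries `vkk ⊕ k` and `vkk ⊕ k ⊕ 1`. There are `t + 1` levels, hence
-- `t + 2` boundaries, which is the offset of the second expansion.
push expand explore : Cmd

push = aFV [ var vtail ]:= aQ ! (var vx ⊗ var vP ⊕ var vj) ▸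
       aFD [ var vtail ]:= var vd ⊕ aD ! (var vx ⊗ var vP ⊕ var vj) ▸
       vtail := var vtail ⊕ lit 1

expand = vx := aFV ! var vlo ▸ vd := aFD ! var vlo ▸ vln := aLN ! var vx ▸ vj := lit 0 ▸ for vj vln push

explore = aST [ var vkk ]:= var vtail ▸
          aFV [ var vtail ]:= var vroot ▸
          aFD [ var vtail ]:= lit 0 ▸
          vtail := var vtail ⊕ lit 1 ▸
          aST [ var vkk ⊕ lit 1 ]:= var vtail ▸
          vlev := lit 0 ▸
          for vlev vt (vlo := aST ! (var vkk ⊕ var vlev) ▸
                       vhi := aST ! (var vkk ⊕ var vlev ⊕ lit 1) ▸
                       for vlo vhi expand ▸
                       aST [ var vkk ⊕ var vlev ⊕ lit 2 ]:= var vtail)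

better : Expr → Expr → Expr
better o n = bin eq o (lit 0) ⊕ bin lt n o

-- Marking the last level of `u` with its shortest lengths lets the common vertices be found in one
-- pass over the last level of `v`, in time `P ^ t` instead of the product of the sizes. The marks
-- start from zero memory.
improve mark find pair pairs : Cmd

improve = cond (better (var vout) (var vc)) (vout := var vc)

mark = vlo := aST ! var vt ▸ vhi := aST ! (var vt ⊕ lit 1) ▸
       for vlo vhi (vx := aFV ! var vlo ▸ vc := aFD ! var vlo ⊕ lit 1 ▸
                    cond (better (aMARK ! var vx) (var vc)) (aMARK [ var vx ]:= var vc))

find = vlo := aST ! (var vkk ⊕ var vt) ▸ vhi := aST ! (var vkk ⊕ var vt ⊕ lit 1) ▸
       for vlo vhi (vx := aFV ! var vlo ▸ cond (aMARK ! var vx) (vc := aMARK ! var vx ⊕ aFD ! var vlo ▸ call improve))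

pair = vx := aFV ! var vlo′ ▸
       cond (aPIV ! var vy ⊗ aPIV ! var vx) (
         vz := aTBL ! ((aPIV ! var vy ⊝ lit 1) ⊗ var vl ⊕ (aPIV ! var vx ⊝ lit 1)) ▸
         cond (var vz) (vc := var vd ⊕ (var vz ⊕ (aFD ! var vlo′ ⊕ aPD ! var vx)) ▸ call improve))

pairs = vi := lit 0 ▸
        for vi vt (vlo := aST ! var vi ▸ vhi := aST ! (var vi ⊕ lit 1) ▸
          for vlo vhi (vy := aFV ! var vlo ▸ vd := aFD ! var vlo ⊕ aPD ! var vy ▸
                       vlev := var vt ⊝ (var vi ⊕ lit 1) ▸
                       vlo′ := aST ! (var vkk ⊕ var vlev) ▸ vhi′ := aST ! (var vkk ⊕ var vlev ⊕ lit 1) ▸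
                       for vlo′ vhi′ pair))

search querying : ℕ → Cmd
search t = vt := lit t ▸
           vroot := aROW ! var va ⊝ lit 1 ▸ vkk := lit 0 ▸ explore ▸
           vroot := aROW ! var vb ⊝ lit 1 ▸ vkk := lit (t + 2) ▸ explore ▸
           mark ▸ find ▸ pairs

querying t = vP := aSC ! lit 0 ▸ vl := aSC ! lit 1 ▸ va := inp (lit 0) ▸ vb := inp (lit 1) ▸
             -- The value 1 encodes the distance 0. Equal vertices are answered apart because an
             -- isolated vertex has no number and yet is at distance 0 from itself.
             cond (bin eq (var va) (var vb)) (vout := lit 1) ▸
             cond (bin eq (bin eq (var va) (var vb)) (lit 0)) (cond (aROW ! var va ⊗ aROW ! var vb) (call (search t)))

-- Estimates are stored with an offset: 0 stands for ∞ and suc c for c.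
_⊴_ : ℕ → ℕ → Set
o ⊴ c = ∃[ c′ ] (o ≡ suc c′ × c′ ≤ c)

better-yes : ∀ {o n c} → ⟦ add ⟧ (⟦ eq ⟧ o 0) (⟦ lt ⟧ (suc n) o) ≢ 0 → o ⊴ c → suc n ⊴ c
better-yes {n = n} h (c′ , refl , c′≤) = n , refl , ≤-trans (<⇒≤ (suc[m]≤n⇒m≤pred[n] (<?-nonzero {suc n} {suc c′} h))) c′≤

better-no : ∀ {o n} → ⟦ add ⟧ (⟦ eq ⟧ o 0) (⟦ lt ⟧ (suc n) o) ≡ 0 → o ⊴ n
better-no {zero}  ()
better-no {suc o} {n} h = o , refl , suc[m]≤n⇒m≤pred[n] (<?-zero {suc n} {suc o} h)

*-split : ∀ {a b} → a * b ≢ 0 → ∃[ k ] ∃[ l ] (a ≡ suc k × b ≡ suc l)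
*-split {zero}  h = ⊥-elim (h refl)
*-split {suc a} {zero}  h = ⊥-elim (h (*-zeroʳ a))
*-split {suc a} {suc b} h = a , b , refl , refl

query-time : (P t : ℕ) → ℕ
query-time P t = t * (1 + 2 * P ^ t) + (t * (1 + 2 * P ^ t) + (P ^ t + (P ^ t + t * (1 + 2 * P ^ t))))

record QueryContext : Set₁ where
  field
    I     : ℕ → ℕ
    B     : ℕ
    {E}   : ℕ → ℕ → Set
    {nv P L} : ℕ
    {ln piv pd lm Qa Da Ta} : ℕ → ℕ
    O     : Oracle E nv P L ln piv pd lm (λ x j → Qa (x * P + j)) (λ x j → Da (x * P + j)) (λ k k′ → Ta (k * L + k′))
    P>0   : 0 < P
    t B₁  : ℕ
    pd≤   : ∀ x → pd x ≤ B₁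
    Ta≤   : ∀ x → Ta x ≤ B₁
    -- The longest candidate: two expansions of length at most `t * P`, two landmark distances, a
    -- table entry, and the offset 1.
    sum≤B : (t * P + B₁) + (B₁ + (t * P + B₁)) + 1 ≤ B
    P≤B   : P ≤ B
    ∑≤B   : ∑ (P ^_) (suc t) + ∑ (P ^_) (suc t) ≤ B
    t+2≤B : t + 2 ≤ B

-- Correctness of the query

module Query (X : QueryContext) where
  open QueryContext X
  open Oracle O using (ball)

  private
    q d : ℕ → ℕ → ℕ
    q x j = Qa (x * P + j)
    d x j = Da (x * P + j)

  Lv : ℕ → ℕ → ℕ → ℕ → Set
  Lv = Level ln q d

  lv< : ∀ {u k x δ} → u < nv → Lv u k x δ → x < nv
  lv< u< root = u<
  lv< u< (next lv j<) = Ball.q< (ball (lv< u< lv)) j<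

  lv≤ : ∀ {u k x δ} → u < nv → Lv u k x δ → δ ≤ k * P
  lv≤ u< root = z≤n
  lv≤ {k = suc k} u< (next {δ = δ} lv j<) = ≤-trans (+-mono-≤ (lv≤ u< lv) (≤-trans (Ball.d≤ b j<) (≤-trans (<⇒≤ j<) (Ball.ln≤cap b))))
      (≤-reflexive (+-comm (k * P) P))
    where b = ball (lv< u< lv)

  record Span (u k : ℕ) (FV FD : ℕ → ℕ) (lo hi : ℕ) : Set where
    field
      lo≤hi    : lo ≤ hi
      sound    : ∀ {a} → lo ≤ a → a < hi → Lv u k (FV a) (FD a)
      complete : ∀ {x δ} → Lv u k x δ → ∃[ a ] (lo ≤ a × a < hi × FV a ≡ x × FD a ≡ δ)
      size     : hi ≤ lo + P ^ k

  Agree : ℕ → (f g : ℕ → ℕ) → Set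
  Agree k f g = ∀ b → b < k → f b ≡ g b

  span-agree : ∀ {u k FV FD FV′ FD′ lo hi} → Agree hi FV′ FV → Agree hi FD′ FD → Span u k FV FD lo hi → Span u k FV′ FD′ lo hi
  span-agree {u} {k} v≡ d≡ sp = record
    { lo≤hi = lo≤hi
    ; sound = λ lo≤ a< → subst₂ (Lv u k) (sym (v≡ _ a<)) (sym (d≡ _ a<)) (sound lo≤ a<)
    ; complete = λ lv → let a , lo≤ , a< , p , r = complete lv in a , lo≤ , a< , trans (v≡ a a<) p , trans (d≡ a a<) r
    ; size = size }
    where open Span sp

  Ctx : Store → Set
  Ctx s = arr s aQ ≡ Qa × arr s aD ≡ Da × arr s aLN ≡ ln × val s vP ≡ P × val s vt ≡ t

  module _ {u : ℕ} (u< : u < nv) (k : ℕ) (lo hi : ℕ) (FV₀ FD₀ : ℕ → ℕ) (sp : Span u k FV₀ FD₀ lo hi) where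

    -- The state of level `k + 1` while entry `a` of level `k` is expanded, with `j` members of its
    -- list done. `tail≤` says that each expanded entry adds at most `P`, with the subtraction of
    -- `lo * P` moved to the left.
    record Grown (a j : ℕ) (FV FD : ℕ → ℕ) (tail : ℕ) : Set where
      field
        sameV   : Agree hi FV FV₀
        sameD   : Agree hi FD FD₀
        hi≤     : hi ≤ tail
        fresh   : ∀ {b} → hi ≤ b → b < tail → Lv u (suc k) (FV b) (FD b)
        before  : ∀ {a′ j′} → lo ≤ a′ → a′ < a → j′ < ln (FV₀ a′) →
                  ∃[ b ] (hi ≤ b × b < tail × FV b ≡ q (FV₀ a′) j′ × FD b ≡ FD₀ a′ + d (FV₀ a′) j′)
        current : ∀ {j′} → j′ < j →
                  ∃[ b ] (hi ≤ b × b < tail × FV b ≡ q (FV₀ a) j′ × FD b ≡ FD₀ a + d (FV₀ a) j′)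
        tail≤   : tail + lo * P ≤ hi + a * P + j

    grown-push : ∀ {a j FV FD tail y e} → lo ≤ a → a < hi → j < ln (FV₀ a) → Grown a j FV FD tail →
                 y ≡ q (FV₀ a) j → e ≡ FD₀ a + d (FV₀ a) j →
                 Grown a (suc j) (FV [ tail ≔ y ]) (FD [ tail ≔ e ]) (tail + 1)
    grown-push {a} {j} {FV} {FD} {tail} lo≤ a< j< g refl refl = subst (Grown a (suc j) FV′ FD′) (+-comm 1 tail) (record
      { sameV = λ b b< → trans (oldV (<-≤-trans b< hi≤)) (sameV b b<)
      ; sameD = λ b b< → trans (oldD (<-≤-trans b< hi≤)) (sameD b b<)
      ; hi≤ = m≤n⇒m≤1+n hi≤
      ; fresh = λ { {b} hi≤b (s≤s b≤) → fresh′ hi≤b b≤ }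
      ; before = λ lo≤ a′< j′< → let b , hi≤b , b< , p , r = before lo≤ a′< j′< in
          b , hi≤b , m≤n⇒m≤1+n b< , trans (oldV b<) p , trans (oldD b<) r
      ; current = λ { (s≤s j′≤) → current′ j′≤ }
      ; tail≤ = ≤-trans (s≤s tail≤) (≤-reflexive (sym (+-suc (hi + a * P) j))) })
      where
      open Grown g
      y = q (FV₀ a) j
      e = FD₀ a + d (FV₀ a) j
      FV′ = FV [ tail ≔ y ]
      FD′ = FD [ tail ≔ e ]
      oldV : ∀ {b} → b < tail → FV′ b ≡ FV b
      oldV b< = upd-≢ FV y (λ { refl → <-irrefl refl b< })
      oldD : ∀ {b} → b < tail → FD′ b ≡ FD b
      oldD b< = upd-≢ FD e (λ { refl → <-irrefl refl b< })
      newV : FV′ tail ≡ y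
      newV = upd-≡ FV {tail} y refl
      newD : FD′ tail ≡ e
      newD = upd-≡ FD {tail} e refl
      fresh′ : ∀ {b} → hi ≤ b → b ≤ tail → Lv u (suc k) (FV′ b) (FD′ b)
      fresh′ hi≤b b≤ with m≤n⇒m<n∨m≡n b≤
      ... | inj₁ b< = subst₂ (Lv u (suc k)) (sym (oldV b<)) (sym (oldD b<)) (fresh hi≤b b<)
      ... | inj₂ refl = subst₂ (Lv u (suc k)) (sym newV) (sym newD) (next (Span.sound sp lo≤ a<) j<)
      current′ : ∀ {j′} → j′ ≤ j → ∃[ b ] (hi ≤ b × b < suc tail × FV′ b ≡ q (FV₀ a) j′ × FD′ b ≡ FD₀ a + d (FV₀ a) j′)
      current′ j′≤ with m≤n⇒m<n∨m≡n j′≤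
      ... | inj₁ j′< = let b , hi≤b , b< , p , r = current j′< in b , hi≤b , m≤n⇒m≤1+n b< , trans (oldV b<) p , trans (oldD b<) r
      ... | inj₂ refl = tail , hi≤ , ≤-refl , newV , newD

    grown-next : ∀ {a FV FD tail} → ln (FV₀ a) ≤ P → Grown a (ln (FV₀ a)) FV FD tail → Grown (suc a) 0 FV FD tail
    grown-next {a} ln≤ g = record
      { sameV = sameV ; sameD = sameD ; hi≤ = hi≤ ; fresh = fresh
      ; before = λ { lo≤ (s≤s a′≤) j′< → before′ lo≤ a′≤ j′< }
      ; current = λ ()
      ; tail≤ = ≤-trans tail≤ (≤-trans (+-monoʳ-≤ (hi + a * P) ln≤) (≤-reflexive (arith hi (a * P) P))) }
      where
      open Grown g
      arith : ∀ h x p → h + x + p ≡ h + (p + x) + 0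
      arith = solve-∀
      before′ : ∀ {a′ j′} → lo ≤ a′ → a′ ≤ a → j′ < ln (FV₀ a′) → _
      before′ lo≤ a′≤ j′< with m≤n⇒m<n∨m≡n a′≤
      ... | inj₁ a′< = before lo≤ a′< j′<
      ... | inj₂ refl = current j′<

    grown-span : ∀ {FV FD tail} → Grown hi 0 FV FD tail → Span u (suc k) FV FD hi tail
    grown-span {FV} {FD} {tail} g = record
      { lo≤hi = hi≤ ; sound = fresh ; complete = complete′
      ; size = +-cancelʳ-≤ (lo * P) tail _ (≤-trans tail≤ (≤-trans (≤-reflexive (+-identityʳ _))
          (≤-trans (+-monoʳ-≤ hi (*-monoˡ-≤ P (Span.size sp))) (≤-reflexive (arith hi lo P (P ^ k)))))) }
      where
      open Grown g
      arith : ∀ h l p x → h + (l + x) * p ≡ h + p * x + l * p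
      arith = solve-∀
      complete′ : ∀ {x δ} → Lv u (suc k) x δ → ∃[ b ] (hi ≤ b × b < tail × FV b ≡ x × FD b ≡ δ)
      complete′ (next {j = j} lv j<) with Span.complete sp lv
      ... | a , lo≤ , a< , refl , refl = before lo≤ a< j<

    expand-correct : ∀ {s a} → Ctx s → val s vlo ≡ a → lo ≤ a → a < hi → k < t → P ≤ B → t * P ≤ B →
      hi + P ^ suc k ≤ B → Grown a 0 (arr s aFV) (arr s aFD) (val s vtail) →
      WP I B expand s (λ τ s′ → τ ≤ P × Grown (suc a) 0 (arr s′ aFV) (arr s′ aFD) (val s′ vtail))
    expand-correct {s} {a} (Q≡ , D≡ , LN≡ , P≡ , _) refl lo≤ a< k<t P≤B tP≤B big g =
      block tt , tt , tt , z≤n , wp-for {y = vln}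
        (λ j τ s′ → τ ≡ j × Grown a j (arr s′ aFV) (arr s′ aFD) (val s′ vtail))
        refl refl refl (≤-trans ln≤ P≤B) refl ln≡ z≤n
        (λ { {j} {τ} {s′} _ j< refl fr (refl , g′) →
           let x≡ : val s′ vx ≡ FV₀ a
               x≡ = trans (onV fr vx refl) (Grown.sameV g a a<)
               index : val s′ vx * val s′ vP + j ≡ FV₀ a * P + j
               index = cong₂ (λ x p → x * p + j) x≡ (trans (onV fr vP refl) P≡)
               y≡ : arr s′ aQ (val s′ vx * val s′ vP + j) ≡ q (FV₀ a) j
               y≡ = trans (cong (λ f → f (val s′ vx * val s′ vP + j)) (trans (onA fr aQ refl) Q≡)) (cong Qa index)
               e≡ : val s′ vd + arr s′ aD (val s′ vx * val s′ vP + j) ≡ FD₀ a + d (FV₀ a) j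
               e≡ = cong₂ _+_ (trans (onV fr vd refl) (Grown.sameD g a a<))
                      (trans (cong (λ f → f (val s′ vx * val s′ vP + j)) (trans (onA fr aD refl) D≡)) (cong Da index))
           in block tt , ≤-trans (≤-reflexive e≡) (≤-trans (lv≤ u< (next (Span.sound sp lo≤ a<) j<)) (≤-trans (*-monoˡ-≤ P k<t) tP≤B))
              , room j< g′ , (+-comm j 1 , grown-push lo≤ a< j< g′ y≡ e≡) })
        (λ { _ (refl , g′) → ln≤ , grown-next ln≤ g′ })
        (refl , g)
      where
      b = ball (lv< u< (Span.sound sp lo≤ a<))
      ln≤ : ln (FV₀ a) ≤ P
      ln≤ = Ball.ln≤cap b
      ln≡ : arr s aLN (arr s aFV a) ≡ ln (FV₀ a)
      ln≡ = trans (cong (λ f → f (arr s aFV a)) LN≡) (cong ln (Grown.sameV g a a<))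
      room : ∀ {j FV FD tail} → j < ln (FV₀ a) → Grown a j FV FD tail → tail + 1 ≤ B
      room {j} {tail = tail} j< g′ = ≤-trans (+-cancelʳ-≤ (lo * P) (tail + 1) (hi + P ^ suc k) (begin
        tail + 1 + lo * P            ≡⟨ swap tail (lo * P) ⟩
        suc (tail + lo * P)          ≤⟨ s≤s (Grown.tail≤ g′) ⟩
        suc (hi + a * P + j)         ≡⟨ sym (+-suc (hi + a * P) j) ⟩
        hi + a * P + suc j           ≤⟨ +-monoʳ-≤ (hi + a * P) (≤-trans j< ln≤) ⟩
        hi + a * P + P               ≡⟨ fold hi (a * P) P ⟩
        hi + suc a * P               ≤⟨ +-monoʳ-≤ hi (*-monoˡ-≤ P (≤-trans a< (Span.size sp))) ⟩
        hi + (lo + P ^ k) * P        ≡⟨ arith hi lo P (P ^ k) ⟩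
        hi + P * P ^ k + lo * P      ∎)) big
        where
        open ≤-Reasoning
        swap : ∀ a b → a + 1 + b ≡ suc (a + b)
        swap = solve-∀
        fold : ∀ h x p → h + x + p ≡ h + (p + x)
        fold = solve-∀
        arith : ∀ h l p x → h + (l + x) * p ≡ h + p * x + l * p
        arith = solve-∀

  record Levels (u k₀ T₀ k τ : ℕ) (s₀ s : Store) : Set where
    field
      spans : ∀ {k′} → k′ ≤ k → Span u k′ (arr s aFV) (arr s aFD) (arr s aST (k₀ + k′)) (arr s aST (k₀ + k′ + 1))
      ends  : ∀ {k′} → k′ ≤ k → arr s aST (k₀ + k′ + 1) ≤ val s vtail
      last  : arr s aST (k₀ + k + 1) ≡ val s vtail
      keepV : Agree T₀ (arr s aFV) (arr s₀ aFV)
      keepD : Agree T₀ (arr s aFD) (arr s₀ aFD)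
      keepS : Agree k₀ (arr s aST) (arr s₀ aST)
      T₀≤   : T₀ ≤ val s vtail
      tail≤ : val s vtail ≤ T₀ + ∑ (P ^_) (suc k)
      time  : τ ≤ k * (1 + 2 * P ^ t)

  setV-levels : ∀ {u k₀ T₀ k τ s₀ s v} → Levels u k₀ T₀ k τ s₀ s → Levels u k₀ T₀ k τ s₀ (setV s vlev v)
  setV-levels L = record { Levels L }

  P^≤ : ∀ {i j} → i ≤ j → P ^ i ≤ P ^ j
  P^≤ = ^-monoʳ-≤ P {{>-nonZero P>0}}

  ∑P≤ : ∀ {i j} → i ≤ j → ∑ (P ^_) i ≤ ∑ (P ^_) j
  ∑P≤ {i} {j} h = subst (λ z → ∑ (P ^_) i ≤ ∑ (P ^_) z) (m∸n+n≡m h) (go (j ∸ i))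
    where go : ∀ e → ∑ (P ^_) i ≤ ∑ (P ^_) (e + i)
          go zero    = ≤-refl
          go (suc e) = ≤-trans (go e) (m≤m+n _ _)

  explore-correct : ∀ {s u k₀ T₀} → u < nv → Ctx s → val s vroot ≡ u → val s vkk ≡ k₀ → val s vtail ≡ T₀ →
    P ≤ B → t * P ≤ B → T₀ + ∑ (P ^_) (suc t) ≤ B → t ≤ B → WP I B explore s (λ τ s′ → Frame explore s s′ × Levels u k₀ T₀ t τ s s′)
  explore-correct {s} {u} {k₀} {T₀} u< (Q≡ , D≡ , LN≡ , P≡ , t≡) refl refl refl P≤B tP≤B big t≤B = wp-frame
    (block tt , tt , z≤n , T₀+1≤B , tt , z≤n , wp-for {y = vt}
      (λ k τ s′ → Levels u k₀ T₀ k τ s s′)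
      refl refl refl t≤B refl t≡ z≤n
      (λ { {k} {τ} {s′} _ k<t refl fr L →
         let k₀≡ : val s′ vkk ≡ k₀
             k₀≡ = onV fr vkk refl
             open Levels L
             lo = arr s′ aST (k₀ + k)
             hi = arr s′ aST (k₀ + k + 1)
             sp = spans ≤-refl
             lo≡ : arr s′ aST (val s′ vkk + k) ≡ lo
             lo≡ = cong (λ z → arr s′ aST (z + k)) k₀≡
             hi≡ : arr s′ aST (val s′ vkk + k + 1) ≡ hi
             hi≡ = cong (λ z → arr s′ aST (z + k + 1)) k₀≡
             hi-big : hi + P ^ suc k ≤ B
             hi-big = ≤-trans (+-monoˡ-≤ (P ^ suc k) (≤-trans (≤-reflexive last) tail≤))
                        (≤-trans (≤-reflexive (+-assoc T₀ _ _)) (≤-trans (+-monoʳ-≤ T₀ (∑P≤ (s≤s k<t))) big))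
         in block tt , tt , wp-seq (wp-for {y = vhi}
           (λ a τ′ s″ → τ′ + lo * (1 + P) ≤ a * (1 + P) × Grown u< k lo hi (arr s′ aFV) (arr s′ aFD) sp a 0 (arr s″ aFV) (arr s″ aFD) (val s″ vtail))
           refl refl refl (≤-trans (m≤m+n hi _) hi-big) lo≡ hi≡ (Span.lo≤hi sp)
           (λ { {a} {τ′} {s″} lo≤ a< vlo≡ fr′ (τ′≤ , g) → wp-mono
              (λ { {τ″} (τ″≤ , g′) → ≤-trans (≤-reflexive (shuffle τ′ τ″ (lo * (1 + P)))) (≤-trans (+-mono-≤ (s≤s τ″≤) τ′≤) ≤-refl) , g′ })
              (expand-correct u< k lo hi (arr s′ aFV) (arr s′ aFD) sp
                 ( trans (onA fr′ aQ refl) (trans (onA fr aQ refl) Q≡) , trans (onA fr′ aD refl) (trans (onA fr aD refl) D≡)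
                 , trans (onA fr′ aLN refl) (trans (onA fr aLN refl) LN≡) , trans (onV fr′ vP refl) (trans (onV fr vP refl) P≡)
                 , trans (onV fr′ vt refl) (trans (onV fr vt refl) t≡))
                 vlo≡ lo≤ a< k<t P≤B tP≤B hi-big g) })
           (λ { {τ′} {s″} fr′ (τ′≤ , g) → block tt ,
              (setV-levels (next-level {s″ = s″} k<t L (onA fr′ aST refl) (cong₂ (λ z k → z + k + 2) (trans (onV fr′ vkk refl) k₀≡) (onV fr′ vlev refl)) (grown-span u< k lo hi _ _ sp g) g τ′≤)) })
           (≤-refl , record { sameV = λ _ _ → refl ; sameD = λ _ _ → refl ; hi≤ = ≤-reflexive last
              ; fresh = λ hi≤b b< → ⊥-elim (<⇒≱ b< (≤-trans (≤-reflexive (sym last)) hi≤b))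
              ; before = λ lo≤ a′< _ → ⊥-elim (<⇒≱ a′< lo≤) ; current = λ ()
              ; tail≤ = ≤-reflexive (trans (cong (_+ lo * P) (sym last)) (sym (+-identityʳ _))) })) })
      (λ _ j → j)
      start-level)
    where
    shuffle : ∀ a b c → a + suc b + c ≡ suc b + (a + c)
    shuffle = solve-∀
    T₀+1≤B : T₀ + 1 ≤ B
    T₀+1≤B = ≤-trans (+-monoʳ-≤ T₀ (∑P≤ {1} {suc t} (s≤s z≤n))) big
    FV₁ FD₁ ST₁ : ℕ → ℕ
    FV₁ = arr s aFV [ T₀ ≔ u ]
    FD₁ = arr s aFD [ T₀ ≔ 0 ]
    ST₁ = (arr s aST [ k₀ ≔ T₀ ]) [ k₀ + 1 ≔ T₀ + 1 ]
    s₁ : Store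
    s₁ = setV (setA (setV (setA (setA (setA s aST k₀ T₀) aFV T₀ u) aFD T₀ 0) vtail (T₀ + 1)) aST (k₀ + 1) (T₀ + 1)) vlev 0
    start-level : Levels u k₀ T₀ 0 0 s s₁
    start-level = record
      { spans = λ { z≤n → subst₂ (Span u 0 FV₁ FD₁) (sym lo≡) (sym hi≡) span₀ }
      ; ends = λ { z≤n → ≤-reflexive hi≡ }
      ; last = hi≡
      ; keepV = λ b b< → upd-≢ (arr s aFV) u (λ { refl → <-irrefl refl b< })
      ; keepD = λ b b< → upd-≢ (arr s aFD) 0 (λ { refl → <-irrefl refl b< })
      ; keepS = λ b b< → trans (upd-≢ (arr s aST [ k₀ ≔ T₀ ]) _ (λ { refl → <⇒≱ b< (m≤m+n k₀ 1) })) (upd-≢ (arr s aST) T₀ (λ { refl → <-irrefl refl b< }))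
      ; T₀≤ = m≤m+n T₀ 1
      ; tail≤ = ≤-refl
      ; time = z≤n }
      where
      lo≡ : ST₁ (k₀ + 0) ≡ T₀
      lo≡ = trans (cong ST₁ (+-identityʳ k₀)) (trans (upd-≢ (arr s aST [ k₀ ≔ T₀ ]) _ (λ p → <-irrefl p (≤-reflexive (+-comm 1 k₀)))) (upd-≡ (arr s aST) {k₀} T₀ refl))
      hi≡ : ST₁ (k₀ + 0 + 1) ≡ T₀ + 1
      hi≡ = upd-≡ (arr s aST [ k₀ ≔ T₀ ]) {k₀ + 1} (T₀ + 1) (cong (_+ 1) (+-identityʳ k₀))
      only : ∀ {a} → T₀ ≤ a → a < T₀ + 1 → a ≡ T₀
      only lo≤ a< = ≤-antisym (suc[m]≤n⇒m≤pred[n] (≤-trans a< (≤-reflexive (+-comm T₀ 1)))) lo≤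
      new : Lv u 0 (FV₁ T₀) (FD₁ T₀)
      new = subst₂ (Lv u 0) (sym (upd-≡ (arr s aFV) {T₀} u refl)) (sym (upd-≡ (arr s aFD) {T₀} 0 refl)) root
      span₀ : Span u 0 FV₁ FD₁ T₀ (T₀ + 1)
      span₀ = record
        { lo≤hi = m≤m+n T₀ 1
        ; sound = λ lo≤ a< → subst (λ a → Lv u 0 (FV₁ a) (FD₁ a)) (sym (only lo≤ a<)) new
        ; complete = λ { root → T₀ , ≤-refl , ≤-reflexive (+-comm 1 T₀) , upd-≡ (arr s aFV) {T₀} u refl , upd-≡ (arr s aFD) {T₀} 0 refl }
        ; size = ≤-refl }
    next-level : ∀ {k τ τ′ s′ s″ i} → k < t → (L : Levels u k₀ T₀ k τ s s′) → arr s″ aST ≡ arr s′ aST → i ≡ k₀ + k + 2 →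
      Span u (suc k) (arr s″ aFV) (arr s″ aFD) (arr s′ aST (k₀ + k + 1)) (val s″ vtail) →
      Grown u< k (arr s′ aST (k₀ + k)) (arr s′ aST (k₀ + k + 1)) (arr s′ aFV) (arr s′ aFD) (Levels.spans L ≤-refl)
        (arr s′ aST (k₀ + k + 1)) 0 (arr s″ aFV) (arr s″ aFD) (val s″ vtail) →
      τ′ + arr s′ aST (k₀ + k) * (1 + P) ≤ arr s′ aST (k₀ + k + 1) * (1 + P) →
      Levels u k₀ T₀ (suc k) (τ + suc (τ′ + 0)) s (setA s″ aST i (val s″ vtail))
    next-level {k} {τ} {τ′} {s′} {s″} k<t L ST≡ refl span g τ′≤ = record
      { spans = spans′ ; ends = ends′
      ; last = trans (cong ST′ (+-assoc k₀ (suc k) 1)) (trans (cong ST′ (step₂ k)) new)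
      ; keepV = λ b b< → trans (sameV b (<-≤-trans b< T₀≤hi)) (keepV b b<)
      ; keepD = λ b b< → trans (sameD b (<-≤-trans b< T₀≤hi)) (keepD b b<)
      ; keepS = λ b b< → trans (old (≤-trans b< (≤-trans (m≤m+n k₀ k) (m≤m+n (k₀ + k) 2)))) (keepS b b<)
      ; T₀≤ = ≤-trans T₀≤hi hi≤
      ; tail≤ = ≤-trans (Span.size span) (≤-trans (+-monoˡ-≤ (P ^ suc k) (≤-trans (≤-reflexive last) tail≤)) (≤-reflexive (+-assoc T₀ _ _)))
      ; time = ≤-trans (≤-reflexive (trans (+-suc τ (τ′ + 0)) (cong (λ z → suc (τ + z)) (+-identityʳ τ′))))
          (≤-trans (s≤s (+-mono-≤ time τ′≤2P)) (≤-reflexive (arith (k * (1 + 2 * P ^ t)) (2 * P ^ t)))) }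
      where
      open Levels L
      open Grown g using (sameV; sameD; hi≤)
      ST ST′ : ℕ → ℕ
      ST = arr s′ aST
      ST′ = arr s″ aST [ k₀ + k + 2 ≔ val s″ vtail ]
      lo = ST (k₀ + k)
      hi = ST (k₀ + k + 1)
      arith : ∀ a b → suc (a + b) ≡ suc (b + a)
      arith a b = cong suc (+-comm a b)
      step₂ : ∀ k → k₀ + (suc k + 1) ≡ k₀ + k + 2
      step₂ k = trans (cong (k₀ +_) (sym (+-suc k 1))) (sym (+-assoc k₀ k 2))
      T₀≤hi : T₀ ≤ hi
      T₀≤hi = ≤-trans T₀≤ (≤-reflexive (sym last))
      new : ST′ (k₀ + k + 2) ≡ val s″ vtail
      new = upd-≡ (arr s″ aST) {k₀ + k + 2} _ refl
      old : ∀ {b} → b < k₀ + k + 2 → ST′ b ≡ ST b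
      old b< = trans (upd-≢ (arr s″ aST) _ (λ p → <-irrefl p b<)) (cong (λ f → f _) ST≡)
      low : ∀ {k′} → k′ ≤ k → k₀ + k′ < k₀ + k + 2
      low {k′} k′≤ = ≤-trans (s≤s (+-monoʳ-≤ k₀ k′≤)) (≤-trans (≤-reflexive (+-comm 1 _)) (+-monoʳ-≤ (k₀ + k) (s≤s z≤n)))
      low+1 : ∀ {k′} → k′ ≤ k → k₀ + k′ + 1 < k₀ + k + 2
      low+1 {k′} k′≤ = ≤-trans (≤-reflexive (sym (+-suc (k₀ + k′) 1))) (+-monoˡ-≤ 2 (+-monoʳ-≤ k₀ k′≤))
      spans′ : ∀ {k′} → k′ ≤ suc k → Span u k′ (arr s″ aFV) (arr s″ aFD) (ST′ (k₀ + k′)) (ST′ (k₀ + k′ + 1))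
      spans′ {k′} k′≤ with m≤n⇒m<n∨m≡n k′≤
      ... | inj₁ (s≤s k′≤k) = subst₂ (Span u k′ _ _) (sym (old (low k′≤k))) (sym (old (low+1 k′≤k)))
              (span-agree (λ b b< → sameV b (<-≤-trans b< below)) (λ b b< → sameD b (<-≤-trans b< below)) (spans k′≤k))
        where below : ST (k₀ + k′ + 1) ≤ hi
              below = ≤-trans (ends k′≤k) (≤-reflexive (sym last))
      ... | inj₂ refl = subst₂ (Span u (suc k) _ _)
              (sym (trans (cong ST′ (trans (+-suc k₀ k) (+-comm 1 _))) (old (low+1 ≤-refl))))
              (sym (trans (cong ST′ (trans (+-assoc k₀ (suc k) 1) (step₂ k))) new)) span
      ends′ : ∀ {k′} → k′ ≤ suc k → ST′ (k₀ + k′ + 1) ≤ val s″ vtail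
      ends′ {k′} k′≤ with m≤n⇒m<n∨m≡n k′≤
      ... | inj₁ (s≤s k′≤k) = ≤-trans (≤-reflexive (old (low+1 k′≤k))) (≤-trans (ends k′≤k) (≤-trans (≤-reflexive (sym last)) hi≤))
      ... | inj₂ refl = ≤-reflexive (trans (cong ST′ (trans (+-assoc k₀ (suc k) 1) (step₂ k))) new)
      -- An entry of level `k` costs one iteration and at most `P` more, so the level costs
      -- `P ^ k + P ^ suc k`, and both powers are at most `P ^ t`.
      τ′≤2P : τ′ ≤ 2 * P ^ t
      τ′≤2P = ≤-trans (+-cancelʳ-≤ (lo * (1 + P)) τ′ (P ^ k * (1 + P)) (≤-trans τ′≤ (≤-trans (*-monoˡ-≤ (1 + P) (Span.size (spans ≤-refl)))
                (≤-reflexive (trans (*-distribʳ-+ (1 + P) lo (P ^ k)) (+-comm _ (P ^ k * (1 + P))))))))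
              (≤-trans (≤-reflexive (expand-P (P ^ k) P)) (+-mono-≤ (P^≤ (<⇒≤ k<t)) (≤-trans (P^≤ k<t) (≤-reflexive (sym (+-identityʳ _))))))
        where expand-P : ∀ x p → x * (1 + p) ≡ x + p * x
              expand-P = solve-∀

  Cand : (u v c : ℕ) → Set
  Cand = Candidate ln piv pd (λ x j → Qa (x * P + j)) (λ x j → Da (x * P + j)) (λ k k′ → Ta (k * L + k′)) t

  -- A running minimum only falls. Phrased by upper bounds, this composes like functions and treats
  -- infinity like every other value.
  Improves : ℕ → ℕ → Set
  Improves o o′ = ∀ c → o ⊴ c → o′ ⊴ c

  private
    tP+B₁≤B : ∀ {a b} → a ≤ t * P → b ≤ B₁ → a + b ≤ B
    tP+B₁≤B h h′ = ≤-trans (+-mono-≤ h h′) (≤-trans (m≤m+n _ _) (≤-trans (m≤m+n _ 1) sum≤B))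

    t≤B : t ≤ B
    t≤B = ≤-trans (m≤m+n t 2) t+2≤B

    tP≤B : t * P ≤ B
    tP≤B = ≤-trans (m≤m+n (t * P) B₁) (≤-trans (m≤m+n _ _) (≤-trans (m≤m+n _ 1) sum≤B))

    tP+1≤B : t * P + 1 ≤ B
    tP+1≤B = ≤-trans (+-monoˡ-≤ 1 (≤-trans (m≤m+n (t * P) B₁) (m≤m+n _ _))) sum≤B

    level≤ : ∀ {w k x δ} → w < nv → k ≤ t → Lv w k x δ → δ ≤ t * P
    level≤ w< k≤ lv = ≤-trans (lv≤ w< lv) (*-monoˡ-≤ P k≤)

  record Explored : Set where
    field
      u v      : ℕ
      u<       : u < nv
      v<       : v < nv
      FV FD ST : ℕ → ℕ
      spanU    : ∀ {k} → k ≤ t → Span u k FV FD (ST k) (ST (k + 1))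
      spanV    : ∀ {k} → k ≤ t → Span v k FV FD (ST (t + 2 + k)) (ST (t + 2 + k + 1))
      ST≤B     : ∀ {k} → k ≤ t → ST (k + 1) ≤ B × ST (t + 2 + k + 1) ≤ B

  module Search (W : Explored) where
    open Explored W

    Sound : ℕ → Set
    Sound o = ∀ c → o ≡ suc c → Cand u v c

    improve-correct : ∀ {s c} → val s vc ≡ suc c → Cand u v c → Sound (val s vout) →
      WP I B improve s (λ τ s′ → τ ≡ 0 × Sound (val s′ vout) × val s′ vout ⊴ c × Improves (val s vout) (val s′ vout))
    improve-correct {s} {c} c≡ cand sound = block
      (λ h → tt , (refl , (λ c′ p → subst (Cand u v) (suc-injective (trans (sym c≡) p)) cand) , (c , c≡ , ≤-refl)
         , λ c′ le → subst (_⊴ c′) (sym c≡) (better-yes {n = c} (subst (λ n → ⟦ add ⟧ (⟦ eq ⟧ (val s vout) 0) (⟦ lt ⟧ n (val s vout)) ≢ 0) c≡ h) le))) ,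
      (λ h → refl , sound , better-no {n = c} (subst (λ n → ⟦ add ⟧ (⟦ eq ⟧ (val s vout) 0) (⟦ lt ⟧ n (val s vout)) ≡ 0) c≡ h) , λ _ le → le)

    Frontiers : Store → Set
    Frontiers s = arr s aFV ≡ FV × arr s aFD ≡ FD × arr s aST ≡ ST × val s vt ≡ t × val s vkk ≡ t + 2

    Marked : (ℕ → ℕ) → Set
    Marked M = (∀ y δ → M y ≡ suc δ → Lv u t y δ) × (∀ y δ → Lv u t y δ → M y ⊴ δ)

    size≤ : ∀ {w k τ lo hi} → Span w k FV FD lo hi → τ + lo ≤ hi → τ ≤ P ^ k
    size≤ {lo = lo} sp h = +-cancelʳ-≤ lo _ _ (≤-trans h (≤-trans (Span.size sp) (≤-reflexive (+-comm lo _))))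

    mark-correct : ∀ {s} → Frontiers s → (∀ y → arr s aMARK y ≡ 0) →
      WP I B mark s (λ τ s′ → Frame mark s s′ × τ ≤ P ^ t × Marked (arr s′ aMARK))
    mark-correct {s} (FV≡ , FD≡ , ST≡ , t≡ , _) none = wp-frame (block tt , tt , wp-for {y = vhi}
      (λ a τ s′ → τ + ST t ≤ a × (∀ y δ → arr s′ aMARK y ≡ suc δ → Lv u t y δ) ×
                  (∀ a′ → ST t ≤ a′ → a′ < a → arr s′ aMARK (FV a′) ⊴ FD a′))
      refl refl refl (proj₁ (ST≤B ≤-refl)) (at (λ z → z)) (at (_+ 1)) lo≤hi
      (λ { {a} {τ} {s′} lo≤ a< refl fr (τ≤ , snd , cov) →
         let x≡ : arr s′ aFV a ≡ FV a
             x≡ = cong (λ f → f a) (trans (onA fr aFV refl) FV≡)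
             c≡ : arr s′ aFD a + 1 ≡ suc (FD a)
             c≡ = trans (+-comm _ 1) (cong (λ f → suc (f a)) (trans (onA fr aFD refl) FD≡))
             lv = sound lo≤ a<
             τ′≤ = ≤-trans (≤-reflexive (trans (cong (_+ ST t) (+-comm τ 1)) refl)) (s≤s τ≤)
         in block tt , ≤-trans (≤-reflexive (trans c≡ (+-comm 1 _))) (≤-trans (+-monoˡ-≤ 1 (level≤ u< ≤-refl lv)) tP+1≤B) ,
           (λ h → tt , (τ′≤ , store-mark {arr s′ aMARK} x≡ c≡ h lv snd cov)) ,
           (λ h → τ′≤ , snd , keep-mark {arr s′ aMARK} x≡ c≡ h cov) })
      (λ { {τ} {s′} _ (τ≤ , snd , cov) → size≤ (spanU ≤-refl) τ≤ , snd
         , λ _ _ lv → let a , lo≤ , a< , p , r = complete lv in subst₂ (λ y δ → arr s′ aMARK y ⊴ δ) p r (cov a lo≤ a<) })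
      (≤-refl , (λ y δ p → contradiction (trans (sym (none y)) p) λ ()) , λ a′ lo≤ a′< → ⊥-elim (<⇒≱ a′< lo≤)))
      where
      open Span (spanU ≤-refl)
      at : (f : ℕ → ℕ) → arr s aST (f (val s vt)) ≡ ST (f t)
      at f = trans (cong (λ g → g (f (val s vt))) ST≡) (cong (λ z → ST (f z)) t≡)
      yes-case : ∀ {m c δ} → c ≡ suc δ → ⟦ add ⟧ (⟦ eq ⟧ m 0) (⟦ lt ⟧ c m) ≢ 0 → ∀ {δ′} → m ⊴ δ′ → c ⊴ δ′
      yes-case {δ = δ} refl h = better-yes {n = δ} h
      store-mark : ∀ {M : ℕ → ℕ} {x a c} → x ≡ FV a → c ≡ suc (FD a) → ⟦ add ⟧ (⟦ eq ⟧ (M x) 0) (⟦ lt ⟧ c (M x)) ≢ 0 → Lv u t (FV a) (FD a) →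
        (∀ y δ → M y ≡ suc δ → Lv u t y δ) → (∀ a′ → ST t ≤ a′ → a′ < a → M (FV a′) ⊴ FD a′) →
        (∀ y δ → (M [ x ≔ c ]) y ≡ suc δ → Lv u t y δ) × (∀ a′ → ST t ≤ a′ → a′ < suc a → (M [ x ≔ c ]) (FV a′) ⊴ FD a′)
      store-mark {M} {x} {a} {c} refl c≡ h lv snd cov = snd′ , λ { a′ lo≤ (s≤s a′≤) → cov′ a′ lo≤ a′≤ }
        where
        snd′ : ∀ y δ → (M [ x ≔ c ]) y ≡ suc δ → Lv u t y δ
        snd′ y δ p with y ≟ x
        ... | yes refl = subst (Lv u t y) (suc-injective (trans (sym c≡) (trans (sym (upd-≡ M {y} c refl)) p))) lv
        ... | no ne = snd y δ (trans (sym (upd-≢ M c ne)) p)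
        cov′ : ∀ a′ → ST t ≤ a′ → a′ ≤ a → (M [ x ≔ c ]) (FV a′) ⊴ FD a′
        cov′ a′ lo≤ a′≤ with FV a′ ≟ x | m≤n⇒m<n∨m≡n a′≤
        ... | no ne | inj₁ a′< = subst (_⊴ FD a′) (sym (upd-≢ M c ne)) (cov a′ lo≤ a′<)
        ... | no ne | inj₂ refl = ⊥-elim (ne refl)
        ... | yes p | inj₁ a′< = subst (_⊴ FD a′) (sym (upd-≡ M {x} c p)) (yes-case c≡ h (subst (λ y → M y ⊴ FD a′) p (cov a′ lo≤ a′<)))
        ... | yes p | inj₂ refl = subst (_⊴ FD a′) (sym (upd-≡ M {x} c p)) (FD a , c≡ , ≤-refl)
      keep-mark : ∀ {M : ℕ → ℕ} {x a c} → x ≡ FV a → c ≡ suc (FD a) → ⟦ add ⟧ (⟦ eq ⟧ (M x) 0) (⟦ lt ⟧ c (M x)) ≡ 0 →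
        (∀ a′ → ST t ≤ a′ → a′ < a → M (FV a′) ⊴ FD a′) → ∀ a′ → ST t ≤ a′ → a′ < suc a → M (FV a′) ⊴ FD a′
      keep-mark {M} {x} {a} refl refl h cov a′ lo≤ (s≤s a′≤) with m≤n⇒m<n∨m≡n a′≤
      ... | inj₁ a′< = cov a′ lo≤ a′<
      ... | inj₂ refl = better-no {n = FD a} h

    find-correct : ∀ {s} → Frontiers s → Marked (arr s aMARK) → Sound (val s vout) →
      WP I B find s (λ τ s′ → Frame find s s′ × τ ≤ P ^ t × Sound (val s′ vout) ×
                              (∀ y δ δ′ → Lv u t y δ → Lv v t y δ′ → val s′ vout ⊴ (δ + δ′)))
    find-correct {s} (FV≡ , FD≡ , ST≡ , t≡ , k≡) (msound , mcomplete) snd₀ = wp-frame (block tt , tt , wp-for {y = vhi}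
      (λ b τ s′ → τ + ST (t + 2 + t) ≤ b × Sound (val s′ vout) ×
                  (∀ b′ → ST (t + 2 + t) ≤ b′ → b′ < b → ∀ δ → Lv u t (FV b′) δ → val s′ vout ⊴ (δ + FD b′)))
      refl refl refl (proj₂ (ST≤B ≤-refl)) (at (λ z → z)) (at (_+ 1)) lo≤hi
      (λ { {b} {τ} {s′} lo≤ b< refl fr (τ≤ , snd , cov) →
         let x≡ : arr s′ aFV b ≡ FV b
             x≡ = cong (λ f → f b) (trans (onA fr aFV refl) FV≡)
             d≡ : arr s′ aFD b ≡ FD b
             d≡ = cong (λ f → f b) (trans (onA fr aFD refl) FD≡)
             M≡ : arr s′ aMARK (arr s′ aFV b) ≡ arr s aMARK (FV b)
             M≡ = trans (cong (λ f → f (arr s′ aFV b)) (onA fr aMARK refl)) (cong (arr s aMARK) x≡)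
             τ′≤ = ≤-trans (≤-reflexive (cong (_+ ST (t + 2 + t)) (+-comm τ 1))) (s≤s τ≤)
             lv = sound lo≤ b<
         in block tt ,
           (λ nz → let δ , p = nonzero (λ z → nz (trans M≡ z))
                       lvU = msound _ _ p
                       c≡ = cong₂ _+_ (trans M≡ p) d≡
                   in ≤-trans (≤-reflexive c≡) (two-levels (level≤ u< ≤-refl lvU) (level≤ v< ≤-refl lv)) ,
                      (wp-mono (λ { (refl , snd′ , le , imp) → τ′≤ , snd′ , λ { b′ lo≤′ (s≤s b′≤) δ′ lv′ →
                           more-found cov imp le mcomplete p b′≤ lo≤′ δ′ lv′ } })
                        (improve-correct c≡ (meet lvU lv) snd))) ,
           (λ z → τ′≤ , snd , λ { b′ lo≤′ (s≤s b′≤) δ′ lv′ → none-found cov (trans (sym M≡) z) b′≤ lo≤′ δ′ lv′ }) })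
      (λ { {τ} {s′} _ (τ≤ , snd , cov) → size≤ (spanV ≤-refl) τ≤ , snd
         , λ y δ δ′ lv lv′ → let b , lo≤ , b< , p , r = complete lv′
                                   in subst (λ d → val s′ vout ⊴ (δ + d)) r (cov b lo≤ b< δ (subst (λ z → Lv u t z δ) (sym p) lv)) })
      (≤-refl , snd₀ , λ b′ lo≤ b′< → ⊥-elim (<⇒≱ b′< lo≤)))
      where
      open Span (spanV ≤-refl)
      at : (f : ℕ → ℕ) → arr s aST (f (val s vkk + val s vt)) ≡ ST (f (t + 2 + t))
      at f = trans (cong (λ g → g (f (val s vkk + val s vt))) ST≡) (cong (λ z → ST (f z)) (cong₂ _+_ k≡ t≡))
      nonzero : ∀ {m} → m ≢ 0 → ∃[ δ ] (m ≡ suc δ)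
      nonzero {zero} h = ⊥-elim (h refl)
      nonzero {suc m} h = m , refl
      two-levels : ∀ {a b} → a ≤ t * P → b ≤ t * P → suc (a + b) ≤ B
      two-levels {a} {b} h h′ = ≤-trans (≤-trans (≤-reflexive (+-comm 1 (a + b))) (+-monoˡ-≤ 1 (+-mono-≤ (≤-trans h (m≤m+n _ B₁))
          (≤-trans h′ (≤-trans (m≤m+n _ B₁) (m≤n+m _ B₁)))))) sum≤B
      -- The mark of `FV b` is the shortest length with which that vertex occurs in the last level
      -- of `u`, so the one candidate formed from it is below those with any other length `δ′`.
      more-found : ∀ {b o o′ δ} → (∀ b′ → ST (t + 2 + t) ≤ b′ → b′ < b → ∀ δ → Lv u t (FV b′) δ → o ⊴ (δ + FD b′)) → Improves o o′ →
        o′ ⊴ (δ + FD b) → (∀ y δ → Lv u t y δ → arr s aMARK y ⊴ δ) → arr s aMARK (FV b) ≡ suc δ →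
        ∀ {b′} → b′ ≤ b → ST (t + 2 + t) ≤ b′ → ∀ δ′ → Lv u t (FV b′) δ′ → o′ ⊴ (δ′ + FD b′)
      more-found {b} cov imp (c , o≡ , c≤) mc p {b′} b′≤ lo≤ δ′ lv′ with m≤n⇒m<n∨m≡n b′≤
      ... | inj₁ b′< = imp _ (cov b′ lo≤ b′< δ′ lv′)
      ... | inj₂ refl with mc _ _ lv′
      ...   | δ″ , q , δ″≤ = c , o≡ , ≤-trans c≤ (+-monoˡ-≤ (FD b) (≤-trans (≤-reflexive (suc-injective (trans (sym p) q))) δ″≤))
      none-found : ∀ {b o} → (∀ b′ → ST (t + 2 + t) ≤ b′ → b′ < b → ∀ δ → Lv u t (FV b′) δ → o ⊴ (δ + FD b′)) → arr s aMARK (FV b) ≡ 0 →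
        ∀ {b′} → b′ ≤ b → ST (t + 2 + t) ≤ b′ → ∀ δ′ → Lv u t (FV b′) δ′ → o ⊴ (δ′ + FD b′)
      none-found {b} cov z {b′} b′≤ lo≤ δ′ lv′ with m≤n⇒m<n∨m≡n b′≤
      ... | inj₁ b′< = cov b′ lo≤ b′< δ′ lv′
      ... | inj₂ refl with mcomplete _ _ lv′
      ...   | _ , q , _ = contradiction (trans (sym z) q) λ ()

    Covers : ℕ → ℕ → ℕ → Set
    Covers o a b = ∀ k k′ D → piv (FV a) ≡ suc k → piv (FV b) ≡ suc k′ → Ta (k * L + k′) ≡ suc D →
                   o ⊴ ((FD a + pd (FV a)) + (D + (FD b + pd (FV b))))

    covers-improve : ∀ {o o′ a b} → Improves o o′ → Covers o a b → Covers o′ a b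
    covers-improve imp c k k′ D p p′ q = imp _ (c k k′ D p p′ q)

    Tables : Store → Set
    Tables s = arr s aPIV ≡ piv × arr s aPD ≡ pd × arr s aTBL ≡ Ta × val s vl ≡ L

    pair-correct : ∀ {s i j a b} → Frontiers s → Tables s → suc (i + j) ≡ t → Lv u i (FV a) (FD a) → Lv v j (FV b) (FD b) →
      val s vy ≡ FV a → val s vd ≡ FD a + pd (FV a) → val s vlo′ ≡ b → Sound (val s vout) →
      WP I B pair s (λ τ s′ → τ ≡ 0 × Sound (val s′ vout) × Covers (val s′ vout) a b × Improves (val s vout) (val s′ vout))
    pair-correct {s} {i} {j} {a} {b} (FV≡ , FD≡ , _) (piv≡ , pd≡ , Ta≡ , l≡) ij lvU lvV y≡ d≡ refl snd =
      block tt ,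
        (λ nz → let k , k′ , p , p′ = *-split nz
                    pa = trans (sym a≡) p
                    pb = trans (sym b≡) p′
                    z≡ = trans (cong (λ f → f _) Ta≡) (cong Ta (cong₂ _+_ (cong₂ _*_ (cong (_∸ 1) p) l≡) (cong (_∸ 1) p′)))
          in tt ,
            (λ nz′ → let D , q = nonzero (λ z → nz′ (trans z≡ z))
                         c≡ = trans (cong₂ _+_ d≡ (cong₂ _+_ (trans z≡ q) (cong₂ _+_ fd≡ pd≡′))) (+-suc _ _)
                     in bound {k = k} {k′} c≡ q , (wp-mono
                       (λ { (τ≡ , snd′ , le , imp) → τ≡ , snd′ , (λ k₁ k₁′ D₁ r r′ q₁ → same pa pb q le r r′ q₁) , imp })
                       (improve-correct c≡ (via ij lvU lvV pa pb q) snd))) ,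
            (λ z → refl , snd , (λ k₁ k₁′ D₁ r r′ q₁ → ⊥-elim (absent pa pb (trans (sym z≡) z) r r′ q₁)) , λ _ le → le)) ,
        (λ z → refl , snd , (λ k₁ k₁′ D₁ r r′ q₁ → ⊥-elim (no-pivot z (trans a≡ r) (trans b≡ r′))) , λ _ le → le)
      where
      x = arr s aFV b
      x≡ : x ≡ FV b
      x≡ = cong (λ f → f b) FV≡
      a≡ : arr s aPIV (val s vy) ≡ piv (FV a)
      a≡ = trans (cong (λ f → f (val s vy)) piv≡) (cong piv y≡)
      b≡ : arr s aPIV x ≡ piv (FV b)
      b≡ = trans (cong (λ f → f x) piv≡) (cong piv x≡)
      fd≡ : arr s aFD b ≡ FD b
      fd≡ = cong (λ f → f b) FD≡
      pd≡′ : arr s aPD x ≡ pd (FV b)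
      pd≡′ = trans (cong (λ f → f x) pd≡) (cong pd x≡)
      i≤t : i ≤ t
      i≤t = ≤-trans (≤-trans (m≤m+n i j) (n≤1+n _)) (≤-reflexive ij)
      j≤t : j ≤ t
      j≤t = ≤-trans (≤-trans (m≤n+m j i) (n≤1+n _)) (≤-reflexive ij)
      nonzero : ∀ {m} → m ≢ 0 → ∃[ δ ] (m ≡ suc δ)
      nonzero {zero} h = ⊥-elim (h refl)
      nonzero {suc m} h = m , refl
      bound : ∀ {c k k′ D} → c ≡ suc ((FD a + pd (FV a)) + (D + (FD b + pd (FV b)))) → Ta (k * L + k′) ≡ suc D → c ≤ B
      bound {k = k} {k′} {D} refl q = ≤-trans (≤-reflexive (+-comm 1 _)) (≤-trans (+-monoˡ-≤ 1
        (+-mono-≤ (+-mono-≤ (level≤ u< i≤t lvU) (pd≤ (FV a)))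
          (+-mono-≤ (≤-trans (n≤1+n D) (≤-trans (≤-reflexive (sym q)) (Ta≤ (k * L + k′)))) (+-mono-≤ (level≤ v< j≤t lvV) (pd≤ (FV b)))))) sum≤B)
      same : ∀ {k k′ D o} → piv (FV a) ≡ suc k → piv (FV b) ≡ suc k′ → Ta (k * L + k′) ≡ suc D →
        o ⊴ ((FD a + pd (FV a)) + (D + (FD b + pd (FV b)))) → ∀ {k₁ k₁′ D₁} → piv (FV a) ≡ suc k₁ → piv (FV b) ≡ suc k₁′ → Ta (k₁ * L + k₁′) ≡ suc D₁ →
        o ⊴ ((FD a + pd (FV a)) + (D₁ + (FD b + pd (FV b))))
      same {o = o} pa pb q le r r′ q₁ with suc-injective (trans (sym pa) r) | suc-injective (trans (sym pb) r′)
      ... | refl | refl = subst (λ D → o ⊴ ((FD a + pd (FV a)) + (D + (FD b + pd (FV b))))) (suc-injective (trans (sym q) q₁)) le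
      absent : ∀ {k k′} → piv (FV a) ≡ suc k → piv (FV b) ≡ suc k′ → Ta (k * L + k′) ≡ 0 →
        ∀ {k₁ k₁′ D₁} → piv (FV a) ≡ suc k₁ → piv (FV b) ≡ suc k₁′ → Ta (k₁ * L + k₁′) ≡ suc D₁ → ⊥
      absent pa pb z r r′ q₁ with suc-injective (trans (sym pa) r) | suc-injective (trans (sym pb) r′)
      ... | refl | refl = contradiction (trans (sym z) q₁) λ ()
      no-pivot : ∀ {A A′ k k′} → A * A′ ≡ 0 → A ≡ suc k → A′ ≡ suc k′ → ⊥
      no-pivot z refl refl = contradiction z λ ()

    AllCover : ℕ → ℕ → Set
    AllCover o i = ∀ a → ST i ≤ a → a < ST (i + 1) → ∀ b → ST (t + 2 + (t ∸ suc i)) ≤ b → b < ST (t + 2 + (t ∸ suc i) + 1) → Covers o a b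

    -- `Inner`, `Middle` and `Outer` are the invariants of the loops over the entries at depth `j`,
    -- over those at depth `i`, and over `i`. Relative to the value `o₀` at entry, `better′` carries
    -- over what was covered before the loop.
    record Inner (o₀ a lo b τ o : ℕ) : Set where
      field
        time    : τ + lo ≤ b
        sound   : Sound o
        better′ : Improves o₀ o
        covered : ∀ {b′} → lo ≤ b′ → b′ < b → Covers o a b′

    inner-step : ∀ {o₀ a lo b τ τ′ o o′} → Inner o₀ a lo b τ o → τ′ ≡ 0 → Sound o′ → Covers o′ a b → Improves o o′ →
                 Inner o₀ a lo (suc b) (τ + suc τ′) o′
    inner-step {lo = lo} {b} {τ} {o′ = o′} J refl snd cv imp = record
      { time = ≤-trans (≤-reflexive (cong (_+ lo) (+-comm τ 1))) (s≤s time)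
      ; sound = snd
      ; better′ = λ c le → imp c (better′ c le)
      ; covered = λ { lo≤ (s≤s b′≤) → extend lo≤ b′≤ } }
      where
      open Inner J
      extend : ∀ {b′} → lo ≤ b′ → b′ ≤ b → Covers o′ _ b′
      extend lo≤ b′≤ with m≤n⇒m<n∨m≡n b′≤
      ... | inj₁ b′< = covers-improve imp (covered lo≤ b′<)
      ... | inj₂ refl = cv

    inner-correct : ∀ {s i j a} → Frontiers s → Tables s → suc (i + j) ≡ t → Lv u i (FV a) (FD a) →
      val s vy ≡ FV a → val s vd ≡ FD a + pd (FV a) → val s vlo′ ≡ ST (t + 2 + j) → val s vhi′ ≡ ST (t + 2 + j + 1) →
      Sound (val s vout) →
      WP I B (for vlo′ vhi′ pair) s (λ τ s′ → Inner (val s vout) a (ST (t + 2 + j)) (ST (t + 2 + j + 1)) τ (val s′ vout))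
    inner-correct {s} {i} {j} {a} (FV≡ , FD≡ , ST≡ , t≡ , k≡) (piv≡ , pd≡ , Ta≡ , l≡) ij lvU y≡ d≡ lo≡ hi≡ snd₀ = wp-for {y = vhi′}
      (λ b τ s′ → Inner (val s vout) a (ST (t + 2 + j)) b τ (val s′ vout))
      refl refl refl (proj₂ (ST≤B j≤t)) lo≡ hi≡ (Span.lo≤hi (spanV j≤t))
      (λ { {b} {τ} {s′} lo≤ b< b≡ fr J → wp-mono (λ { (τ≡ , snd , cv , imp) → inner-step J τ≡ snd cv imp })
           (pair-correct
             ( trans (onA fr aFV refl) FV≡ , trans (onA fr aFD refl) FD≡ , trans (onA fr aST refl) ST≡
             , trans (onV fr vt refl) t≡ , trans (onV fr vkk refl) k≡)
             ( trans (onA fr aPIV refl) piv≡ , trans (onA fr aPD refl) pd≡ , trans (onA fr aTBL refl) Ta≡ , trans (onV fr vl refl) l≡)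
             ij lvU (Span.sound (spanV j≤t) lo≤ b<) (trans (onV fr vy refl) y≡) (trans (onV fr vd refl) d≡) b≡ (Inner.sound J)) })
      (λ _ J → J)
      (record { time = ≤-refl ; sound = snd₀ ; better′ = λ _ le → le ; covered = λ lo≤ b< → ⊥-elim (<⇒≱ b< lo≤) })
      where
      j≤t : j ≤ t
      j≤t = ≤-trans (≤-trans (m≤n+m j i) (n≤1+n _)) (≤-reflexive ij)

    record Middle (o₀ i a τ o : ℕ) : Set where
      field
        time    : τ + ST i * (1 + P ^ (t ∸ suc i)) ≤ a * (1 + P ^ (t ∸ suc i))
        sound   : Sound o
        better′ : Improves o₀ o
        covered : ∀ {a′} → ST i ≤ a′ → a′ < a → ∀ b → ST (t + 2 + (t ∸ suc i)) ≤ b → b < ST (t + 2 + (t ∸ suc i) + 1) → Covers o a′ b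

    middle-step : ∀ {o₀ i a τ τ′ o o′} → i < t → Middle o₀ i a τ o →
                  Inner o a (ST (t + 2 + (t ∸ suc i))) (ST (t + 2 + (t ∸ suc i) + 1)) τ′ o′ → Middle o₀ i (suc a) (τ + suc τ′) o′
    middle-step {i = i} {a} {τ} {τ′} {o′ = o′} i< J K = record
      { time = ≤-trans (≤-reflexive (shuffle τ τ′ _)) (+-mono-≤ (s≤s (size≤ (spanV (m∸n≤m t (suc i))) K.time)) J.time)
      ; sound = K.sound
      ; better′ = λ c le → K.better′ c (J.better′ c le)
      ; covered = λ { lo≤ (s≤s a′≤) → extend lo≤ a′≤ } }
      where
      module J = Middle J
      module K = Inner K
      shuffle : ∀ a b c → a + suc b + c ≡ suc b + (a + c)
      shuffle = solve-∀
      extend : ∀ {a′} → ST i ≤ a′ → a′ ≤ a → ∀ b → ST (t + 2 + (t ∸ suc i)) ≤ b → b < ST (t + 2 + (t ∸ suc i) + 1) → Covers o′ a′ b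
      extend lo≤ a′≤ b lo≤′ b< with m≤n⇒m<n∨m≡n a′≤
      ... | inj₁ a′< = covers-improve K.better′ (J.covered lo≤ a′< b lo≤′ b<)
      ... | inj₂ refl = K.covered lo≤′ b<

    scan-pairs : Cmd
    scan-pairs = vy := aFV ! var vlo ▸ vd := aFD ! var vlo ⊕ aPD ! var vy ▸
                 vlev := var vt ⊝ (var vi ⊕ lit 1) ▸
                 vlo′ := aST ! (var vkk ⊕ var vlev) ▸ vhi′ := aST ! (var vkk ⊕ var vlev ⊕ lit 1) ▸
                 for vlo′ vhi′ pair

    scan-pairs-correct : ∀ {s i a} → Frontiers s → Tables s → i < t → val s vi ≡ i → val s vlo ≡ a → Lv u i (FV a) (FD a) → Sound (val s vout) →
      WP I B scan-pairs s (λ τ s′ → Inner (val s vout) a (ST (t + 2 + (t ∸ suc i))) (ST (t + 2 + (t ∸ suc i) + 1)) τ (val s′ vout))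
    scan-pairs-correct {s} {i} {a} fs@(FV≡ , FD≡ , ST≡ , t≡ , k≡) ts@(piv≡ , pd≡ , Ta≡ , l≡) i< i≡ refl lvU snd =
      block tt , ≤-trans (≤-reflexive d≡) (tP+B₁≤B (level≤ u< (<⇒≤ i<) lvU) (pd≤ (FV a))) , tt , tt , tt ,
        inner-correct {i = i} {t ∸ suc i} {a} fs ts (m+[n∸m]≡n i<) lvU y≡ d≡
          (trans (cong (λ f → f (val s vkk + j′)) ST≡) (cong ST index)) (trans (cong (λ f → f (val s vkk + j′ + 1)) ST≡) (cong (λ z → ST (z + 1)) index)) snd
      where
      j′ = val s vt ∸ (val s vi + 1)
      y≡ : arr s aFV a ≡ FV a
      y≡ = cong (λ f → f a) FV≡
      d≡ : arr s aFD a + arr s aPD (arr s aFV a) ≡ FD a + pd (FV a)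
      d≡ = cong₂ _+_ (cong (λ f → f a) FD≡) (trans (cong (λ f → f (arr s aFV a)) pd≡) (cong pd y≡))
      index : val s vkk + j′ ≡ t + 2 + (t ∸ suc i)
      index = cong₂ _+_ k≡ (cong₂ _∸_ t≡ (trans (+-comm (val s vi) 1) (cong suc i≡)))

    middle-correct : ∀ {s i} → Frontiers s → Tables s → i < t → val s vi ≡ i → val s vlo ≡ ST i → val s vhi ≡ ST (i + 1) → Sound (val s vout) →
      WP I B (for vlo vhi scan-pairs) s (λ τ s′ → Middle (val s vout) i (ST (i + 1)) τ (val s′ vout))
    middle-correct {s} {i} (FV≡ , FD≡ , ST≡ , t≡ , k≡) (piv≡ , pd≡ , Ta≡ , l≡) i< i≡ lo≡ hi≡ snd₀ = wp-for {y = vhi}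
      (λ a τ s′ → Middle (val s vout) i a τ (val s′ vout))
      refl refl refl (proj₁ (ST≤B (<⇒≤ i<))) lo≡ hi≡ (Span.lo≤hi (spanU (<⇒≤ i<)))
      (λ { {a} {τ} {s′} lo≤ a< a≡ fr J → wp-mono (middle-step i< J)
           (scan-pairs-correct
             ( trans (onA fr aFV refl) FV≡ , trans (onA fr aFD refl) FD≡ , trans (onA fr aST refl) ST≡
             , trans (onV fr vt refl) t≡ , trans (onV fr vkk refl) k≡)
             ( trans (onA fr aPIV refl) piv≡ , trans (onA fr aPD refl) pd≡ , trans (onA fr aTBL refl) Ta≡ , trans (onV fr vl refl) l≡)
             i< (trans (onV fr vi refl) i≡) a≡ (Span.sound (spanU (<⇒≤ i<)) lo≤ a<) (Middle.sound J)) })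
      (λ _ J → J)
      (record { time = ≤-refl ; sound = snd₀ ; better′ = λ _ le → le ; covered = λ lo≤ a< → ⊥-elim (<⇒≱ a< lo≤) })

    record Outer (o₀ i τ o : ℕ) : Set where
      field
        time    : τ ≤ i * (1 + 2 * P ^ t)
        sound   : Sound o
        better′ : Improves o₀ o
        covered : ∀ {i′} → i′ < i → AllCover o i′

    outer-step : ∀ {o₀ i τ τ′ o o′} → i < t → Outer o₀ i τ o → Middle o i (ST (i + 1)) τ′ o′ → Outer o₀ (suc i) (τ + suc τ′) o′
    outer-step {i = i} {τ} {τ′} {o′ = o′} i< J K = record
      { time = ≤-trans (≤-reflexive (+-suc τ τ′)) (≤-trans (s≤s (+-mono-≤ J.time τ′≤)) (≤-reflexive (cong suc (+-comm (i * (1 + 2 * P ^ t)) _))))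
      ; sound = K.sound
      ; better′ = λ c le → K.better′ c (J.better′ c le)
      ; covered = λ { (s≤s i′≤) → extend i′≤ } }
      where
      module J = Outer J
      module K = Middle K
      j = t ∸ suc i
      -- Here `P ^ i * (1 + P ^ j)` is `P ^ i + P ^ (i + j)`, and `i + j` is `t ∸ 1`: complementary
      -- depths keep the pairs within the budget of a last level.
      τ′≤ : τ′ ≤ 2 * P ^ t
      τ′≤ = ≤-trans (+-cancelʳ-≤ (ST i * (1 + P ^ j)) τ′ (P ^ i * (1 + P ^ j)) (≤-trans K.time (≤-trans (*-monoˡ-≤ (1 + P ^ j) (Span.size (spanU (<⇒≤ i<))))
              (≤-reflexive (trans (*-distribʳ-+ (1 + P ^ j) (ST i) (P ^ i)) (+-comm _ (P ^ i * (1 + P ^ j))))))))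
            (≤-trans (≤-reflexive (trans (*-distribˡ-+ (P ^ i) 1 (P ^ j)) (cong₂ _+_ (*-identityʳ _) (sym (^-distribˡ-+-* P i j)))))
              (+-mono-≤ (P^≤ (<⇒≤ i<)) (≤-trans (P^≤ (≤-trans (n≤1+n _) (≤-reflexive (m+[n∸m]≡n i<)))) (≤-reflexive (sym (+-identityʳ _))))))
      extend : ∀ {i′} → i′ ≤ i → AllCover o′ i′
      extend i′≤ with m≤n⇒m<n∨m≡n i′≤
      ... | inj₁ i′< = λ a lo≤ a< b lo≤′ b< → covers-improve K.better′ (J.covered i′< a lo≤ a< b lo≤′ b<)
      ... | inj₂ refl = λ a lo≤ a< b lo≤′ b< → K.covered lo≤ a< b lo≤′ b<

    pairs-correct : ∀ {s} → Frontiers s → Tables s → Sound (val s vout) →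
      WP I B pairs s (λ τ s′ → Outer (val s vout) t τ (val s′ vout))
    pairs-correct {s} (FV≡ , FD≡ , ST≡ , t≡ , k≡) (piv≡ , pd≡ , Ta≡ , l≡) snd₀ = block z≤n , wp-for {y = vt}
      (λ i τ s′ → Outer (val s vout) i τ (val s′ vout))
      refl refl refl t≤B refl t≡ z≤n
      (λ { {i} {τ} {s′} _ i< refl fr J → let ST≡′ = trans (onA fr aST refl) ST≡ in
        block tt , tt , wp-mono (outer-step i< J)
          (middle-correct
             ( trans (onA fr aFV refl) FV≡ , trans (onA fr aFD refl) FD≡ , ST≡′
             , trans (onV fr vt refl) t≡ , trans (onV fr vkk refl) k≡)
             ( trans (onA fr aPIV refl) piv≡ , trans (onA fr aPD refl) pd≡ , trans (onA fr aTBL refl) Ta≡ , trans (onV fr vl refl) l≡)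
             i< refl (cong (λ f → f i) ST≡′) (cong (λ f → f (i + 1)) ST≡′) (Outer.sound J)) })
      (λ _ J → J)
      (record { time = z≤n ; sound = snd₀ ; better′ = λ _ le → le ; covered = λ () })

  record Loaded (s : Store) : Set where
    field
      Q≡   : arr s aQ ≡ Qa
      D≡   : arr s aD ≡ Da
      LN≡  : arr s aLN ≡ ln
      PIV≡ : arr s aPIV ≡ piv
      PD≡  : arr s aPD ≡ pd
      TBL≡ : arr s aTBL ≡ Ta

  record Optimal (u v o : ℕ) : Set where
    field
      sound    : ∀ {c} → o ≡ suc c → Cand u v c
      complete : ∀ {c} → Cand u v c → o ⊴ c

  module _ {u v : ℕ} (u< : u < nv) (v< : v < nv) where
    via-covered : ∀ {FV FD ST : ℕ → ℕ} {o : ℕ} → (∀ {k} → k ≤ t → Span u k FV FD (ST k) (ST (k + 1))) →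
      (spanV : ∀ {k} → k ≤ t → Span v k FV FD (ST (t + 2 + k)) (ST (t + 2 + k + 1))) →
      (∀ {i} → i < t → ∀ a → ST i ≤ a → a < ST (i + 1) → ∀ b → ST (t + 2 + (t ∸ suc i)) ≤ b → b < ST (t + 2 + (t ∸ suc i) + 1) →
        ∀ k k′ D → piv (FV a) ≡ suc k → piv (FV b) ≡ suc k′ → Ta (k * L + k′) ≡ suc D → o ⊴ ((FD a + pd (FV a)) + (D + (FD b + pd (FV b))))) →
      ∀ {i j w x δ δ′ k k′ D} → suc (i + j) ≡ t → Lv u i w δ → Lv v j x δ′ → piv w ≡ suc k → piv x ≡ suc k′ → Ta (k * L + k′) ≡ suc D →
      o ⊴ ((δ + pd w) + (D + (δ′ + pd x)))
    via-covered {FV} {FD} {ST} spanU spanV cov {i} {j} ij lv lv′ pw px tk with Span.complete (spanU i≤t) lv | Span.complete (spanV j≤t) lv″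
      where
      i<t : i < t
      i<t = ≤-trans (s≤s (m≤m+n i j)) (≤-reflexive ij)
      i≤t = <⇒≤ i<t
      j≡ : j ≡ t ∸ suc i
      j≡ = trans (sym (m+n∸m≡n (suc i) j)) (cong (_∸ suc i) ij)
      j≤t : t ∸ suc i ≤ t
      j≤t = m∸n≤m t (suc i)
      lv″ = subst (λ k → Lv v k _ _) j≡ lv′
    ... | a , lo≤ , a< , refl , refl | b , lo≤′ , b< , refl , refl =
      cov (≤-trans (s≤s (m≤m+n i j)) (≤-reflexive ij)) a lo≤ a< b lo≤′ b< _ _ _ pw px tk

    search-correct : ∀ {s} → Loaded s → val s vP ≡ P → val s vl ≡ L → arr s aROW (val s va) ≡ suc u → arr s aROW (val s vb) ≡ suc v →
      val s vtail ≡ 0 → val s vout ≡ 0 → (∀ y → arr s aMARK y ≡ 0) →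
      WP I B (search t) s (λ τ s′ → τ ≤ query-time P t × Optimal u v (val s′ vout))
    search-correct {s} ld P≡ l≡ a≡ b≡ tail≡ out≡ mark≡ =
      block_ {C = search t} {s = s} {Q = λ τ s′ → τ ≤ query-time P t × Optimal u v (val s′ vout)} (t≤B , tt , z≤n , wp-seq (wp-mono (λ { {τ₁} {s₁} (fr₁ , L₁) →
        block tt , t+2≤B , wp-seq (wp-mono (λ { {τ₂} {s₂} (fr₂ , L₂) → after fr₁ L₁ fr₂ L₂ })
          (explore-correct v<
            ( trans (onA fr₁ aQ refl) Q≡ , trans (onA fr₁ aD refl) D≡ , trans (onA fr₁ aLN refl) LN≡ , trans (onV fr₁ vP refl) P≡ , onV fr₁ vt refl)
            (cong (_∸ 1) (trans (cong₂ (λ f x → f x) (onA fr₁ aROW refl) (onV fr₁ vb refl)) b≡)) refl refl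
            P≤B tP≤B (≤-trans (+-monoˡ-≤ _ (Levels.tail≤ L₁)) ∑≤B) t≤B)) })
        (explore-correct u< (Q≡ , D≡ , LN≡ , P≡ , refl) (cong (_∸ 1) a≡) refl tail≡ P≤B tP≤B (≤-trans (m≤m+n _ _) ∑≤B) t≤B)))
      where
      open Loaded ld
      s₀ : Store
      s₀ = setV (setV (setV s vt t) vroot (arr s aROW (val s va) ∸ 1)) vkk 0
      module _ {τ₁ s₁} (fr₁ : Frame explore s₀ s₁) (L₁ : Levels u 0 0 t τ₁ s₀ s₁) where
        s₁′ : Store
        s₁′ = setV (setV s₁ vroot (arr s₁ aROW (val s₁ vb) ∸ 1)) vkk (t + 2)
        module _ {τ₂ s₂} (fr₂ : Frame explore s₁′ s₂) (L₂ : Levels v (t + 2) (val s₁ vtail) t τ₂ s₁′ s₂) where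
          module L₁ = Levels L₁
          module L₂ = Levels L₂

          early : ∀ {k} → k ≤ t → k + 1 < t + 2
          early {k} k≤ = ≤-trans (≤-reflexive (trans (+-comm 1 (k + 1)) (+-assoc k 1 1))) (+-monoˡ-≤ 2 k≤)

          ST-end : ∀ {k} → k ≤ t → arr s₂ aST (k + 1) ≡ arr s₁ aST (k + 1)
          ST-end k≤ = L₂.keepS _ (early k≤)

          spanU : ∀ {k} → k ≤ t → Span u k (arr s₂ aFV) (arr s₂ aFD) (arr s₂ aST k) (arr s₂ aST (k + 1))
          spanU {k} k≤ = subst₂ (Span u k _ _) (sym (L₂.keepS k (≤-trans (s≤s (m≤m+n k 1)) (early k≤)))) (sym (ST-end k≤))
            (span-agree (λ b b< → L₂.keepV b (<-≤-trans b< (L₁.ends k≤))) (λ b b< → L₂.keepD b (<-≤-trans b< (L₁.ends k≤))) (L₁.spans k≤))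

          ST≤B : ∀ {k} → k ≤ t → arr s₂ aST (k + 1) ≤ B × arr s₂ aST (t + 2 + k + 1) ≤ B
          ST≤B k≤ = ≤-trans (≤-reflexive (ST-end k≤)) (≤-trans (L₁.ends k≤) (≤-trans L₂.T₀≤ tail₂)) , ≤-trans (L₂.ends k≤) tail₂
            where tail₂ : val s₂ vtail ≤ B
                  tail₂ = ≤-trans L₂.tail≤ (≤-trans (+-monoˡ-≤ _ L₁.tail≤) ∑≤B)

          explored : Explored
          explored = record { u< = u< ; v< = v< ; FV = arr s₂ aFV ; FD = arr s₂ aFD ; ST = arr s₂ aST ; spanU = spanU ; spanV = L₂.spans ; ST≤B = ST≤B }

          after : WP I B (mark ▸ find ▸ pairs) s₂ (λ τ s′ → τ₁ + (τ₂ + τ) ≤ query-time P t × Optimal u v (val s′ vout))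
          after = wp-seq (wp-mono (λ { {τ₃} {s₃} (fr₃ , t₃ , marked) → wp-seq (wp-mono (λ { {τ₄} {s₄} (fr₄ , t₄ , snd₄ , meets) → wp-mono
              (λ {τ₅} {s₅} out →
                   +-mono-≤ L₁.time (+-mono-≤ L₂.time (+-mono-≤ t₃ (+-mono-≤ t₄ (Search.Outer.time out))))
                 , record { sound = λ {c} → Search.Outer.sound out c
                          ; complete = λ { (meet lv lv′) → Search.Outer.better′ out _ (meets _ _ _ lv lv′)
                                         ; (via ij lv lv′ pw px tk) → via-covered {ST = arr s₂ aST} spanU L₂.spans (Search.Outer.covered out) ij lv lv′ pw px tk } })
              (Search.pairs-correct explored (front fr₃ fr₄)
                ( trans (onA fr₄ aPIV refl) (trans (onA fr₃ aPIV refl) (trans (onA fr₂ aPIV refl) (trans (onA fr₁ aPIV refl) PIV≡)))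
                , trans (onA fr₄ aPD refl) (trans (onA fr₃ aPD refl) (trans (onA fr₂ aPD refl) (trans (onA fr₁ aPD refl) PD≡)))
                , trans (onA fr₄ aTBL refl) (trans (onA fr₃ aTBL refl) (trans (onA fr₂ aTBL refl) (trans (onA fr₁ aTBL refl) TBL≡)))
                , trans (onV fr₄ vl refl) (trans (onV fr₃ vl refl) (trans (onV fr₂ vl refl) (trans (onV fr₁ vl refl) l≡)))) snd₄) })
            (Search.find-correct explored (front₃ fr₃) marked
              (λ c p → contradiction (trans (sym (trans (onV fr₃ vout refl) (trans (onV fr₂ vout refl) (trans (onV fr₁ vout refl) out≡)))) p) λ ()))) })
            (Search.mark-correct explored (refl , refl , refl , vt≡ , onV fr₂ vkk refl)
              (λ y → trans (cong (λ f → f y) (trans (onA fr₂ aMARK refl) (onA fr₁ aMARK refl))) (mark≡ y))))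
            where
            vt≡ : val s₂ vt ≡ t
            vt≡ = trans (onV fr₂ vt refl) (onV fr₁ vt refl)
            front₃ : ∀ {s₃} → Frame mark s₂ s₃ → arr s₃ aFV ≡ arr s₂ aFV × arr s₃ aFD ≡ arr s₂ aFD × arr s₃ aST ≡ arr s₂ aST × val s₃ vt ≡ t × val s₃ vkk ≡ t + 2
            front₃ fr₃ = onA fr₃ aFV refl , onA fr₃ aFD refl , onA fr₃ aST refl , trans (onV fr₃ vt refl) vt≡ , trans (onV fr₃ vkk refl) (onV fr₂ vkk refl)
            front : ∀ {s₃ s₄} → Frame mark s₂ s₃ → Frame find s₃ s₄ → arr s₄ aFV ≡ arr s₂ aFV × arr s₄ aFD ≡ arr s₂ aFD × arr s₄ aST ≡ arr s₂ aST × val s₄ vt ≡ t × val s₄ vkk ≡ t + 2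
            front fr₃ fr₄ = let a , b , c , d , e = front₃ fr₃ in
              trans (onA fr₄ aFV refl) a , trans (onA fr₄ aFD refl) b , trans (onA fr₄ aST refl) c , trans (onV fr₄ vt refl) d , trans (onV fr₄ vkk refl) e

  data Answer (row : ℕ → ℕ) (U V o : ℕ) : Set where
    same     : U ≡ V → o ≡ 1 → Answer row U V o
    isolated : U ≢ V → row U * row V ≡ 0 → o ≡ 0 → Answer row U V o
    estimate : ∀ {u v} → row U ≡ suc u → row V ≡ suc v → Optimal u v o → Answer row U V o

  querying-correct : ∀ {s} → Loaded s → (row : ℕ → ℕ) → arr s aROW ≡ row → (∀ {U x} → row U ≡ suc x → x < nv) →
    arr s aSC 0 ≡ P → arr s aSC 1 ≡ L → val s vtail ≡ 0 → val s vout ≡ 0 → (∀ y → arr s aMARK y ≡ 0) → 1 ≤ B →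
    WP I B (querying t) s (λ τ s′ → τ ≤ query-time P t × Answer row (I 0) (I 1) (val s′ vout))
  querying-correct {s} ld row refl row< P≡ l≡ tail≡ out≡ mark≡ 1≤B =
    block_ {C = querying t} {s = s} {Q = Post} (tt , tt , tt , tt , wp-seq
      (block_ {C = cond (bin eq (var va) (var vb)) (vout := lit 1)} {s = s₁} {Q = λ τ s′ → WP I B final s′ (λ τ′ → Post (τ + τ′))}
        ((λ eq? → 1≤B , equal eq?) , distinct)))
    where
    Post : ℕ → Store → Set
    Post τ s′ = τ ≤ query-time P t × Answer row (I 0) (I 1) (val s′ vout)
    s₁ : Store
    s₁ = setV (setV (setV (setV s vP (arr s aSC 0)) vl (arr s aSC 1)) va (I 0)) vb (I 1)
    final : Cmd
    final = cond (bin eq (bin eq (var va) (var vb)) (lit 0)) (cond (aROW ! var va ⊗ aROW ! var vb) (call (search t)))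
    equal : ⟦ eq ⟧ (I 0) (I 1) ≢ 0 → WP I B final (setV s₁ vout 1) Post
    equal eq? = block_ {C = final} {s = setV s₁ vout 1} {Q = Post}
      ((λ ne → ⊥-elim (≡?-zero {I 0} {I 1} (≡?-nonzero ne) (≡?-nonzero eq?))) , (λ _ → z≤n , same (≡?-nonzero eq?) refl))
    distinct : ⟦ eq ⟧ (I 0) (I 1) ≡ 0 → WP I B final s₁ Post
    distinct ne? = block_ {C = final} {s = s₁} {Q = Post} ((λ _ → joined , unreachable) , λ z → ⊥-elim (≡?-zero {⟦ eq ⟧ (I 0) (I 1)} {0} z ne?))
      where
      joined : row (I 0) * row (I 1) ≢ 0 → WP I B (search t) s₁ Post
      joined nz = let u , v , a , b = *-split nz in
        wp-mono (λ { (τ≤ , opt) → τ≤ , estimate a b opt }) (search-correct (row< a) (row< b) loaded P≡ l≡ a b tail≡ out≡ mark≡)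
        where loaded : Loaded s₁
              loaded = record { Loaded ld }
      unreachable : row (I 0) * row (I 1) ≡ 0 → Post 0 s₁
      unreachable z = z≤n , isolated (≡?-zero ne?) z out≡

-- Graphs as inputs

-- Swaps `2 k` and `2 k + 1`, the two ends of an edge. This recursive form follows the list of
-- edges, whereas `other` is what the program computes.
partner : ℕ → ℕ
partner zero          = 1
partner (suc zero)    = 0
partner (suc (suc e)) = suc (suc (partner e))

partner-involutive : ∀ e → partner (partner e) ≡ e
partner-involutive zero          = refl
partner-involutive (suc zero)    = refl
partner-involutive (suc (suc e)) = cong (λ z → suc (suc z)) (partner-involutive e)

partner-< : ∀ {e} k → e < k * 2 → partner e < k * 2
partner-< {zero}        (suc k) _ = s≤s (s≤s z≤n)
partner-< {suc zero}    (suc k) _ = s≤s z≤n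
partner-< {suc (suc e)} (suc k) (s≤s (s≤s e<)) = s≤s (s≤s (partner-< k e<))

partner-even : ∀ k → partner (k * 2) ≡ suc (k * 2)
partner-even zero    = refl
partner-even (suc k) = cong (λ z → suc (suc z)) (partner-even k)

other-partner : ∀ e → other e ≡ partner e + 3
other-partner zero          = refl
other-partner (suc zero)    = refl
other-partner (suc (suc e)) = trans (cong (λ r → suc (suc e) + 4 ∸ r * 2) (trans (cong (_% 2) (+-comm 2 e)) ([m+n]%n≡m%n e 2)))
    (trans (+-∸-assoc 2 {e + 4} (small e)) (cong (2 +_) (other-partner e)))
  where small : ∀ e → e % 2 * 2 ≤ e + 4
        small e = ≤-trans (*-monoˡ-≤ 2 (≤-pred′ (m%n<n′ e))) (≤-trans (s≤s (s≤s z≤n)) (m≤n+m 4 e))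
          where m%n<n′ : ∀ e → e % 2 < 2
                m%n<n′ e = Data.Nat.DivMod.m%n<n e 2
                ≤-pred′ : ∀ {a} → a < 2 → a ≤ 1
                ≤-pred′ = suc[m]≤n⇒m≤pred[n]

endpoints : ∀ {n} → List (Fin n × Fin n) → List ℕ
endpoints = concatMap (λ (u , v) → toℕ u ∷ toℕ v ∷ [])

module _ {n : ℕ} where

  ends : List (Fin n × Fin n) → ℕ → ℕ
  ends es = cells (endpoints es)

  Joined : List (Fin n × Fin n) → Fin n → Fin n → Set
  Joined es u v = (u , v) ∈ es ⊎ (v , u) ∈ es

  arc-edge : ∀ es {e} → e < length es * 2 → ∃[ u ] ∃[ v ] (Joined es u v × toℕ u ≡ ends es e × toℕ v ≡ ends es (partner e))
  arc-edge ((u , v) ∷ es) {zero}        _ = u , v , inj₁ (here refl) , refl , refl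
  arc-edge ((u , v) ∷ es) {suc zero}    _ = v , u , inj₂ (here refl) , refl , refl
  arc-edge (_ ∷ es)       {suc (suc e)} (s≤s (s≤s e<)) with arc-edge es e<
  ... | u , v , inj₁ m , p , q = u , v , inj₁ (there m) , p , q
  ... | u , v , inj₂ m , p , q = u , v , inj₂ (there m) , p , q

  edge-arc : ∀ {es u v} → (u , v) ∈ es → ∃[ e ] (e < length es * 2 × ends es e ≡ toℕ u × ends es (partner e) ≡ toℕ v)
  edge-arc (here refl) = 0 , s≤s z≤n , refl , refl
  edge-arc (there m)   = let e , e< , p , q = edge-arc m in suc (suc e) , s≤s (s≤s e<) , p , q

  joined-arc : ∀ {es u v} → Joined es u v → ∃[ e ] (e < length es * 2 × ends es e ≡ toℕ u × ends es (partner e) ≡ toℕ v)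
  joined-arc (inj₁ m) = edge-arc m
  joined-arc {es} (inj₂ m) = let e , e< , p , q = edge-arc m
                             in partner e , partner-< (length es) e< , q , trans (cong (ends es) (partner-involutive e)) p

  Ordered : List (Fin n × Fin n) → Set
  Ordered = All (λ (u , v) → toℕ u < toℕ v)

  -- A repeated arc would come from a second copy of an edge, excluded by uniqueness, or from its
  -- reversal, excluded because pairs are listed in increasing order.
  ends-simple : ∀ es → Ordered es → Unique es → ∀ {e e′} → e < length es * 2 → e′ < length es * 2 →
                ends es e ≡ ends es e′ → ends es (partner e) ≡ ends es (partner e′) → e ≡ e′
  ends-simple ((u , v) ∷ es) (u<v ∷ os) (new ∷ us) = go
    where
    absent : ∀ {e} → e < length es * 2 → ∀ {a b} → (a ≡ u × b ≡ v) ⊎ (a ≡ v × b ≡ u) →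
             toℕ a ≡ ends es e → toℕ b ≡ ends es (partner e) → ⊥
    absent e< which p q with arc-edge es e<
    ... | u′ , v′ , m , p′ , q′ with toℕ-injective (trans p (sym p′)) | toℕ-injective (trans q (sym q′))
    absent e< (inj₁ (refl , refl)) p q | _ , _ , inj₁ m , _ | refl | refl = All.lookup new m refl
    absent e< (inj₁ (refl , refl)) p q | _ , _ , inj₂ m , _ | refl | refl = <-asym u<v (All.lookup os m)
    absent e< (inj₂ (refl , refl)) p q | _ , _ , inj₁ m , _ | refl | refl = <-asym u<v (All.lookup os m)
    absent e< (inj₂ (refl , refl)) p q | _ , _ , inj₂ m , _ | refl | refl = All.lookup new m refl
    go : ∀ {e e′} → e < suc (suc (length es * 2)) → e′ < suc (suc (length es * 2)) →
         ends ((u , v) ∷ es) e ≡ ends ((u , v) ∷ es) e′ → ends ((u , v) ∷ es) (partner e) ≡ ends ((u , v) ∷ es) (partner e′) → e ≡ e′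
    go {zero}        {zero}         _ _ _ _ = refl
    go {suc zero}    {suc zero}     _ _ _ _ = refl
    go {zero}        {suc zero}     _ _ p _ = ⊥-elim (<-irrefl p u<v)
    go {suc zero}    {zero}         _ _ p _ = ⊥-elim (<-irrefl (sym p) u<v)
    go {zero}        {suc (suc e′)} _ (s≤s (s≤s e′<)) p q = ⊥-elim (absent e′< (inj₁ (refl , refl)) p q)
    go {suc zero}    {suc (suc e′)} _ (s≤s (s≤s e′<)) p q = ⊥-elim (absent e′< (inj₂ (refl , refl)) p q)
    go {suc (suc e)} {zero}         (s≤s (s≤s e<)) _ p q = ⊥-elim (absent e< (inj₁ (refl , refl)) (sym p) (sym q))
    go {suc (suc e)} {suc zero}     (s≤s (s≤s e<)) _ p q = ⊥-elim (absent e< (inj₂ (refl , refl)) (sym p) (sym q))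
    go {suc (suc e)} {suc (suc e′)} (s≤s (s≤s e<)) (s≤s (s≤s e′<)) p q =
      cong (λ z → suc (suc z)) (ends-simple es os us e< e′< p q)

module Encoding (G : Graph) (p : ℕ) where
  open Graph G

  inputs : List ℕ
  inputs = n ∷ m ∷ p ∷ endpoints edges

  I : ℕ → ℕ
  I = cells inputs

  I-end : ∀ e → I (e + 3) ≡ ends edges e
  I-end e = cong I (+-comm e 3)

  I-other : ∀ e → I (other e) ≡ ends edges (partner e)
  I-other e = trans (cong I (other-partner e)) (I-end (partner e))

  end< : ∀ {e} → e < m * 2 → ends edges e < n
  end< e< = let u , _ , _ , q , _ = arc-edge edges e< in subst (_< n) q (toℕ<n u)

  encoding : Input I n m p
  encoding = record
    { cell-0 = refl ; cell-1 = refl ; cell-2 = refl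
    ; endpoint = λ {e} e< → subst (_< n) (sym (I-end e)) (end< e<)
    ; opposite = λ {e} e< → partner e , partner-< m e< , trans (I-end (partner e)) (sym (I-other e))
        , trans (I-other (partner e)) (trans (cong (ends edges) (partner-involutive e)) (sym (I-end e)))
    ; simple = λ {e} {e′} e< e′< q r → ends-simple edges ordered unique e< e′<
        (trans (sym (I-end e)) (trans q (I-end e′))) (trans (sym (I-other e)) (trans r (I-other e′))) }

  -- An edge is determined by its two ends, coded as one number below `n * n`. The bound makes `m`
  -- fit into a word.
  m≤n² : m ≤ n * n
  m≤n² = rel-pigeonhole (λ k i → i ≡ code k)
    (λ k k< → code k , code< k< , refl)
    (λ {k} {k′} k< k′< q q′ → let a , b = index-inj {n} {ends edges (k * 2)} {ends edges (k′ * 2)} (end< (odd k<)) (end< (odd k′<)) (trans (sym q) q′)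
      in *-cancelʳ-≡ k k′ 2 (ends-simple edges ordered unique (even k<) (even k′<) a
           (trans (cong (ends edges) (partner-even k)) (trans b (cong (ends edges) (sym (partner-even k′)))))))
    where
    code : ℕ → ℕ
    code k = ends edges (k * 2) * n + ends edges (suc (k * 2))
    odd : ∀ {k} → k < m → suc (k * 2) < m * 2
    odd k< = *-monoˡ-≤ 2 k<
    even : ∀ {k} → k < m → k * 2 < m * 2
    even k< = ≤-trans (n≤1+n _) (odd k<)
    code< : ∀ {k} → k < m → code k < n * n
    code< {k} k< = ≤-trans (≤-trans (≤-reflexive (sym (+-suc _ _))) (+-monoʳ-≤ (ends edges (k * 2) * n) (end< (odd k<))))
      (≤-trans (≤-reflexive (+-comm _ n)) (*-monoˡ-≤ n (end< (even k<))))

  I≤ : ∀ {B} → n ≤ B → m ≤ B → p ≤ B → ∀ i → I i ≤ B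
  I≤ n≤ m≤ p≤ zero                = n≤
  I≤ n≤ m≤ p≤ (suc zero)          = m≤
  I≤ n≤ m≤ p≤ (suc (suc zero))    = p≤
  I≤ {B} n≤ m≤ p≤ (suc (suc (suc e))) = go edges e
    where go : ∀ es e → ends es e ≤ B
          go [] e = z≤n
          go ((u , v) ∷ es) zero = ≤-trans (<⇒≤ (toℕ<n u)) n≤
          go ((u , v) ∷ es) (suc zero) = ≤-trans (<⇒≤ (toℕ<n v)) n≤
          go (_ ∷ es) (suc (suc e)) = go es e

  _∷ʷ_ : ∀ {u w v l} → Walk u w l → Adjacent w v → Walk u v (suc l)
  here ∷ʷ a = step a here
  step b w ∷ʷ a = step b (w ∷ʷ a)

  module Translate {nv : ℕ} {row : ℕ → ℕ} (N : Numbering I nv (m * 2) row) where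
    open Numbering N

    E : ℕ → ℕ → Set
    E = ArcOf I row (m * 2)

    adjacent-arc : ∀ {u w} → Adjacent u w → ∃[ x ] ∃[ y ] (row (toℕ u) ≡ suc x × row (toℕ w) ≡ suc y × E x y)
    adjacent-arc {u} {w} a with joined-arc a
    ... | e , e< , q , r = x , y , ru , rw
            , e , e< , cong (_∸ 1) (trans (cong row (trans (I-end e) q)) ru) , cong (_∸ 1) (trans (cong row (trans (I-other e) r)) rw)
      where
      X = numbered e<
      Y = numbered (partner-< m e<)
      x = proj₁ X
      y = proj₁ Y
      ru : row (toℕ u) ≡ suc x
      ru = trans (cong row (sym (trans (I-end e) q))) (proj₂ (proj₂ X))
      rw : row (toℕ w) ≡ suc y
      rw = trans (cong row (sym (trans (I-end (partner e)) r))) (proj₂ (proj₂ Y))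

    walk-path : ∀ {u v l x} → Walk u v l → row (toℕ u) ≡ suc x → ∃[ y ] (row (toℕ v) ≡ suc y × Path E x y l)
    walk-path here r = _ , r , stay
    walk-path (step a w) r with adjacent-arc a
    ... | x′ , y , ru , rw , e with suc-injective (trans (sym ru) r) | walk-path w rw
    ...   | refl | z , rv , path = z , rv , (stay ∷ʳ e) ++ᵖ path

    path-walk : ∀ {u v x y l} → Path E x y l → row (toℕ u) ≡ suc x → row (toℕ v) ≡ suc y → Walk u v l
    path-walk {u} stay ru rv = subst (λ v → Walk u v 0) (toℕ-injective (row-inj ru rv)) here
    path-walk {u} {v} (path ∷ʳ (e , e< , refl , refl)) ru rv with arc-edge edges e<
    ... | a , b , join , q , r = subst (λ v → Walk u v _) b≡v (path-walk path ru ra ∷ʷ join)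
      where
      X = numbered e<
      Y = numbered (partner-< m e<)
      ra : row (toℕ a) ≡ suc (row (I (e + 3)) ∸ 1)
      ra = trans (cong row (trans q (sym (I-end e)))) (trans (proj₂ (proj₂ X)) (cong (λ z → suc (z ∸ 1)) (sym (proj₂ (proj₂ X)))))
      rb : row (toℕ b) ≡ suc (row (I (other e)) ∸ 1)
      rb = trans (cong row (trans r (sym (I-other e)))) (back (trans (cong row (trans (I-other e) (sym (I-end (partner e))))) (proj₂ (proj₂ Y))))
        where back : ∀ {r y} → r ≡ suc y → r ≡ suc (r ∸ 1)
              back refl = refl
      b≡v : b ≡ v
      b≡v = toℕ-injective (row-inj rb rv)

    -- A walk between different vertices uses an edge at each of its ends, so neither end is
    -- isolated.
    connected-numbered : ∀ {u v l} → toℕ u ≢ toℕ v → Walk u v l → row (toℕ u) * row (toℕ v) ≢ 0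
    connected-numbered u≢v here = ⊥-elim (u≢v refl)
    connected-numbered u≢v w@(step a _) z with adjacent-arc a
    ... | x , _ , ru , _ with walk-path w ru
    ...   | y , rv , _ = contradiction (trans (sym (cong₂ _*_ ru rv)) z) λ ()

  adjacent? : ∀ u v → Dec (Adjacent u v)
  adjacent? u v = ((u , v) ∈? edges) ⊎-dec ((v , u) ∈? edges)
    where open DecMembership (≡-dec Finₚ._≟_ Finₚ._≟_) using (_∈?_)

  walk? : ∀ l u v → Dec (Walk u v l)
  walk? zero u v = map′ (λ { refl → here }) (λ { here → refl }) (u Finₚ.≟ v)
  walk? (suc l) u v = map′ (λ { (_ , a , w) → step a w }) (λ { (step a w) → _ , a , w })
    (any? (λ w → adjacent? u w ×-dec walk? l w v))

  least : ∀ {P : ℕ → Set} → (∀ i → Dec (P i)) → ∀ k → (∃[ d ] (P d × (∀ {i} → P i → d ≤ i))) ⊎ (∀ i → i < k → ¬ P i)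
  least P? zero = inj₂ (λ _ ())
  least P? (suc k) with least P? k
  ... | inj₁ found = inj₁ found
  ... | inj₂ none with P? k
  ...   | yes q = inj₁ (k , q , λ {i} r → ≮⇒≥ (λ i<k → none i i<k r))
  ...   | no ¬q = inj₂ (λ i i<1+k r → case i i<1+k r)
    where case : ∀ i → i < suc k → _ → ⊥
          case i (s≤s i≤k) r with m≤n⇒m<n∨m≡n i≤k
          ... | inj₁ i<k = none i i<k r
          ... | inj₂ refl = ¬q r

  -- `Estimates` refers to the exact distance, which has to be produced: walks of a given length are
  -- decidable, and the length of any walk bounds the search.
  distance : ∀ {u v l} → Walk u v l → ∃[ d ] IsDistance u v d
  distance {u} {v} {l} w with least (λ l → walk? l u v) (suc l)
  ... | inj₁ (d , q , min) = d , q , λ r → min r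
  ... | inj₂ none = ⊥-elim (none l ≤-refl w)

-- Real exponents

open import Data.Integer using (+_)

-- Here and below, fractions are handled by passing to unnormalised ones, where equality and order
-- are cross-multiplication.
frac-≡ : ∀ {a b c d} .{{_ : NonZero b}} .{{_ : NonZero d}} → a * d ≡ c * b → + a ℚ./ b ≡ + c ℚ./ d
frac-≡ {a} {suc b} {c} {suc d} p = ℚₚ.fromℚᵘ-cong {ℚᵘ.mkℚᵘ (+ a) b} {ℚᵘ.mkℚᵘ (+ c) d}
  (ℚᵘ.*≡* (trans (sym (ℤₚ.pos-* a (suc d))) (trans (cong +_ p) (ℤₚ.pos-* c (suc b)))))

frac-< : ∀ {a b c d} .{{_ : NonZero b}} .{{_ : NonZero d}} → a * d < c * b → + a ℚ./ b ℚ.< + c ℚ./ d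
frac-< {a} {suc b} {c} {suc d} h = ℚₚ.toℚᵘ-cancel-< (ℚᵘₚ.<-respˡ-≃ (ℚᵘₚ.≃-sym (ℚₚ.toℚᵘ-fromℚᵘ (ℚᵘ.mkℚᵘ (+ a) b)))
  (ℚᵘₚ.<-respʳ-≃ (ℚᵘₚ.≃-sym (ℚₚ.toℚᵘ-fromℚᵘ (ℚᵘ.mkℚᵘ (+ c) d)))
    (ℚᵘ.*<* (subst₂ ℤ._<_ (ℤₚ.pos-* a (suc d)) (ℤₚ.pos-* c (suc b)) (ℤ.+<+ h)))))

frac-* : ∀ a b c d .{{_ : NonZero b}} .{{_ : NonZero d}} .{{_ : NonZero (b * d)}} →
         (+ a ℚ./ b) ℚ.* (+ c ℚ./ d) ≡ + (a * c) ℚ./ (b * d)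
frac-* a (suc b) c (suc d) = ℚₚ.toℚᵘ-injective (ℚᵘₚ.≃-trans (ℚₚ.toℚᵘ-homo-* (+ a ℚ./ suc b) (+ c ℚ./ suc d))
  (ℚᵘₚ.≃-trans (ℚᵘₚ.*-cong (ℚₚ.toℚᵘ-fromℚᵘ (ℚᵘ.mkℚᵘ (+ a) b)) (ℚₚ.toℚᵘ-fromℚᵘ (ℚᵘ.mkℚᵘ (+ c) d)))
    (ℚᵘₚ.≃-trans (ℚᵘₚ.≃-reflexive (cong (λ z → ℚᵘ.mkℚᵘ z (d + b * suc d)) (sym (ℤₚ.pos-* a c))))
      (ℚᵘₚ.≃-sym (ℚₚ.toℚᵘ-fromℚᵘ (ℚᵘ.mkℚᵘ (+ (a * c)) (d + b * suc d)))))))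

frac-+ : ∀ a b c d .{{_ : NonZero b}} .{{_ : NonZero d}} .{{_ : NonZero (b * d)}} →
         (+ a ℚ./ b) ℚ.+ (+ c ℚ./ d) ≡ + (a * d + c * b) ℚ./ (b * d)
frac-+ a (suc b) c (suc d) = ℚₚ.toℚᵘ-injective (ℚᵘₚ.≃-trans (ℚₚ.toℚᵘ-homo-+ (+ a ℚ./ suc b) (+ c ℚ./ suc d))
  (ℚᵘₚ.≃-trans (ℚᵘₚ.+-cong (ℚₚ.toℚᵘ-fromℚᵘ (ℚᵘ.mkℚᵘ (+ a) b)) (ℚₚ.toℚᵘ-fromℚᵘ (ℚᵘ.mkℚᵘ (+ c) d)))
    (ℚᵘₚ.≃-trans (ℚᵘₚ.≃-reflexive (cong (λ z → ℚᵘ.mkℚᵘ z (d + b * suc d))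
        (trans (cong₂ ℤ._+_ (sym (ℤₚ.pos-* a (suc d))) (sym (ℤₚ.pos-* c (suc b)))) (sym (ℤₚ.pos-+ (a * suc d) (c * suc b))))))
      (ℚᵘₚ.≃-sym (ℚₚ.toℚᵘ-fromℚᵘ (ℚᵘ.mkℚᵘ (+ (a * suc d + c * suc b)) (d + b * suc d)))))))

minus : ∀ {x q k} → x ℚ.+ q ≡ k → x ≡ k ℚ.- q
minus {x} {q} refl = sym (trans (ℚₚ.+-assoc x q (ℚ.- q)) (trans (cong (x ℚ.+_) (ℚₚ.+-inverseʳ q)) (ℚₚ.+-identityʳ x)))

-- The three exponents of the theorem, with their rational arguments cleared.
module _ (c : ℝ) where

  scaled-upper : ∀ t a b .{{_ : NonZero t}} .{{_ : NonZero b}} → t · c <ᵁ + a ℚ./ b → .{{nz : NonZero (b * t)}} → c <ᵁ + a ℚ./ (b * t)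
  scaled-upper t a b h {{nz}} = subst (ℝ.Upper c) (sym eqn) h
    where
    pos-t = ℚₚ.normalize-pos t 1
    eqn : + a ℚ./ (b * t) ≡ (+ a ℚ./ b) ℚ.* inv (+ t ℚ./ 1) {{pos-t}}
    eqn = trans (sym (*÷ (+ t ℚ./ 1) {{pos-t}} (+ a ℚ./ (b * t)))) (cong (λ z → z ℚ.* inv (+ t ℚ./ 1) {{pos-t}})
            (trans (frac-* a (b * t) t 1 {{nz}} {{_}} {{m*n≢0 (b * t) 1}}) (frac-≡ {a * t} {b * t * 1} {a} {b} {{m*n≢0 (b * t) 1}} (arith a t b))))
      where arith : ∀ a t b → a * t * b ≡ a * (b * t * 1)
            arith = solve-∀

  1-lower : ∀ a b .{{_ : NonZero b}} → a ≤ b → (1ℚ ⊖ c) <ᵁ + a ℚ./ b → + (b ∸ a) ℚ./ b <ᴸ c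
  1-lower a b a≤b h = subst (ℝ.Lower c) (sym (minus {+ (b ∸ a) ℚ./ b} {+ a ℚ./ b} total)) h
    where
    instance
      nz : NonZero (b * b)
      nz = m*n≢0 b b
    total : (+ (b ∸ a) ℚ./ b) ℚ.+ (+ a ℚ./ b) ≡ 1ℚ
    total = trans (frac-+ (b ∸ a) b a b) (frac-≡ {(b ∸ a) * b + a * b} {b * b} {1} {1}
      (trans (*-identityʳ _) (trans (sym (*-distribʳ-+ b (b ∸ a) a)) (trans (cong (_* b) (m∸n+n≡m a≤b)) (sym (*-identityˡ _))))))

  2-lower : ∀ a b .{{_ : NonZero b}} .{{_ : NonZero (2 * b)}} → a ≤ 2 * b → (+ 2 ℚ./ 1 ⊖ 2 · c) <ᵁ + a ℚ./ b → + (2 * b ∸ a) ℚ./ (2 * b) <ᴸ c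
  2-lower a b a≤2b h = subst (ℝ.Lower c) (sym (trans (sym (*÷ (+ 2 ℚ./ 1) y)) (cong (ℚ._* inv (+ 2 ℚ./ 1)) (minus {y ℚ.* (+ 2 ℚ./ 1)} {+ a ℚ./ b} total)))) h
    where
    y = + (2 * b ∸ a) ℚ./ (2 * b)
    x = 2 * b ∸ a
    arith : ∀ x a b → (x * 2 * b + a * (2 * b * 1)) * 1 ≡ (x + a) * (2 * b)
    arith = solve-∀
    arith′ : ∀ b → 2 * b * (2 * b) ≡ 2 * (2 * b * 1 * b)
    arith′ = solve-∀
    instance
      nz₁ : NonZero (2 * b * 1)
      nz₁ = m*n≢0 (2 * b) 1
      nz₂ : NonZero (2 * b * 1 * b)
      nz₂ = m*n≢0 (2 * b * 1) b
    total : y ℚ.* (+ 2 ℚ./ 1) ℚ.+ (+ a ℚ./ b) ≡ + 2 ℚ./ 1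
    total = trans (cong (ℚ._+ (+ a ℚ./ b)) (frac-* x (2 * b) 2 1)) (trans (frac-+ (x * 2) (2 * b * 1) a b)
      (frac-≡ {x * 2 * b + a * (2 * b * 1)} {2 * b * 1 * b} {2} {1} (trans (arith x a b) (trans (cong (_* (2 * b)) (m∸n+n≡m a≤2b)) (arith′ b)))))

-- Arithmetic of bounds by real powers

n≤2^log : ∀ n .{{_ : NonZero n}} → n ≤ 2 ^ ⌈log₂ n ⌉
n≤2^log n = <-rec (λ n → 0 < n → n ≤ 2 ^ ⌈log₂ n ⌉) step n (n≢0⇒n>0 (≢-nonZero⁻¹ n))
  where
  step : ∀ n → (∀ {m} → m < n → 0 < m → m ≤ 2 ^ ⌈log₂ m ⌉) → 0 < n → n ≤ 2 ^ ⌈log₂ n ⌉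
  step (suc zero)    rec _ = s≤s z≤n
  step n@(suc (suc k)) rec _ = begin
    n                              ≡⟨ sym (⌊n/2⌋+⌈n/2⌉≡n n) ⟩
    ⌊ n /2⌋ + ⌈ n /2⌉              ≤⟨ +-monoˡ-≤ ⌈ n /2⌉ (⌊n/2⌋≤⌈n/2⌉ n) ⟩
    ⌈ n /2⌉ + ⌈ n /2⌉              ≤⟨ +-mono-≤ half half ⟩
    2 ^ (⌈log₂ n ⌉ ∸ 1) + 2 ^ (⌈log₂ n ⌉ ∸ 1) ≡⟨ cong (λ z → 2 ^ (⌈log₂ n ⌉ ∸ 1) + z) (sym (+-identityʳ _)) ⟩
    2 ^ suc (⌈log₂ n ⌉ ∸ 1)        ≡⟨ cong (2 ^_) (m+[n∸m]≡n (⌈log₂⌉-mono-≤ {2} {n} (s≤s (s≤s z≤n)))) ⟩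
    2 ^ ⌈log₂ n ⌉                  ∎
    where
    open ≤-Reasoning
    half : ⌈ n /2⌉ ≤ 2 ^ (⌈log₂ n ⌉ ∸ 1)
    half = subst (λ e → ⌈ n /2⌉ ≤ 2 ^ e) (⌈log₂⌈n/2⌉⌉≡⌈log₂n⌉∸1 n) (rec (⌈n/2⌉<n k) (s≤s z≤n))

≼-mono : ∀ n e {x y A A′} → x ≤ y → A ≤ A′ → y ≼ A · n ^ e → x ≼ A′ · n ^ e
≼-mono n e h h′ p a b e< = ≤-trans (^-monoˡ-≤ b h) (≤-trans (p a b e<) (*-monoˡ-≤ (n ^ a) (^-monoˡ-≤ b h′)))

^-* : ∀ x y b → (x * y) ^ b ≡ x ^ b * y ^ b
^-* x y zero    = refl
^-* x y (suc b) = trans (cong (x * y *_) (^-* x y b)) (arith x y (x ^ b) (y ^ b))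
  where arith : ∀ x y u v → x * y * (u * v) ≡ x * u * (y * v)
        arith = solve-∀

≼-scale : ∀ n e k {x A} → x ≼ A · n ^ e → k * x ≼ k * A · n ^ e
≼-scale n e k {x} {A} p a b e< = ≤-trans (≤-reflexive (^-* k x b)) (≤-trans (*-monoʳ-≤ (k ^ b) (p a b e<))
  (≤-reflexive (trans (sym (*-assoc (k ^ b) (A ^ b) (n ^ a))) (cong (_* n ^ a) (sym (^-* k A b))))))

-- The `b`-th power of a sum does not split, so the sum is bounded by twice its larger summand.
≼-+ : ∀ n e {x y A} → x ≼ A · n ^ e → y ≼ A · n ^ e → x + y ≼ 2 * A · n ^ e
≼-+ n e {x} {y} p q with ≤-total x y
... | inj₁ x≤y = ≼-mono n e (≤-trans (+-monoˡ-≤ y x≤y) (≤-reflexive (cong (λ z → y + z) (sym (+-identityʳ y))))) ≤-refl (≼-scale n e 2 q)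
... | inj₂ y≤x = ≼-mono n e (≤-trans (+-monoʳ-≤ x y≤x) (≤-reflexive (cong (λ z → x + z) (sym (+-identityʳ x))))) ≤-refl (≼-scale n e 2 p)

≼-const : ∀ n e .{{_ : NonZero n}} A → A ≼ A · n ^ e
≼-const n e A a b _ = m≤m*n (A ^ b) (n ^ a) {{m^n≢0 n a}}

-- Comparing cubes avoids the exponent 1/3.
cube-cancel : ∀ {x y} → x ^ 3 ≤ y ^ 3 → x ≤ y
cube-cancel {x} {y} h with x ≤? y
... | yes x≤y = x≤y
... | no x≰y = ⊥-elim (<⇒≱ (^-monoˡ-< 3 (≰⇒> x≰y)) h)

^-cube : ∀ x b → (x ^ b) ^ 3 ≡ (x ^ 3) ^ b
^-cube x b = trans (^-*-assoc x b 3) (trans (cong (x ^_) (*-comm b 3)) (sym (^-*-assoc x 3 b)))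

module Powers (n : ℕ) .{{_ : NonZero n}} (c : ℝ) (0<c : 0ℚ <ᴸ c) (c<⅓ : c <ᵁ + 1 ℚ./ 3) (p : ℕ) (rp : RoundedPower n c p) where

  p>0 : 0 < p
  p>0 = ≤-trans (proj₁ rp 0 1 0<c) (≤-reflexive (*-identityʳ p))

  -- Rounding bounds only `p ∸ 1` from above; from 2 on `p` is at most twice that, and `p ≤ 1` is
  -- trivial. Hence the factor `2 ^ t` in the query time.
  p≤ : ∀ a b .{{_ : NonZero b}} → c <ᵁ + a ℚ./ b → p ^ b ≤ 2 ^ b * n ^ a
  p≤ a b h = [ small , large ]′ (≤-<-connex p 1)
    where small : p ≤ 1 → p ^ b ≤ 2 ^ b * n ^ a
          small p≤1 = ≤-trans (^-monoˡ-≤ b p≤1) (≤-trans (≤-reflexive (^-zeroˡ b)) (*-mono-≤ (m^n>0 2 b) (m^n>0 n a)))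
          double : ∀ p → 2 ≤ p → p ≤ 2 * (p ∸ 1)
          double (suc (suc q)) _ = s≤s (≤-trans (s≤s (m≤m+n q 0)) (≤-trans (m≤n+m (suc (q + 0)) q) ≤-refl))
          double (suc zero) (s≤s ())
          large : 1 < p → p ^ b ≤ 2 ^ b * n ^ a
          large 1<p = ≤-trans (^-monoˡ-≤ b (double p 1<p)) (≤-trans (≤-reflexive (^-* 2 (p ∸ 1) b))
            (*-monoʳ-≤ (2 ^ b) (≤-trans (proj₂ rp a b h) (≤-reflexive (trans (cong (_* n ^ a) (^-zeroˡ b)) (*-identityˡ _))))))

  p³≤ : p ^ 3 ≤ 8 * n
  p³≤ = ≤-trans (p≤ 1 3 c<⅓) (≤-reflexive (cong (8 *_) (*-identityʳ n)))

  p≤8n : p ≤ 8 * n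
  p≤8n = ≤-trans (≤-trans (≤-reflexive (sym (*-identityʳ p))) (*-monoʳ-≤ p (≤-trans (s≤s z≤n) (^-monoˡ-≤ 2 p>0)))) p³≤

  -- Were `x / y` above 1/3, downward closure would put 1/3 below `c` as well, against `c < 1/3`.
  no-lower : ∀ x y .{{_ : NonZero y}} → + x ℚ./ y <ᴸ c → 3 * x ≤ y
  no-lower x y l = ≮⇒≥ λ h →
    ℝ.disjoint c (ℝ.lower-closed c (frac-< {1} {3} {x} {y} (≤-trans (≤-reflexive (cong suc (*-identityˡ y))) (≤-trans h (≤-reflexive (*-comm 3 x))))) l) c<⅓

  -- From `p ^ 3 ≤ 8 n` follows `p ^ 6 ≤ 4 ^ 3 * n ^ 2`, that is `p ^ 2 ≤ 4 n ^ (2/3)`, and 2/3 is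
  -- at most `1 - c`.
  square≼ : p * p ≼ 4 · n ^ (1ℚ ⊖ c)
  square≼ a b h = cube-cancel (begin
    ((p * p) ^ b) ^ 3        ≡⟨ ^-cube (p * p) b ⟩
    ((p * p) ^ 3) ^ b        ≡⟨ cong (_^ b) (^-* p p 3) ⟩
    (p ^ 3 * p ^ 3) ^ b      ≤⟨ ^-monoˡ-≤ b (*-mono-≤ p³≤ p³≤) ⟩
    (8 * n * (8 * n)) ^ b    ≡⟨ cong (_^ b) (arith n) ⟩
    (4 ^ 3 * n ^ 2) ^ b      ≡⟨ ^-* (4 ^ 3) (n ^ 2) b ⟩
    (4 ^ 3) ^ b * (n ^ 2) ^ b ≡⟨ cong₂ _*_ (sym (^-cube 4 b)) (^-*-assoc n 2 b) ⟩
    (4 ^ b) ^ 3 * n ^ (2 * b) ≤⟨ *-monoʳ-≤ ((4 ^ b) ^ 3) (^-monoʳ-≤ n 2b≤3a) ⟩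
    (4 ^ b) ^ 3 * n ^ (a * 3) ≡⟨ cong ((4 ^ b) ^ 3 *_) (sym (^-*-assoc n a 3)) ⟩
    (4 ^ b) ^ 3 * (n ^ a) ^ 3 ≡⟨ sym (^-* (4 ^ b) (n ^ a) 3) ⟩
    (4 ^ b * n ^ a) ^ 3      ∎)
    where
    open ≤-Reasoning
    arith : ∀ n → 8 * n * (8 * n) ≡ 64 * (n * (n * 1))
    arith = solve-∀
    2b≤3a : 2 * b ≤ a * 3
    2b≤3a = [ low , (λ b≤a → ≤-trans (*-mono-≤ {2} {3} (s≤s (s≤s z≤n)) b≤a) (≤-reflexive (*-comm 3 a))) ]′ (≤-total a b)
      where
      low : a ≤ b → 2 * b ≤ a * 3
      low a≤b = +-cancelʳ-≤ b _ _ (begin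
        2 * b + b            ≡⟨ +-comm (2 * b) b ⟩
        3 * b                ≡⟨ cong (3 *_) (sym (m∸n+n≡m a≤b)) ⟩
        3 * (b ∸ a + a)      ≡⟨ *-distribˡ-+ 3 (b ∸ a) a ⟩
        3 * (b ∸ a) + 3 * a  ≤⟨ +-monoˡ-≤ (3 * a) (no-lower (b ∸ a) b (1-lower c a b a≤b h)) ⟩
        b + 3 * a            ≡⟨ trans (+-comm b (3 * a)) (cong (_+ b) (*-comm 3 a)) ⟩
        a * 3 + b            ∎)

  -- Since `n ^ c ≤ p`, dividing `A n` by `p` leaves at most `A n ^ (1 - c)`. For `a ≤ b` both sides
  -- are multiplied by `n ^ (b ∸ a)`, which is cancelled at the end; for `a ≥ b` already `l ≤ A n`
  -- suffices.
  quotient≼ : ∀ {l A} → l * p ≤ A * n → l ≼ A · n ^ (1ℚ ⊖ c)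
  quotient≼ {l} {A} lp≤ a b h = [ low , high ]′ (≤-total a b)
    where
    open ≤-Reasoning
    high : b ≤ a → l ^ b ≤ A ^ b * n ^ a
    high b≤a = begin
      l ^ b          ≤⟨ ^-monoˡ-≤ b (≤-trans (m≤m*n l p {{>-nonZero p>0}}) lp≤) ⟩
      (A * n) ^ b    ≡⟨ ^-* A n b ⟩
      A ^ b * n ^ b  ≤⟨ *-monoʳ-≤ (A ^ b) (^-monoʳ-≤ n b≤a) ⟩
      A ^ b * n ^ a  ∎
    low : a ≤ b → l ^ b ≤ A ^ b * n ^ a
    low a≤b = *-cancelʳ-≤ _ _ (n ^ (b ∸ a)) {{m^n≢0 n (b ∸ a)}} (begin
      l ^ b * n ^ (b ∸ a)          ≤⟨ *-monoʳ-≤ (l ^ b) (proj₁ rp (b ∸ a) b (1-lower c a b a≤b h)) ⟩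
      l ^ b * p ^ b                ≡⟨ sym (^-* l p b) ⟩
      (l * p) ^ b                  ≤⟨ ^-monoˡ-≤ b lp≤ ⟩
      (A * n) ^ b                  ≡⟨ ^-* A n b ⟩
      A ^ b * n ^ b                ≡⟨ cong (λ e → A ^ b * n ^ e) (sym (m+[n∸m]≡n a≤b)) ⟩
      A ^ b * n ^ (a + (b ∸ a))    ≡⟨ cong (A ^ b *_) (^-distribˡ-+-* n a (b ∸ a)) ⟩
      A ^ b * (n ^ a * n ^ (b ∸ a)) ≡⟨ sym (*-assoc (A ^ b) (n ^ a) _) ⟩
      A ^ b * n ^ a * n ^ (b ∸ a)  ∎)

  -- `(n p) ^ 3 ≤ 8 n ^ 4` gives the exponent 4/3, and `c < 1/3` makes it at most `2 - 2c`.
  space≼ : n * p ≼ 2 · n ^ (+ 2 ℚ./ 1 ⊖ 2 · c)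
  space≼ a b {{nz}} h = cube-cancel (begin
    ((n * p) ^ b) ^ 3        ≡⟨ ^-cube (n * p) b ⟩
    ((n * p) ^ 3) ^ b        ≡⟨ cong (_^ b) (^-* n p 3) ⟩
    (n ^ 3 * p ^ 3) ^ b      ≤⟨ ^-monoˡ-≤ b (*-monoʳ-≤ (n ^ 3) p³≤) ⟩
    (n ^ 3 * (8 * n)) ^ b    ≡⟨ cong (_^ b) (arith n) ⟩
    (2 ^ 3 * n ^ 4) ^ b      ≡⟨ ^-* (2 ^ 3) (n ^ 4) b ⟩
    (2 ^ 3) ^ b * (n ^ 4) ^ b ≡⟨ cong₂ _*_ (sym (^-cube 2 b)) (^-*-assoc n 4 b) ⟩
    (2 ^ b) ^ 3 * n ^ (4 * b) ≤⟨ *-monoʳ-≤ ((2 ^ b) ^ 3) (^-monoʳ-≤ n 4b≤3a) ⟩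
    (2 ^ b) ^ 3 * n ^ (a * 3) ≡⟨ cong ((2 ^ b) ^ 3 *_) (sym (^-*-assoc n a 3)) ⟩
    (2 ^ b) ^ 3 * (n ^ a) ^ 3 ≡⟨ sym (^-* (2 ^ b) (n ^ a) 3) ⟩
    (2 ^ b * n ^ a) ^ 3      ∎)
    where
    open ≤-Reasoning
    arith : ∀ n → n * (n * (n * 1)) * (8 * n) ≡ 8 * (n * (n * (n * (n * 1))))
    arith = solve-∀
    4b≤3a : 4 * b ≤ a * 3
    4b≤3a = [ low , high ]′ (≤-total a (2 * b))
      where
      high : 2 * b ≤ a → 4 * b ≤ a * 3
      high 2b≤a = ≤-trans (*-monoˡ-≤ b {4} {6} (s≤s (s≤s (s≤s (s≤s z≤n))))) (≤-trans (≤-reflexive (six b)) (*-monoˡ-≤ 3 2b≤a))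
        where six : ∀ b → 6 * b ≡ 2 * b * 3
              six = solve-∀
      low : a ≤ 2 * b → 4 * b ≤ a * 3
      low a≤2b = +-cancelʳ-≤ (2 * b) _ _ (begin
        4 * b + 2 * b                ≡⟨ six b ⟩
        3 * (2 * b)                  ≡⟨ cong (3 *_) (sym (m∸n+n≡m a≤2b)) ⟩
        3 * (2 * b ∸ a + a)          ≡⟨ *-distribˡ-+ 3 (2 * b ∸ a) a ⟩
        3 * (2 * b ∸ a) + 3 * a      ≤⟨ +-monoˡ-≤ (3 * a) (no-lower (2 * b ∸ a) (2 * b) {{m*n≢0 2 b}} (2-lower c a b {{nz}} {{m*n≢0 2 b}} a≤2b h)) ⟩
        2 * b + 3 * a                ≡⟨ trans (+-comm (2 * b) (3 * a)) (cong (_+ 2 * b) (*-comm 3 a)) ⟩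
        a * 3 + 2 * b                ∎)
        where six : ∀ b → 4 * b + 2 * b ≡ 3 * (2 * b)
              six = solve-∀

  -- The square of `quotient≼`. From `a / b` above `2 - 2c` one gets `(2 b ∸ a) / (2 b)` below `c`,
  -- whence the powers `2 * b`.
  table≼ : ∀ {l A} → l * p ≤ A * n → l * l ≼ A * A · n ^ (+ 2 ℚ./ 1 ⊖ 2 · c)
  table≼ {l} {A} lp≤ a b {{nz}} h = ≤-trans (≤-reflexive (^-* l l b)) (≤-trans main (≤-reflexive (cong (_* n ^ a) (sym (^-* A A b)))))
    where
    open ≤-Reasoning
    pow-2 : ∀ x → x ^ (2 * b) ≡ x ^ b * x ^ b
    pow-2 x = trans (cong (x ^_) (cong (λ z → b + z) (+-identityʳ b))) (^-distribˡ-+-* x b b)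
    squared : l ^ b * l ^ b * p ^ (2 * b) ≤ A ^ b * A ^ b * n ^ (2 * b)
    squared = begin
      l ^ b * l ^ b * p ^ (2 * b)   ≡⟨ cong (l ^ b * l ^ b *_) (pow-2 p) ⟩
      l ^ b * l ^ b * (p ^ b * p ^ b) ≡⟨ shuffle (l ^ b) (p ^ b) ⟩
      (l ^ b * p ^ b) * (l ^ b * p ^ b) ≡⟨ cong₂ _*_ (sym (^-* l p b)) (sym (^-* l p b)) ⟩
      (l * p) ^ b * (l * p) ^ b     ≤⟨ *-mono-≤ (^-monoˡ-≤ b lp≤) (^-monoˡ-≤ b lp≤) ⟩
      (A * n) ^ b * (A * n) ^ b     ≡⟨ cong₂ _*_ (^-* A n b) (^-* A n b) ⟩
      (A ^ b * n ^ b) * (A ^ b * n ^ b) ≡⟨ sym (shuffle (A ^ b) (n ^ b)) ⟩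
      A ^ b * A ^ b * (n ^ b * n ^ b) ≡⟨ cong (A ^ b * A ^ b *_) (sym (pow-2 n)) ⟩
      A ^ b * A ^ b * n ^ (2 * b)   ∎
      where shuffle : ∀ x y → x * x * (y * y) ≡ (x * y) * (x * y)
            shuffle = solve-∀
    main : l ^ b * l ^ b ≤ A ^ b * A ^ b * n ^ a
    main = [ low , high ]′ (≤-total a (2 * b))
      where
      high : 2 * b ≤ a → l ^ b * l ^ b ≤ A ^ b * A ^ b * n ^ a
      high 2b≤a = ≤-trans (m≤m*n _ (p ^ (2 * b)) {{m^n≢0 p (2 * b) {{>-nonZero p>0}}}}) (≤-trans squared (*-monoʳ-≤ (A ^ b * A ^ b) (^-monoʳ-≤ n 2b≤a)))
      low : a ≤ 2 * b → l ^ b * l ^ b ≤ A ^ b * A ^ b * n ^ a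
      low a≤2b = *-cancelʳ-≤ _ _ (n ^ x) {{m^n≢0 n x}} (begin
        l ^ b * l ^ b * n ^ x         ≤⟨ *-monoʳ-≤ (l ^ b * l ^ b) (proj₁ rp x (2 * b) {{m*n≢0 2 b}} (2-lower c a b {{nz}} {{m*n≢0 2 b}} a≤2b h)) ⟩
        l ^ b * l ^ b * p ^ (2 * b)   ≤⟨ squared ⟩
        A ^ b * A ^ b * n ^ (2 * b)   ≡⟨ cong (λ e → A ^ b * A ^ b * n ^ e) (sym (m+[n∸m]≡n a≤2b)) ⟩
        A ^ b * A ^ b * n ^ (a + x)   ≡⟨ cong (A ^ b * A ^ b *_) (^-distribˡ-+-* n a x) ⟩
        A ^ b * A ^ b * (n ^ a * n ^ x) ≡⟨ sym (*-assoc (A ^ b * A ^ b) (n ^ a) _) ⟩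
        A ^ b * A ^ b * n ^ a * n ^ x ∎)
        where x = 2 * b ∸ a

  power≼ : ∀ t .{{_ : NonZero t}} → (p ^ t) ≼ (2 ^ t) · n ^ (t · c)
  power≼ t a b h = begin
    (p ^ t) ^ b          ≡⟨ trans (^-*-assoc p t b) (cong (p ^_) (*-comm t b)) ⟩
    p ^ (b * t)          ≤⟨ p≤ a (b * t) {{m*n≢0 b t}} (scaled-upper c t a b h {{m*n≢0 b t}}) ⟩
    2 ^ (b * t) * n ^ a  ≡⟨ cong (_* n ^ a) (sym (trans (^-*-assoc 2 t b) (cong (2 ^_) (*-comm t b)))) ⟩
    (2 ^ t) ^ b * n ^ a  ∎
    where open ≤-Reasoning

-- The oracle

-- A query sees only the announced part of memory, and the rest reads 0. So its arrays agree with
-- the preprocessed ones on the ranges that an oracle refers to, but not everywhere.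
oracle-cong : ∀ {E nv P L ln piv pd lm q d tbl} {ln′ piv′ pd′ : ℕ → ℕ} {q′ d′ tbl′ : ℕ → ℕ → ℕ} →
  (∀ {x} → x < nv → ln′ x ≡ ln x) → (∀ {x} → x < nv → piv′ x ≡ piv x) → (∀ {x} → x < nv → pd′ x ≡ pd x) →
  (∀ {x j} → x < nv → j < P → q′ x j ≡ q x j) → (∀ {x j} → x < nv → j < P → d′ x j ≡ d x j) →
  (∀ {k k′} → k < L → k′ < L → tbl′ k k′ ≡ tbl k k′) →
  Oracle E nv P L ln piv pd lm q d tbl → Oracle E nv P L ln′ piv′ pd′ lm q′ d′ tbl′
oracle-cong {E} {nv} {P} {L} ln≡ piv≡ pd≡ q≡ d≡ tbl≡ O = record
  { E-sym = E-sym ; E< = E<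
  ; ball = λ {x} x< → subst (Ball E nv P x _ _) (sym (ln≡ x<))
      (ball-cong (λ j< → q≡ x< (inside x< j<)) (λ j< → d≡ x< (inside x< j<)) (ball x<))
  ; pivot = λ x< full → let k , p , j , j< , r = pivot x< (trans (sym (ln≡ x<)) full) in
      k , trans (piv≡ x<) p , j , subst (j <_) (sym (ln≡ x<)) j< , trans (pd≡ x<) (trans r (sym (d≡ x< (inside x< j<))))
  ; pivot-sound = λ x< p → let k< , path = pivot-sound x< (trans (sym (piv≡ x<)) p) in k< , subst (Path E _ _) (sym (pd≡ x<)) path
  ; tbl-sound = λ k< k′< p → tbl-sound k< k′< (trans (sym (tbl≡ k< k′<)) p)
  ; tbl-complete = λ k< k′< path → let D , p , D≤ = tbl-complete k< k′< path in D , trans (tbl≡ k< k′<) p , D≤ }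
  where
  open Oracle O
  inside : ∀ {x j} → x < nv → j < _ → j < P
  inside x< j< = <-≤-trans j< (Ball.ln≤cap (ball x<))

-- The first summand bounds both expansions together, each with `t + 1` levels of at most
-- `p ^ t ≤ N ^ (3 t)` entries. The second bounds the longest candidate, stored values being at most
-- `N ^ 14`.
querying-exponent : ℕ → ℕ
querying-exponent t = suc (suc t + 3 * t) + (t + 18)

-- Magnitudes as powers of the word base

module Magnitudes (N : ℕ) (3≤N : 3 ≤ N) where

  instance
    N-nonZero : NonZero N
    N-nonZero = >-nonZero (≤-trans (s≤s z≤n) 3≤N)

  2≤N : 2 ≤ N
  2≤N = ≤-trans (n≤1+n 2) 3≤N

  up : ∀ {x a b} → a ≤ b → x ≤ N ^ a → x ≤ N ^ b
  up a≤b h = ≤-trans h (^-monoʳ-≤ N a≤b)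

  times : ∀ {x y} a b → x ≤ N ^ a → y ≤ N ^ b → x * y ≤ N ^ (a + b)
  times a b h h′ = ≤-trans (*-mono-≤ h h′) (≤-reflexive (sym (^-distribˡ-+-* N a b)))

  plus : ∀ {x y} a → x ≤ N ^ a → y ≤ N ^ a → x + y ≤ N ^ suc a
  plus a h h′ = ≤-trans (+-mono-≤ h h′) (≤-trans (≤-reflexive (cong (λ z → N ^ a + z) (sym (+-identityʳ (N ^ a))))) (*-monoˡ-≤ (N ^ a) 2≤N))

  1≤ : ∀ a → 1 ≤ N ^ a
  1≤ = m^n>0 N

  N≤ : ∀ {x} → x ≤ N → x ≤ N ^ 1
  N≤ h = ≤-trans h (≤-reflexive (sym (*-identityʳ N)))

  three : ∀ {x} k → x ≤ 3 ^ k → x ≤ N ^ k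
  three k h = ≤-trans h (^-monoˡ-≤ k 3≤N)

  module _ {n p : ℕ} (n≤N : n ≤ N) (p≤8n : p ≤ 8 * n) where

    p≤N³ : p ≤ N ^ 3
    p≤N³ = ≤-trans p≤8n (times 2 1 (three 2 (n≤1+n 8)) (N≤ n≤N))

    X≤ : (n + p + 4) * (n + p + 4) * 32 ≤ N ^ 14
    -- Origin of the exponent 14: `n + p + 4 ≤ N ^ 5` for both factors, and `32 ≤ 3 ^ 4`.
    X≤ = times 10 4 (times 5 5 side side) (three 4 (m≤m+n 32 49))
      where side : n + p + 4 ≤ N ^ 5
            side = plus 4 (plus 3 (up (s≤s (z≤n {2})) (N≤ n≤N)) p≤N³) (three 4 (m≤m+n 4 77))

    module _ (t : ℕ) where

      t≤ : t ≤ N ^ suc t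
      t≤ = <⇒≤ (k<N^1+k N 2≤N t)

      sum≤ : (t * p + N ^ 14) + (N ^ 14 + (t * p + N ^ 14)) + 1 ≤ N ^ querying-exponent t
      sum≤ = up (≤-trans (≤-reflexive (exponent t)) (m≤n+m (t + 18) (suc (suc t + 3 * t))))
        (plus (3 + (t + 14)) (plus (2 + (t + 14)) (up (n≤1+n (suc (t + 14))) A) (plus (suc (t + 14)) (up (n≤1+n (t + 14)) B₁≤) A)) (1≤ (3 + (t + 14))))
        where
        exponent : ∀ t → 4 + (t + 14) ≡ t + 18
        exponent = solve-∀
        B₁≤ : N ^ 14 ≤ N ^ (t + 14)
        B₁≤ = ^-monoʳ-≤ N (m≤n+m 14 t)
        A : t * p + N ^ 14 ≤ N ^ suc (t + 14)
        A = plus (t + 14) (up (≤-trans (≤-reflexive (sym (+-suc t 3))) (+-monoʳ-≤ t (m≤m+n 4 10))) (times (suc t) 3 t≤ p≤N³)) B₁≤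

      room≤ : 0 < p → ∑ (p ^_) (suc t) + ∑ (p ^_) (suc t) ≤ N ^ querying-exponent t
      room≤ p>0 = up (m≤m+n (suc (suc t + 3 * t)) (t + 18)) (plus (suc t + 3 * t) total total)
        where
        powers : ∀ i → i < suc t → p ^ i ≤ N ^ (3 * t)
        powers i (s≤s i≤t) = ≤-trans (^-monoʳ-≤ p {{>-nonZero p>0}} i≤t) (≤-trans (^-monoˡ-≤ t p≤N³) (≤-reflexive (^-*-assoc N 3 t)))
        total : ∑ (p ^_) (suc t) ≤ N ^ (suc t + 3 * t)
        total = ≤-trans (∑-mono (suc t) powers) (≤-trans (≤-reflexive (∑-const (N ^ (3 * t)) (suc t)))
          (times (suc t) (3 * t) (k<N^1+k N 2≤N t) ≤-refl))

      t+2≤ : t + 2 ≤ N ^ querying-exponent t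
      t+2≤ = up (≤-trans (s≤s (m≤m+n (suc t) (3 * t))) (m≤m+n _ (t + 18))) (plus (suc t) t≤ (≤-trans 2≤N (≤-trans (≤-reflexive (sym (*-identityʳ N))) (^-monoʳ-≤ N {1} {suc t} (s≤s z≤n)))))

m<1+m+n : ∀ m n → m < suc (m + n)
m<1+m+n m n = s≤s (m≤m+n m n)

n<1+m+n : ∀ m n → n < suc (m + n)
n<1+m+n m n = s≤s (m≤n+m n m)

-- These are closed numerals, which must not be unfolded.
abstract
  preprocessing-cost : ℕ
  preprocessing-cost = costC preprocessing

  querying-cost : ℕ → ℕ
  querying-cost t = costC (querying t)

  preprocessing-cost≡ : costC preprocessing ≡ preprocessing-cost
  preprocessing-cost≡ = refl

  querying-cost≡ : ∀ t → costC (querying t) ≡ querying-cost t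
  querying-cost≡ t = refl

  word-exponent : ℕ → ℕ
  word-exponent t = suc (sizeC 14 preprocessing + sizeC (querying-exponent t) (querying t))

  preprocessing-fits : ∀ t → sizeC 14 preprocessing < word-exponent t
  preprocessing-fits t = m<1+m+n (sizeC 14 preprocessing) (sizeC (querying-exponent t) (querying t))

  querying-fits : ∀ t → sizeC (querying-exponent t) (querying t) < word-exponent t
  querying-fits t = n<1+m+n (sizeC 14 preprocessing) (sizeC (querying-exponent t) (querying t))

-- `1 ⊔ m` covers the edgeless graph, where the program still takes steps. With `suc a` for `1 ⊔ m`
-- and `suc b` for `P`, the difference of the two sides is a polynomial with natural coefficients,
-- given explicitly.
preprocessing-time≤ : ∀ {n m P F nv L} → nv ≤ m * 2 → L ≤ nv → 0 < P →
  suc (preprocessing-time n m P F nv L) ≤ 17 * ((1 ⊔ m) * (P * P + (F + L)))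
preprocessing-time≤ {n} {m} {P} {F} {nv} {L} nv≤ L≤ P>0 = ≤-trans (s≤s coarse) (polynomial (1 ⊔ m) P (m≤m⊔n 1 m) P>0)
  where
  μ = 1 ⊔ m
  m≤ : m * 2 ≤ μ * 2
  m≤ = *-monoˡ-≤ 2 (m≤n⊔m 1 m)
  nv≤′ : nv ≤ μ * 2
  nv≤′ = ≤-trans nv≤ m≤
  L≤′ : L ≤ μ * 2
  L≤′ = ≤-trans L≤ nv≤′
  coarse : preprocessing-time n m P F nv L ≤
    μ * 2 + (μ * 2 + (μ * 2 * (1 + P * (1 + P)) + (μ * 2 * (1 + P) + ((F * (1 + μ * 2) + L * (μ * 2) + μ * 2 * P) + L * (1 + (2 * (μ * 2) + μ * 2))))))
  coarse = +-mono-≤ m≤ (+-mono-≤ m≤ (+-mono-≤ (*-monoˡ-≤ (1 + P * (1 + P)) nv≤′) (+-mono-≤ (*-monoˡ-≤ (1 + P) nv≤′)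
    (+-mono-≤ (+-mono-≤ (+-mono-≤ (*-monoʳ-≤ F (s≤s nv≤′)) (*-monoʳ-≤ L nv≤′)) (*-monoˡ-≤ P nv≤′))
      (*-monoʳ-≤ L (s≤s (+-mono-≤ (*-monoʳ-≤ 2 m≤) L≤′)))))))
  polynomial : ∀ μ P → 1 ≤ μ → 1 ≤ P →
    suc (μ * 2 + (μ * 2 + (μ * 2 * (1 + P * (1 + P)) + (μ * 2 * (1 + P) + ((F * (1 + μ * 2) + L * (μ * 2) + μ * 2 * P) + L * (1 + (2 * (μ * 2) + μ * 2)))))))
    ≤ 17 * (μ * (P * P + (F + L)))
  polynomial (suc a) (suc b) _ _ = ≤-trans (m≤m+n _ (a + suc a * (24 * b + 15 * (b * b)) + F * (14 + 15 * a) + L * (8 + 9 * a))) (≤-reflexive (identity a b F L))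
    where
    identity : ∀ a b F L →
      suc (suc a * 2 + (suc a * 2 + (suc a * 2 * (1 + suc b * (1 + suc b)) + (suc a * 2 * (1 + suc b) +
        ((F * (1 + suc a * 2) + L * (suc a * 2) + suc a * 2 * suc b) + L * (1 + (2 * (suc a * 2) + suc a * 2)))))))
      + (a + suc a * (24 * b + 15 * (b * b)) + F * (14 + 15 * a) + L * (8 + 9 * a))
      ≡ 17 * (suc a * (suc b * suc b + (F + L)))
    identity = solve-∀

query-time≤ : ∀ P t → 0 < P → suc (query-time P t) ≤ (9 * t + 3) * P ^ t
query-time≤ P t P>0 = go (P ^ t) (m^n>0 P {{>-nonZero P>0}} t)
  where
  go : ∀ Y → 0 < Y → suc (t * (1 + 2 * Y) + (t * (1 + 2 * Y) + (Y + (Y + t * (1 + 2 * Y))))) ≤ (9 * t + 3) * Y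
  go (suc y) _ = ≤-trans (m≤m+n _ (3 * t * y + y)) (≤-reflexive (identity t y))
    where identity : ∀ t y → suc (t * (1 + 2 * suc y) + (t * (1 + 2 * suc y) + (suc y + (suc y + t * (1 + 2 * suc y))))) + (3 * t * y + y) ≡ (9 * t + 3) * suc y
          identity = solve-∀

oracle-program : ℕ → DistanceOracle
oracle-program t = record { κ = word-exponent t ; preprocess = compile preprocessing ; query = compile (querying t) }

-- One summand each for construction time, space and query time. `272` is 17 times the 16 collected
-- from two sums and the bound `4 * ℓ`; `2048` is the 32 interleaved arrays times the 64 from two
-- sums and the bound `16 * ℓ ^ 2` for the table.
constant : ℕ → ℕ
constant t = preprocessing-cost * 272 + 2048 + querying-cost t * ((9 * t + 3) * 2 ^ t)

stretch : (t : ℕ) .{{_ : NonZero t}} → ℕ → ℕ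
stretch t d = d + 2 * ⌈ d / t ⌉ + 2

estimate-same : ∀ {G u v} (t : ℕ) .{{_ : NonZero t}} → toℕ u ≡ toℕ v → Estimates G (stretch t) u v (just 0)
estimate-same {G} {u} {v} t p with toℕ-injective {i = u} {v} p
... | refl = 0 , (Graph.here , λ _ → z≤n) , z≤n , z≤n

module Estimation (G : Graph) (p : ℕ) {nv P L : ℕ} {row ln piv pd lm : ℕ → ℕ} {q d tbl : ℕ → ℕ → ℕ}
                  (N : Numbering (Encoding.I G p) nv (Graph.m G * 2) row)
                  (O : Oracle (ArcOf (Encoding.I G p) row (Graph.m G * 2)) nv P L ln piv pd lm q d tbl) where
  open Graph G
  open Encoding G p
  open Translate N using (walk-path; path-walk; connected-numbered)

  module _ {u v : V} (t : ℕ) .{{_ : NonZero t}} where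

    estimate-isolated : toℕ u ≢ toℕ v → row (toℕ u) * row (toℕ v) ≡ 0 → Estimates G (stretch t) u v nothing
    estimate-isolated u≢v z l w = connected-numbered u≢v w z

    module _ {x y o : ℕ} (x< : x < nv) (y< : y < nv) (ru : row (toℕ u) ≡ suc x) (rv : row (toℕ v) ≡ suc y) where

      within : (∀ {δ} → Candidate ln piv pd q d tbl t x y δ → o ⊴ δ) → ∀ {l} → Walk u v l → o ⊴ stretch t l
      within complete w with walk-path w ru
      ... | y′ , rv′ , path with suc-injective (trans (sym rv) rv′)
      ...   | refl with Analysis.candidate-complete O {t} x< y< path
      ...     | _ , cand , δ≤ with complete cand
      ...       | c , eqn , c≤ = c , eqn , ≤-trans c≤ δ≤

    estimate-optimal : ∀ {x y o} → x < nv → y < nv → row (toℕ u) ≡ suc x → row (toℕ v) ≡ suc y → (Or : DistanceOracle) →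
      (∀ {δ} → o ≡ suc δ → Candidate ln piv pd q d tbl t x y δ) → (∀ {δ} → Candidate ln piv pd q d tbl t x y δ → o ⊴ δ) →
      Estimates G (stretch t) u v (decode Or o)
    -- Against the answer 0, any walk would give a candidate and with it a finite estimate.
    estimate-optimal {o = zero} x< y< ru rv Or sound complete l w with within x< y< ru rv complete w
    ... | _ , () , _
    estimate-optimal {o = suc d̂} x< y< ru rv Or sound complete =
      proj₁ shortest , proj₂ shortest , proj₂ (proj₂ shortest) walk , upper (within x< y< ru rv complete (proj₁ (proj₂ shortest)))
      where
      walk : Walk u v d̂
      walk = path-walk (Analysis.candidate-sound O x< y< (sound refl)) ru rv
      shortest = distance walk
      upper : ∀ {e} → suc d̂ ⊴ e → d̂ ≤ e
      upper (_ , refl , h) = h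

if-either : ∀ {A : Set} (Q : A → Set) b {x y} → Q x → Q y → Q (if b then x else y)
if-either Q true  p q = p
if-either Q false p q = q

if-below : ∀ {A : Set} {a k} {x y : A} → a < k → (if a <ᵇ k then x else y) ≡ x
if-below {a = a} {k} a<k with a <ᵇ k | <⇒<ᵇ a<k
... | true | _ = refl

-- Both runs on a given graph, and their bounds

module Execution (t : ℕ) .{{_ : NonZero t}} (c : ℝ) (0<c : 0ℚ <ᴸ c) (c<⅓ : c <ᵁ + 1 ℚ./ 3)
                 (G : Graph) (p : ℕ) (rp : RoundedPower (Graph.n G) c p) (N : ℕ) (N≡ : N ≡ 2 + Graph.n G) where
  open Graph G
  open Encoding G p
  open Powers n c 0<c c<⅓ p rp

  n≥1 : 1 ≤ n
  n≥1 = n≢0⇒n>0 (≢-nonZero⁻¹ n)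

  open Magnitudes N (subst (3 ≤_) (sym N≡) (s≤s (s≤s n≥1)))

  n≤N : n ≤ N
  n≤N = ≤-trans (m≤n+m n 2) (≤-reflexive (sym N≡))

  B₁ B₂ κ F ℓ : ℕ
  B₁ = N ^ 14
  B₂ = N ^ querying-exponent t
  κ = word-exponent t
  ℓ = suc ⌈log₂ n ⌉
  -- Two more than the logarithm: the first threshold is at most `n + 1 < 2 ^ F`, so `F` halvings
  -- bring it to 0.
  F = suc ℓ

  F-big : n + 1 < 2 ^ F
  F-big = ≤-trans (s≤s (≤-trans (+-mono-≤ (n≤2^log n) (m^n>0 2 ⌈log₂ n ⌉)) (≤-reflexive (cong (λ z → 2 ^ ⌈log₂ n ⌉ + z) (sym (+-identityʳ _))))))
    (≤-trans (+-monoˡ-≤ (2 ^ ℓ) (m^n>0 2 ℓ)) (≤-reflexive (cong (λ z → 2 ^ ℓ + z) (sym (+-identityʳ (2 ^ ℓ))))))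

  m≤N² : m ≤ N ^ 2
  m≤N² = ≤-trans m≤n² (times 1 1 (N≤ n≤N) (N≤ n≤N))

  M≤B₁ : m * 2 ≤ B₁
  M≤B₁ = up (m≤m+n 3 11) (times 2 1 m≤N² (N≤ 2≤N))

  p≤B₁ : p ≤ B₁
  p≤B₁ = up (m≤m+n 3 11) (p≤N³ n≤N p≤8n)

  private
    module Pre = Preprocess I B₁ n m p F encoding p>0 M≤B₁ (X≤ n≤N p≤8n) F-big

  opaque
    result₁ : WP I B₁ preprocessing blank (λ t s → Frame preprocessing blank s × Built I n m p F t s)
    result₁ = Pre.preprocessing-correct

  ticks : ℕ
  ticks = proj₁ result₁

  s : Store
  s = proj₁ (proj₂ result₁)

  steps : Steps I B₁ preprocessing blank ticks s
  steps = proj₁ (proj₂ (proj₂ result₁))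

  untouched : ∀ k → modA preprocessing k ≡ false → ∀ a → arr s k a ≡ 0
  untouched k h a = cong (λ f → f a) (onA (proj₁ (proj₂ (proj₂ (proj₂ result₁)))) k h)

  built : Built I n m p F ticks s
  built = proj₂ (proj₂ (proj₂ (proj₂ result₁)))

  open Built built

  module C₁ = Compile N 2≤N 14 κ I (I≤ {B₁} (up {b = 14} (m≤m+n 1 13) (N≤ n≤N)) (up {b = 14} (m≤m+n 2 12) m≤N²) p≤B₁)

  opaque
    outcome₁ : C₁.Outcome (compile preprocessing) s zeros zeros (costC preprocessing * suc ticks)
    outcome₁ = C₁.runC steps ((λ _ → z≤n) , (λ _ _ → z≤n)) tt (preprocessing-fits t) (sim (λ _ → refl) (λ _ _ _ → refl))

  module O₁ = C₁.Outcome outcome₁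

  bounded : Bounded B₁ s
  bounded = C₁.steps-bounded ((λ _ → z≤n) , (λ _ _ → z≤n)) steps

  D : Structure
  D = record { size = O₁.regs′ 0 ; content = O₁.mem′ }

  range : ℕ
  range = n * p + L * L + 2

  size-D : Structure.size D ≡ range * 32
  size-D = trans (Sim.vars O₁.sim′ 0) size

  q₀ : Store
  q₀ = ⟨ zeros , (λ k i → Structure.memory D (i * 32 + k)) ⟩

  memory-below : ∀ {a} → a < range * 32 → Structure.memory D a ≡ O₁.mem′ a
  memory-below a< = if-below (<-≤-trans a< (≤-reflexive (sym size-D)))

  loaded : ∀ k → k < 32 → ∀ {i} → i < range → arr q₀ k i ≡ arr s k i
  loaded k k<32 {i} i< = trans (memory-below {i * 32 + k} (≤-trans (≤-trans (≤-reflexive (sym (+-suc (i * 32) k))) (+-monoʳ-≤ (i * 32) k<32))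
      (≤-trans (≤-reflexive (+-comm (i * 32) 32)) (*-monoˡ-≤ 32 i<)))) (Sim.mems O₁.sim′ k i k<32)

  -- Weaker than `loaded`, but valid at every index. It suffices where 0 is harmless: for marks,
  -- which have to be 0, and for rows, where 0 means isolated.
  loaded-or-0 : ∀ k → k < 32 → ∀ i → (arr q₀ k i ≡ 0) ⊎ (arr q₀ k i ≡ arr s k i)
  loaded-or-0 k k<32 i = if-either (λ x → (x ≡ 0) ⊎ (x ≡ arr s k i)) ((i * 32 + k) <ᵇ O₁.regs′ 0) (inj₂ (Sim.mems O₁.sim′ k i k<32)) (inj₁ refl)

  content≤ : ∀ a → O₁.mem′ a ≤ B₁
  content≤ a = subst (λ a → O₁.mem′ a ≤ B₁) (trans (+-comm (a / 32 * 32) (a % 32)) (sym (m≡m%n+[m/n]*n a 32)))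
    (≤-trans (≤-reflexive (Sim.mems O₁.sim′ (a % 32) (a / 32) (m%n<n a 32))) (proj₂ bounded (a % 32) (a / 32)))

  q₀≤ : ∀ k i → arr q₀ k i ≤ B₁
  q₀≤ k i = if-either (_≤ B₁) ((i * 32 + k) <ᵇ O₁.regs′ 0) (content≤ (i * 32 + k)) z≤n

  in-space : ∀ {i} → i < n * p → i < range
  in-space i< = ≤-trans i< (≤-trans (m≤m+n (n * p) (L * L)) (m≤m+n _ 2))

  in-n : ∀ {i} → i < n → i < range
  in-n i< = in-space (≤-trans i< (m≤m*n n p {{>-nonZero p>0}}))

  in-table : ∀ {i} → i < L * L → i < range
  in-table i< = ≤-trans i< (≤-trans (m≤n+m (L * L) (n * p)) (m≤m+n _ 2))

  cell< : ∀ {x j a b} → x < a → j < b → x * b + j < a * b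
  cell< {x} {j} {a} {b} x< j< = ≤-trans (≤-reflexive (sym (+-suc (x * b) j)))
    (≤-trans (+-monoʳ-≤ (x * b) j<) (≤-trans (≤-reflexive (+-comm (x * b) b)) (*-monoˡ-≤ b x<)))

  oracle₀ : Oracle (ArcOf I (arr s aROW) (m * 2)) nv p L (arr q₀ aLN) (arr q₀ aPIV) (arr q₀ aPD) (arr s aLM)
    (λ x j → arr q₀ aQ (x * p + j)) (λ x j → arr q₀ aD (x * p + j)) (λ k k′ → arr q₀ aTBL (k * L + k′))
  oracle₀ = oracle-cong
    (λ x< → loaded aLN (m≤m+n 7 25) (in-n (<-≤-trans x< nv≤n)))
    (λ x< → loaded aPIV (m≤m+n 11 21) (in-n (<-≤-trans x< nv≤n)))
    (λ x< → loaded aPD (m≤m+n 12 20) (in-n (<-≤-trans x< nv≤n)))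
    (λ {x} {j} x< j< → loaded aQ (m≤m+n 5 27) (in-space (≤-trans (cell< {x} {j} {nv} {p} x< j<) (*-monoˡ-≤ p nv≤n))))
    (λ {x} {j} x< j< → loaded aD (m≤m+n 6 26) (in-space (≤-trans (cell< {x} {j} {nv} {p} x< j<) (*-monoˡ-≤ p nv≤n))))
    (λ {k} {k′} k< k′< → loaded aTBL (m≤m+n 14 18) (in-table (cell< {k} {k′} {L} {L} k< k′<)))
    oracle

  module Es = Estimation G p numbering oracle₀

  row₀ : ℕ → ℕ
  row₀ = arr q₀ aROW

  row≡ : ∀ u → row₀ (toℕ u) ≡ arr s aROW (toℕ {n} u)
  row≡ u = loaded aROW (m≤m+n 3 29) (in-n (toℕ<n u))

  row₀< : ∀ {U x} → row₀ U ≡ suc x → x < nv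
  row₀< {U} h = [ (λ z → contradiction (trans (sym h) z) λ ()) , (λ q → proj₁ (Numbering.occurs numbering (trans (sym q) h))) ]′
    (loaded-or-0 aROW (m≤m+n 3 29) U)

  module _ (u v : V) where

    J : ℕ → ℕ
    J = cells (toℕ u ∷ toℕ v ∷ [])

    J≤ : ∀ i → J i ≤ B₂
    J≤ zero          = ≤-trans (≤-trans (<⇒≤ (toℕ<n u)) n≤N) (up {a = 1} {querying-exponent t} (s≤s z≤n) (N≤ ≤-refl))
    J≤ (suc zero)    = ≤-trans (≤-trans (<⇒≤ (toℕ<n v)) n≤N) (up {a = 1} {querying-exponent t} (s≤s z≤n) (N≤ ≤-refl))
    J≤ (suc (suc i)) = z≤n

    p≤B₂ : p ≤ B₂
    p≤B₂ = up (≤-trans (m≤m+n 3 15) (≤-trans (m≤n+m 18 t) (m≤n+m (t + 18) (suc (suc t + 3 * t))))) (p≤N³ n≤N p≤8n)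

    B₁≤B₂ : B₁ ≤ B₂
    B₁≤B₂ = ^-monoʳ-≤ N (≤-trans (m≤m+n 14 4) (≤-trans (m≤n+m 18 t) (m≤n+m (t + 18) (suc (suc t + 3 * t)))))

    context : QueryContext
    context = record
      { I = J ; B = B₂ ; Qa = arr q₀ aQ ; Da = arr q₀ aD ; Ta = arr q₀ aTBL ; O = oracle₀ ; P>0 = p>0 ; t = t ; B₁ = B₁
      ; pd≤ = q₀≤ aPD ; Ta≤ = q₀≤ aTBL ; sum≤B = sum≤ n≤N p≤8n t ; P≤B = p≤B₂ ; ∑≤B = room≤ n≤N p≤8n t p>0 ; t+2≤B = t+2≤ n≤N p≤8n t }

    opaque
      result₂ : WP J B₂ (querying t) q₀ (λ τ s′ → τ ≤ query-time p t × Query.Answer context row₀ (toℕ u) (toℕ v) (val s′ vout))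
      result₂ = Query.querying-correct context {q₀} (record { Q≡ = refl ; D≡ = refl ; LN≡ = refl ; PIV≡ = refl ; PD≡ = refl ; TBL≡ = refl })
        row₀ refl (λ {U} → row₀< {U}) (trans (loaded aSC (m≤m+n 15 17) (≤-trans (s≤s z≤n) (m≤n+m 2 (n * p + L * L)))) P-stored)
        (trans (loaded aSC (m≤m+n 15 17) (m≤n+m 2 (n * p + L * L))) L-stored) refl refl
        marks-0 (1≤ (querying-exponent t))
        where marks-0 : ∀ y → arr q₀ aMARK y ≡ 0
              marks-0 y = [ (λ z → z) , (λ q → trans q (untouched aMARK refl y)) ]′ (loaded-or-0 aMARK (m≤m+n 19 13) y)

    ticks₂ : ℕ
    ticks₂ = proj₁ result₂

    s₂ : Store
    s₂ = proj₁ (proj₂ result₂)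

    steps₂ : Steps J B₂ (querying t) q₀ ticks₂ s₂
    steps₂ = proj₁ (proj₂ (proj₂ result₂))

    ticks₂≤ : ticks₂ ≤ query-time p t
    ticks₂≤ = proj₁ (proj₂ (proj₂ (proj₂ result₂)))

    answer : Query.Answer context row₀ (toℕ u) (toℕ v) (val s₂ vout)
    answer = proj₂ (proj₂ (proj₂ (proj₂ result₂)))

    module C₂ = Compile N 2≤N (querying-exponent t) κ J J≤

    opaque
      outcome₂ : C₂.Outcome (compile (querying t)) s₂ zeros (Structure.memory D) (costC (querying t) * suc ticks₂)
      outcome₂ = C₂.runC steps₂ ((λ _ → z≤n) , (λ k i → ≤-trans (q₀≤ k i) B₁≤B₂)) tt (querying-fits t) (sim (λ _ → refl) (λ _ _ _ → refl))

    module O₂ = C₂.Outcome outcome₂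

    estimate-correct : ∀ {o} → Query.Answer context row₀ (toℕ u) (toℕ v) o → Estimates G (stretch t) u v (decode (oracle-program t) o)
    estimate-correct (Query.same U≡V refl) = estimate-same t U≡V
    estimate-correct (Query.isolated U≢V z refl) = Es.estimate-isolated t U≢V (trans (sym (cong₂ _*_ (row≡ u) (row≡ v))) z)
    estimate-correct (Query.estimate {x} {y} a b opt) = Es.estimate-optimal t (row₀< {toℕ u} a) (row₀< {toℕ v} b)
      (trans (sym (row≡ u)) a) (trans (sym (row≡ v)) b) (oracle-program t) (Query.Optimal.sound opt) (Query.Optimal.complete opt)

    estimate : Estimates G (stretch t) u v (decode (oracle-program t) (O₂.regs′ 0))
    estimate = estimate-correct (subst (Query.Answer context row₀ (toℕ u) (toℕ v)) (sym (Sim.vars O₂.sim′ 0)) answer)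

  LP≤n : L * p ≤ 2 * F * n
  LP≤n = ≤-trans LP≤ (≤-trans (*-monoʳ-≤ F (*-monoʳ-≤ 2 nv≤n)) (≤-reflexive (arith F n)))
    where arith : ∀ f n → f * (2 * n) ≡ 2 * f * n
          arith = solve-∀

  F≤2ℓ : F ≤ 2 * ℓ
  F≤2ℓ = ≤-trans (+-monoˡ-≤ ℓ {1} {ℓ} (s≤s z≤n)) (≤-reflexive (cong (λ z → ℓ + z) (sym (+-identityʳ ℓ))))

  ℓ≤ℓ² : ℓ ≤ ℓ ^ 2
  ℓ≤ℓ² = ≤-trans (m≤m*n ℓ ℓ) (≤-reflexive (cong (ℓ *_) (sym (*-identityʳ ℓ))))

  K : ℕ
  K = constant t

  -- The three summands are the truncated searches, the sweeps of the greedy algorithm and the work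
  -- per landmark; they are bounded by `square≼`, by a multiple of the logarithm and by `quotient≼`.
  time-bound : O₁.time ≼ polylog K 2 n * (1 ⊔ m) · n ^ (1ℚ ⊖ c)
  time-bound = ≼-mono n (1ℚ ⊖ c)
    (≤-trans (subst (λ k → O₁.time ≤ k * suc ticks) preprocessing-cost≡ O₁.time≤) (≤-trans (*-monoʳ-≤ preprocessing-cost {suc ticks} {17 * ((1 ⊔ m) * (p * p + (F + L)))} (≤-trans (s≤s time) (preprocessing-time≤ {n} {m} {p} {F} {nv} {L} nv≤M L≤nv p>0)))
      (≤-reflexive (arith₁ (preprocessing-cost) (1 ⊔ m) (p * p + (F + L))))))
    (≤-trans (≤-reflexive (arith₂ (preprocessing-cost) (1 ⊔ m) ℓ)) (*-monoˡ-≤ (1 ⊔ m) (*-mono-≤ (≤-trans (m≤m+n (preprocessing-cost * 272) 2048) (m≤m+n _ _)) ℓ≤ℓ²)))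
    (≼-scale n (1ℚ ⊖ c) (preprocessing-cost * 17 * (1 ⊔ m))
      (≼-+ n (1ℚ ⊖ c) (≼-mono n (1ℚ ⊖ c) ≤-refl 4≤ square≼)
        (≼-+ n (1ℚ ⊖ c) (≼-mono n (1ℚ ⊖ c) ≤-refl F≤ (≼-const n (1ℚ ⊖ c) F)) (≼-mono n (1ℚ ⊖ c) ≤-refl 2F≤ (quotient≼ {L} LP≤n)))))
    where
    nv≤M : nv ≤ m * 2
    nv≤M = Numbering.nv≤ numbering
    arith₁ : ∀ k μ x → k * (17 * (μ * x)) ≡ k * 17 * μ * x
    arith₁ = solve-∀
    arith₂ : ∀ k μ l → k * 17 * μ * (2 * (2 * (4 * l))) ≡ k * 272 * l * μ
    arith₂ = solve-∀
    2F≤ : 2 * F ≤ 4 * ℓ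
    2F≤ = ≤-trans (*-monoʳ-≤ 2 F≤2ℓ) (≤-reflexive (sym (*-assoc 2 2 ℓ)))
    F≤ : F ≤ 4 * ℓ
    F≤ = ≤-trans (m≤m+n F _) 2F≤
    4≤ : 4 ≤ 2 * (4 * ℓ)
    4≤ = ≤-trans (m≤m*n 4 ℓ) (m≤m+n (4 * ℓ) _)

  space-bound : Structure.size D ≼ polylog K 2 n · n ^ (+ 2 ℚ./ 1 ⊖ 2 · c)
  space-bound = ≼-mono n e (≤-trans (≤-reflexive size-D) (≤-reflexive (*-comm range 32)))
    (≤-trans (≤-reflexive (arith (ℓ ^ 2))) (*-monoˡ-≤ (ℓ ^ 2) (≤-trans (m≤n+m 2048 (preprocessing-cost * 272)) (m≤m+n _ _))))
    (≼-scale n e 32 (≼-+ n e (≼-+ n e (≼-mono n e ≤-refl (≤-trans (m≤m+n 2 14) 16≤) space≼) (≼-mono n e ≤-refl table≤ (table≼ {L} LP≤n)))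
      (≼-mono n e ≤-refl (≤-trans (m≤m+n 2 14) (≤-trans 16≤ (m≤m+n (16 * ℓ ^ 2) _))) (≼-const n e 2))))
    where
    e = + 2 ℚ./ 1 ⊖ 2 · c
    arith : ∀ x → 32 * (2 * (2 * (16 * x))) ≡ 2048 * x
    arith = solve-∀
    16≤ : 16 ≤ 16 * ℓ ^ 2
    16≤ = m≤m*n 16 (ℓ ^ 2) {{m^n≢0 ℓ 2}}
    table≤ : 2 * F * (2 * F) ≤ 16 * ℓ ^ 2
    table≤ = ≤-trans (*-mono-≤ (*-monoʳ-≤ 2 F≤2ℓ) (*-monoʳ-≤ 2 F≤2ℓ)) (≤-reflexive (square ℓ))
      where square : ∀ l → 2 * (2 * l) * (2 * (2 * l)) ≡ 16 * (l * (l * 1))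
            square = solve-∀

  query-bound : ∀ u v → O₂.time u v ≼ polylog K 2 n · n ^ (t · c)
  query-bound u v = ≼-mono n (t · c)
    (≤-trans (subst (λ k → O₂.time u v ≤ k * suc (ticks₂ u v)) (querying-cost≡ t) (O₂.time≤ u v)) (≤-trans (*-monoʳ-≤ (querying-cost t) {suc (ticks₂ u v)} {(9 * t + 3) * p ^ t} (≤-trans (s≤s (ticks₂≤ u v)) (query-time≤ p t p>0))) (≤-reflexive (sym (*-assoc (querying-cost t) (9 * t + 3) (p ^ t))))))
    (≤-trans (≤-reflexive (*-assoc (querying-cost t) (9 * t + 3) (2 ^ t))) (≤-trans (m≤n+m _ (preprocessing-cost * 272 + 2048)) (m≤m*n K (ℓ ^ 2) {{m^n≢0 ℓ 2}})))
    (≼-scale n (t · c) (querying-cost t * (9 * t + 3)) (power≼ t))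

theorem10 :
    (t : ℕ) .{{_ : NonZero t}} (c : ℝ) → 0ℚ <ᴸ c → c <ᵁ + 1 ℚ./ 3 →
    (γ : ℕ) →
    ∃[ O ] ∃[ C ] ∃[ k ]
      ((G : Graph) → let open Graph G in
       (p : ℕ) → RoundedPower n c p →
       WithFailure1/ (suc n ^ γ) (λ coins →
         ∃[ T ] ∃[ D ]
           (Preprocesses O G p coins T D
            × (T ≼ polylog C k n * (1 ⊔ m) · n ^ (1ℚ ⊖ c))
            × (Structure.size D ≼ polylog C k n · n ^ (+ 2 ℚ./ 1 ⊖ 2 · c))
            × ((u v : V) →
               ∃[ S ] ∃[ d̂ ]
                 (Answers O G D u v S d̂
                  × (S ≼ polylog C k n · n ^ (t · c))
                  × Estimates G (λ d → d + 2 * ⌈ d / t ⌉ + 2) u v d̂)))))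
-- The exponent 2 of the logarithm comes from the table: the number of landmarks carries one
-- logarithm, and the table squares it.
theorem10 t c 0<c c<⅓ γ = oracle-program t , constant t , 2 , λ G p rp →
  -- The sample space is the single empty vector of coins, and no outcome is bad.
  0 , (λ _ → false) , (λ { [] _ → let module E = Execution t c 0<c c<⅓ G p rp (2 + Graph.n G) refl in
    E.O₁.time , E.D , (_ , E.O₁.runs′ , refl) , E.time-bound , E.space-bound , λ u v →
      E.O₂.time u v , _ , (_ , E.O₂.runs′ u v , refl) , E.query-bound u v , E.estimate u v }) , z≤n
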